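{- As identities of $q$-series (for $|q|<1$): \begin{align*} \varphi^4 (q) =& 8L(q) -32L(q^4),\\ \varphi^2 (q) \varphi^2 (q^2)=& 4 L(q) - 4 L(q^2) +8 L(q^4) - 32 L(q^{8}) ,\\ \varphi^2 (q) \varphi^2 (q^5)=& \tfrac{4}{3}L(q) - \tfrac{16}{3}L(q^4) + \tfrac{20}{3}L(q^5) - \tfrac{80}{3}L(q^{20}) + \tfrac{8}{3}A_1(q),\\ \varphi^2 (q) \varphi^2 (q^{10})=& \tfrac{2}{3}L(q) - \tfrac{2}{3}L(q^2) + \tfrac{4}{3}L(q^4) + \tfrac{10}{3}L(q^5) - \tfrac{16}{3}L(q^8) - \tfrac{10}{3} L(q^{10}) +\tfrac{20}{3}L(q^{20}) -\tfrac{80}{3}L(q^{40})\\&+\tfrac{10}{3} A_1(q) + \tfrac{8}{3}A_2(q) +4 A_3(q),\\ \varphi (q)\varphi (q^2)\varphi (q^5)\varphi (q^{10})=& L(q) - L(q^2) -2 L(q^4) -5L(q^5) +8 L(q^8) +5 L(q^{10}) +10 L(q^{20}) -40L(q^{40}) + A_1(q) + 2A_3(q),\\ \varphi^2 (q^2) \varphi^2 (q^5)=& \tfrac{2}{3}L(q) - \tfrac{2}{3}L(q^2) + \tfrac{4}{3}L(q^4) + \tfrac{10}{3}L(q^5) - \tfrac{16}{3}L(q^8) - \tfrac{10}{3} L(q^{10}) +\tfrac{20}{3}L(q^{20}) -\tfrac{80}{3}L(q^{40})\\& -\tfrac{2}{3} A_1(q) + \tfrac{8}{3}A_2(q) -4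 A_3(q). \end{align*}
   Context: $\varphi(q)=\sum_{m=-\infty}^{\infty}q^{m^2}$. For $n\in\mathbb{N}$, $\sigma(n)=\sum_{d\mid n}d$; $L(q)=-\frac{1}{24}+\sum_{n\ge1}\sigma(n)q^n$. With $q=e^{2\pi i z}$ and $\eta(z)=q^{1/24}\prod_{m\ge1}(1-q^m)$, the series $A_1(q)=\eta^2(2z)\eta^2(10z)$, $A_2(q)=\eta^2(4z)\eta^2(20z)$, $A_3(q)=\frac{\eta^5(4z)\eta(10z)\eta^2(40z)}{\eta(2z)\eta^2(8z)\eta(20z)}$ (these are power series in $q$ with integer coefficients). -}

module Defs where

open import Data.Nat as ℕ using (ℕ; zero; suc; _∸_; NonZero)
open import Data.Nat.Divisibility using (_∣?_)
open import Data.Nat.DivMod using (_/_)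
open import Data.Integer as ℤ using (ℤ; +_)
open import Data.Rational as ℚ using (ℚ; 0ℚ; 1ℚ)
open import Relation.Nullary using (yes; no)

-- A formal power series in q with rational coefficients,
-- given by its coefficient function: f n = coefficient of q^n.
Series : Set
Series = ℕ → ℚ

sumTo : ℕ → (ℕ → ℚ) → ℚ
sumTo zero    f = f 0
sumTo (suc n) f = sumTo n f ℚ.+ f (suc n)

oneS : Series
oneS zero    = 1ℚ
oneS (suc _) = 0ℚ

infixl 6 _⊕_
infixl 7 _⊛_
infixl 7 _·_

_⊕_ : Series → Series → Series
(f ⊕ g) n = f n ℚ.+ g n

_·_ : ℚ → Series → Series
(c · f) n = c ℚ.* f n

_⊛_ : Series → Series → Series
(f ⊛ g) n = sumTo n (λ i → f i ℚ.* g (n ∸ i))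

powS : Series → ℕ → Series
powS f zero    = oneS
powS f (suc e) = powS f e ⊛ f

shift : ℕ → Series → Series
shift zero    f n       = f n
shift (suc s) f zero    = 0ℚ
shift (suc s) f (suc n) = shift s f n

sub : (k : ℕ) → .{{NonZero k}} → Series → Series
sub k f n with k ∣? n
... | yes _ = f (n / k)
... | no  _ = 0ℚ

_//_ : ℕ → (b : ℕ) → .{{NonZero b}} → ℚ
a // b = (+ a) ℚ./ b

-- φ(q) = Σ_{m∈ℤ} q^{m²}: coefficient of q^n is #{m ∈ ℤ : m² = n};
-- every such m satisfies |m| ≤ n, so we count m = j - n for j = 0..2n.
φ : Series
φ n = sumTo (2 ℕ.* n) (λ j → ind (+ j ℤ.- + n))
  where
  ind : ℤ → ℚ
  ind m with m ℤ.* m ℤ.≟ + n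
  ... | yes _ = 1ℚ
  ... | no  _ = 0ℚ

σ : ℕ → ℕ
σ n = go n
  where
  go : ℕ → ℕ
  go zero = 0
  go (suc d) with suc d ∣? n
  ... | yes _ = go d ℕ.+ suc d
  ... | no  _ = go d

L : Series
L zero    = ℚ.- (1 // 24)
L (suc n) = (+ σ (suc n)) ℚ./ 1

oneMinusQ : ℕ → Series
oneMinusQ a n with n ℕ.≟ 0 | n ℕ.≟ a
... | yes _ | _     = 1ℚ
... | no _  | yes _ = ℚ.- 1ℚ
... | no _  | no _  = 0ℚ

-- the series 1/(1 - q^a) = Σ_{j≥0} q^{a j}  (a ≥ 1)
geomQ : (a : ℕ) → .{{NonZero a}} → Series
geomQ a n with a ∣? n
... | yes _ = 1ℚ
... | no  _ = 0ℚ

prodUpTo : (ℕ → Series) → ℕ → Series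
prodUpTo F zero    = oneS
prodUpTo F (suc N) = prodUpTo F N ⊛ F (suc N)

-- infinite product ∏_{m≥1} F m, where each F m ≡ 1 mod q^{m}
-- (true for all factors used below): the coefficient of q^n only
-- depends on the factors m ≤ n.
infProd : (ℕ → Series) → Series
infProd F n = prodUpTo F n n

-- A₁ = η²(2z)η²(10z) = q ∏ (1-q^{2m})² (1-q^{10m})²
A₁ : Series
A₁ = shift 1 (infProd λ m →
       powS (oneMinusQ (2 ℕ.* m)) 2 ⊛ powS (oneMinusQ (10 ℕ.* m)) 2)

-- A₂ = η²(4z)η²(20z) = q² ∏ (1-q^{4m})² (1-q^{20m})²
A₂ : Series
A₂ = shift 2 (infProd λ m →
       powS (oneMinusQ (4 ℕ.* m)) 2 ⊛ powS (oneMinusQ (20 ℕ.* m)) 2)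

-- A₃ = η⁵(4z)η(10z)η²(40z) / (η(2z)η²(8z)η(20z))
--    = q³ ∏ (1-q^{4m})⁵ (1-q^{10m}) (1-q^{40m})² / ((1-q^{2m}) (1-q^{8m})² (1-q^{20m}))
A₃ : Series
A₃ = shift 3 (infProd factor)
  where
  factor : ℕ → Series
  factor zero    = oneS
  factor (suc k) =
    powS (oneMinusQ (4 ℕ.* m)) 5 ⊛ oneMinusQ (10 ℕ.* m) ⊛ powS (oneMinusQ (40 ℕ.* m)) 2
    ⊛ geomQ (2 ℕ.* m) ⊛ powS (geomQ (8 ℕ.* m)) 2 ⊛ geomQ (20 ℕ.* m)
    where m = suc k

{-# OPTIONS --safe #-}
module Submission where

-- Write D = q d/dq and f_k = ∏ (1 - q^{km}), so that D log f_k = -k Σ σ(n) q^{kn}.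
--
-- Jacobi's triple product gives φ(q) = f₂⁵ / (f₁² f₄²) and φ(-q) = f₁² / f₂, whose logarithmic
-- derivatives are therefore combinations of L(q), L(q²), L(q⁴).  Differentiating
-- φ(q)² + φ(-q)² = 2 φ(q²)² shows that δ = D log (φ(q) / φ(-q)) satisfies
-- (φ(q)² - φ(-q)²) δ(q) = 8 φ(q²)² δ(q²).  The series (φ(q)⁴ - φ(-q)⁴) / 4 satisfies the same
-- equation, which determines a solution from its first two coefficients.  So the two agree, and a
-- second recursion from q to q² extracts φ(q)⁴ from the difference.  This is Jacobi's four-square
-- theorem, and it contains the first two identities.
--
-- Let X, Y, Z, W be φ(q)², φ(q²)², φ(q⁵)², φ(q¹⁰)².  The other identities rest on
-- (X - Z)(5Z - X) = 16 A₁ and XW - YZ = 4 A₁ + 8 A₃.  In the first one, (X - Z)/4 is a sum over a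
-- coset of (2 + i)ℤ[i], (5Z - X)/4 is a sum over ℤ[i] twisted by a character modulo 2 + i, and both
-- are infinite products by the triple product (at fifth roots of unity for the second).  The second
-- one comes from f₂ f₁₀ = ψ(q⁴) φ(q¹⁰) - q² φ(q²) ψ(q²⁰), found by dissecting a single lattice sum
-- modulo 2 and modulo 3.  The first one at q, -q and q², together with the second, gives every
-- identity except the one for φ(q) φ(q²) φ(q⁵) φ(q¹⁰).  For that one, differentiating the first
-- expresses D log (φ(q) / φ(q⁵)) rationally in X, Z, φ(-q)⁴, φ(-q⁵)⁴.  In terms of t = A₃ / A₂ all
-- these series are polynomials in three series with a single relation, modulo which the asserted
-- formula and the product have the same square; the constant terms fix the sign.

-- The argument is entirely formal. Series are coefficient functions, limits are congruences modulo
-- powers of q, and an identity of series comes either from two summations of one lattice sum or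
-- from a functional equation with a unique solution; this replaces the finite-dimensionality of
-- spaces of modular forms. Denominators are mostly multiplied out: product formulas and logarithmic
-- derivatives are stated without quotients, and a factor is cancelled once its leading coefficient
-- is known to be invertible. No complex numbers occur: the triple product is proved over any
-- commutative ring and involves only s = α + β and w = αβ, so a fifth root of unity ζ enters
-- through τ = ζ + ζ⁻¹ alone. The product φ(q) φ(q²) φ(q⁵) φ(q¹⁰) resists linear elimination because
-- it meets the other relations only through its square XYZW. The logarithmic derivative of
-- φ(q)/φ(q⁵) is the missing element: it is linear in values of L and rational in the theta series.
-- The parameter t comes from the quadric in X, Y, Z, W left after adding the first relation at q
-- and at -q, where A₁ cancels; t is the ratio of linear forms given by one of its rulings.

open import Defs
open import Level using (Level; 0ℓ)
open import Algebra.Bundles using (CommutativeRing)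
open import Data.Nat as ℕ using (ℕ; zero; suc; _∸_; _≤_; _<_; z≤n; s≤s; NonZero)
import Data.Nat.Properties as ℕₚ
open import Data.Integer as ℤ using (ℤ; +_; -[1+_])
import Data.Integer.Properties as ℤₚ
open import Data.Maybe using (Maybe; just; nothing)
open import Relation.Nullary using (yes; no; contradiction; ¬_)
open import Relation.Binary.PropositionalEquality as ≡ using (_≡_; _≢_)
import Algebra.Solver.Ring
import Algebra.Solver.Ring.AlmostCommutativeRing as ACR
import Algebra.Properties.Ring
import Algebra.Properties.AbelianGroup
import Algebra.Properties.Semiring.Mult.TCOptimised
import Data.Nat.Solver
import Data.Integer.Solver
import Data.Rational.Solver

module ℕS = Data.Nat.Solver.+-*-Solver
module Z = Data.Integer.Solver.+-*-Solver
module Q = Data.Rational.Solver.+-*-Solver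

-- A ring solver with integer coefficients over any commutative ring.

module IntegerSolver {c ℓ : Level} (R : CommutativeRing c ℓ) where
  open CommutativeRing R
  open import Relation.Binary.Reasoning.Setoid setoid
  open Algebra.Properties.Ring ring using (-0#≈0#; -‿involutive; -‿distribˡ-*; -‿distribʳ-*)
  open Algebra.Properties.AbelianGroup +-abelianGroup using (⁻¹-∙-comm)
  open Algebra.Properties.Semiring.Mult.TCOptimised semiring using (_×_; 1+×; ×-homo-+; ×1-homo-*)

  ♯ : ℤ → Carrier
  ♯ (+ n)    = n × 1#
  ♯ -[1+ n ] = - (suc n × 1#)

  cancel₁ : ∀ x y → (1# + x) + - (1# + y) ≈ x + - y
  cancel₁ x y = begin
    (1# + x) + - (1# + y)       ≈⟨ +-cong (+-comm 1# x) (sym (⁻¹-∙-comm 1# y)) ⟩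
    (x + 1#) + (- 1# + - y)     ≈⟨ +-assoc x 1# _ ⟩
    x + (1# + (- 1# + - y))     ≈⟨ +-congˡ (sym (+-assoc 1# (- 1#) (- y))) ⟩
    x + ((1# + - 1#) + - y)     ≈⟨ +-congˡ (+-congʳ (-‿inverseʳ 1#)) ⟩
    x + (0# + - y)              ≈⟨ +-congˡ (+-identityˡ (- y)) ⟩
    x + - y                     ∎

  ♯-⊖ : ∀ m n → ♯ (m ℤ.⊖ n) ≈ m × 1# + - (n × 1#)
  ♯-⊖ m       zero    = sym (trans (+-congˡ -0#≈0#) (+-identityʳ _))
  ♯-⊖ zero    (suc n) = sym (+-identityˡ _)
  ♯-⊖ (suc m) (suc n) = begin
    ♯ (suc m ℤ.⊖ suc n)                 ≡⟨ ≡.cong ♯ (ℤₚ.[1+m]⊖[1+n]≡m⊖n m n) ⟩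
    ♯ (m ℤ.⊖ n)                         ≈⟨ ♯-⊖ m n ⟩
    m × 1# + - (n × 1#)                 ≈⟨ sym (cancel₁ _ _) ⟩
    (1# + m × 1#) + - (1# + n × 1#)     ≈⟨ +-cong (sym (1+× m 1#)) (-‿cong (sym (1+× n 1#))) ⟩
    suc m × 1# + - (suc n × 1#)         ∎

  ♯-neg : ∀ i → ♯ (ℤ.- i) ≈ - ♯ i
  ♯-neg (+ zero)    = sym -0#≈0#
  ♯-neg (+ (suc n)) = refl
  ♯-neg -[1+ n ]    = sym (-‿involutive _)

  ♯-+ : ∀ i j → ♯ (i ℤ.+ j) ≈ ♯ i + ♯ j
  ♯-+ (+ m)    (+ n)    = ×-homo-+ 1# m n
  ♯-+ (+ m)    -[1+ n ] = ♯-⊖ m (suc n)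
  ♯-+ -[1+ m ] (+ n)    = trans (♯-⊖ n (suc m)) (+-comm _ _)
  ♯-+ -[1+ m ] -[1+ n ] = begin
    - (suc (suc (m ℕ.+ n)) × 1#)            ≡⟨ ≡.cong (λ k → - (k × 1#)) (≡.cong suc (≡.sym (ℕₚ.+-suc m n))) ⟩
    - ((suc m ℕ.+ suc n) × 1#)              ≈⟨ -‿cong (×-homo-+ 1# (suc m) (suc n)) ⟩
    - (suc m × 1# + suc n × 1#)             ≈⟨ sym (⁻¹-∙-comm _ _) ⟩
    - (suc m × 1#) + - (suc n × 1#)         ∎

  ♯-*⁺ : ∀ m n → ♯ (+ m ℤ.* + n) ≈ ♯ (+ m) * ♯ (+ n)
  ♯-*⁺ m n = trans (reflexive (≡.cong ♯ (≡.sym (ℤₚ.pos-* m n)))) (×1-homo-* m n)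

  ♯-* : ∀ i j → ♯ (i ℤ.* j) ≈ ♯ i * ♯ j
  ♯-* (+ m)    (+ n)    = ♯-*⁺ m n
  ♯-* (+ m)    -[1+ n ] = begin
    ♯ (+ m ℤ.* -[1+ n ])              ≡⟨ ≡.cong ♯ (≡.sym (ℤₚ.neg-distribʳ-* (+ m) (+ suc n))) ⟩
    ♯ (ℤ.- (+ m ℤ.* + suc n))         ≈⟨ ♯-neg (+ m ℤ.* + suc n) ⟩
    - ♯ (+ m ℤ.* + suc n)             ≈⟨ -‿cong (♯-*⁺ m (suc n)) ⟩
    - (♯ (+ m) * ♯ (+ suc n))         ≈⟨ -‿distribʳ-* _ _ ⟩
    ♯ (+ m) * ♯ -[1+ n ]              ∎
  ♯-* -[1+ m ] j        = begin
    ♯ (-[1+ m ] ℤ.* j)                ≡⟨ ≡.cong ♯ (≡.sym (ℤₚ.neg-distribˡ-* (+ suc m) j)) ⟩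
    ♯ (ℤ.- (+ suc m ℤ.* j))           ≈⟨ ♯-neg (+ suc m ℤ.* j) ⟩
    - ♯ (+ suc m ℤ.* j)               ≈⟨ -‿cong (pos j) ⟩
    - (♯ (+ suc m) * ♯ j)             ≈⟨ -‿distribˡ-* _ _ ⟩
    ♯ -[1+ m ] * ♯ j                  ∎
    where
    pos : ∀ j → ♯ (+ suc m ℤ.* j) ≈ ♯ (+ suc m) * ♯ j
    pos (+ n)    = ♯-*⁺ (suc m) n
    pos -[1+ n ] = begin
      ♯ (+ suc m ℤ.* -[1+ n ])            ≡⟨ ≡.cong ♯ (≡.sym (ℤₚ.neg-distribʳ-* (+ suc m) (+ suc n))) ⟩
      ♯ (ℤ.- (+ suc m ℤ.* + suc n))       ≈⟨ ♯-neg (+ suc m ℤ.* + suc n) ⟩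
      - ♯ (+ suc m ℤ.* + suc n)           ≈⟨ -‿cong (♯-*⁺ (suc m) (suc n)) ⟩
      - (♯ (+ suc m) * ♯ (+ suc n))       ≈⟨ -‿distribʳ-* _ _ ⟩
      ♯ (+ suc m) * ♯ -[1+ n ]            ∎

  ♯-morphism : ℤ.+-*-rawRing ACR.-Raw-AlmostCommutative⟶ ACR.fromCommutativeRing R
  ♯-morphism = record
    { ⟦_⟧    = ♯
    ; +-homo = ♯-+
    ; *-homo = ♯-*
    ; -‿homo = ♯-neg
    ; 0-homo = refl
    ; 1-homo = refl
    }

  ♯-≟ : ∀ i j → Maybe (♯ i ≈ ♯ j)
  ♯-≟ i j with i ℤ.≟ j
  ... | yes ≡.refl = just refl
  ... | no _       = nothing

  open Algebra.Solver.Ring ℤ.+-*-rawRing (ACR.fromCommutativeRing R) ♯-morphism ♯-≟ public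
    using (solve; _:=_; con; _:+_; _:*_; _:-_; :-_; _:^_; Polynomial)

-- Gaussian binomial coefficients.

module GaussCoefficients {c ℓ : Level} (R : CommutativeRing c ℓ) (w : CommutativeRing.Carrier R) where
  open CommutativeRing R
  open IntegerSolver R
  open import Relation.Binary.Reasoning.Setoid setoid

  pw : ℕ → Carrier
  pw zero    = 1#
  pw (suc k) = w * pw k

  poch : ℕ → Carrier
  poch zero    = 1#
  poch (suc j) = poch j * (1# - pw (suc j))

  -- gauss N k is the Gaussian binomial coefficient [2N, N+k] in base w, for k ≤ N, and 0 for k > N.
  gauss : ℕ → ℕ → Carrier
  gauss zero    zero    = 1#
  gauss zero    (suc k) = 0#
  gauss (suc N) zero    = gauss N 0 * (1# + pw (N ℕ.+ suc N)) + (1# + 1#) * (pw (suc N) * gauss N 1)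
  gauss (suc N) (suc k) = gauss N (suc k) * (1# + pw (N ℕ.+ suc N)) + pw (N ∸ k) * gauss N k
                        + pw (suc (suc (N ℕ.+ k))) * gauss N (suc (suc k))

  pw-+ : ∀ a b → pw (a ℕ.+ b) ≈ pw a * pw b
  pw-+ zero    b = sym (*-identityˡ (pw b))
  pw-+ (suc a) b = trans (*-congˡ (pw-+ a b)) (sym (*-assoc w (pw a) (pw b)))

  pw-cong : ∀ {a b} → a ≡ b → pw a ≈ pw b
  pw-cong ≡.refl = refl

  poch-cong : ∀ {a b} → a ≡ b → poch a ≈ poch b
  poch-cong ≡.refl = refl

  -- Makes the truncated subtraction in the exponent `N ∸ k` of the recursion harmless: wherever it
  -- truncates, the coefficient beside it is zero.
  gauss-> : ∀ N k → N < k → gauss N k ≈ 0#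
  gauss-> zero    (suc k) _         = refl
  gauss-> (suc N) (suc k) (s≤s N<k) = begin
    gauss N (suc k) * A + B * gauss N k + C * gauss N (suc (suc k))
      ≈⟨ +-cong (+-cong (*-congʳ (gauss-> N (suc k) (ℕₚ.m<n⇒m<1+n N<k))) (*-congˡ (gauss-> N k N<k)))
                (*-congˡ (gauss-> N (suc (suc k)) (ℕₚ.m<n⇒m<1+n (ℕₚ.m<n⇒m<1+n N<k)))) ⟩
    0# * A + B * 0# + C * 0#
      ≈⟨ +-cong (+-cong (zeroˡ A) (zeroʳ B)) (zeroʳ C) ⟩
    0# + 0# + 0#
      ≈⟨ trans (+-identityʳ _) (+-identityʳ _) ⟩
    0# ∎
    where
    A = 1# + pw (N ℕ.+ suc N)
    B = pw (N ∸ k)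
    C = pw (suc (suc (N ℕ.+ k)))

  gauss-diag : ∀ N → gauss N N ≈ 1#
  gauss-diag zero    = refl
  gauss-diag (suc N) = begin
    gauss N (suc N) * A + pw (N ∸ N) * gauss N N + C * gauss N (suc (suc N))
      ≈⟨ +-cong (+-cong (*-congʳ (gauss-> N (suc N) ℕₚ.≤-refl)) (*-cong (pw-cong (ℕₚ.n∸n≡0 N)) (gauss-diag N)))
                (*-congˡ (gauss-> N (suc (suc N)) (ℕₚ.m<n⇒m<1+n ℕₚ.≤-refl))) ⟩
    0# * A + 1# * 1# + C * 0#
      ≈⟨ +-cong (+-cong (zeroˡ A) (*-identityˡ 1#)) (zeroʳ C) ⟩
    0# + 1# + 0#
      ≈⟨ trans (+-identityʳ _) (+-identityˡ _) ⟩
    1# ∎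
    where
    A = 1# + pw (N ℕ.+ suc N)
    C = pw (suc (suc (N ℕ.+ N)))

  one-minus-pw0 : 1# - pw 0 ≈ 0#
  one-minus-pw0 = -‿inverseʳ 1#

  -- The two-step Pascal recursion for x = w^a, y = w^b, W = w.
  pascal : ∀ W x y → (1# - W * x) * (1# - W * y) * (1# + W * (x * y)) + W * x * ((1# - y) * (1# - W * y)) + W * y * ((1# - x) * (1# - W * x))
                   ≈ (1# - W * (x * y)) * (1# - W * (W * (x * y)))
  pascal = solve 3 (λ W x y → (k1 :- W :* x) :* (k1 :- W :* y) :* (k1 :+ W :* (x :* y)) :+ W :* x :* ((k1 :- y) :* (k1 :- W :* y)) :+ W :* y :* ((k1 :- x) :* (k1 :- W :* x))
              := (k1 :- W :* (x :* y)) :* (k1 :- W :* (W :* (x :* y)))) refl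
    where
    k1 : ∀ {n} → Polynomial n
    k1 = con (+ 1)

  mutual
    -- Neither k nor j decreases along the recursion, only k + j does, so the bound n carries the
    -- induction. The induction hypothesis turns each of the three neighbours into (w)_{2N} times a
    -- polynomial in x = w^j and y = w^b, and `pascal` adds these up. The quotient (w)_{2N} /
    -- ((w)_{N-k} (w)_{N+k}) is multiplied out because `poch` need not be invertible in R.
    gauss-poch′ : ∀ n k j → k ℕ.+ j ≤ n → gauss (k ℕ.+ j) k * (poch j * poch (j ℕ.+ (k ℕ.+ k))) ≈ poch ((k ℕ.+ j) ℕ.+ (k ℕ.+ j))
    gauss-poch′ n zero zero _ = trans (*-identityˡ _) (*-identityˡ _)
    -- At k = 0 the neighbours on the two sides coincide by symmetry; the coefficient 2 is split so
    -- that `pascal` applies with y = x.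
    gauss-poch′ (suc n) zero (suc N) (s≤s p) = begin
      (g0 * (1# + pw (N ℕ.+ suc N)) + (1# + 1#) * (pw (suc N) * g1)) * (poch N * (1# - w * x) * (poch (N ℕ.+ 0) * (1# - pw (suc (N ℕ.+ 0)))))
        ≈⟨ *-cong (+-congʳ (*-congˡ (+-congˡ (trans (pw-cong (ℕₚ.+-suc N N)) (*-congˡ (pw-+ N N))))))
             (*-congˡ (*-cong (poch-cong (ℕₚ.+-identityʳ N)) (+-congˡ (-‿cong (pw-cong (≡.cong suc (ℕₚ.+-identityʳ N))))))) ⟩
      (g0 * (1# + w * (x * x)) + (1# + 1#) * (w * x * g1)) * (poch N * (1# - w * x) * (poch N * (1# - w * x)))
        ≈⟨ solve 6 (λ i g0 g1 w x P → (g0 :* (i :+ w :* (x :* x)) :+ (i :+ i) :* (w :* x :* g1)) :* (P :* (i :- w :* x) :* (P :* (i :- w :* x)))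
              := (g0 :* (P :* P)) :* ((i :- w :* x) :* (i :- w :* x) :* (i :+ w :* (x :* x)))
                 :+ i :* (g1 :* (P :* (P :* (i :- w :* x)))) :* (w :* x :* (i :- w :* x))
                 :+ i :* (g1 :* (P :* (P :* (i :- w :* x)))) :* (w :* x :* (i :- w :* x))) refl 1# g0 g1 w x (poch N) ⟩
      (g0 * (poch N * poch N)) * ((1# - w * x) * (1# - w * x) * (1# + w * (x * x)))
        + 1# * (g1 * (poch N * (poch N * (1# - w * x)))) * (w * x * (1# - w * x)) + 1# * (g1 * (poch N * (poch N * (1# - w * x)))) * (w * x * (1# - w * x))
        ≈⟨ +-cong (+-cong (*-congʳ (trans (*-congˡ (*-congˡ (poch-cong (≡.sym (ℕₚ.+-identityʳ N))))) (gauss-poch′ n 0 N p)))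
             (*-congʳ up)) (*-congʳ up) ⟩
      E * ((1# - w * x) * (1# - w * x) * (1# + w * (x * x))) + ((1# - x) * E) * (w * x * (1# - w * x)) + ((1# - x) * E) * (w * x * (1# - w * x))
        ≈⟨ solve 4 (λ i w x E → E :* ((i :- w :* x) :* (i :- w :* x) :* (i :+ w :* (x :* x))) :+ ((i :- x) :* E) :* (w :* x :* (i :- w :* x)) :+ ((i :- x) :* E) :* (w :* x :* (i :- w :* x))
              := E :* ((i :- w :* x) :* (i :- w :* x) :* (i :+ w :* (x :* x)) :+ w :* x :* ((i :- x) :* (i :- w :* x)) :+ w :* x :* ((i :- x) :* (i :- w :* x)))) refl 1# w x E ⟩
      E * ((1# - w * x) * (1# - w * x) * (1# + w * (x * x)) + w * x * ((1# - x) * (1# - w * x)) + w * x * ((1# - x) * (1# - w * x)))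
        ≈⟨ *-congˡ (pascal w x x) ⟩
      E * ((1# - w * (x * x)) * (1# - w * (w * (x * x))))
        ≈⟨ trans (sym (*-assoc _ _ _)) (*-cong (*-congˡ (+-congˡ (-‿cong (*-congˡ (sym (pw-+ N N)))))) (+-congˡ (-‿cong (*-congˡ (*-congˡ (sym (pw-+ N N))))))) ⟩
      poch (suc (suc (N ℕ.+ N)))
        ≈⟨ poch-cong (≡.cong suc (≡.sym (ℕₚ.+-suc N N))) ⟩
      poch (suc (N ℕ.+ suc N)) ∎
      where
      g0 = gauss N 0
      g1 = gauss N 1
      x  = pw N
      E  = poch (N ℕ.+ N)
      up : 1# * (g1 * (poch N * (poch N * (1# - w * x)))) ≈ (1# - x) * E
      up = trans (*-identityˡ _) (trans (*-congˡ (*-congˡ (poch-cong (≡.sym (ℕₚ.+-comm N 1))))) (gauss-poch-up n 0 N p))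
    gauss-poch′ n (suc k) zero _ rewrite ℕₚ.+-identityʳ k = trans (*-congʳ (gauss-diag (suc k))) (trans (*-identityˡ _) (*-identityˡ _))
    gauss-poch′ (suc n) (suc k) (suc j) (s≤s p) = begin
      (gm * (1# + pw (N ℕ.+ suc N)) + pw (N ∸ k) * gl + pw (suc (suc (N ℕ.+ k))) * gr) * (poch j * (1# - w * x) * poch (suc j ℕ.+ (suc k ℕ.+ suc k)))
        ≈⟨ *-cong (+-cong (+-cong (*-congˡ (+-congˡ (trans (pw-cong n₁) (*-congˡ (pw-+ j b))))) (*-congʳ (pw-cong n₂))) (*-congʳ (pw-cong n₃)))
             (*-congˡ (poch-cong n₄)) ⟩
      (gm * (1# + w * (x * y)) + w * x * gl + w * y * gr) * (poch j * (1# - w * x) * (Pb * (1# - w * y)))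
        ≈⟨ solve 9 (λ i gm gl gr w x y P Q → (gm :* (i :+ w :* (x :* y)) :+ w :* x :* gl :+ w :* y :* gr) :* (P :* (i :- w :* x) :* (Q :* (i :- w :* y)))
             := (gm :* (P :* Q)) :* ((i :- w :* x) :* (i :- w :* y) :* (i :+ w :* (x :* y)))
                :+ (gl :* (P :* (i :- w :* x) :* Q)) :* (w :* x :* (i :- w :* y))
                :+ (gr :* (P :* (Q :* (i :- w :* y)))) :* (w :* y :* (i :- w :* x))) refl 1# gm gl gr w x y (poch j) Pb ⟩
      (gm * (poch j * Pb)) * ((1# - w * x) * (1# - w * y) * (1# + w * (x * y)))
        + (gl * (poch j * (1# - w * x) * Pb)) * (w * x * (1# - w * y))
        + (gr * (poch j * (Pb * (1# - w * y)))) * (w * y * (1# - w * x))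
        ≈⟨ +-cong (+-cong (*-congʳ mid) (*-congʳ low)) (*-congʳ up) ⟩
      E * ((1# - w * x) * (1# - w * y) * (1# + w * (x * y))) + (E * (1# - y)) * (w * x * (1# - w * y)) + ((1# - x) * E) * (w * y * (1# - w * x))
        ≈⟨ solve 5 (λ i w x y E → E :* ((i :- w :* x) :* (i :- w :* y) :* (i :+ w :* (x :* y))) :+ (E :* (i :- y)) :* (w :* x :* (i :- w :* y)) :+ ((i :- x) :* E) :* (w :* y :* (i :- w :* x))
             := E :* ((i :- w :* x) :* (i :- w :* y) :* (i :+ w :* (x :* y)) :+ w :* x :* ((i :- y) :* (i :- w :* y)) :+ w :* y :* ((i :- x) :* (i :- w :* x)))) refl 1# w x y E ⟩
      E * ((1# - w * x) * (1# - w * y) * (1# + w * (x * y)) + w * x * ((1# - y) * (1# - w * y)) + w * y * ((1# - x) * (1# - w * x)))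
        ≈⟨ *-congˡ (pascal w x y) ⟩
      E * ((1# - w * (x * y)) * (1# - w * (w * (x * y))))
        ≈⟨ trans (sym (*-assoc _ _ _)) (*-cong (*-congˡ (+-congˡ (-‿cong (*-congˡ xy)))) (+-congˡ (-‿cong (*-congˡ (*-congˡ xy))))) ⟩
      poch (suc (suc (N ℕ.+ N)))
        ≈⟨ poch-cong (≡.cong suc (≡.sym (ℕₚ.+-suc N N))) ⟩
      poch (suc (N ℕ.+ suc N)) ∎
      where
      p′ : suc k ℕ.+ j ≤ n
      p′ = ≡.subst (_≤ n) (ℕₚ.+-suc k j) p
      N  = k ℕ.+ suc j
      b  = j ℕ.+ (suc k ℕ.+ suc k)
      x  = pw j
      y  = pw b
      Pb = poch b
      E  = poch (N ℕ.+ N)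
      gm = gauss N (suc k)
      gl = gauss N k
      gr = gauss N (suc (suc k))
      n₁ : N ℕ.+ suc N ≡ suc (j ℕ.+ b)
      n₁ = ℕS.solve 2 (λ k j → (k ℕS.:+ (ℕS.con 1 ℕS.:+ j)) ℕS.:+ (ℕS.con 1 ℕS.:+ (k ℕS.:+ (ℕS.con 1 ℕS.:+ j))) ℕS.:= ℕS.con 1 ℕS.:+ (j ℕS.:+ (j ℕS.:+ ((ℕS.con 1 ℕS.:+ k) ℕS.:+ (ℕS.con 1 ℕS.:+ k))))) ≡.refl k j
      n₂ : N ∸ k ≡ suc j
      n₂ = ℕₚ.m+n∸m≡n k (suc j)
      n₃ : suc (suc (N ℕ.+ k)) ≡ suc b
      n₃ = ℕS.solve 2 (λ k j → ℕS.con 2 ℕS.:+ ((k ℕS.:+ (ℕS.con 1 ℕS.:+ j)) ℕS.:+ k) ℕS.:= ℕS.con 1 ℕS.:+ (j ℕS.:+ ((ℕS.con 1 ℕS.:+ k) ℕS.:+ (ℕS.con 1 ℕS.:+ k)))) ≡.refl k j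
      n₄ : suc j ℕ.+ (suc k ℕ.+ suc k) ≡ suc b
      n₄ = ≡.refl
      n₅ : j ℕ.+ b ≡ N ℕ.+ N
      n₅ = ℕₚ.suc-injective (≡.trans (≡.sym n₁) (ℕₚ.+-suc N N))
      xy : x * y ≈ pw (N ℕ.+ N)
      xy = trans (sym (pw-+ j b)) (pw-cong n₅)
      mid : gm * (poch j * Pb) ≈ E
      mid = ≡.subst (λ M → gauss M (suc k) * (poch j * Pb) ≈ poch (M ℕ.+ M)) (≡.sym (ℕₚ.+-suc k j)) (gauss-poch′ n (suc k) j p′)
      low : gl * (poch j * (1# - w * x) * Pb) ≈ E * (1# - y)
      low = trans (*-congˡ (*-congˡ (trans (poch-cong b₁) (*-congˡ (+-congˡ (-‿cong (pw-cong (≡.sym b₁))))))))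
        (trans (solve 4 (λ g P Q z → g :* (P :* (Q :* z)) := g :* (P :* Q) :* z) refl gl (poch (suc j)) (poch (suc j ℕ.+ (k ℕ.+ k))) (1# - y))
          (*-congʳ (gauss-poch′ n k (suc j) p)))
        where
        b₁ : b ≡ suc (suc j ℕ.+ (k ℕ.+ k))
        b₁ = ℕS.solve 2 (λ k j → j ℕS.:+ ((ℕS.con 1 ℕS.:+ k) ℕS.:+ (ℕS.con 1 ℕS.:+ k)) ℕS.:= ℕS.con 2 ℕS.:+ (j ℕS.:+ (k ℕS.:+ k))) ≡.refl k j
      up : gr * (poch j * (Pb * (1# - w * y))) ≈ (1# - x) * E
      up = ≡.subst (λ M → gauss M (suc (suc k)) * (poch j * poch (suc b)) ≈ (1# - x) * poch (M ℕ.+ M)) (≡.sym (ℕₚ.+-suc k j))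
        (trans (*-congˡ (*-congˡ (poch-cong (≡.sym (ℕₚ.+-comm b 1))))) (trans (*-congˡ (*-congˡ (poch-cong (ℕₚ.+-assoc j (suc k ℕ.+ suc k) 1)))) (gauss-poch-up n (suc k) j p′)))

    -- The neighbour one step further out for the same N = k + j. The factor 1 - w^j covers j = 0,
    -- where k + 1 is out of range and both sides vanish.
    gauss-poch-up : ∀ n k j → k ℕ.+ j ≤ n → gauss (k ℕ.+ j) (suc k) * (poch j * poch (j ℕ.+ (k ℕ.+ k ℕ.+ 1))) ≈ (1# - pw j) * poch ((k ℕ.+ j) ℕ.+ (k ℕ.+ j))
    gauss-poch-up n k zero    _ = trans (*-congʳ (gauss-> (k ℕ.+ 0) (suc k) (s≤s (ℕₚ.≤-reflexive (ℕₚ.+-identityʳ k)))))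
      (trans (zeroˡ _) (sym (trans (*-congʳ one-minus-pw0) (zeroˡ _))))
    gauss-poch-up n k (suc j) p = begin
      gauss (k ℕ.+ suc j) (suc k) * (poch j * (1# - pw (suc j)) * poch (suc j ℕ.+ (k ℕ.+ k ℕ.+ 1)))
        ≈⟨ *-congˡ (*-congˡ (poch-cong eq)) ⟩
      gauss (k ℕ.+ suc j) (suc k) * (poch j * (1# - pw (suc j)) * poch (j ℕ.+ (suc k ℕ.+ suc k)))
        ≈⟨ solve 4 (λ g P z Q → g :* (P :* z :* Q) := z :* (g :* (P :* Q))) refl (gauss (k ℕ.+ suc j) (suc k)) (poch j) (1# - pw (suc j)) (poch (j ℕ.+ (suc k ℕ.+ suc k))) ⟩
      (1# - pw (suc j)) * (gauss (k ℕ.+ suc j) (suc k) * (poch j * poch (j ℕ.+ (suc k ℕ.+ suc k))))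
        ≈⟨ *-congˡ (≡.subst (λ M → gauss M (suc k) * (poch j * poch (j ℕ.+ (suc k ℕ.+ suc k))) ≈ poch (M ℕ.+ M)) (≡.sym (ℕₚ.+-suc k j)) (gauss-poch′ n (suc k) j (≡.subst (_≤ n) (ℕₚ.+-suc k j) p))) ⟩
      (1# - pw (suc j)) * poch ((k ℕ.+ suc j) ℕ.+ (k ℕ.+ suc j)) ∎
      where
      eq : suc j ℕ.+ (k ℕ.+ k ℕ.+ 1) ≡ j ℕ.+ (suc k ℕ.+ suc k)
      eq = ℕS.solve 2 (λ k j → (ℕS.con 1 ℕS.:+ j) ℕS.:+ (k ℕS.:+ k ℕS.:+ ℕS.con 1) ℕS.:= j ℕS.:+ ((ℕS.con 1 ℕS.:+ k) ℕS.:+ (ℕS.con 1 ℕS.:+ k))) ≡.refl k j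

  gauss-poch : ∀ k j → gauss (k ℕ.+ j) k * (poch j * poch (j ℕ.+ (k ℕ.+ k))) ≈ poch ((k ℕ.+ j) ℕ.+ (k ℕ.+ j))
  gauss-poch k j = gauss-poch′ (k ℕ.+ j) k j ℕₚ.≤-refl

-- The finite form of Jacobi's triple product.

module FiniteTripleProduct {c ℓ : Level} (R : CommutativeRing c ℓ) (s w : CommutativeRing.Carrier R) where
  open CommutativeRing R renaming (refl to ≈-refl)
  open IntegerSolver R
  open GaussCoefficients R w
  open import Relation.Binary.Reasoning.Setoid setoid

  sumR : ℕ → (ℕ → Carrier) → Carrier
  sumR zero    f = f 0
  sumR (suc n) f = sumR n f + f (suc n)

  sumR-cong : ∀ n {f g} → (∀ k → f k ≈ g k) → sumR n f ≈ sumR n g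
  sumR-cong zero    e = e 0
  sumR-cong (suc n) e = +-cong (sumR-cong n e) (e (suc n))

  sumR-+ : ∀ n f g → sumR n (λ k → f k + g k) ≈ sumR n f + sumR n g
  sumR-+ zero    f g = ≈-refl
  sumR-+ (suc n) f g = trans (+-congʳ (sumR-+ n f g)) (solve 4 (λ a b c d → a :+ b :+ (c :+ d) := a :+ c :+ (b :+ d)) ≈-refl (sumR n f) (sumR n g) (f (suc n)) (g (suc n)))

  sumR-*ʳ : ∀ n f x → sumR n (λ k → f k * x) ≈ sumR n f * x
  sumR-*ʳ zero    f x = ≈-refl
  sumR-*ʳ (suc n) f x = trans (+-congʳ (sumR-*ʳ n f x)) (sym (distribʳ x (sumR n f) (f (suc n))))

  sumR-first : ∀ n f → sumR (suc n) f ≈ f 0 + sumR n (λ k → f (suc k))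
  sumR-first zero    f = ≈-refl
  sumR-first (suc n) f = trans (+-congʳ (sumR-first n f)) (+-assoc (f 0) (sumR n (λ k → f (suc k))) (f (suc (suc n))))

  sumR-rotate : ∀ n f → f (suc n) ≈ 0# → f 0 + sumR n (λ k → f (suc k)) ≈ sumR n f
  sumR-rotate n f z = trans (sym (sumR-first n f)) (trans (+-congˡ z) (+-identityʳ (sumR n f)))

  -- powerSum k = α^k + β^k when s = α + β and w = αβ.
  powerSum : ℕ → Carrier
  powerSum zero          = 1# + 1#
  powerSum (suc zero)    = s
  powerSum (suc (suc k)) = s * powerSum (suc k) - w * powerSum k

  triPower : ℕ → Carrier
  triPower zero    = 1#
  triPower (suc k) = triPower k * pw k

  term : ℕ → Carrier
  term k = triPower k * powerSum k

  -- The recurrence p_{k+2} = s p_{k+1} - w p_k of the power sums, with the powers of w distributed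
  -- as in the recursion for `gauss`.
  term-step : ∀ j k → let N = j ℕ.+ suc k in s * pw N * term (suc k) ≈ pw j * term (suc (suc k)) + pw (suc (N ℕ.+ k)) * term k
  term-step j k = begin
    s * pw N * (t * pw k * p₁)
      ≈⟨ solve 7 (λ s n t k p₁ w p₀ → s :* n :* (t :* k :* p₁) := (t :* k) :* n :* (s :* p₁ :- w :* p₀) :+ w :* (n :* k) :* (t :* p₀)) ≈-refl s (pw N) t (pw k) p₁ w p₀ ⟩
    (t * pw k) * pw N * (s * p₁ - w * p₀) + w * (pw N * pw k) * (t * p₀)
      ≈⟨ +-cong (*-congʳ (*-congˡ (pw-+ j (suc k)))) (*-congʳ (*-congˡ (sym (pw-+ N k)))) ⟩
    (t * pw k) * (pw j * pw (suc k)) * (s * p₁ - w * p₀) + pw (suc (N ℕ.+ k)) * (t * p₀)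
      ≈⟨ +-congʳ (solve 4 (λ a j b p → a :* (j :* b) :* p := j :* (a :* b :* p)) ≈-refl (t * pw k) (pw j) (pw (suc k)) (s * p₁ - w * p₀)) ⟩
    pw j * (t * pw k * pw (suc k) * (s * p₁ - w * p₀)) + pw (suc (N ℕ.+ k)) * (t * p₀) ∎
    where
    N  = j ℕ.+ suc k
    t  = triPower k
    p₀ = powerSum k
    p₁ = powerSum (suc k)

  partial : ℕ → Carrier
  partial N = gauss N 0 + sumR N (λ k → gauss N (suc k) * term (suc k))

  -- The N-th factor is (1 + α w^N)(1 + β w^N), expanded so that only s and w = αβ occur.
  prodR : ℕ → Carrier
  prodR zero    = 1#
  prodR (suc N) = prodR N * (1# + s * pw N + pw (N ℕ.+ suc N))

  -- Multiplication by s w^N sends the k-th term to its neighbours k + 1 and k - 1 by `term-step`.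
  -- After an index shift these two sums (`G₁`, `G₃`) and the undisturbed one (`G₂`) are the three
  -- summands in the recursion for `gauss`.
  triple : ∀ N → prodR N ≈ partial N
  triple zero    = sym (trans (+-congˡ (zeroˡ _)) (+-identityʳ 1#))
  triple (suc N) = begin
    prodR N * (1# + s * pw N + pw M)
      ≈⟨ *-congʳ (triple N) ⟩
    (gauss N 0 + Σ₀) * (1# + s * pw N + pw M)
      ≈⟨ solve 6 (λ i g S s n m → (g :+ S) :* (i :+ s :* n :+ m) := g :* (i :+ m) :+ S :* (i :+ m) :+ (g :* (s :* n) :+ S :* (s :* n))) ≈-refl 1# (gauss N 0) Σ₀ s (pw N) (pw M) ⟩
    gauss N 0 * A + Σ₀ * A + (gauss N 0 * (s * pw N) + Σ₀ * (s * pw N))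
      ≈⟨ +-cong (+-congˡ (sym (sumR-*ʳ N _ A))) (+-cong head (trans (sym (sumR-*ʳ N _ (s * pw N))) (trans (sumR-cong N body) (sumR-+ N (λ k → G₁ (suc k)) G₃)))) ⟩
    gauss N 0 * A + sumR N G₂ + (G₁ 0 + (sumR N (λ k → G₁ (suc k)) + sumR N G₃))
      ≈⟨ +-congˡ (trans (sym (+-assoc _ _ _)) (+-cong (sumR-rotate N G₁ vanish₁) (sym (sumR-rotate N G₃ vanish₃)))) ⟩
    gauss N 0 * A + sumR N G₂ + (sumR N G₁ + (G₃ 0 + sumR N (λ k → G₃ (suc k))))
      ≈⟨ solve 5 (λ a b c d e → a :+ b :+ (c :+ (d :+ e)) := (a :+ d) :+ (b :+ c :+ e)) ≈-refl (gauss N 0 * A) (sumR N G₂) (sumR N G₁) (G₃ 0) (sumR N (λ k → G₃ (suc k))) ⟩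
    (gauss N 0 * A + G₃ 0) + (sumR N G₂ + sumR N G₁ + sumR N (λ k → G₃ (suc k)))
      ≈⟨ +-cong (+-congˡ first) (trans (+-congʳ (sym (sumR-+ N G₂ G₁))) (trans (sym (sumR-+ N (λ k → G₂ k + G₁ k) (λ k → G₃ (suc k)))) (sumR-cong N collect))) ⟩
    gauss (suc N) 0 + sumR N (λ k → gauss (suc N) (suc k) * term (suc k))
      ≈⟨ +-congˡ (sym (trans (+-congˡ (trans (*-congʳ (gauss-> (suc N) (suc (suc N)) ℕₚ.≤-refl)) (zeroˡ _))) (+-identityʳ _))) ⟩
    gauss (suc N) 0 + sumR (suc N) (λ k → gauss (suc N) (suc k) * term (suc k)) ∎
    where
    M  = N ℕ.+ suc N
    A  = 1# + pw M
    Σ₀ = sumR N (λ k → gauss N (suc k) * term (suc k))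
    G₁ G₂ G₃ : ℕ → Carrier
    G₁ k = pw (N ∸ k) * gauss N k * term (suc k)
    G₂ k = gauss N (suc k) * term (suc k) * A
    G₃ k = pw (suc (N ℕ.+ k)) * gauss N (suc k) * term k
    head : gauss N 0 * (s * pw N) ≈ G₁ 0
    head = begin
      gauss N 0 * (s * pw N)                     ≈⟨ solve 3 (λ g s n → g :* (s :* n) := n :* g :* s) ≈-refl (gauss N 0) s (pw N) ⟩
      pw N * gauss N 0 * s                       ≈⟨ *-congˡ (sym (trans (*-congʳ (*-identityˡ 1#)) (*-identityˡ s))) ⟩
      pw N * gauss N 0 * (1# * 1# * s)           ∎
    body : ∀ k → gauss N (suc k) * term (suc k) * (s * pw N) ≈ G₁ (suc k) + G₃ k
    body k with suc k ℕ.≤? N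
    ... | yes k<N = begin
      g * term (suc k) * (s * pw N)              ≈⟨ solve 4 (λ g t s n → g :* t :* (s :* n) := g :* (s :* n :* t)) ≈-refl g (term (suc k)) s (pw N) ⟩
      g * (s * pw N * term (suc k))              ≈⟨ *-congˡ (≡.subst (λ n → s * pw n * term (suc k) ≈ pw (N ∸ suc k) * term (suc (suc k)) + pw (suc (n ℕ.+ k)) * term k) (ℕₚ.m∸n+n≡m k<N) (term-step (N ∸ suc k) k)) ⟩
      g * (pw (N ∸ suc k) * term (suc (suc k)) + pw (suc (N ℕ.+ k)) * term k)
        ≈⟨ solve 5 (λ g a b c d → g :* (a :* b :+ c :* d) := a :* g :* b :+ c :* g :* d) ≈-refl g (pw (N ∸ suc k)) (term (suc (suc k))) (pw (suc (N ℕ.+ k))) (term k) ⟩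
      G₁ (suc k) + G₃ k                          ∎
      where g = gauss N (suc k)
    -- Beyond k = N the exponent `N ∸ suc k` is truncated, but every term then contains a vanishing
    -- `gauss`.
    ... | no k≮N = trans (vanishˡ g≈0) (sym (trans (+-cong (vanishᵐ g≈0) (vanishᵐ g≈0)) (+-identityʳ 0#)))
      where
      g≈0 = gauss-> N (suc k) (ℕₚ.≰⇒> k≮N)
      vanishˡ : ∀ {g x y} → g ≈ 0# → g * x * y ≈ 0#
      vanishˡ z = trans (*-congʳ (trans (*-congʳ z) (zeroˡ _))) (zeroˡ _)
      vanishᵐ : ∀ {g x y} → g ≈ 0# → x * g * y ≈ 0#
      vanishᵐ z = trans (*-congʳ (trans (*-congˡ z) (zeroʳ _))) (zeroˡ _)
    vanish₁ : G₁ (suc N) ≈ 0#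
    vanish₁ = trans (*-congʳ (trans (*-congˡ (gauss-> N (suc N) ℕₚ.≤-refl)) (zeroʳ _))) (zeroˡ _)
    vanish₃ : G₃ (suc N) ≈ 0#
    vanish₃ = trans (*-congʳ (trans (*-congˡ (gauss-> N (suc (suc N)) (ℕₚ.m<n⇒m<1+n ℕₚ.≤-refl))) (zeroʳ _))) (zeroˡ _)
    first : G₃ 0 ≈ (1# + 1#) * (pw (suc N) * gauss N 1)
    first = begin
      pw (suc (N ℕ.+ 0)) * gauss N 1 * (1# * (1# + 1#))   ≈⟨ *-cong (*-congʳ (pw-cong (≡.cong suc (ℕₚ.+-identityʳ N)))) (*-identityˡ (1# + 1#)) ⟩
      pw (suc N) * gauss N 1 * (1# + 1#)                  ≈⟨ *-comm _ _ ⟩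
      (1# + 1#) * (pw (suc N) * gauss N 1)                ∎
    collect : ∀ k → G₂ k + G₁ k + G₃ (suc k) ≈ gauss (suc N) (suc k) * term (suc k)
    collect k = trans (+-congˡ (*-congʳ (*-congʳ (pw-cong (≡.cong suc (ℕₚ.+-suc N k))))))
      (solve 7 (λ g A t a b c d → g :* t :* A :+ a :* b :* t :+ c :* d :* t := (g :* A :+ a :* b :+ c :* d) :* t) ≈-refl
        (gauss N (suc k)) A (term (suc k)) (pw (N ∸ k)) (gauss N k) (pw (suc (suc (N ℕ.+ k)))) (gauss N (suc (suc k))))

  powerSum-split : ∀ α β → s ≈ α + β → w ≈ α * β → ∀ k → powerSum k ≈ GaussCoefficients.pw R α k + GaussCoefficients.pw R β k
  powerSum-split α β s≈ w≈ = go
    where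
    module α = GaussCoefficients R α
    module β = GaussCoefficients R β
    go : ∀ k → powerSum k ≈ α.pw k + β.pw k
    go zero          = ≈-refl
    go (suc zero)    = trans s≈ (+-cong (sym (*-identityʳ α)) (sym (*-identityʳ β)))
    go (suc (suc k)) = trans (+-cong (*-cong s≈ (go (suc k))) (-‿cong (*-cong w≈ (go k))))
      (solve 4 (λ α β a b → (α :+ β) :* (α :* a :+ β :* b) :- α :* β :* (a :+ b) := α :* (α :* a) :+ β :* (β :* b)) ≈-refl α β (α.pw k) (β.pw k))

-- The polynomial identities behind the theta and Eisenstein computations.

module RingIdentities {a ℓ : Level} (R : CommutativeRing a ℓ) where
  open CommutativeRing R
  open IntegerSolver R

  infix 9 #_
  #_ : ℕ → Carrier
  # n = ♯ (+ n)

  private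
    k : ∀ {n} → ℕ → Polynomial n
    k n = con (+ n)

  from-difference : ∀ {x y} → x - y ≈ 0# → x ≈ y
  from-difference {x} {y} e = trans (solve 2 (λ x y → x := (x :- y) :+ y) refl x y) (trans (+-congʳ e) (+-identityˡ y))

  to-difference : ∀ {l r} → l ≈ r → l - r ≈ 0#
  to-difference {l} {r} e = trans (+-congʳ e) (-‿inverseʳ r)

  -- A certificate for ideal membership: once x - y is written as a cofactor times l - r, a pure
  -- polynomial identity remains for the solver. The variants below take several hypotheses.
  linear : ∀ {x y l r} c → x - y ≈ c * (l - r) → l ≈ r → x ≈ y
  linear c e h = from-difference (trans e (trans (*-congˡ (to-difference h)) (zeroʳ c)))

  linear₂ : ∀ {x y l r l′ r′} c c′ → x - y ≈ c * (l - r) + c′ * (l′ - r′) → l ≈ r → l′ ≈ r′ → x ≈ y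
  linear₂ c c′ e h h′ = from-difference (trans e (trans (+-cong (trans (*-congˡ (to-difference h)) (zeroʳ c)) (trans (*-congˡ (to-difference h′)) (zeroʳ c′))) (+-identityˡ 0#)))

  linear₃ : ∀ {x y l r l′ r′ l″ r″} c c′ c″ → x - y ≈ c * (l - r) + c′ * (l′ - r′) + c″ * (l″ - r″) → l ≈ r → l′ ≈ r′ → l″ ≈ r″ → x ≈ y
  linear₃ c c′ c″ e h h′ h″ = from-difference (trans e (trans (+-cong (trans (+-cong (trans (*-congˡ (to-difference h)) (zeroʳ c)) (trans (*-congˡ (to-difference h′)) (zeroʳ c′))) (+-identityˡ 0#)) (trans (*-congˡ (to-difference h″)) (zeroʳ c″))) (+-identityˡ 0#)))

  -- For L(q), L(q²), L(q⁴), `e` and `e⁻` are D log φ(q) and D log φ(-q), and `δ` is their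
  -- difference. `x²` and `u⁴` are the values of φ(q)⁴ and φ(-q)⁴ to be established.
  module Eisenstein (L₁ L₂ L₄ : Carrier) where
    e e⁻ δ x² u⁴ : Carrier
    e  = # 2 * L₁ - # 10 * L₂ + # 8 * L₄
    e⁻ = # 2 * L₂ - # 2 * L₁
    δ  = # 4 * L₁ - # 12 * L₂ + # 8 * L₄
    x² = # 8 * L₁ - # 32 * L₄
    u⁴ = # 48 * L₂ - # 8 * L₁ - # 64 * L₄

  module _ {X U Y L₁ L₂ L₄ L₈ : Carrier} (sum : X + U ≈ # 2 * Y) where
    module E₁ = Eisenstein L₁ L₂ L₄
    module E₂ = Eisenstein L₂ L₄ L₈

    -- Write X e + U e⁻ through the half sum and half difference of e and e⁻. The sum e + e⁻ is four
    -- times e⁻ at q², in accordance with φ(q) φ(-q) = φ(-q²)², and this turns the e at q² on the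
    -- right into δ at q².
    δ-equation : X * (E₁.e + E₁.e) + U * (E₁.e⁻ + E₁.e⁻) ≈ # 2 * (Y * (# 2 * E₂.e + # 2 * E₂.e)) → (X - U) * E₁.δ ≈ # 8 * (Y * E₂.δ)
    δ-equation h = linear₂ (# 1) (# 4 * E₂.δ - # 2 * (# 2 * E₂.e)) (solve 7 (λ X U Y L₁ L₂ L₄ L₈ →
        let e = k 2 :* L₁ :- k 10 :* L₂ :+ k 8 :* L₄ ; e⁻ = k 2 :* L₂ :- k 2 :* L₁ ; δ = k 4 :* L₁ :- k 12 :* L₂ :+ k 8 :* L₄
            e₂ = k 2 :* L₂ :- k 10 :* L₄ :+ k 8 :* L₈ ; δ₂ = k 4 :* L₂ :- k 12 :* L₄ :+ k 8 :* L₈ in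
        (X :- U) :* δ :- k 8 :* (Y :* δ₂) := k 1 :* ((X :* (e :+ e) :+ U :* (e⁻ :+ e⁻)) :- k 2 :* (Y :* (k 2 :* e₂ :+ k 2 :* e₂))) :+ (k 4 :* δ₂ :- k 2 :* (k 2 :* e₂)) :* ((X :+ U) :- k 2 :* Y))
      refl X U Y L₁ L₂ L₄ L₈) h sum

    -- From X + U = 2Y follows (X - U)² = 4 (Y² - XU). As XU = φ(-q²)⁴, the bracket on the right is
    -- X² - U² at q², so X² - U² obeys the same law as δ.
    Δ-equation : (X - U) * (X * X - U * U) ≈ # 8 * (Y * (Y * Y - X * U))
    Δ-equation = linear ((X + U) * (X + U) + # 2 * ((X + U) * Y) + # 4 * (Y * Y) - # 4 * (X * U)) (solve 3 (λ X U Y →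
        (X :- U) :* (X :* X :- U :* U) :- k 8 :* (Y :* (Y :* Y :- X :* U)) := ((X :+ U) :* (X :+ U) :+ k 2 :* ((X :+ U) :* Y) :+ k 4 :* (Y :* Y) :- k 4 :* (X :* U)) :* ((X :+ U) :- k 2 :* Y)) refl X U Y) sum

    -- Says that the error U² - u⁴ is invariant under q ↦ q², because U² becomes XU under that
    -- substitution.
    J-equation : X * X - U * U ≈ # 4 * E₁.δ → Y * Y - X * U ≈ # 4 * E₂.δ → # 2 * (U * U - E₁.u⁴) ≈ # 2 * (X * U - E₂.u⁴)
    J-equation h h₂ = linear₃ (- # 1) (# 4) (X + U + # 2 * Y) (solve 7 (λ X U Y L₁ L₂ L₄ L₈ →
        let δ = k 4 :* L₁ :- k 12 :* L₂ :+ k 8 :* L₄ ; δ₂ = k 4 :* L₂ :- k 12 :* L₄ :+ k 8 :* L₈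
            u⁴ = k 48 :* L₂ :- k 8 :* L₁ :- k 64 :* L₄ ; u⁴₂ = k 48 :* L₄ :- k 8 :* L₂ :- k 64 :* L₈ in
        k 2 :* (U :* U :- u⁴) :- k 2 :* (X :* U :- u⁴₂) := (:- k 1) :* ((X :* X :- U :* U) :- k 4 :* δ) :+ k 4 :* ((Y :* Y :- X :* U) :- k 4 :* δ₂) :+ (X :+ U :+ k 2 :* Y) :* ((X :+ U) :- k 2 :* Y))
      refl X U Y L₁ L₂ L₄ L₈) h h₂ sum

    x²-formula : X * X - U * U ≈ # 4 * E₁.δ → U * U ≈ E₁.u⁴ → X * X ≈ E₁.x²
    x²-formula h h′ = linear₂ (# 1) (# 1) (solve 5 (λ X U L₁ L₂ L₄ →
        let δ = k 4 :* L₁ :- k 12 :* L₂ :+ k 8 :* L₄ ; u⁴ = k 48 :* L₂ :- k 8 :* L₁ :- k 64 :* L₄ in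
        X :* X :- (k 8 :* L₁ :- k 32 :* L₄) := k 1 :* ((X :* X :- U :* U) :- k 4 :* δ) :+ k 1 :* (U :* U :- u⁴)) refl X U L₁ L₂ L₄) h h′

    -- Multiply X + U = 2Y by X; both X² and XU = φ(-q²)⁴ are already known in terms of L.
    xy-formula : X * X ≈ E₁.x² → X * U ≈ E₂.u⁴ → # 2 * (X * Y) ≈ # 2 * (# 4 * L₁ - # 4 * L₂ + # 8 * L₄ - # 32 * L₈)
    xy-formula h h′ = linear₃ (# 1) (# 1) (- X) (solve 7 (λ X U Y L₁ L₂ L₄ L₈ →
        k 2 :* (X :* Y) :- k 2 :* (k 4 :* L₁ :- k 4 :* L₂ :+ k 8 :* L₄ :- k 32 :* L₈) :=
          k 1 :* (X :* X :- (k 8 :* L₁ :- k 32 :* L₄)) :+ k 1 :* (X :* U :- (k 48 :* L₄ :- k 8 :* L₂ :- k 64 :* L₈)) :+ (:- X) :* ((X :+ U) :- k 2 :* Y)) refl X U Y L₁ L₂ L₄ L₈) h h′ sum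

  linear₄ : ∀ {x y l r l′ r′ l″ r″ l‴ r‴} c c′ c″ c‴ → x - y ≈ c * (l - r) + c′ * (l′ - r′) + c″ * (l″ - r″) + c‴ * (l‴ - r‴) → l ≈ r → l′ ≈ r′ → l″ ≈ r″ → l‴ ≈ r‴ → x ≈ y
  linear₄ {l = l} {r} {l′} {r′} {l″} {r″} c c′ c″ c‴ e h h′ h″ h‴ = linear₂ {l = c * l + c′ * l′ + c″ * l″} {c * r + c′ * r′ + c″ * r″} (# 1) c‴
    (trans e (+-congʳ (solve 9 (λ c c′ c″ l r l′ r′ l″ r″ → c :* (l :- r) :+ c′ :* (l′ :- r′) :+ c″ :* (l″ :- r″) := k 1 :* ((c :* l :+ c′ :* l′ :+ c″ :* l″) :- (c :* r :+ c′ :* r′ :+ c″ :* r″))) refl c c′ c″ l r l′ r′ l″ r″)))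
    (+-cong (+-cong (*-congˡ h) (*-congˡ h′)) (*-congˡ h″)) h‴

  -- X, Y, Z, W stand for φ(q)², φ(q²)², φ(q⁵)², φ(q¹⁰)².
  module Quintic {X Y Z W A₁ A₂ A₃ : Carrier}
    (hP  : # 16 * A₁ ≈ (X - Z) * (# 5 * Z - X))
    (hP⁻ : - (# 16 * A₁) ≈ ((# 2 * Y - X) - (# 2 * W - Z)) * (# 5 * (# 2 * W - Z) - (# 2 * Y - X)))
    (hP₂ : # 16 * A₂ ≈ (Y - W) * (# 5 * W - Y))
    (hQ  : X * W - Y * Z ≈ # 4 * A₁ + # 8 * A₃) where

    xz-formula : # 6 * (X * Z) ≈ X * X + # 5 * (Z * Z) + # 16 * A₁
    xz-formula = linear (- # 1) (solve 3 (λ X Z A → k 6 :* (X :* Z) :- (X :* X :+ k 5 :* (Z :* Z) :+ k 16 :* A) := (:- k 1) :* (k 16 :* A :- (X :- Z) :* (k 5 :* Z :- X))) refl X Z A₁) hP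

    -- The relations at q, -q and q² together determine XW + YZ, while `hQ` gives XW - YZ. This
    -- formula and `yz-formula` are the half sum and half difference, with denominators cleared.
    xw-formula : # 24 * (X * W) ≈ # 4 * (X * Y + # 5 * (Z * W) + # 20 * A₁ + # 16 * A₂ + # 24 * A₃)
    xw-formula = linear₄ (# 12) (- # 4) (- # 1) (# 1) (solve 7 (λ X Y Z W A₁ A₂ A₃ →
        k 24 :* (X :* W) :- k 4 :* (X :* Y :+ k 5 :* (Z :* W) :+ k 20 :* A₁ :+ k 16 :* A₂ :+ k 24 :* A₃) :=
          k 12 :* ((X :* W :- Y :* Z) :- (k 4 :* A₁ :+ k 8 :* A₃)) :+ (:- k 4) :* (k 16 :* A₂ :- (Y :- W) :* (k 5 :* W :- Y))
          :+ (:- k 1) :* (k 16 :* A₁ :- (X :- Z) :* (k 5 :* Z :- X)) :+ k 1 :* (:- (k 16 :* A₁) :- ((k 2 :* Y :- X) :- (k 2 :* W :- Z)) :* (k 5 :* (k 2 :* W :- Z) :- (k 2 :* Y :- X))))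
      refl X Y Z W A₁ A₂ A₃) hQ hP₂ hP hP⁻

    yz-formula : # 24 * (Y * Z) ≈ # 4 * (X * Y + # 5 * (Z * W) - # 4 * A₁ + # 16 * A₂ - # 24 * A₃)
    yz-formula = linear₄ (- # 12) (- # 4) (- # 1) (# 1) (solve 7 (λ X Y Z W A₁ A₂ A₃ →
        k 24 :* (Y :* Z) :- k 4 :* (X :* Y :+ k 5 :* (Z :* W) :- k 4 :* A₁ :+ k 16 :* A₂ :- k 24 :* A₃) :=
          (:- k 12) :* ((X :* W :- Y :* Z) :- (k 4 :* A₁ :+ k 8 :* A₃)) :+ (:- k 4) :* (k 16 :* A₂ :- (Y :- W) :* (k 5 :* W :- Y))
          :+ (:- k 1) :* (k 16 :* A₁ :- (X :- Z) :* (k 5 :* Z :- X)) :+ k 1 :* (:- (k 16 :* A₁) :- ((k 2 :* Y :- X) :- (k 2 :* W :- Z)) :* (k 5 :* (k 2 :* W :- Z) :- (k 2 :* Y :- X))))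
      refl X Y Z W A₁ A₂ A₃) hQ hP₂ hP hP⁻

    -- Adding the relations at q and -q eliminates A₁. What remains equates two products of linear
    -- forms, so it can be parametrised by the ratio of a form on one side to a form on the other.
    quadric : # 2 * ((Y - W) * (# 5 * W - Y)) ≈ # 2 * ((X - Z - (Y - W)) * (X - # 5 * Z - (Y - # 5 * W)))
    quadric = linear₂ (- # 1) (- # 1) (solve 5 (λ X Y Z W A₁ →
        k 2 :* ((Y :- W) :* (k 5 :* W :- Y)) :- k 2 :* ((X :- Z :- (Y :- W)) :* (X :- k 5 :* Z :- (Y :- k 5 :* W))) :=
          (:- k 1) :* (k 16 :* A₁ :- (X :- Z) :* (k 5 :* Z :- X)) :+ (:- k 1) :* (:- (k 16 :* A₁) :- ((k 2 :* Y :- X) :- (k 2 :* W :- Z)) :* (k 5 :* (k 2 :* W :- Z) :- (k 2 :* Y :- X))))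
      refl X Y Z W A₁) hP hP⁻

  -- Differentiating hP; here DX = 2 X e, DZ = 2 Z e′, DA₁ = A₁ Λ and g = e - e′.
  derived : ∀ {X Z A₁ e e′ Λ} → # 16 * A₁ ≈ (X - Z) * (# 5 * Z - X) →
    # 16 * (A₁ * Λ) ≈ (X * (e + e) - Z * (e′ + e′)) * (# 5 * Z - X) + (X - Z) * (# 5 * (Z * (e′ + e′)) - X * (e + e)) →
    # 2 * ((e - e′) * (# 5 * (Z * Z) - X * X)) ≈ # 16 * A₁ * (Λ - # 2 * e - # 2 * e′)
  derived {X} {Z} {A₁} {e} {e′} {Λ} hP hD = linear₂ (# 2 * e + # 2 * e′) (- # 1) (solve 6 (λ X Z A e f Λ →
      k 2 :* ((e :- f) :* (k 5 :* (Z :* Z) :- X :* X)) :- k 16 :* A :* (Λ :- k 2 :* e :- k 2 :* f) :=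
        (k 2 :* e :+ k 2 :* f) :* (k 16 :* A :- (X :- Z) :* (k 5 :* Z :- X))
        :+ (:- k 1) :* (k 16 :* (A :* Λ) :- ((X :* (e :+ e) :- Z :* (f :+ f)) :* (k 5 :* Z :- X) :+ (X :- Z) :* (k 5 :* (Z :* (f :+ f)) :- X :* (e :+ e)))))
    refl X Z A₁ e e′ Λ) hP hD

  -- With t = A₃/A₂, the eight theta and eta products become polynomials in m, n, t subject to one relation.
  module Parametrised (m n t : Carrier) where
    -- `c` is A₁/(mn), `rel` is the relation A₁ Y (Z - W) = 4 A₃² divided by mn, and `D₁` is a
    -- quarter of 5Z² - X². `N` and `M` are the values of c D log (φ(q)/φ(q⁵)) and c φ(q) φ(q²)
    -- φ(q⁵) φ(q¹⁰) in these parameters.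
    c X Y Z W U U₅ rel D₁ N M : Carrier
    c   = # 1 - t * t
    X   = (# 1 - t) * n + # 5 * ((# 1 + t) * m)
    Y   = n + # 5 * (t * m)
    Z   = (# 1 - t) * n + (# 1 + t) * m
    W   = n + t * m
    U   = # 2 * Y - X
    U₅  = # 2 * W - Z
    rel = c * (Y * (Z - W)) - # 4 * ((t * t) * (t * t) * (m * n))
    D₁  = (# 1 - t) * (# 1 - t) * (n * n) - # 5 * ((# 1 + t) * (# 1 + t) * (m * m))
    N   = # 2 * (t * c * (n * n + # 5 * (m * m))) - # 4 * (t * (# 1 + t * t) * (m * n))
    M   = c * (m * n * (# 1 + t * t) + (# 1 + t) * (n * n) + # 5 * (t * (# 1 - t) * (m * m))) + # 4 * (t * (# 1 + t * t) * (m * n))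

    private
      module P {i : ℕ} (m n t : Polynomial i) where
        cᵖ Xᵖ Yᵖ Zᵖ Wᵖ Uᵖ U₅ᵖ relᵖ D₁ᵖ Nᵖ Mᵖ : Polynomial i
        cᵖ   = k 1 :- t :* t
        Xᵖ   = (k 1 :- t) :* n :+ k 5 :* ((k 1 :+ t) :* m)
        Yᵖ   = n :+ k 5 :* (t :* m)
        Zᵖ   = (k 1 :- t) :* n :+ (k 1 :+ t) :* m
        Wᵖ   = n :+ t :* m
        Uᵖ   = k 2 :* Yᵖ :- Xᵖ
        U₅ᵖ  = k 2 :* Wᵖ :- Zᵖ
        relᵖ = cᵖ :* (Yᵖ :* (Zᵖ :- Wᵖ)) :- k 4 :* ((t :* t) :* (t :* t) :* (m :* n))
        D₁ᵖ  = (k 1 :- t) :* (k 1 :- t) :* (n :* n) :- k 5 :* ((k 1 :+ t) :* (k 1 :+ t) :* (m :* m))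
        Nᵖ   = k 2 :* (t :* cᵖ :* (n :* n :+ k 5 :* (m :* m))) :- k 4 :* (t :* (k 1 :+ t :* t) :* (m :* n))
        Mᵖ   = cᵖ :* (m :* n :* (k 1 :+ t :* t) :+ (k 1 :+ t) :* (n :* n) :+ k 5 :* (t :* (k 1 :- t) :* (m :* m))) :+ k 4 :* (t :* (k 1 :+ t :* t) :* (m :* n))

    A₁-formula : ∀ {A₁} → # 16 * A₁ ≈ (X - Z) * (# 5 * Z - X) → # 16 * A₁ ≈ # 16 * (m * n * c)
    A₁-formula h = trans h (solve 3 (λ m n t → let open P m n t in (Xᵖ :- Zᵖ) :* (k 5 :* Zᵖ :- Xᵖ) := k 16 :* (m :* n :* cᵖ)) refl m n t)

    A₃-formula : ∀ {A₁ A₃} → A₁ ≈ m * n * c → X * W - Y * Z ≈ # 4 * A₁ + # 8 * A₃ → # 8 * A₃ ≈ # 8 * (t * t * (m * n))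
    A₃-formula {A₁} {A₃} h h′ = linear₂ (- # 1) (- # 4) (solve 5 (λ m n t A₁ A₃ → let open P m n t in
        k 8 :* A₃ :- k 8 :* (t :* t :* (m :* n)) := (:- k 1) :* ((Xᵖ :* Wᵖ :- Yᵖ :* Zᵖ) :- (k 4 :* A₁ :+ k 8 :* A₃)) :+ (:- k 4) :* (A₁ :- m :* n :* cᵖ)) refl m n t A₁ A₃) h′ h

    relation : ∀ {A₁ A₃} → A₁ ≈ m * n * c → A₃ ≈ t * t * (m * n) → A₁ * (Y * (Z - W)) ≈ # 4 * (A₃ * A₃) → n * (m * rel) ≈ n * (m * 0#)
    relation {A₁} {A₃} h h′ h″ = trans (solve 3 (λ m n t → let open P m n t in n :* (m :* relᵖ) := m :* n :* cᵖ :* (Yᵖ :* (Zᵖ :- Wᵖ)) :- k 4 :* ((t :* t :* (m :* n)) :* (t :* t :* (m :* n)))) refl m n t)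
      (trans (to-difference (trans (*-congʳ (sym h)) (trans h″ (*-congˡ (*-cong h′ h′))))) (sym (trans (*-congˡ (zeroʳ m)) (zeroʳ n))))

    -- Substituting the parametrisation gives 48 D₁ on the left. The right side is divisible by D₁
    -- only modulo `rel`, with quotient `N`; the factor D₁ stays until it can be cancelled as a
    -- series with invertible constant term.
    g-formula : ∀ {A₁ g} → rel ≈ 0# → A₁ ≈ m * n * c →
      # 12 * (g * (# 5 * (Z * Z) - X * X)) ≈ # 16 * A₁ * (# 2 * (U * U) - X * X + # 5 * (# 2 * (U₅ * U₅) - Z * Z)) →
      # 48 * (D₁ * (c * g)) ≈ # 48 * (D₁ * N)
    g-formula {A₁} {g} hr hA hg = linear₃ c (# 16 * c * (# 2 * (U * U) - X * X + # 5 * (# 2 * (U₅ * U₅) - Z * Z)))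
        (# 48 * (# 2 * ((# 1 - t) * (# 1 - t) * (n * n)) - # 20 * (c * (m * n)) + # 10 * ((# 1 + t) * (# 1 + t) * (m * m))))
        (solve 5 (λ m n t A₁ g → let open P m n t in
          k 48 :* (D₁ᵖ :* (cᵖ :* g)) :- k 48 :* (D₁ᵖ :* Nᵖ) :=
            cᵖ :* (k 12 :* (g :* (k 5 :* (Zᵖ :* Zᵖ) :- Xᵖ :* Xᵖ)) :- k 16 :* A₁ :* (k 2 :* (Uᵖ :* Uᵖ) :- Xᵖ :* Xᵖ :+ k 5 :* (k 2 :* (U₅ᵖ :* U₅ᵖ) :- Zᵖ :* Zᵖ)))
            :+ (k 16 :* cᵖ :* (k 2 :* (Uᵖ :* Uᵖ) :- Xᵖ :* Xᵖ :+ k 5 :* (k 2 :* (U₅ᵖ :* U₅ᵖ) :- Zᵖ :* Zᵖ))) :* (A₁ :- m :* n :* cᵖ)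
            :+ (k 48 :* (k 2 :* ((k 1 :- t) :* (k 1 :- t) :* (n :* n)) :- k 20 :* (cᵖ :* (m :* n)) :+ k 10 :* ((k 1 :+ t) :* (k 1 :+ t) :* (m :* m)))) :* (relᵖ :- k 0))
        refl m n t A₁ g) hg hA hr

    -- The difference c² XYZW - M² is a multiple of `rel`. It is stated in factored form so that the
    -- factor c F + M can be cancelled.
    square-formula : ∀ {F} → rel ≈ 0# → F * F ≈ X * Y * (Z * W) → (c * F + M) * (c * F - M) ≈ (c * F + M) * 0#
    square-formula {F} hr hF = trans (linear₂ (c * c) (# 4 * (c * (n * n)) + # 4 * ((# 1 + # 2 * t + # 2 * (t * t) - # 2 * (t * t * t) + t * t * t * t) * (m * n)) + # 20 * (t * t * c * (m * m)))
        (solve 4 (λ m n t F → let open P m n t in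
          (cᵖ :* F :+ Mᵖ) :* (cᵖ :* F :- Mᵖ) :- k 0 := cᵖ :* cᵖ :* (F :* F :- Xᵖ :* Yᵖ :* (Zᵖ :* Wᵖ))
            :+ (k 4 :* (cᵖ :* (n :* n)) :+ k 4 :* ((k 1 :+ k 2 :* t :+ k 2 :* (t :* t) :- k 2 :* (t :* t :* t) :+ t :* t :* t :* t) :* (m :* n)) :+ k 20 :* (t :* t :* cᵖ :* (m :* m))) :* (relᵖ :- k 0))
        refl m n t F) hF hr) (sym (zeroʳ _))

    -- Replaces `M` and `N` by those products of X, Y, Z, W whose expansions in L, A₁ and A₃ are
    -- known. The unknown F appears together with g because g is itself a combination of values of
    -- L.
    theta-formula : ∀ {F g} → c * F - M ≈ 0# → c * g ≈ N → c * (# 4 * F + # 4 * g) ≈ c * (X * W - Y * Z - # 4 * (Y * Y) + # 3 * (X * Y) + # 20 * (W * W) - # 15 * (Z * W))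
    theta-formula {F} {g} hF hg = linear₂ (# 4) (# 4) (solve 5 (λ m n t F g → let open P m n t in
        cᵖ :* (k 4 :* F :+ k 4 :* g) :- cᵖ :* (Xᵖ :* Wᵖ :- Yᵖ :* Zᵖ :- k 4 :* (Yᵖ :* Yᵖ) :+ k 3 :* (Xᵖ :* Yᵖ) :+ k 20 :* (Wᵖ :* Wᵖ) :- k 15 :* (Zᵖ :* Wᵖ)) :=
          k 4 :* ((cᵖ :* F :- Mᵖ) :- k 0) :+ k 4 :* (cᵖ :* g :- Nᵖ)) refl m n t F g) hF hg

-- Adjoining τ = ζ + ζ⁻¹ for a fifth root of unity ζ.

open import Data.Product using (_×_; _,_; proj₁; proj₂; ∃)

-- R[τ] with τ² = 1 - τ; the pair (a , b) is a + bτ.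
module Golden {c ℓ : Level} (R : CommutativeRing c ℓ) where
  open CommutativeRing R renaming (Carrier to C; refl to ≈-refl; sym to ≈-sym; trans to ≈-trans; _≈_ to _≈₁_; _+_ to _+₁_; _*_ to _*₁_; -_ to -₁_; _-_ to _-₁_; +-cong to +₁-cong; *-cong to *₁-cong; -‿cong to -₁-cong)
  module S = IntegerSolver R

  infixl 7 _⊠_
  _⊠_ : C × C → C × C → C × C
  (a , b) ⊠ (x , y) = a *₁ x +₁ b *₁ y , a *₁ y +₁ b *₁ x -₁ b *₁ y

  goldenRing : CommutativeRing c ℓ
  goldenRing = record
    { Carrier = C × C
    ; _≈_ = λ (a , b) (x , y) → (a ≈₁ x) × (b ≈₁ y)
    ; _+_ = λ (a , b) (x , y) → a +₁ x , b +₁ y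
    ; _*_ = _⊠_
    ; -_  = λ (a , b) → -₁ a , -₁ b
    ; 0#  = 0# , 0#
    ; 1#  = 1# , 0#
    ; isCommutativeRing = record
      { isRing = record
        { +-isAbelianGroup = record
          { isGroup = record
            { isMonoid = record
              { isSemigroup = record
                { isMagma = record
                  { isEquivalence = record
                    { refl = ≈-refl , ≈-refl ; sym = λ (p , q) → ≈-sym p , ≈-sym q ; trans = λ (p , q) (p′ , q′) → ≈-trans p p′ , ≈-trans q q′ }
                  ; ∙-cong = λ (p , q) (p′ , q′) → +₁-cong p p′ , +₁-cong q q′ }
                ; assoc = λ (a , b) (x , y) (u , v) → +-assoc a x u , +-assoc b y v }
              ; identity = (λ (a , b) → +-identityˡ a , +-identityˡ b) , (λ (a , b) → +-identityʳ a , +-identityʳ b) }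
            ; inverse = (λ (a , b) → -‿inverseˡ a , -‿inverseˡ b) , (λ (a , b) → -‿inverseʳ a , -‿inverseʳ b)
            ; ⁻¹-cong = λ (p , q) → -₁-cong p , -₁-cong q }
          ; comm = λ (a , b) (x , y) → +-comm a x , +-comm b y }
        ; *-cong = λ (p , q) (p′ , q′) → +₁-cong (*₁-cong p p′) (*₁-cong q q′) , +₁-cong (+₁-cong (*₁-cong p q′) (*₁-cong q p′)) (-₁-cong (*₁-cong q q′))
        ; *-assoc = λ (a , b) (x , y) (u , v) →
            S.solve 6 (λ a b x y u v → (a S.:* x S.:+ b S.:* y) S.:* u S.:+ (a S.:* y S.:+ b S.:* x S.:- b S.:* y) S.:* v
              S.:= a S.:* (x S.:* u S.:+ y S.:* v) S.:+ b S.:* (x S.:* v S.:+ y S.:* u S.:- y S.:* v)) ≈-refl a b x y u v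
          , S.solve 6 (λ a b x y u v → (a S.:* x S.:+ b S.:* y) S.:* v S.:+ (a S.:* y S.:+ b S.:* x S.:- b S.:* y) S.:* u S.:- (a S.:* y S.:+ b S.:* x S.:- b S.:* y) S.:* v
              S.:= a S.:* (x S.:* v S.:+ y S.:* u S.:- y S.:* v) S.:+ b S.:* (x S.:* u S.:+ y S.:* v) S.:- b S.:* (x S.:* v S.:+ y S.:* u S.:- y S.:* v)) ≈-refl a b x y u v
        ; *-identity = identˡ , λ p → (let (e , f) = comm p (1# , 0#) ; (g , h) = identˡ p in ≈-trans e g , ≈-trans f h)
        ; distrib = distˡ , λ p r s → (let (e , f) = comm (r +₂ s) p ; (g , h) = distˡ p r s ; (i , j) = comm p r ; (k , l) = comm p s in
            ≈-trans e (≈-trans g (+₁-cong i k)) , ≈-trans f (≈-trans h (+₁-cong j l))) }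
      ; *-comm = comm } }
    where
    _+₂_ : C × C → C × C → C × C
    (a , b) +₂ (x , y) = a +₁ x , b +₁ y
    comm : ∀ p r → (proj₁ (p ⊠ r) ≈₁ proj₁ (r ⊠ p)) × (proj₂ (p ⊠ r) ≈₁ proj₂ (r ⊠ p))
    comm (a , b) (x , y) = S.solve 4 (λ a b x y → a S.:* x S.:+ b S.:* y S.:= x S.:* a S.:+ y S.:* b) ≈-refl a b x y
      , S.solve 4 (λ a b x y → a S.:* y S.:+ b S.:* x S.:- b S.:* y S.:= x S.:* b S.:+ y S.:* a S.:- y S.:* b) ≈-refl a b x y
    identˡ : ∀ p → (proj₁ ((1# , 0#) ⊠ p) ≈₁ proj₁ p) × (proj₂ ((1# , 0#) ⊠ p) ≈₁ proj₂ p)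
    identˡ (a , b) = ≈-trans (+₁-cong (*-identityˡ a) (zeroˡ b)) (+-identityʳ a)
      , ≈-trans (+₁-cong (+₁-cong (*-identityˡ b) (zeroˡ a)) (-₁-cong (zeroˡ b))) (S.solve 1 (λ b → b S.:+ S.con (+ 0) S.:- S.con (+ 0) S.:= b) ≈-refl b)
    distˡ : ∀ p r s → (proj₁ (p ⊠ (r +₂ s)) ≈₁ proj₁ (p ⊠ r) +₁ proj₁ (p ⊠ s)) × (proj₂ (p ⊠ (r +₂ s)) ≈₁ proj₂ (p ⊠ r) +₁ proj₂ (p ⊠ s))
    distˡ (a , b) (x , y) (u , v) =
        S.solve 6 (λ a b x y u v → a S.:* (x S.:+ u) S.:+ b S.:* (y S.:+ v) S.:= a S.:* x S.:+ b S.:* y S.:+ (a S.:* u S.:+ b S.:* v)) ≈-refl a b x y u v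
      , S.solve 6 (λ a b x y u v → a S.:* (y S.:+ v) S.:+ b S.:* (x S.:+ u) S.:- b S.:* (y S.:+ v)
          S.:= a S.:* y S.:+ b S.:* x S.:- b S.:* y S.:+ (a S.:* v S.:+ b S.:* u S.:- b S.:* v)) ≈-refl a b x y u v

  -- The product of a + bτ with its conjugate, in which τ is replaced by the other root -1 - τ.
  norm : C × C → C
  norm (a , b) = a *₁ a -₁ a *₁ b -₁ b *₁ b

  norm-⊠ : ∀ p r → norm (p ⊠ r) ≈₁ norm p *₁ norm r
  norm-⊠ (a , b) (x , y) = S.solve 4 (λ a b x y → let u = a S.:* x S.:+ b S.:* y ; v = a S.:* y S.:+ b S.:* x S.:- b S.:* y in
      u S.:* u S.:- u S.:* v S.:- v S.:* v S.:= (a S.:* a S.:- a S.:* b S.:- b S.:* b) S.:* (x S.:* x S.:- x S.:* y S.:- y S.:* y)) ≈-refl a b x y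

open import Data.Fin using (Fin; zero; suc; toℕ; fromℕ<)
import Data.Fin.Properties as Finₚ
open import Data.Integer.DivMod using (_/ℕ_; _%ℕ_; n%ℕd<d; a≡a%ℕn+[a/ℕn]*n)
open import Data.List using (List; []; _∷_; _++_; map; cartesianProduct)
open import Data.List.Membership.Propositional using (_∈_)
open import Data.List.Membership.Propositional.Properties using (∈-∃++; ∈-map⁺; ∈-map⁻; ∈-++⁺ˡ; ∈-++⁺ʳ; ∈-cartesianProduct⁺)
open import Data.List.Relation.Binary.Permutation.Propositional as Perm using (_↭_; ↭⇒↭ₛ)
open import Data.List.Relation.Binary.Permutation.Propositional.Properties using (∈-resp-↭) renaming (shift to ↭-shift)
import Data.List.Relation.Binary.Permutation.Setoid.Properties as PermS
open import Data.List.Relation.Unary.All as All using ([]; _∷_)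
open import Data.List.Relation.Unary.AllPairs using ([]; _∷_)
open import Data.List.Relation.Unary.Any using (here; there)
open import Data.List.Relation.Unary.Unique.Propositional using (Unique)
import Data.List.Relation.Unary.Unique.Propositional.Properties as Uniq
open import Data.Nat.Divisibility using (_∣_; _∣?_; divides; ∣m+n∣m⇒∣n; ∣m∣n⇒∣m+n; ∣-refl; ∣⇒≤; _∣0)
open import Data.Nat.DivMod using (_/_; m/n≤m; 0/n≡0; +-distrib-/-∣ˡ; n/n≡1; n/1≡n; m/n*n≡m; m<n*o⇒m/o<n)
open import Data.Rational as ℚ using (ℚ; 0ℚ; 1ℚ)
import Data.Rational.Properties as ℚₚ
open import Data.Rational.Unnormalised using (mkℚᵘ; *≡*) renaming (_≃_ to _≃ᵘ_)
import Data.Rational.Unnormalised.Properties as ℚᵘₚ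
open import Function using (_∘_)
open import Relation.Binary.PropositionalEquality using (refl; cong; cong₂; sym; trans; subst; module ≡-Reasoning)
open import Relation.Binary.Structures using (IsEquivalence)

-- Finite sums of rationals.

module FiniteSums where
  open ≡-Reasoning

  sumTo-cong≤ : ∀ n {f g : ℕ → ℚ} → (∀ i → i ≤ n → f i ≡ g i) → sumTo n f ≡ sumTo n g
  sumTo-cong≤ zero    h = h 0 z≤n
  sumTo-cong≤ (suc n) h = cong₂ ℚ._+_ (sumTo-cong≤ n λ i i≤n → h i (ℕₚ.m≤n⇒m≤1+n i≤n)) (h (suc n) ℕₚ.≤-refl)

  sumTo-cong : ∀ n {f g : ℕ → ℚ} → (∀ i → f i ≡ g i) → sumTo n f ≡ sumTo n g
  sumTo-cong n h = sumTo-cong≤ n λ i _ → h i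

  sumTo-0 : ∀ n {f : ℕ → ℚ} → (∀ i → i ≤ n → f i ≡ 0ℚ) → sumTo n f ≡ 0ℚ
  sumTo-0 zero    h = h 0 z≤n
  sumTo-0 (suc n) h = trans (cong₂ ℚ._+_ (sumTo-0 n λ i i≤n → h i (ℕₚ.m≤n⇒m≤1+n i≤n)) (h (suc n) ℕₚ.≤-refl)) (ℚₚ.+-identityʳ 0ℚ)

  interchange : ∀ a b c d → (a ℚ.+ b) ℚ.+ (c ℚ.+ d) ≡ (a ℚ.+ c) ℚ.+ (b ℚ.+ d)
  interchange = Q.solve 4 (λ a b c d → (a Q.:+ b) Q.:+ (c Q.:+ d) Q.:= (a Q.:+ c) Q.:+ (b Q.:+ d)) refl

  sumTo-+ : ∀ n (f g : ℕ → ℚ) → sumTo n (λ i → f i ℚ.+ g i) ≡ sumTo n f ℚ.+ sumTo n g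
  sumTo-+ zero    f g = refl
  sumTo-+ (suc n) f g = trans (cong (ℚ._+ (f (suc n) ℚ.+ g (suc n))) (sumTo-+ n f g)) (interchange (sumTo n f) (sumTo n g) (f (suc n)) (g (suc n)))

  sumTo-*ˡ : ∀ n c (f : ℕ → ℚ) → sumTo n (λ i → c ℚ.* f i) ≡ c ℚ.* sumTo n f
  sumTo-*ˡ zero    c f = refl
  sumTo-*ˡ (suc n) c f = trans (cong (ℚ._+ (c ℚ.* f (suc n))) (sumTo-*ˡ n c f)) (sym (ℚₚ.*-distribˡ-+ c (sumTo n f) (f (suc n))))

  sumTo-*ʳ : ∀ n c (f : ℕ → ℚ) → sumTo n (λ i → f i ℚ.* c) ≡ sumTo n f ℚ.* c
  sumTo-*ʳ n c f = trans (sumTo-cong n λ i → ℚₚ.*-comm (f i) c) (trans (sumTo-*ˡ n c f) (ℚₚ.*-comm c (sumTo n f)))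

  sumTo-first : ∀ n (f : ℕ → ℚ) → sumTo (suc n) f ≡ f 0 ℚ.+ sumTo n (λ i → f (suc i))
  sumTo-first zero    f = refl
  sumTo-first (suc n) f = trans (cong (ℚ._+ f (suc (suc n))) (sumTo-first n f)) (ℚₚ.+-assoc (f 0) (sumTo n (λ i → f (suc i))) (f (suc (suc n))))

  sumTo-rev : ∀ n (f : ℕ → ℚ) → sumTo n f ≡ sumTo n (λ i → f (n ∸ i))
  sumTo-rev zero    f = refl
  sumTo-rev (suc n) f = begin
    sumTo n f ℚ.+ f (suc n)                          ≡⟨ ℚₚ.+-comm (sumTo n f) (f (suc n)) ⟩
    f (suc n) ℚ.+ sumTo n f                          ≡⟨ cong (f (suc n) ℚ.+_) (sumTo-rev n f) ⟩
    f (suc n) ℚ.+ sumTo n (λ i → f (n ∸ i))          ≡⟨ sym (sumTo-first n (λ i → f (suc n ∸ i))) ⟩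
    sumTo (suc n) (λ i → f (suc n ∸ i))              ∎

  -- Sums over a triangle by diagonals and by rows; this is the content of associativity of the
  -- Cauchy product.
  sumTo-triangle : ∀ n (F : ℕ → ℕ → ℚ) →
    sumTo n (λ i → sumTo i (λ j → F j (i ∸ j))) ≡ sumTo n (λ j → sumTo (n ∸ j) (F j))
  sumTo-triangle zero    F = refl
  sumTo-triangle (suc n) F = begin
    sumTo n (λ i → sumTo i (λ j → F j (i ∸ j))) ℚ.+ (sumTo n (λ j → F j (suc n ∸ j)) ℚ.+ F (suc n) (n ∸ n))
      ≡⟨ cong (ℚ._+ (sumTo n (λ j → F j (suc n ∸ j)) ℚ.+ F (suc n) (n ∸ n))) (sumTo-triangle n F) ⟩
    sumTo n (λ j → sumTo (n ∸ j) (F j)) ℚ.+ (sumTo n (λ j → F j (suc n ∸ j)) ℚ.+ F (suc n) (n ∸ n))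
      ≡⟨ sym (ℚₚ.+-assoc (sumTo n (λ j → sumTo (n ∸ j) (F j))) (sumTo n (λ j → F j (suc n ∸ j))) (F (suc n) (n ∸ n))) ⟩
    (sumTo n (λ j → sumTo (n ∸ j) (F j)) ℚ.+ sumTo n (λ j → F j (suc n ∸ j))) ℚ.+ F (suc n) (n ∸ n)
      ≡⟨ cong₂ ℚ._+_ (trans (sym (sumTo-+ n (λ j → sumTo (n ∸ j) (F j)) (λ j → F j (suc n ∸ j)))) (sumTo-cong≤ n step)) (last (n ∸ n) (ℕₚ.n∸n≡0 n)) ⟩
    sumTo n (λ j → sumTo (suc n ∸ j) (F j)) ℚ.+ sumTo (n ∸ n) (F (suc n)) ∎
    where
    step : ∀ j → j ≤ n → sumTo (n ∸ j) (F j) ℚ.+ F j (suc n ∸ j) ≡ sumTo (suc n ∸ j) (F j)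
    step j j≤n rewrite ℕₚ.+-∸-assoc 1 j≤n = refl
    last : ∀ k → k ≡ 0 → F (suc n) k ≡ sumTo k (F (suc n))
    last .0 refl = refl

open FiniteSums public

-- The ring of formal power series.

infix 4 _≋_
record _≋_ (f g : Series) : Set where
  constructor coeffwise
  field
    coeff : ∀ n → f n ≡ g n
open _≋_ public

zeroS : Series
zeroS _ = 0ℚ

infix 8 ⊖_
⊖_ : Series → Series
(⊖ f) n = ℚ.- f n

module SeriesLaws where
  open ≡-Reasoning

  ⊛-comm : ∀ f g → f ⊛ g ≋ g ⊛ f
  ⊛-comm f g .coeff n = trans (sumTo-rev n (λ i → f i ℚ.* g (n ∸ i))) (sumTo-cong≤ n λ i i≤n →
    trans (ℚₚ.*-comm (f (n ∸ i)) (g (n ∸ (n ∸ i)))) (cong (λ k → g k ℚ.* f (n ∸ i)) (ℕₚ.m∸[m∸n]≡n i≤n)))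

  ⊛-assoc : ∀ f g h → (f ⊛ g) ⊛ h ≋ f ⊛ (g ⊛ h)
  ⊛-assoc f g h .coeff n = begin
    sumTo n (λ i → sumTo i (λ j → f j ℚ.* g (i ∸ j)) ℚ.* h (n ∸ i))
      ≡⟨ sumTo-cong n (λ i → sym (sumTo-*ʳ i (h (n ∸ i)) (λ j → f j ℚ.* g (i ∸ j)))) ⟩
    sumTo n (λ i → sumTo i (λ j → f j ℚ.* g (i ∸ j) ℚ.* h (n ∸ i)))
      ≡⟨ sumTo-cong≤ n (λ i i≤n → sumTo-cong≤ i λ j j≤i →
           trans (ℚₚ.*-assoc (f j) (g (i ∸ j)) (h (n ∸ i))) (cong (λ k → f j ℚ.* (g (i ∸ j) ℚ.* h k)) (index i j j≤i))) ⟩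
    sumTo n (λ i → sumTo i (λ j → f j ℚ.* (g (i ∸ j) ℚ.* h (n ∸ j ∸ (i ∸ j)))))
      ≡⟨ sumTo-triangle n (λ j k → f j ℚ.* (g k ℚ.* h (n ∸ j ∸ k))) ⟩
    sumTo n (λ j → sumTo (n ∸ j) (λ k → f j ℚ.* (g k ℚ.* h (n ∸ j ∸ k))))
      ≡⟨ sumTo-cong n (λ j → sumTo-*ˡ (n ∸ j) (f j) (λ k → g k ℚ.* h (n ∸ j ∸ k))) ⟩
    sumTo n (λ j → f j ℚ.* sumTo (n ∸ j) (λ k → g k ℚ.* h (n ∸ j ∸ k))) ∎
    where
    index : ∀ i j → j ≤ i → n ∸ i ≡ n ∸ j ∸ (i ∸ j)
    index i j j≤i = sym (trans (ℕₚ.∸-+-assoc n j (i ∸ j)) (cong (n ∸_) (ℕₚ.m+[n∸m]≡n j≤i)))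

  ⊛-identityˡ : ∀ f → oneS ⊛ f ≋ f
  ⊛-identityˡ f .coeff zero    = ℚₚ.*-identityˡ (f 0)
  ⊛-identityˡ f .coeff (suc n) = begin
    (oneS ⊛ f) (suc n)                                     ≡⟨ sumTo-first n (λ i → oneS i ℚ.* f (suc n ∸ i)) ⟩
    1ℚ ℚ.* f (suc n) ℚ.+ sumTo n (λ i → 0ℚ ℚ.* f (n ∸ i))  ≡⟨ cong₂ ℚ._+_ (ℚₚ.*-identityˡ (f (suc n))) (sumTo-0 n λ i _ → ℚₚ.*-zeroˡ (f (n ∸ i))) ⟩
    f (suc n) ℚ.+ 0ℚ                                       ≡⟨ ℚₚ.+-identityʳ (f (suc n)) ⟩
    f (suc n)                                              ∎

  ⊛-distribˡ : ∀ f g h → f ⊛ (g ⊕ h) ≋ (f ⊛ g) ⊕ (f ⊛ h)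
  ⊛-distribˡ f g h .coeff n = trans
    (sumTo-cong n λ i → ℚₚ.*-distribˡ-+ (f i) (g (n ∸ i)) (h (n ∸ i)))
    (sumTo-+ n (λ i → f i ℚ.* g (n ∸ i)) (λ i → f i ℚ.* h (n ∸ i)))

  ⊛-cong : ∀ {f f′ g g′} → f ≋ f′ → g ≋ g′ → f ⊛ g ≋ f′ ⊛ g′
  ⊛-cong p r .coeff n = sumTo-cong n λ i → cong₂ ℚ._*_ (p .coeff i) (r .coeff (n ∸ i))

  ≋-isEquivalence : IsEquivalence _≋_
  ≋-isEquivalence = record
    { refl  = coeffwise λ _ → refl
    ; sym   = λ p → coeffwise λ n → sym (p .coeff n)
    ; trans = λ p r → coeffwise λ n → trans (p .coeff n) (r .coeff n) }

  open IsEquivalence ≋-isEquivalence using () renaming (trans to ≋-trans)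

  seriesRing : CommutativeRing 0ℓ 0ℓ
  seriesRing = record
    { Carrier = Series ; _≈_ = _≋_ ; _+_ = _⊕_ ; _*_ = _⊛_ ; -_ = ⊖_ ; 0# = zeroS ; 1# = oneS
    ; isCommutativeRing = record
      { isRing = record
        { +-isAbelianGroup = record
          { isGroup = record
            { isMonoid = record
              { isSemigroup = record
                { isMagma = record
                  { isEquivalence = ≋-isEquivalence
                  ; ∙-cong = λ p r → coeffwise λ n → cong₂ ℚ._+_ (p .coeff n) (r .coeff n) }
                ; assoc = λ f g h → coeffwise λ n → ℚₚ.+-assoc (f n) (g n) (h n) }
              ; identity = (λ f → coeffwise λ n → ℚₚ.+-identityˡ (f n)) , (λ f → coeffwise λ n → ℚₚ.+-identityʳ (f n)) }
            ; inverse = (λ f → coeffwise λ n → ℚₚ.+-inverseˡ (f n)) , (λ f → coeffwise λ n → ℚₚ.+-inverseʳ (f n))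
            ; ⁻¹-cong = λ p → coeffwise λ n → cong ℚ.-_ (p .coeff n) }
          ; comm = λ f g → coeffwise λ n → ℚₚ.+-comm (f n) (g n) }
        ; *-cong = ⊛-cong
        ; *-assoc = ⊛-assoc
        ; *-identity = ⊛-identityˡ , (λ f → ≋-trans (⊛-comm f oneS) (⊛-identityˡ f))
        ; distrib = ⊛-distribˡ , (λ f g h → ≋-trans (⊛-comm (g ⊕ h) f) (≋-trans (⊛-distribˡ f g h)
            (coeffwise λ n → cong₂ ℚ._+_ (⊛-comm f g .coeff n) (⊛-comm f h .coeff n)))) }
      ; *-comm = ⊛-comm } }

open SeriesLaws public using (seriesRing)

module 𝕊 = CommutativeRing seriesRing

open IntegerSolver seriesRing using (♯; solve; _:=_; con; _:+_; _:*_; _:-_; :-_; Polynomial)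

module ≋-Reasoning where
  open import Relation.Binary.Reasoning.Setoid 𝕊.setoid public

-- Shifts, monomials and constants.

tail : Series → Series
tail f n = f (suc n)

shift-cong : ∀ e {f g} → f ≋ g → shift e f ≋ shift e g
shift-cong zero    p = coeffwise λ n → p .coeff n
shift-cong (suc e) p = coeffwise λ { zero → refl ; (suc n) → shift-cong e p .coeff n }

shift-suc : ∀ e f → shift (suc e) f ≋ shift 1 (shift e f)
shift-suc e f = coeffwise λ { zero → refl ; (suc n) → refl }

shift-shift : ∀ a b f → shift a (shift b f) ≋ shift (a ℕ.+ b) f
shift-shift zero    b f = coeffwise λ n → refl
shift-shift (suc a) b f = coeffwise λ { zero → refl ; (suc n) → shift-shift a b f .coeff n }

shift-< : ∀ e f {n} → n < e → shift e f n ≡ 0ℚ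
shift-< (suc e) f {zero}  _         = refl
shift-< (suc e) f {suc n} (s≤s n<e) = shift-< e f n<e

shift-+ : ∀ e f n → shift e f (e ℕ.+ n) ≡ f n
shift-+ zero    f n = refl
shift-+ (suc e) f n = shift-+ e f n

shift₁-⊛ : ∀ f g → shift 1 f ⊛ g ≋ shift 1 (f ⊛ g)
shift₁-⊛ f g .coeff zero    = ℚₚ.*-zeroˡ (g 0)
shift₁-⊛ f g .coeff (suc n) = trans (sumTo-first n (λ i → shift 1 f i ℚ.* g (suc n ∸ i)))
  (trans (cong (ℚ._+ (f ⊛ g) n) (ℚₚ.*-zeroˡ (g (suc n)))) (ℚₚ.+-identityˡ ((f ⊛ g) n)))

shift-⊛ : ∀ e f g → shift e f ⊛ g ≋ shift e (f ⊛ g)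
shift-⊛ zero    f g = coeffwise λ n → refl
shift-⊛ (suc e) f g = begin
  shift (suc e) f ⊛ g        ≈⟨ 𝕊.*-congʳ {g} (shift-suc e f) ⟩
  shift 1 (shift e f) ⊛ g    ≈⟨ shift₁-⊛ (shift e f) g ⟩
  shift 1 (shift e f ⊛ g)    ≈⟨ shift-cong 1 (shift-⊛ e f g) ⟩
  shift 1 (shift e (f ⊛ g))  ≈⟨ 𝕊.sym (shift-suc e (f ⊛ g)) ⟩
  shift (suc e) (f ⊛ g)      ∎
  where open ≋-Reasoning

mono : ℕ → Series
mono e = shift e oneS

mono-⊛ : ∀ e f → mono e ⊛ f ≋ shift e f
mono-⊛ e f = 𝕊.trans (shift-⊛ e oneS f) (shift-cong e (𝕊.*-identityˡ f))

mono-+ : ∀ a b → mono a ⊛ mono b ≋ mono (a ℕ.+ b)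
mono-+ a b = 𝕊.trans (mono-⊛ a (mono b)) (shift-shift a b oneS)

mono-cong : ∀ {a b} → a ≡ b → mono a ≋ mono b
mono-cong refl = 𝕊.refl

mono-≢ : ∀ e n → e ≢ n → mono e n ≡ 0ℚ
mono-≢ zero    zero    e≢n = contradiction refl e≢n
mono-≢ zero    (suc n) e≢n = refl
mono-≢ (suc e) zero    e≢n = refl
mono-≢ (suc e) (suc n) e≢n = mono-≢ e n λ { refl → e≢n refl }

mono-≡ : ∀ e → mono e e ≡ 1ℚ
mono-≡ zero    = refl
mono-≡ (suc e) = mono-≡ e

const : ℚ → Series
const c = c · oneS

·-const : ∀ c f → c · f ≋ const c ⊛ f
·-const c f = coeffwise λ n → sym (trans (sumTo-cong n λ i → ℚₚ.*-assoc c (oneS i) (f (n ∸ i)))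
  (trans (sumTo-*ˡ n c (λ i → oneS i ℚ.* f (n ∸ i))) (cong (c ℚ.*_) (𝕊.*-identityˡ f .coeff n))))

const-* : ∀ c d → const (c ℚ.* d) ≋ const c ⊛ const d
const-* c d = 𝕊.trans (coeffwise λ n → ℚₚ.*-assoc c d (oneS n)) (·-const c (const d))

const-cong : ∀ {c d} → c ≡ d → const c ≋ const d
const-cong refl = 𝕊.refl

-- Congruence modulo q^(n+1).
infix 4 _≈[_]_
record _≈[_]_ (f : Series) (n : ℕ) (g : Series) : Set where
  constructor upTo
  field
    below : ∀ k → k ≤ n → f k ≡ g k
open _≈[_]_ public

≋⇒≈ : ∀ {n f g} → f ≋ g → f ≈[ n ] g
≋⇒≈ p = upTo λ k _ → p .coeff k

≈⇒≋ : ∀ {f g} → (∀ n → f ≈[ n ] g) → f ≋ g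
≈⇒≋ p = coeffwise λ n → p n .below n ℕₚ.≤-refl

≈-weaken : ∀ {m n f g} → m ≤ n → f ≈[ n ] g → f ≈[ m ] g
≈-weaken m≤n p = upTo λ k k≤m → p .below k (ℕₚ.≤-trans k≤m m≤n)

truncRing : ℕ → CommutativeRing 0ℓ 0ℓ
truncRing n = record
  { Carrier = Series ; _≈_ = _≈[ n ]_ ; _+_ = _⊕_ ; _*_ = _⊛_ ; -_ = ⊖_ ; 0# = zeroS ; 1# = oneS
  ; isCommutativeRing = record
    { isRing = record
      { +-isAbelianGroup = record
        { isGroup = record
          { isMonoid = record
            { isSemigroup = record
              { isMagma = record
                { isEquivalence = record
                  { refl  = upTo λ _ _ → refl
                  ; sym   = λ p → upTo λ k k≤n → sym (p .below k k≤n)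
                  ; trans = λ p r → upTo λ k k≤n → trans (p .below k k≤n) (r .below k k≤n) }
                ; ∙-cong = λ p r → upTo λ k k≤n → cong₂ ℚ._+_ (p .below k k≤n) (r .below k k≤n) }
              ; assoc = λ f g h → ≋⇒≈ (𝕊.+-assoc f g h) }
            ; identity = (λ f → ≋⇒≈ (𝕊.+-identityˡ f)) , (λ f → ≋⇒≈ (𝕊.+-identityʳ f)) }
          ; inverse = (λ f → ≋⇒≈ (𝕊.-‿inverseˡ f)) , (λ f → ≋⇒≈ (𝕊.-‿inverseʳ f))
          ; ⁻¹-cong = λ p → upTo λ k k≤n → cong ℚ.-_ (p .below k k≤n) }
        ; comm = λ f g → ≋⇒≈ (𝕊.+-comm f g) }
      ; *-cong = λ p r → upTo λ k k≤n → sumTo-cong≤ k λ i i≤k →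
          cong₂ ℚ._*_ (p .below i (ℕₚ.≤-trans i≤k k≤n)) (r .below (k ∸ i) (ℕₚ.≤-trans (ℕₚ.m∸n≤m k i) k≤n))
      ; *-assoc = λ f g h → ≋⇒≈ (𝕊.*-assoc f g h)
      ; *-identity = (λ f → ≋⇒≈ (𝕊.*-identityˡ f)) , (λ f → ≋⇒≈ (𝕊.*-identityʳ f))
      ; distrib = (λ f g h → ≋⇒≈ (𝕊.distribˡ f g h)) , (λ f g h → ≋⇒≈ (𝕊.distribʳ f g h)) }
    ; *-comm = λ f g → ≋⇒≈ (𝕊.*-comm f g) } }

module 𝕋 (n : ℕ) = CommutativeRing (truncRing n)

shift-≈0 : ∀ {e n} f → n < e → shift e f ≈[ n ] zeroS
shift-≈0 {e} f n<e = upTo λ k k≤n → shift-< e f (ℕₚ.≤-<-trans k≤n n<e)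

mono-≈0 : ∀ {e n} f → n < e → mono e ⊛ f ≈[ n ] zeroS
mono-≈0 {e} {n} f n<e = 𝕋.trans n (≋⇒≈ (mono-⊛ e f)) (shift-≈0 f n<e)

shift₁-≈ : ∀ {n f g} → f ≈[ n ] g → shift 1 f ≈[ suc n ] shift 1 g
shift₁-≈ p = upTo λ { zero _ → refl ; (suc k) (s≤s k≤n) → p .below k k≤n }

mono-≈ : ∀ {n f g} e .{{_ : NonZero e}} → f ≈[ n ] g → mono e ⊛ f ≈[ suc n ] mono e ⊛ g
mono-≈ {n} {f} {g} (suc e) p = 𝕋.trans (suc n) (≋⇒≈ (split f)) (𝕋.trans (suc n) (shift₁-≈ (𝕋.*-congˡ n {mono e} p)) (≋⇒≈ (𝕊.sym (split g))))
  where
  split : ∀ f → mono (suc e) ⊛ f ≋ shift 1 (mono e ⊛ f)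
  split f = 𝕊.trans (𝕊.*-congʳ {f} (shift-suc e oneS)) (shift₁-⊛ (mono e) f)

-- Coefficientwise convergence.

Conv : (ℕ → Series) → Series → Set
Conv P s = ∀ n → ∃ λ N₀ → ∀ N → N₀ ≤ N → P N ≈[ n ] s

conv-unique : ∀ {P s t} → Conv P s → Conv P t → s ≋ t
conv-unique p r = ≈⇒≋ λ n → let (M , p′) = p n ; (N , r′) = r n in
  𝕋.trans n (𝕋.sym n (p′ (M ℕ.⊔ N) (ℕₚ.m≤m⊔n M N))) (r′ (M ℕ.⊔ N) (ℕₚ.m≤n⊔m M N))

conv-cong : ∀ {P P′ s} → (∀ N → P N ≋ P′ N) → Conv P s → Conv P′ s
conv-cong e p n = let (M , p′) = p n in M , λ N M≤N → 𝕋.trans n (≋⇒≈ (𝕊.sym (e N))) (p′ N M≤N)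

conv-lim : ∀ {P s t} → s ≋ t → Conv P s → Conv P t
conv-lim e p n = let (M , p′) = p n in M , λ N M≤N → 𝕋.trans n (p′ N M≤N) (≋⇒≈ e)

conv-const : ∀ s → Conv (λ _ → s) s
conv-const s n = 0 , λ _ _ → 𝕋.refl n

conv-⊛ : ∀ {P R s t} → Conv P s → Conv R t → Conv (λ N → P N ⊛ R N) (s ⊛ t)
conv-⊛ p r n = let (M , p′) = p n ; (N , r′) = r n in M ℕ.⊔ N , λ K K≥ →
  𝕋.*-cong n (p′ K (ℕₚ.≤-trans (ℕₚ.m≤m⊔n M N) K≥)) (r′ K (ℕₚ.≤-trans (ℕₚ.m≤n⊔m M N) K≥))

conv-⊕ : ∀ {P R s t} → Conv P s → Conv R t → Conv (λ N → P N ⊕ R N) (s ⊕ t)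
conv-⊕ p r n = let (M , p′) = p n ; (N , r′) = r n in M ℕ.⊔ N , λ K K≥ →
  𝕋.+-cong n (p′ K (ℕₚ.≤-trans (ℕₚ.m≤m⊔n M N) K≥)) (r′ K (ℕₚ.≤-trans (ℕₚ.m≤n⊔m M N) K≥))

conv-⊖ : ∀ {P s} → Conv P s → Conv (λ N → ⊖ P N) (⊖ s)
conv-⊖ p n = let (M , p′) = p n in M , λ K K≥ → 𝕋.-‿cong n (p′ K K≥)

conv-along : ∀ {P s} (g : ℕ → ℕ) → (∀ N → N ≤ g N) → Conv P s → Conv (λ N → P (g N)) s
conv-along g N≤g p n = let (M , p′) = p n in M , λ N M≤N → p′ (g N) (ℕₚ.≤-trans M≤N (N≤g N))

-- The limit of a Cauchy sequence is read off its diagonal because `infProd` is defined in exactly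
-- this way.
diag : (ℕ → Series) → Series
diag P n = P n n

Cauchy : (ℕ → Series) → Set
Cauchy P = ∀ N → P (suc N) ≈[ N ] P N

cauchy-≤ : ∀ {P} → Cauchy P → ∀ {n N} → n ≤ N → P N ≈[ n ] P n
cauchy-≤ {P} c {n} n≤N = go (ℕₚ.≤⇒≤′ n≤N)
  where
  go : ∀ {N} → n ℕ.≤′ N → P N ≈[ n ] P n
  go ℕ.≤′-refl         = 𝕋.refl n
  go (ℕ.≤′-step n≤′N)  = 𝕋.trans n (≈-weaken (ℕₚ.≤′⇒≤ n≤′N) (c _)) (go n≤′N)

diag-≈ : ∀ {P} → Cauchy P → ∀ {n N} → n ≤ N → P N ≈[ n ] diag P
diag-≈ c n≤N = upTo λ k k≤n → cauchy-≤ c (ℕₚ.≤-trans k≤n n≤N) .below k ℕₚ.≤-refl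

conv-diag : ∀ {P} → Cauchy P → Conv P (diag P)
conv-diag c n = n , λ N n≤N → diag-≈ c n≤N

-- Inverses and cancellation.

module Inverse (f : Series) (f0 : f 0 ≡ 1ℚ) where
  h : Series
  h = oneS ⊕ ⊖ f

  hᵏ : ℕ → Series
  hᵏ zero    = oneS
  hᵏ (suc k) = h ⊛ hᵏ k

  h≋ : h ≋ mono 1 ⊛ tail h
  h≋ = 𝕊.trans (coeffwise λ { zero → trans (cong (λ c → 1ℚ ℚ.+ ℚ.- c) f0) refl ; (suc n) → refl }) (𝕊.sym (mono-⊛ 1 (tail h)))

  hᵏ-≈0 : ∀ k → hᵏ (suc k) ≈[ k ] zeroS
  hᵏ-≈0 zero    = 𝕋.trans 0 (≋⇒≈ (𝕊.trans (𝕊.*-identityʳ h) h≋)) (mono-≈0 (tail h) ℕₚ.≤-refl)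
  hᵏ-≈0 (suc k) = 𝕋.trans (suc k) (≋⇒≈ (𝕊.trans (𝕊.*-congʳ {hᵏ (suc k)} h≋) (𝕊.*-assoc (mono 1) (tail h) (hᵏ (suc k)))))
    (𝕋.trans (suc k) (mono-≈ 1 (𝕋.trans k (𝕋.*-congˡ k {tail h} (hᵏ-≈0 k)) (𝕋.zeroʳ k (tail h)))) (𝕋.zeroʳ (suc k) (mono 1)))

  -- Partial sums of the geometric series in h = 1 - f. They converge because h has no constant
  -- term, so that h^k is divisible by q^k.
  G : ℕ → Series
  G zero    = oneS
  G (suc N) = G N ⊕ hᵏ (suc N)

  G-cauchy : Cauchy G
  G-cauchy N = 𝕋.trans N (𝕋.+-congˡ N {G N} (hᵏ-≈0 N)) (𝕋.+-identityʳ N (G N))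

  inv : Series
  inv = diag G

  telescope : ∀ N → f ⊛ G N ≋ oneS ⊕ ⊖ hᵏ (suc N)
  telescope zero    = solve 1 (λ f → f :* con (+ 1) := con (+ 1) :+ :- ((con (+ 1) :+ :- f) :* con (+ 1))) 𝕊.refl f
  telescope (suc N) = 𝕊.trans (𝕊.distribˡ f (G N) (hᵏ (suc N))) (𝕊.trans (𝕊.+-congʳ {f ⊛ hᵏ (suc N)} (telescope N))
    (solve 2 (λ f x → con (+ 1) :+ :- x :+ f :* x := con (+ 1) :+ :- ((con (+ 1) :+ :- f) :* x)) 𝕊.refl f (hᵏ (suc N))))

  inverseʳ : f ⊛ inv ≋ oneS
  inverseʳ = ≈⇒≋ λ n → 𝕋.trans n (𝕋.*-congˡ n {f} (𝕋.sym n (diag-≈ G-cauchy (ℕₚ.≤-refl {n}))))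
    (𝕋.trans n (≋⇒≈ (telescope n)) (𝕋.trans n (𝕋.+-congˡ n {oneS} (𝕋.-‿cong n (hᵏ-≈0 n))) (≋⇒≈ (coeffwise λ k → ℚₚ.+-identityʳ (oneS k)))))

open Inverse public using (inv; inverseʳ)

⊛-cancel-unit-≈ : ∀ {n} f → f 0 ≡ 1ℚ → ∀ {g h} → f ⊛ g ≈[ n ] f ⊛ h → g ≈[ n ] h
⊛-cancel-unit-≈ {n} f f0 {g} {h} p = 𝕋.trans n (≋⇒≈ (𝕊.sym (undo g))) (𝕋.trans n (𝕋.*-congˡ n {inv f f0} p) (≋⇒≈ (undo h)))
  where
  undo : ∀ g → inv f f0 ⊛ (f ⊛ g) ≋ g
  undo g = 𝕊.trans (𝕊.sym (𝕊.*-assoc (inv f f0) f g))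
    (𝕊.trans (𝕊.*-congʳ {g} (𝕊.trans (𝕊.*-comm (inv f f0) f) (inverseʳ f f0))) (𝕊.*-identityˡ g))

⊛-cancel-unit : ∀ f → f 0 ≡ 1ℚ → ∀ {g h} → f ⊛ g ≋ f ⊛ h → g ≋ h
⊛-cancel-unit f f0 p = ≈⇒≋ λ n → ⊛-cancel-unit-≈ f f0 (≋⇒≈ p)

⊛-cancel-mono : ∀ e {g h} → mono e ⊛ g ≋ mono e ⊛ h → g ≋ h
⊛-cancel-mono e {g} {h} p = coeffwise λ n → trans (sym (at g n)) (trans (p .coeff (e ℕ.+ n)) (at h n))
  where
  at : ∀ g n → (mono e ⊛ g) (e ℕ.+ n) ≡ g n
  at g n = trans (mono-⊛ e g .coeff (e ℕ.+ n)) (shift-+ e g n)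

-- The substitution q ↦ q^k

sub-∣ : ∀ k .{{_ : NonZero k}} f {n} → k ∣ n → sub k f n ≡ f (n / k)
sub-∣ k f {n} k∣n with k ∣? n
... | yes _   = refl
... | no  k∤n = contradiction k∣n k∤n

sub-∤ : ∀ k .{{_ : NonZero k}} f {n} → ¬ (k ∣ n) → sub k f n ≡ 0ℚ
sub-∤ k f {n} k∤n with k ∣? n
... | yes k∣n = contradiction k∣n k∤n
... | no  _   = refl

sub-0 : ∀ k .{{_ : NonZero k}} f → sub k f 0 ≡ f 0
sub-0 k f = trans (sub-∣ k f (k ∣0)) (cong f (0/n≡0 k))

sub-+ : ∀ k .{{_ : NonZero k}} f n → sub k f (k ℕ.+ n) ≡ sub k (tail f) n
sub-+ k f n with k ∣? n
... | yes k∣n = trans (sub-∣ k f (∣m∣n⇒∣m+n ∣-refl k∣n)) (cong f (trans (+-distrib-/-∣ˡ n ∣-refl) (cong (ℕ._+ n / k) (n/n≡1 k))))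
... | no  k∤n = sub-∤ k f λ k∣k+n → k∤n (∣m+n∣m⇒∣n k∣k+n ∣-refl)

sub-unfold : ∀ k .{{_ : NonZero k}} f → sub k f ≋ const (f 0) ⊕ mono k ⊛ sub k (tail f)
sub-unfold k f = 𝕊.trans (coeffwise step) (𝕊.+-congˡ {const (f 0)} (𝕊.sym (mono-⊛ k (sub k (tail f)))))
  where
  g = sub k (tail f)
  small : ∀ n → n < k → sub k f n ≡ (const (f 0) ⊕ shift k g) n
  small zero    0<k = trans (sub-0 k f) (sym (trans (cong₂ ℚ._+_ (ℚₚ.*-identityʳ (f 0)) (shift-< k g 0<k)) (ℚₚ.+-identityʳ (f 0))))
  small (suc n) n<k = trans (sub-∤ k f λ k∣n → ℕₚ.<⇒≱ n<k (∣⇒≤ k∣n))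
    (sym (trans (cong₂ ℚ._+_ (ℚₚ.*-zeroʳ (f 0)) (shift-< k g n<k)) (ℚₚ.+-identityʳ 0ℚ)))
  large : ∀ n → sub k f (k ℕ.+ n) ≡ (const (f 0) ⊕ shift k g) (k ℕ.+ n)
  large n = trans (sub-+ k f n) (sym (trans (cong₂ ℚ._+_ (vanish (k ℕ.+ n) (ℕₚ.<-≤-trans (ℕ.>-nonZero⁻¹ k) (ℕₚ.m≤m+n k n))) (shift-+ k g n)) (ℚₚ.+-identityˡ (g n))))
    where
    vanish : ∀ m → 0 < m → const (f 0) m ≡ 0ℚ
    vanish (suc m) _ = ℚₚ.*-zeroʳ (f 0)
  step : ∀ n → sub k f n ≡ (const (f 0) ⊕ shift k g) n
  step n with k ℕ.≤? n
  ... | yes k≤n = subst (λ m → sub k f m ≡ (const (f 0) ⊕ shift k g) m) (ℕₚ.m+[n∸m]≡n k≤n) (large (n ∸ k))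
  ... | no  k≰n = small n (ℕₚ.≰⇒> k≰n)

-- An operator that respects the unfolding f = f(0) + q tail f, with q^k in place of q, is
-- determined: each unfolding gains at least one correct coefficient since k is positive.
sub-unique : ∀ k .{{_ : NonZero k}} (Φ : Series → Series) →
  (∀ f → Φ f ≋ const (f 0) ⊕ mono k ⊛ Φ (tail f)) → ∀ f → Φ f ≋ sub k f
sub-unique k Φ rec f = ≈⇒≋ λ n → go n f
  where
  head-eq : ∀ f → Φ f ≈[ 0 ] sub k f
  head-eq f = 𝕋.trans 0 (≋⇒≈ (rec f)) (𝕋.trans 0
    (𝕋.+-congˡ 0 {const (f 0)} (𝕋.trans 0 (mono-≈0 (Φ (tail f)) (ℕ.>-nonZero⁻¹ k)) (𝕋.sym 0 (mono-≈0 (sub k (tail f)) (ℕ.>-nonZero⁻¹ k)))))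
    (≋⇒≈ (𝕊.sym (sub-unfold k f))))
  go : ∀ n f → Φ f ≈[ n ] sub k f
  go zero    f = head-eq f
  go (suc n) f = 𝕋.trans (suc n) (≋⇒≈ (rec f)) (𝕋.trans (suc n)
    (𝕋.+-congˡ (suc n) {const (f 0)} (mono-≈ k (go n (tail f)))) (≋⇒≈ (𝕊.sym (sub-unfold k f))))

sub-cong : ∀ k .{{_ : NonZero k}} {f g} → f ≋ g → sub k f ≋ sub k g
sub-cong k {f} {g} p = coeffwise step
  where
  step : ∀ n → sub k f n ≡ sub k g n
  step n with k ∣? n
  ... | yes _ = p .coeff (n / k)
  ... | no  _ = refl

sub-⊕ : ∀ k .{{_ : NonZero k}} f g → sub k (f ⊕ g) ≋ sub k f ⊕ sub k g
sub-⊕ k f g = coeffwise step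
  where
  step : ∀ n → sub k (f ⊕ g) n ≡ (sub k f ⊕ sub k g) n
  step n with k ∣? n
  ... | yes _ = refl
  ... | no  _ = sym (ℚₚ.+-identityʳ 0ℚ)

sub-⊖ : ∀ k .{{_ : NonZero k}} f → sub k (⊖ f) ≋ ⊖ sub k f
sub-⊖ k f = coeffwise step
  where
  step : ∀ n → sub k (⊖ f) n ≡ (⊖ sub k f) n
  step n with k ∣? n
  ... | yes _ = refl
  ... | no  _ = refl

sub-· : ∀ k .{{_ : NonZero k}} c f → sub k (c · f) ≋ c · sub k f
sub-· k c f = coeffwise step
  where
  step : ∀ n → sub k (c · f) n ≡ (c · sub k f) n
  step n with k ∣? n
  ... | yes _ = refl
  ... | no  _ = sym (ℚₚ.*-zeroʳ c)

sub-zero : ∀ k .{{_ : NonZero k}} → sub k zeroS ≋ zeroS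
sub-zero k = coeffwise step
  where
  step : ∀ n → sub k zeroS n ≡ 0ℚ
  step n with k ∣? n
  ... | yes _ = refl
  ... | no  _ = refl

sub-one : ∀ k .{{_ : NonZero k}} → sub k oneS ≋ oneS
sub-one k = 𝕊.trans (sub-unfold k oneS) (𝕊.trans (𝕊.+-cong (coeffwise λ n → ℚₚ.*-identityˡ (oneS n))
  (𝕊.trans (𝕊.*-congˡ {mono k} (sub-zero k)) (𝕊.zeroʳ (mono k)))) (𝕊.+-identityʳ oneS))

sub-mono : ∀ k .{{_ : NonZero k}} e → sub k (mono e) ≋ mono (k ℕ.* e)
sub-mono k zero    = 𝕊.trans (sub-one k) (mono-cong (sym (ℕₚ.*-zeroʳ k)))
sub-mono k (suc e) = begin
  sub k (mono (suc e))                            ≈⟨ sub-unfold k (mono (suc e)) ⟩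
  const 0ℚ ⊕ mono k ⊛ sub k (mono e)              ≈⟨ 𝕊.+-congʳ {mono k ⊛ sub k (mono e)} (coeffwise λ n → ℚₚ.*-zeroˡ (oneS n)) ⟩
  zeroS ⊕ mono k ⊛ sub k (mono e)                 ≈⟨ 𝕊.+-identityˡ (mono k ⊛ sub k (mono e)) ⟩
  mono k ⊛ sub k (mono e)                         ≈⟨ 𝕊.*-congˡ {mono k} (sub-mono k e) ⟩
  mono k ⊛ mono (k ℕ.* e)                         ≈⟨ mono-+ k (k ℕ.* e) ⟩
  mono (k ℕ.+ k ℕ.* e)                            ≈⟨ mono-cong (sym (ℕₚ.*-suc k e)) ⟩
  mono (k ℕ.* suc e)                              ∎
  where open ≋-Reasoning

tail-⊛ : ∀ f g → tail (f ⊛ g) ≋ const (f 0) ⊛ tail g ⊕ tail f ⊛ g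
tail-⊛ f g = 𝕊.trans (coeffwise λ n → sumTo-first n (λ i → f i ℚ.* g (suc n ∸ i))) (𝕊.+-congʳ {tail f ⊛ g} (·-const (f 0) (tail g)))

const-⊛-head : ∀ c k .{{_ : NonZero k}} f → const (c ℚ.* f 0) ⊕ mono k ⊛ sub k (const c ⊛ tail f) ≋ const c ⊛ sub k f
const-⊛-head c k f = begin
  const (c ℚ.* f 0) ⊕ mono k ⊛ sub k (const c ⊛ tail f)
    ≈⟨ 𝕊.+-cong (const-* c (f 0)) (𝕊.*-congˡ {mono k} (𝕊.trans (sub-cong k (𝕊.sym (·-const c (tail f)))) (𝕊.trans (sub-· k c (tail f)) (·-const c (sub k (tail f)))))) ⟩
  const c ⊛ const (f 0) ⊕ mono k ⊛ (const c ⊛ sub k (tail f))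
    ≈⟨ solve 4 (λ c d m t → c :* d :+ m :* (c :* t) := c :* (d :+ m :* t)) 𝕊.refl (const c) (const (f 0)) (mono k) (sub k (tail f)) ⟩
  const c ⊛ (const (f 0) ⊕ mono k ⊛ sub k (tail f))
    ≈⟨ 𝕊.*-congˡ {const c} (𝕊.sym (sub-unfold k f)) ⟩
  const c ⊛ sub k f ∎
  where open ≋-Reasoning

-- Both sides obey the same recursion when the constant term of f is peeled off; the rest carries a
-- factor q^k, so agreement improves by at least one coefficient.
sub-⊛ : ∀ k .{{_ : NonZero k}} f g → sub k (f ⊛ g) ≋ sub k f ⊛ sub k g
sub-⊛ k f g = ≈⇒≋ λ n → go n f
  where
  open ≋-Reasoning
  left : ∀ f → sub k (f ⊛ g) ≋ const (f 0) ⊛ sub k g ⊕ mono k ⊛ sub k (tail f ⊛ g)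
  left f = begin
    sub k (f ⊛ g)
      ≈⟨ sub-unfold k (f ⊛ g) ⟩
    const (f 0 ℚ.* g 0) ⊕ mono k ⊛ sub k (tail (f ⊛ g))
      ≈⟨ 𝕊.+-congˡ {const (f 0 ℚ.* g 0)} (𝕊.*-congˡ {mono k} (𝕊.trans (sub-cong k (tail-⊛ f g)) (sub-⊕ k (const (f 0) ⊛ tail g) (tail f ⊛ g)))) ⟩
    const (f 0 ℚ.* g 0) ⊕ mono k ⊛ (sub k (const (f 0) ⊛ tail g) ⊕ sub k (tail f ⊛ g))
      ≈⟨ solve 4 (λ c m x y → c :+ m :* (x :+ y) := c :+ m :* x :+ m :* y) 𝕊.refl (const (f 0 ℚ.* g 0)) (mono k) (sub k (const (f 0) ⊛ tail g)) (sub k (tail f ⊛ g)) ⟩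
    const (f 0 ℚ.* g 0) ⊕ mono k ⊛ sub k (const (f 0) ⊛ tail g) ⊕ mono k ⊛ sub k (tail f ⊛ g)
      ≈⟨ 𝕊.+-congʳ {mono k ⊛ sub k (tail f ⊛ g)} (const-⊛-head (f 0) k g) ⟩
    const (f 0) ⊛ sub k g ⊕ mono k ⊛ sub k (tail f ⊛ g) ∎
  right : ∀ f → sub k f ⊛ sub k g ≋ const (f 0) ⊛ sub k g ⊕ mono k ⊛ (sub k (tail f) ⊛ sub k g)
  right f = 𝕊.trans (𝕊.*-congʳ {sub k g} (sub-unfold k f))
    (solve 4 (λ c m x y → (c :+ m :* x) :* y := c :* y :+ m :* (x :* y)) 𝕊.refl (const (f 0)) (mono k) (sub k (tail f)) (sub k g))
  go : ∀ n f → sub k (f ⊛ g) ≈[ n ] sub k f ⊛ sub k g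
  go zero    f = 𝕋.trans 0 (≋⇒≈ (left f)) (𝕋.trans 0
    (𝕋.+-congˡ 0 {const (f 0) ⊛ sub k g} (𝕋.trans 0 (mono-≈0 (sub k (tail f ⊛ g)) (ℕ.>-nonZero⁻¹ k)) (𝕋.sym 0 (mono-≈0 (sub k (tail f) ⊛ sub k g) (ℕ.>-nonZero⁻¹ k)))))
    (≋⇒≈ (𝕊.sym (right f))))
  go (suc n) f = 𝕋.trans (suc n) (≋⇒≈ (left f)) (𝕋.trans (suc n)
    (𝕋.+-congˡ (suc n) {const (f 0) ⊛ sub k g} (mono-≈ k (go n (tail f)))) (≋⇒≈ (𝕊.sym (right f))))

sub-const : ∀ k .{{_ : NonZero k}} c → sub k (const c) ≋ const c
sub-const k c = 𝕊.trans (sub-· k c oneS) (coeffwise λ n → cong (c ℚ.*_) (sub-one k .coeff n))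

sub-sub : ∀ j k .{{_ : NonZero j}} .{{_ : NonZero k}} .{{_ : NonZero (j ℕ.* k)}} f → sub j (sub k f) ≋ sub (j ℕ.* k) f
sub-sub j k f = sub-unique (j ℕ.* k) (λ f → sub j (sub k f)) rec f
  where
  open ≋-Reasoning
  rec : ∀ f → sub j (sub k f) ≋ const (f 0) ⊕ mono (j ℕ.* k) ⊛ sub j (sub k (tail f))
  rec f = begin
    sub j (sub k f)                                           ≈⟨ sub-cong j (sub-unfold k f) ⟩
    sub j (const (f 0) ⊕ mono k ⊛ sub k (tail f))             ≈⟨ sub-⊕ j (const (f 0)) (mono k ⊛ sub k (tail f)) ⟩
    sub j (const (f 0)) ⊕ sub j (mono k ⊛ sub k (tail f))     ≈⟨ 𝕊.+-cong (sub-const j (f 0)) (sub-⊛ j (mono k) (sub k (tail f))) ⟩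
    const (f 0) ⊕ sub j (mono k) ⊛ sub j (sub k (tail f))     ≈⟨ 𝕊.+-congˡ {const (f 0)} (𝕊.*-congʳ {sub j (sub k (tail f))} (sub-mono j k)) ⟩
    const (f 0) ⊕ mono (j ℕ.* k) ⊛ sub j (sub k (tail f))     ∎

sub-≈ : ∀ k .{{_ : NonZero k}} {n f g} → f ≈[ n ] g → sub k f ≈[ n ] sub k g
sub-≈ k {n} {f} {g} p = upTo step
  where
  step : ∀ i → i ≤ n → sub k f i ≡ sub k g i
  step i i≤n with k ∣? i
  ... | yes _ = p .below (i / k) (ℕₚ.≤-trans (m/n≤m i k) i≤n)
  ... | no  _ = refl

-- The substitution q ↦ -q

sgn : ℕ → ℚ
sgn zero    = 1ℚ
sgn (suc n) = ℚ.- sgn n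

sgn-+ : ∀ m n → sgn (m ℕ.+ n) ≡ sgn m ℚ.* sgn n
sgn-+ zero    n = sym (ℚₚ.*-identityˡ (sgn n))
sgn-+ (suc m) n = trans (cong ℚ.-_ (sgn-+ m n)) (ℚₚ.neg-distribˡ-* (sgn m) (sgn n))

alt : Series → Series
alt f n = sgn n ℚ.* f n

alt-cong : ∀ {f g} → f ≋ g → alt f ≋ alt g
alt-cong p = coeffwise λ n → cong (sgn n ℚ.*_) (p .coeff n)

alt-⊕ : ∀ f g → alt (f ⊕ g) ≋ alt f ⊕ alt g
alt-⊕ f g = coeffwise λ n → ℚₚ.*-distribˡ-+ (sgn n) (f n) (g n)

alt-⊖ : ∀ f → alt (⊖ f) ≋ ⊖ alt f
alt-⊖ f = coeffwise λ n → sym (ℚₚ.neg-distribʳ-* (sgn n) (f n))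

alt-one : alt oneS ≋ oneS
alt-one = coeffwise λ { zero → refl ; (suc n) → ℚₚ.*-zeroʳ (sgn (suc n)) }

alt-⊛ : ∀ f g → alt (f ⊛ g) ≋ alt f ⊛ alt g
alt-⊛ f g = coeffwise λ n → trans (sym (sumTo-*ˡ n (sgn n) (λ i → f i ℚ.* g (n ∸ i)))) (sumTo-cong≤ n (step n))
  where
  step : ∀ n i → i ≤ n → sgn n ℚ.* (f i ℚ.* g (n ∸ i)) ≡ (sgn i ℚ.* f i) ℚ.* (sgn (n ∸ i) ℚ.* g (n ∸ i))
  step n i i≤n = trans (cong (ℚ._* (f i ℚ.* g (n ∸ i))) (trans (cong sgn (sym (ℕₚ.m+[n∸m]≡n i≤n))) (sgn-+ i (n ∸ i))))
    (Q.solve 4 (λ a b c d → (a Q.:* b) Q.:* (c Q.:* d) Q.:= (a Q.:* c) Q.:* (b Q.:* d)) refl (sgn i) (sgn (n ∸ i)) (f i) (g (n ∸ i)))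

alt-mono : ∀ e → alt (mono e) ≋ const (sgn e) ⊛ mono e
alt-mono e = 𝕊.trans (coeffwise step) (·-const (sgn e) (mono e))
  where
  step : ∀ n → sgn n ℚ.* mono e n ≡ sgn e ℚ.* mono e n
  step n with e ℕ.≟ n
  ... | yes refl = refl
  ... | no  e≢n  = trans (trans (cong (sgn n ℚ.*_) (mono-≢ e n e≢n)) (ℚₚ.*-zeroʳ (sgn n)))
                         (sym (trans (cong (sgn e ℚ.*_) (mono-≢ e n e≢n)) (ℚₚ.*-zeroʳ (sgn e))))

sgn-square : ∀ n → sgn n ℚ.* sgn n ≡ 1ℚ
sgn-square zero    = refl
sgn-square (suc n) = trans (sym (ℚₚ.neg-distribˡ-* (sgn n) (ℚ.- sgn n)))
  (trans (cong ℚ.-_ (sym (ℚₚ.neg-distribʳ-* (sgn n) (sgn n)))) (trans (neg-neg (sgn n ℚ.* sgn n)) (sgn-square n)))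
  where
  neg-neg : ∀ x → ℚ.- (ℚ.- x) ≡ x
  neg-neg = Q.solve 1 (λ x → Q.:- (Q.:- x) Q.:= x) refl

alt-sub₂ : ∀ f → alt (sub 2 f) ≋ sub 2 f
alt-sub₂ f = coeffwise step
  where
  even : ∀ m → sgn (m ℕ.* 2) ≡ 1ℚ
  even m = trans (cong sgn (trans (ℕₚ.*-comm m 2) (cong (m ℕ.+_) (ℕₚ.+-identityʳ m)))) (trans (sgn-+ m m) (sgn-square m))
  step : ∀ n → sgn n ℚ.* sub 2 f n ≡ sub 2 f n
  step n with 2 ∣? n
  ... | yes 2∣n = trans (cong (ℚ._* f (n / 2)) (trans (cong sgn (sym (m/n*n≡m 2∣n))) (even (n / 2)))) (ℚₚ.*-identityˡ (f (n / 2)))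
  ... | no  _   = ℚₚ.*-zeroʳ (sgn n)

alt-sub₅ : ∀ f → alt (sub 5 f) ≋ sub 5 (alt f)
alt-sub₅ f = coeffwise step
  where
  odd : ∀ m → sgn (m ℕ.* 5) ≡ sgn m
  odd zero    = refl
  odd (suc m) = trans (neg-neg² (ℚ.- sgn (m ℕ.* 5))) (cong ℚ.-_ (odd m))
    where
    neg-neg² : ∀ x → ℚ.- (ℚ.- (ℚ.- (ℚ.- x))) ≡ x
    neg-neg² = Q.solve 1 (λ x → Q.:- (Q.:- (Q.:- (Q.:- x))) Q.:= x) refl
  step : ∀ n → sgn n ℚ.* sub 5 f n ≡ sub 5 (alt f) n
  step n with 5 ∣? n
  ... | yes 5∣n = cong (ℚ._* f (n / 5)) (trans (cong sgn (sym (m/n*n≡m 5∣n))) (odd (n / 5)))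
  ... | no  _   = ℚₚ.*-zeroʳ (sgn n)

-- The derivation q d/dq

rat : ℕ → ℚ
rat n = n // 1

D : Series → Series
D f n = rat n ℚ.* f n

rat-ᵘ : ∀ n → ℚ.toℚᵘ (rat n) ≃ᵘ mkℚᵘ (+ n) 0
rat-ᵘ n = ℚₚ.toℚᵘ-fromℚᵘ (mkℚᵘ (+ n) 0)

rat-+ : ∀ m n → rat (m ℕ.+ n) ≡ rat m ℚ.+ rat n
rat-+ m n = ℚₚ.toℚᵘ-injective (ℚᵘₚ.≃-trans (rat-ᵘ (m ℕ.+ n)) (ℚᵘₚ.≃-trans
  (*≡* (cong (ℤ._* + 1) (trans (ℤₚ.pos-+ m n) (cong₂ ℤ._+_ (sym (ℤₚ.*-identityʳ (+ m))) (sym (ℤₚ.*-identityʳ (+ n)))))))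
  (ℚᵘₚ.≃-sym (ℚᵘₚ.≃-trans (ℚₚ.toℚᵘ-homo-+ (rat m) (rat n)) (ℚᵘₚ.+-cong (rat-ᵘ m) (rat-ᵘ n))))))

rat-* : ∀ m n → rat (m ℕ.* n) ≡ rat m ℚ.* rat n
rat-* m n = ℚₚ.toℚᵘ-injective (ℚᵘₚ.≃-trans (rat-ᵘ (m ℕ.* n)) (ℚᵘₚ.≃-trans
  (*≡* (cong (ℤ._* + 1) (ℤₚ.pos-* m n)))
  (ℚᵘₚ.≃-sym (ℚᵘₚ.≃-trans (ℚₚ.toℚᵘ-homo-* (rat m) (rat n)) (ℚᵘₚ.*-cong (rat-ᵘ m) (rat-ᵘ n))))))

D-cong : ∀ {f g} → f ≋ g → D f ≋ D g
D-cong p = coeffwise λ n → cong (rat n ℚ.*_) (p .coeff n)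

D-≈ : ∀ {n f g} → f ≈[ n ] g → D f ≈[ n ] D g
D-≈ p = upTo λ k k≤n → cong (rat k ℚ.*_) (p .below k k≤n)

D-⊕ : ∀ f g → D (f ⊕ g) ≋ D f ⊕ D g
D-⊕ f g = coeffwise λ n → ℚₚ.*-distribˡ-+ (rat n) (f n) (g n)

D-⊖ : ∀ f → D (⊖ f) ≋ ⊖ D f
D-⊖ f = coeffwise λ n → sym (ℚₚ.neg-distribʳ-* (rat n) (f n))

D-one : D oneS ≋ zeroS
D-one = coeffwise λ { zero → refl ; (suc n) → ℚₚ.*-zeroʳ (rat (suc n)) }

D-mono : ∀ e → D (mono e) ≋ const (rat e) ⊛ mono e
D-mono e = 𝕊.trans (coeffwise step) (·-const (rat e) (mono e))
  where
  step : ∀ n → rat n ℚ.* mono e n ≡ rat e ℚ.* mono e n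
  step n with e ℕ.≟ n
  ... | yes refl = refl
  ... | no  e≢n  = trans (trans (cong (rat n ℚ.*_) (mono-≢ e n e≢n)) (ℚₚ.*-zeroʳ (rat n)))
                         (sym (trans (cong (rat e ℚ.*_) (mono-≢ e n e≢n)) (ℚₚ.*-zeroʳ (rat e))))

D-⊛ : ∀ f g → D (f ⊛ g) ≋ D f ⊛ g ⊕ f ⊛ D g
D-⊛ f g = coeffwise λ n → trans (sym (sumTo-*ˡ n (rat n) (λ i → f i ℚ.* g (n ∸ i))))
  (trans (sumTo-cong≤ n (step n)) (sumTo-+ n (λ i → (rat i ℚ.* f i) ℚ.* g (n ∸ i)) (λ i → f i ℚ.* (rat (n ∸ i) ℚ.* g (n ∸ i)))))
  where
  step : ∀ n i → i ≤ n → rat n ℚ.* (f i ℚ.* g (n ∸ i)) ≡ (rat i ℚ.* f i) ℚ.* g (n ∸ i) ℚ.+ f i ℚ.* (rat (n ∸ i) ℚ.* g (n ∸ i))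
  step n i i≤n = trans (cong (ℚ._* (f i ℚ.* g (n ∸ i))) (trans (cong rat (sym (ℕₚ.m+[n∸m]≡n i≤n))) (rat-+ i (n ∸ i))))
    (Q.solve 4 (λ a b c d → (a Q.:+ b) Q.:* (c Q.:* d) Q.:= (a Q.:* c) Q.:* d Q.:+ c Q.:* (b Q.:* d)) refl (rat i) (rat (n ∸ i)) (f i) (g (n ∸ i)))

D-sub : ∀ k .{{_ : NonZero k}} f → D (sub k f) ≋ const (rat k) ⊛ sub k (D f)
D-sub k f = 𝕊.trans (coeffwise step) (·-const (rat k) (sub k (D f)))
  where
  step : ∀ n → rat n ℚ.* sub k f n ≡ rat k ℚ.* sub k (D f) n
  step n with k ∣? n
  ... | yes k∣n = trans (cong (ℚ._* f (n / k)) (trans (cong rat (trans (sym (m/n*n≡m k∣n)) (ℕₚ.*-comm (n / k) k))) (rat-* k (n / k)))) (ℚₚ.*-assoc (rat k) (rat (n / k)) (f (n / k)))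
  ... | no  _   = trans (ℚₚ.*-zeroʳ (rat n)) (sym (ℚₚ.*-zeroʳ (rat k)))

-- Infinite products

prodUpTo-cong : ∀ {F G} → (∀ m → F (suc m) ≋ G (suc m)) → ∀ N → prodUpTo F N ≋ prodUpTo G N
prodUpTo-cong e zero    = 𝕊.refl
prodUpTo-cong e (suc N) = 𝕊.*-cong (prodUpTo-cong e N) (e N)

prodUpTo-⊛ : ∀ F G N → prodUpTo (λ m → F m ⊛ G m) N ≋ prodUpTo F N ⊛ prodUpTo G N
prodUpTo-⊛ F G zero    = 𝕊.sym (𝕊.*-identityˡ oneS)
prodUpTo-⊛ F G (suc N) = 𝕊.trans (𝕊.*-congʳ {F (suc N) ⊛ G (suc N)} (prodUpTo-⊛ F G N))
  (solve 4 (λ a b c d → (a :* b) :* (c :* d) := (a :* c) :* (b :* d)) 𝕊.refl (prodUpTo F N) (prodUpTo G N) (F (suc N)) (G (suc N)))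

prodUpTo-hom : (h : Series → Series) → h oneS ≋ oneS → (∀ f g → h (f ⊛ g) ≋ h f ⊛ h g) →
  ∀ F N → h (prodUpTo F N) ≋ prodUpTo (λ m → h (F m)) N
prodUpTo-hom h h1 h⊛ F zero    = h1
prodUpTo-hom h h1 h⊛ F (suc N) = 𝕊.trans (h⊛ (prodUpTo F N) (F (suc N))) (𝕊.*-congʳ {h (F (suc N))} (prodUpTo-hom h h1 h⊛ F N))

-- The index starts at 1 because `prodUpTo` never uses F 0; the condition is F m ≡ 1 modulo q^m, the
-- one under which partial products stabilise.
record Unital (F : ℕ → Series) : Set where
  constructor unital
  field
    ≈one : ∀ m → F (suc m) ≈[ m ] oneS
open Unital public

unital-⊛ : ∀ {F G} → Unital F → Unital G → Unital (λ m → F m ⊛ G m)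
unital-⊛ p r .≈one m = 𝕋.trans m (𝕋.*-cong m (p .≈one m) (r .≈one m)) (𝕋.*-identityˡ m oneS)

unital-⊕mono : ∀ (e : ℕ → ℕ) → (∀ m → m < e (suc m)) → Unital (λ m → oneS ⊕ mono (e m))
unital-⊕mono e m<e .≈one m = 𝕋.trans m (𝕋.+-congˡ m {oneS} (shift-≈0 oneS (m<e m))) (𝕋.+-identityʳ m oneS)

unital-⊖mono : ∀ (e : ℕ → ℕ) → (∀ m → m < e (suc m)) → Unital (λ m → oneS ⊕ ⊖ mono (e m))
unital-⊖mono e m<e .≈one m = 𝕋.trans m (𝕋.+-congˡ m {oneS} (𝕋.-‿cong m (shift-≈0 oneS (m<e m)))) (𝕋.+-identityʳ m oneS)

infProd-conv : ∀ {F} → Unital F → Conv (prodUpTo F) (infProd F)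
infProd-conv {F} u = conv-diag λ N → 𝕋.trans N (𝕋.*-congˡ N {prodUpTo F N} (u .≈one N)) (𝕋.*-identityʳ N (prodUpTo F N))

infProd-cong : ∀ {F G} → (∀ m → F (suc m) ≋ G (suc m)) → infProd F ≋ infProd G
infProd-cong e = coeffwise λ n → prodUpTo-cong e n .coeff n

infProd-⊛ : ∀ {F G} → Unital F → Unital G → infProd (λ m → F m ⊛ G m) ≋ infProd F ⊛ infProd G
infProd-⊛ {F} {G} p r = conv-unique (infProd-conv (unital-⊛ p r))
  (conv-cong (λ N → 𝕊.sym (prodUpTo-⊛ F G N)) (conv-⊛ (infProd-conv p) (infProd-conv r)))

unital-pow : ∀ {F} → Unital F → ∀ e → Unital (λ m → powS (F m) e)
unital-pow u zero    = unital λ m → 𝕋.refl m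
unital-pow u (suc e) = unital-⊛ (unital-pow u e) u

infProd-one : infProd (λ _ → oneS) ≋ oneS
infProd-one = coeffwise λ n → go n .coeff n
  where
  go : ∀ N → prodUpTo (λ _ → oneS) N ≋ oneS
  go zero    = 𝕊.refl
  go (suc N) = 𝕊.trans (𝕊.*-identityʳ (prodUpTo (λ _ → oneS) N)) (go N)

infProd-pow : ∀ {F} → Unital F → ∀ e → infProd (λ m → powS (F m) e) ≋ powS (infProd F) e
infProd-pow u zero    = infProd-one
infProd-pow {F} u (suc e) = 𝕊.trans (infProd-⊛ (unital-pow u e) u) (𝕊.*-congʳ {infProd F} (infProd-pow u e))

infProd-sub : ∀ k .{{_ : NonZero k}} {F} → Unital F → Unital (λ m → sub k (F m)) → sub k (infProd F) ≋ infProd (λ m → sub k (F m))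
infProd-sub k {F} u u′ = conv-unique {λ N → sub k (prodUpTo F N)}
  (λ n → let (M , p) = infProd-conv u n in M , λ N M≤N → sub-≈ k (p N M≤N))
  (conv-cong (λ N → 𝕊.sym (prodUpTo-hom (sub k) (sub-one k) (sub-⊛ k) F N)) (infProd-conv u′))

infProd-alt : ∀ {F} → Unital F → Unital (λ m → alt (F m)) → alt (infProd F) ≋ infProd (λ m → alt (F m))
infProd-alt {F} u u′ = conv-unique {λ N → alt (prodUpTo F N)}
  (λ n → let (M , p) = infProd-conv u n in M , λ N M≤N → upTo λ k k≤n → cong (sgn k ℚ.*_) (p N M≤N .below k k≤n))
  (conv-cong (λ N → 𝕊.sym (prodUpTo-hom alt alt-one alt-⊛ F N)) (infProd-conv u′))

prodBelow : (ℕ → Series) → ℕ → Series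
prodBelow H zero    = oneS
prodBelow H (suc r) = prodBelow H r ⊛ H r

prodBelow-⊛ : ∀ F G r → prodBelow (λ j → F j ⊛ G j) r ≋ prodBelow F r ⊛ prodBelow G r
prodBelow-⊛ F G zero    = 𝕊.sym (𝕊.*-identityˡ oneS)
prodBelow-⊛ F G (suc r) = 𝕊.trans (𝕊.*-congʳ {F r ⊛ G r} (prodBelow-⊛ F G r))
  (solve 4 (λ a b c d → (a :* b) :* (c :* d) := (a :* c) :* (b :* d)) 𝕊.refl (prodBelow F r) (prodBelow G r) (F r) (G r))

prodBelow-one : ∀ r → prodBelow (λ _ → oneS) r ≋ oneS
prodBelow-one zero    = 𝕊.refl
prodBelow-one (suc r) = 𝕊.trans (𝕊.*-identityʳ (prodBelow (λ _ → oneS) r)) (prodBelow-one r)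

-- The m-th positive integer congruent to j + 1 modulo r.
stride : ℕ → ℕ → ℕ → ℕ
stride r j m = suc (j ℕ.+ (m ∸ 1) ℕ.* r)

prodUpTo-+ : ∀ F M r → prodUpTo F (r ℕ.+ M) ≋ prodUpTo F M ⊛ prodBelow (λ j → F (suc (j ℕ.+ M))) r
prodUpTo-+ F M zero    = 𝕊.sym (𝕊.*-identityʳ (prodUpTo F M))
prodUpTo-+ F M (suc r) = 𝕊.trans (𝕊.*-congʳ {F (suc (r ℕ.+ M))} (prodUpTo-+ F M r))
  (𝕊.*-assoc (prodUpTo F M) (prodBelow (λ j → F (suc (j ℕ.+ M))) r) (F (suc (r ℕ.+ M))))

prodUpTo-stride : ∀ F r N → prodUpTo F (N ℕ.* r) ≋ prodBelow (λ j → prodUpTo (λ m → F (stride r j m)) N) r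
prodUpTo-stride F r zero    = 𝕊.sym (prodBelow-one r)
prodUpTo-stride F r (suc N) = begin
  prodUpTo F (r ℕ.+ N ℕ.* r)
    ≈⟨ prodUpTo-+ F (N ℕ.* r) r ⟩
  prodUpTo F (N ℕ.* r) ⊛ prodBelow (λ j → F (suc (j ℕ.+ N ℕ.* r))) r
    ≈⟨ 𝕊.*-congʳ {prodBelow (λ j → F (suc (j ℕ.+ N ℕ.* r))) r} (prodUpTo-stride F r N) ⟩
  prodBelow (λ j → prodUpTo (λ m → F (stride r j m)) N) r ⊛ prodBelow (λ j → F (suc (j ℕ.+ N ℕ.* r))) r
    ≈⟨ 𝕊.sym (prodBelow-⊛ (λ j → prodUpTo (λ m → F (stride r j m)) N) (λ j → F (suc (j ℕ.+ N ℕ.* r))) r) ⟩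
  prodBelow (λ j → prodUpTo (λ m → F (stride r j m)) (suc N)) r ∎
  where open ≋-Reasoning

unital-stride : ∀ {F} → Unital F → ∀ r .{{_ : NonZero r}} j → Unital (λ m → F (stride r j m))
unital-stride u r j .≈one m = ≈-weaken (ℕₚ.≤-trans (ℕₚ.m≤m*n m r) (ℕₚ.m≤n+m (m ℕ.* r) j)) (u .≈one (j ℕ.+ m ℕ.* r))

conv-prodBelow : ∀ {P : ℕ → ℕ → Series} {s} → (∀ j → Conv (P j) (s j)) → ∀ r → Conv (λ N → prodBelow (λ j → P j N) r) (prodBelow s r)
conv-prodBelow c zero    = conv-const oneS
conv-prodBelow c (suc r) = conv-⊛ (conv-prodBelow c r) (c r)

-- Sorts the factors by the residue of their index modulo r. The partial products of length N r are
-- cofinal, and there the sorting is a finite rearrangement.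
infProd-stride : ∀ {F} → Unital F → ∀ r .{{_ : NonZero r}} → infProd F ≋ prodBelow (λ j → infProd (λ m → F (stride r j m))) r
infProd-stride {F} u r = conv-unique (conv-along (ℕ._* r) (λ N → ℕₚ.m≤m*n N r) (infProd-conv u))
  (conv-cong (λ N → 𝕊.sym (prodUpTo-stride F r N)) (conv-prodBelow (λ j → infProd-conv (unital-stride u r j)) r))

-- The factors 1 - q^a, their inverses, and Euler products.

oneMinusQ≋ : ∀ a .{{_ : NonZero a}} → oneMinusQ a ≋ oneS ⊕ ⊖ mono a
oneMinusQ≋ a = coeffwise step
  where
  step : ∀ n → oneMinusQ a n ≡ oneS n ℚ.+ ℚ.- mono a n
  step n with n ℕ.≟ 0 | n ℕ.≟ a
  ... | yes refl | _        = sym (cong (λ c → 1ℚ ℚ.+ ℚ.- c) (shift-< a oneS (ℕ.>-nonZero⁻¹ a)))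
  ... | no n≢0   | yes refl = sym (cong₂ (λ c d → c ℚ.+ ℚ.- d) (mono-≢ 0 n (λ 0≡n → n≢0 (sym 0≡n))) (mono-≡ n))
  ... | no n≢0   | no n≢a   = sym (cong₂ (λ c d → c ℚ.+ ℚ.- d) (mono-≢ 0 n (λ 0≡n → n≢0 (sym 0≡n))) (mono-≢ a n (λ a≡n → n≢a (sym a≡n))))

ones : Series
ones _ = 1ℚ

geomQ≋ : ∀ a .{{_ : NonZero a}} → geomQ a ≋ sub a ones
geomQ≋ a = coeffwise step
  where
  step : ∀ n → geomQ a n ≡ sub a ones n
  step n with a ∣? n
  ... | yes _ = refl
  ... | no  _ = refl

geomQ-inverse : ∀ a .{{_ : NonZero a}} → geomQ a ⊛ (oneS ⊕ ⊖ mono a) ≋ oneS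
geomQ-inverse a = begin
  geomQ a ⊛ (oneS ⊕ ⊖ mono a)                  ≈⟨ 𝕊.*-cong (geomQ≋ a) (𝕊.sym (𝕊.trans (sub-⊕ a oneS (⊖ mono 1)) (𝕊.+-cong (sub-one a)
                                                    (𝕊.trans (sub-⊖ a (mono 1)) (𝕊.-‿cong (𝕊.trans (sub-mono a 1) (mono-cong (ℕₚ.*-identityʳ a)))))))) ⟩
  sub a ones ⊛ sub a (oneS ⊕ ⊖ mono 1)         ≈⟨ 𝕊.sym (sub-⊛ a ones (oneS ⊕ ⊖ mono 1)) ⟩
  sub a (ones ⊛ (oneS ⊕ ⊖ mono 1))             ≈⟨ sub-cong a ones-inverse ⟩
  sub a oneS                                   ≈⟨ sub-one a ⟩
  oneS                                         ∎
  where
  open ≋-Reasoning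
  ones≋ : ones ≋ oneS ⊕ mono 1 ⊛ ones
  ones≋ = 𝕊.trans (coeffwise λ { zero → refl ; (suc n) → refl }) (𝕊.+-congˡ {oneS} (𝕊.sym (mono-⊛ 1 ones)))
  ones-inverse : ones ⊛ (oneS ⊕ ⊖ mono 1) ≋ oneS
  ones-inverse = 𝕊.trans (𝕊.distribˡ ones oneS (⊖ mono 1)) (𝕊.trans (𝕊.+-congʳ {ones ⊛ ⊖ mono 1} (𝕊.trans (𝕊.*-identityʳ ones) ones≋))
    (solve 2 (λ m s → con (+ 1) :+ m :* s :+ s :* (:- m) := con (+ 1)) 𝕊.refl (mono 1) ones))

euler : ℕ → Series
euler r = infProd (λ m → oneS ⊕ ⊖ mono (r ℕ.* m))

unital-euler : ∀ r .{{_ : NonZero r}} → Unital (λ m → oneS ⊕ ⊖ mono (r ℕ.* m))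
unital-euler r = unital-⊖mono (r ℕ.*_) λ m → ℕₚ.m≤n*m (suc m) r

sub-1-mono : ∀ k .{{_ : NonZero k}} e → sub k (oneS ⊕ ⊖ mono e) ≋ oneS ⊕ ⊖ mono (k ℕ.* e)
sub-1-mono k e = 𝕊.trans (sub-⊕ k oneS (⊖ mono e)) (𝕊.+-cong (sub-one k) (𝕊.trans (sub-⊖ k (mono e)) (𝕊.-‿cong (sub-mono k e))))

unital-cong : ∀ {F G} → (∀ m → F (suc m) ≋ G (suc m)) → Unital F → Unital G
unital-cong e u .≈one m = 𝕋.trans m (≋⇒≈ (𝕊.sym (e m))) (u .≈one m)

sub-euler : ∀ k r .{{_ : NonZero k}} .{{_ : NonZero r}} → sub k (euler r) ≋ euler (k ℕ.* r)
sub-euler k r = 𝕊.trans (infProd-sub k (unital-euler r) (unital-cong (λ m → 𝕊.sym (eq (suc m))) (unital-euler (k ℕ.* r) {{ℕₚ.m*n≢0 k r}})))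
  (infProd-cong λ m → eq (suc m))
  where
  eq : ∀ m → sub k (oneS ⊕ ⊖ mono (r ℕ.* m)) ≋ oneS ⊕ ⊖ mono (k ℕ.* r ℕ.* m)
  eq m = 𝕊.trans (sub-1-mono k (r ℕ.* m)) (𝕊.+-congˡ {oneS} (𝕊.-‿cong (mono-cong (sym (ℕₚ.*-assoc k r m)))))

-- σ is defined through a local function, which the unifier recovers here.
mutual
  divisorSum : ℕ → ℕ → ℕ
  divisorSum = _

  σ-divisorSum : ∀ d → σ (suc d) ≡ divisorSum (suc d) d ℕ.+ suc d
  σ-divisorSum d with suc d ∣? suc d
  ... | no ∤ = contradiction ∣-refl ∤
  -- Generalising `suc d` to a variable turns the remaining equation into a pattern unification
  -- problem, which fixes `divisorSum`.
  ... | yes _ with suc d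
  ...   | n = refl

-- Sums of sequences of series.

sumS : ℕ → (ℕ → Series) → Series
sumS zero    F = F 0
sumS (suc n) F = sumS n F ⊕ F (suc n)

partialSum : (ℕ → Series) → ℕ → Series
partialSum α N = α 0 ⊕ sumS N (λ k → α (suc k))

seriesSum : (ℕ → Series) → Series
seriesSum α = diag (partialSum α)

-- The condition starts at index 2 because a theta series may have small terms at |x| = 1: with β =
-- 0 the term x = -1 has exponent 0.
record Summable (α : ℕ → Series) : Set where
  constructor summable
  field
    tail≈0 : ∀ k → α (suc (suc k)) ≈[ k ] zeroS
open Summable public

sumS-≈ : ∀ {n} N {F G : ℕ → Series} → (∀ k → k ≤ N → F k ≈[ n ] G k) → sumS N F ≈[ n ] sumS N G
sumS-≈ zero    e = e 0 z≤n
sumS-≈ {n} (suc N) e = 𝕋.+-cong n (sumS-≈ N λ k k≤N → e k (ℕₚ.m≤n⇒m≤1+n k≤N)) (e (suc N) ℕₚ.≤-refl)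

sumS-⊛ : ∀ N f (F : ℕ → Series) → f ⊛ sumS N F ≋ sumS N (λ k → f ⊛ F k)
sumS-⊛ zero    f F = 𝕊.refl
sumS-⊛ (suc N) f F = 𝕊.trans (𝕊.distribˡ f (sumS N F) (F (suc N))) (𝕊.+-congʳ {f ⊛ F (suc N)} (sumS-⊛ N f F))

partialSum-cauchy : ∀ {α} → Summable α → Cauchy (partialSum α)
partialSum-cauchy {α} s N = 𝕋.+-congˡ N {α 0} (𝕋.trans N (𝕋.+-congˡ N {sumS N (λ k → α (suc k))} (s .tail≈0 N)) (𝕋.+-identityʳ N (sumS N (λ k → α (suc k)))))

-- The limit of the Gaussian binomial coefficients.

module GaussLimit (a : ℕ) .{{_ : NonZero a}} where
  open GaussCoefficients seriesRing (mono a) public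

  pw≋ : ∀ k → pw k ≋ mono (a ℕ.* k)
  pw≋ zero    = mono-cong (sym (ℕₚ.*-zeroʳ a))
  pw≋ (suc k) = 𝕊.trans (𝕊.*-congˡ {mono a} (pw≋ k)) (𝕊.trans (mono-+ a (a ℕ.* k)) (mono-cong (sym (ℕₚ.*-suc a k))))

  poch≋ : ∀ j → poch j ≋ prodUpTo (λ m → oneS ⊕ ⊖ mono (a ℕ.* m)) j
  poch≋ zero    = 𝕊.refl
  poch≋ (suc j) = 𝕊.*-cong (poch≋ j) (𝕊.+-congˡ {oneS} (𝕊.-‿cong (pw≋ (suc j))))

  poch-≈ : ∀ {n j} → n ≤ j → poch j ≈[ n ] euler a
  poch-≈ {n} {j} n≤j = 𝕋.trans n (≋⇒≈ (poch≋ j)) (diag-≈ cauchy n≤j)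
    where
    F : ℕ → Series
    F m = oneS ⊕ ⊖ mono (a ℕ.* m)
    cauchy : Cauchy (prodUpTo F)
    cauchy N = 𝕋.trans N (𝕋.*-congˡ N {prodUpTo F N} (unital-euler a .≈one N)) (𝕋.*-identityʳ N (prodUpTo F N))

  -- As j grows, all three Pochhammer products in `gauss-poch` tend to the Euler product E, so E²
  -- times the coefficient tends to E, and one E is cancelled. The precision is that of the shortest
  -- product, j = N - k.
  gauss-limit′ : ∀ {n} k j → n ≤ j → euler a ⊛ gauss (k ℕ.+ j) k ≈[ n ] oneS
  gauss-limit′ {n} k j n≤j = ⊛-cancel-unit-≈ (euler a) refl (begin
    E ⊛ (E ⊛ g)                                     ≈⟨ ≋⇒≈ (solve 2 (λ E g → E :* (E :* g) := g :* (E :* E)) 𝕊.refl E g) ⟩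
    g ⊛ (E ⊛ E)                                     ≈⟨ 𝕋.*-congˡ n {g} (𝕋.*-cong n (𝕋.sym n (poch-≈ n≤j)) (𝕋.sym n (poch-≈ (ℕₚ.≤-trans n≤j (ℕₚ.m≤m+n j (k ℕ.+ k)))))) ⟩
    g ⊛ (poch j ⊛ poch (j ℕ.+ (k ℕ.+ k)))           ≈⟨ ≋⇒≈ (gauss-poch k j) ⟩
    poch ((k ℕ.+ j) ℕ.+ (k ℕ.+ j))                  ≈⟨ poch-≈ (ℕₚ.≤-trans n≤j (ℕₚ.≤-trans (ℕₚ.m≤n+m j k) (ℕₚ.m≤m+n (k ℕ.+ j) (k ℕ.+ j)))) ⟩
    E                                               ≈⟨ ≋⇒≈ (𝕊.sym (𝕊.*-identityʳ E)) ⟩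
    E ⊛ oneS                                        ∎)
    where
    open import Relation.Binary.Reasoning.Setoid (𝕋.setoid n)
    E = euler a
    g = gauss (k ℕ.+ j) k

  gauss-limit : ∀ {n} N k → k ℕ.+ n ≤ N → euler a ⊛ gauss N k ≈[ n ] oneS
  gauss-limit {n} N k k+n≤N = subst (λ M → euler a ⊛ gauss M k ≈[ n ] oneS) (ℕₚ.m+[n∸m]≡n (ℕₚ.m+n≤o⇒m≤o k k+n≤N))
    (gauss-limit′ k (N ∸ k) (ℕₚ.m+n≤o⇒m≤o∸n n (subst (_≤ N) (ℕₚ.+-comm k n) k+n≤N)))

  weighted : (ℕ → Series) → ℕ → Series
  weighted α N = gauss N 0 ⊛ α 0 ⊕ sumS N (λ k → gauss N (suc k) ⊛ α (suc k))

  -- Terms with index at most n + 1 have coefficients within reach of `gauss-limit`, which asks for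
  -- k + n ≤ N and thus for N ≥ 2n + 1; later terms vanish modulo q^(n+1) on their own.
  weighted-conv : ∀ {α} → Summable α → Conv (λ N → euler a ⊛ weighted α N) (seriesSum α)
  weighted-conv {α} s n = suc (n ℕ.+ n) , λ N 2n<N →
    𝕋.trans n (≋⇒≈ (𝕊.trans (𝕊.distribˡ E (gauss N 0 ⊛ α 0) (sumS N (λ k → gauss N (suc k) ⊛ α (suc k))))
                (𝕊.+-congˡ {E ⊛ (gauss N 0 ⊛ α 0)} (sumS-⊛ N E (λ k → gauss N (suc k) ⊛ α (suc k))))))
      (𝕋.trans n (𝕋.+-cong n (each N 2n<N 0) (sumS-≈ N λ k _ → each N 2n<N (suc k)))
        (diag-≈ (partialSum-cauchy s) (ℕₚ.≤-trans (ℕₚ.m≤m+n n n) (ℕₚ.≤-trans (ℕₚ.n≤1+n (n ℕ.+ n)) 2n<N))))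
    where
    E = euler a
    near : ∀ N → suc (n ℕ.+ n) ≤ N → ∀ k → k ≤ suc n → E ⊛ (gauss N k ⊛ α k) ≈[ n ] α k
    near N 2n<N k k≤ = 𝕋.trans n (≋⇒≈ (𝕊.sym (𝕊.*-assoc E (gauss N k) (α k))))
      (𝕋.trans n (𝕋.*-congʳ n {α k} (gauss-limit N k (ℕₚ.≤-trans (ℕₚ.+-monoˡ-≤ n k≤) 2n<N))) (𝕋.*-identityˡ n (α k)))
    far : ∀ N k → n ≤ k → E ⊛ (gauss N (suc (suc k)) ⊛ α (suc (suc k))) ≈[ n ] α (suc (suc k))
    far N k n≤k = 𝕋.trans n (𝕋.*-congˡ n {E} (𝕋.trans n (𝕋.*-congˡ n {g} z) (𝕋.zeroʳ n g))) (𝕋.trans n (𝕋.zeroʳ n E) (𝕋.sym n z))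
      where
      g = gauss N (suc (suc k))
      z = ≈-weaken n≤k (s .tail≈0 k)
    each : ∀ N → suc (n ℕ.+ n) ≤ N → ∀ k → E ⊛ (gauss N k ⊛ α k) ≈[ n ] α k
    each N 2n<N zero          = near N 2n<N 0 z≤n
    each N 2n<N (suc zero)    = near N 2n<N 1 (s≤s z≤n)
    each N 2n<N (suc (suc k)) with n ℕ.≤? k
    ... | yes n≤k = far N k n≤k
    ... | no  n≰k = near N 2n<N (suc (suc k)) (s≤s (ℕₚ.≰⇒> n≰k))

-- Sums over arbitrary countable families.

private
  variable
    I J : Set

sumL : List I → (I → ℚ) → ℚ
sumL []      f = 0ℚ
sumL (x ∷ l) f = f x ℚ.+ sumL l f

sumL-cong : ∀ (l : List I) {f g} → (∀ i → f i ≡ g i) → sumL l f ≡ sumL l g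
sumL-cong []      e = refl
sumL-cong (x ∷ l) e = cong₂ ℚ._+_ (e x) (sumL-cong l e)

sumL-0 : ∀ (l : List I) {f} → (∀ i → i ∈ l → f i ≡ 0ℚ) → sumL l f ≡ 0ℚ
sumL-0 []      z = refl
sumL-0 (x ∷ l) z = trans (cong₂ ℚ._+_ (z x (here refl)) (sumL-0 l λ i i∈l → z i (there i∈l))) (ℚₚ.+-identityʳ 0ℚ)

sumL-*ˡ : ∀ (l : List I) c f → sumL l (λ i → c ℚ.* f i) ≡ c ℚ.* sumL l f
sumL-*ˡ []      c f = sym (ℚₚ.*-zeroʳ c)
sumL-*ˡ (x ∷ l) c f = trans (cong (c ℚ.* f x ℚ.+_) (sumL-*ˡ l c f)) (sym (ℚₚ.*-distribˡ-+ c (f x) (sumL l f)))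

sumL-*ʳ : ∀ (l : List I) c f → sumL l (λ i → f i ℚ.* c) ≡ sumL l f ℚ.* c
sumL-*ʳ l c f = trans (sumL-cong l λ i → ℚₚ.*-comm (f i) c) (trans (sumL-*ˡ l c f) (ℚₚ.*-comm c (sumL l f)))

sumL-map : ∀ (g : J → I) l f → sumL (map g l) f ≡ sumL l (f ∘ g)
sumL-map g []      f = refl
sumL-map g (x ∷ l) f = cong (f (g x) ℚ.+_) (sumL-map g l f)

sumL-++ : ∀ (l m : List I) f → sumL (l ++ m) f ≡ sumL l f ℚ.+ sumL m f
sumL-++ []      m f = sym (ℚₚ.+-identityˡ (sumL m f))
sumL-++ (x ∷ l) m f = trans (cong (f x ℚ.+_) (sumL-++ l m f)) (sym (ℚₚ.+-assoc (f x) (sumL l f) (sumL m f)))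

sumL-cartesian : ∀ (l : List I) (m : List J) f → sumL (cartesianProduct l m) f ≡ sumL l (λ i → sumL m (λ j → f (i , j)))
sumL-cartesian []      m f = refl
sumL-cartesian (x ∷ l) m f = trans (sumL-++ (map (x ,_) m) (cartesianProduct l m) f)
  (cong₂ ℚ._+_ (sumL-map (x ,_) m f) (sumL-cartesian l m f))

sumL-sumTo : ∀ (l : List I) n (F : I → ℕ → ℚ) → sumL l (λ i → sumTo n (F i)) ≡ sumTo n (λ k → sumL l (λ i → F i k))
sumL-sumTo []      n F = sym (sumTo-0 n λ _ _ → refl)
sumL-sumTo (x ∷ l) n F = trans (cong (sumTo n (F x) ℚ.+_) (sumL-sumTo l n F)) (sym (sumTo-+ n (F x) (λ k → sumL l (λ i → F i k))))

sumL-↭ : ∀ {l m : List I} f → l ↭ m → sumL l f ≡ sumL m f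
sumL-↭ f Perm.refl          = refl
sumL-↭ f (Perm.prep x p)    = cong (f x ℚ.+_) (sumL-↭ f p)
sumL-↭ {l = _ ∷ _ ∷ l} f (Perm.swap x y p) = trans (cong (λ z → f x ℚ.+ (f y ℚ.+ z)) (sumL-↭ f p)) (swap (f x) (f y) _)
  where
  swap : ∀ a b c → a ℚ.+ (b ℚ.+ c) ≡ b ℚ.+ (a ℚ.+ c)
  swap a b c = trans (sym (ℚₚ.+-assoc a b c)) (trans (cong (ℚ._+ c) (ℚₚ.+-comm a b)) (ℚₚ.+-assoc b a c))
sumL-↭ f (Perm.trans p r)   = trans (sumL-↭ f p) (sumL-↭ f r)

sumL-support : ∀ (f : I → ℚ) l m → Unique l → Unique m →
  (∀ i → i ∈ l → f i ≢ 0ℚ → i ∈ m) → (∀ i → i ∈ m → f i ≢ 0ℚ → i ∈ l) → sumL l f ≡ sumL m f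
sumL-support f []      m ul um l⊆m m⊆l = sym (sumL-0 m zero′)
  where
  zero′ : ∀ i → i ∈ m → f i ≡ 0ℚ
  zero′ i i∈m with f i ℚ.≟ 0ℚ
  ... | yes z = z
  ... | no ≢0 with () ← m⊆l i i∈m ≢0
sumL-support f (x ∷ l) m (x∉l ∷ ul) um l⊆m m⊆l with f x ℚ.≟ 0ℚ
... | yes z = trans (cong (ℚ._+ sumL l f) z) (trans (ℚₚ.+-identityˡ (sumL l f))
  (sumL-support f l m ul um (λ i i∈l → l⊆m i (there i∈l)) back))
  where
  back : ∀ i → i ∈ m → f i ≢ 0ℚ → i ∈ l
  back i i∈m ≢0 with m⊆l i i∈m ≢0
  ... | here refl = contradiction z ≢0
  ... | there i∈l = i∈l
... | no ≢0 with ∈-∃++ (l⊆m x (here refl) ≢0)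
...   | ys , zs , refl = trans (cong (f x ℚ.+_) (sumL-support f l (ys ++ zs) ul um′ forth back)) (sym (sumL-↭ f π))
  where
  π : ys ++ x ∷ zs ↭ x ∷ ys ++ zs
  π = ↭-shift x ys zs
  unique-π : Unique (x ∷ ys ++ zs)
  unique-π = PermS.Unique-resp-↭ (≡.setoid _) (↭⇒↭ₛ π) um
  um′ : Unique (ys ++ zs)
  um′ with unique-π
  ... | _ ∷ u = u
  x∉ : ∀ i → i ∈ ys ++ zs → x ≢ i
  x∉ i i∈ with unique-π
  ... | p ∷ _ = All.lookup p i∈
  forth : ∀ i → i ∈ l → f i ≢ 0ℚ → i ∈ ys ++ zs
  forth i i∈l i≢0 with ∈-resp-↭ π (l⊆m i (there i∈l) i≢0)
  ... | here refl = contradiction refl (All.lookup x∉l i∈l)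
  ... | there i∈  = i∈
  back : ∀ i → i ∈ ys ++ zs → f i ≢ 0ℚ → i ∈ l
  back i i∈ i≢0 with m⊆l i (∈-resp-↭ (Perm.↭-sym π) (there i∈)) i≢0
  ... | here refl = contradiction refl (x∉ i i∈)
  ... | there i∈l = i∈l

-- An unordered infinite sum up to degree n: the list contains every index that contributes there
-- and may contain others, which leaves freedom to use boxes, products and images as enumerations.
record Enumeration {I : Set} (F : I → Series) (s : Series) (n : ℕ) : Set where
  constructor enumeration
  field
    list    : List I
    unique  : Unique list
    support : ∀ i k → k ≤ n → F i k ≢ 0ℚ → i ∈ list
    total   : ∀ k → k ≤ n → sumL list (λ i → F i k) ≡ s k
open Enumeration

record HasSum {I : Set} (F : I → Series) (s : Series) : Set where
  constructor hasSum
  field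
    enum : ∀ n → Enumeration F s n
open HasSum

-- The source of the lattice identities below: one family, summed after two different bijections of
-- its index set.
hasSum-unique : ∀ {F : I → Series} {s t} → HasSum F s → HasSum F t → s ≋ t
hasSum-unique {F = F} p r = coeffwise λ n → let a = p .enum n ; b = r .enum n in
  trans (sym (a .total n ℕₚ.≤-refl)) (trans
    (sumL-support (λ i → F i n) (a .list) (b .list) (a .unique) (b .unique) (λ i _ → b .support i n ℕₚ.≤-refl) (λ i _ → a .support i n ℕₚ.≤-refl))
    (b .total n ℕₚ.≤-refl))

hasSum-cong : ∀ {F G : I → Series} {s} → (∀ i → F i ≋ G i) → HasSum F s → HasSum G s
hasSum-cong e p .enum n = let a = p .enum n in enumeration (a .list) (a .unique)
  (λ i k k≤n G≢0 → a .support i k k≤n λ F≡0 → G≢0 (trans (sym (e i .coeff k)) F≡0))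
  (λ k k≤n → trans (sumL-cong (a .list) λ i → sym (e i .coeff k)) (a .total k k≤n))

hasSum-lim : ∀ {F : I → Series} {s t} → s ≋ t → HasSum F s → HasSum F t
hasSum-lim e p .enum n = let a = p .enum n in enumeration (a .list) (a .unique) (a .support) λ k k≤n → trans (a .total k k≤n) (e .coeff k)

sumTo-≢0 : ∀ n (f : ℕ → ℚ) → sumTo n f ≢ 0ℚ → ∃ λ i → i ≤ n × f i ≢ 0ℚ
sumTo-≢0 zero    f ≢0 = 0 , z≤n , ≢0
sumTo-≢0 (suc n) f ≢0 with f (suc n) ℚ.≟ 0ℚ
... | no  fn≢0 = suc n , ℕₚ.≤-refl , fn≢0
... | yes fn≡0 with sumTo-≢0 n f (λ z → ≢0 (trans (cong₂ ℚ._+_ z fn≡0) (ℚₚ.+-identityʳ 0ℚ)))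
...   | i , i≤n , fi≢0 = i , ℕₚ.m≤n⇒m≤1+n i≤n , fi≢0

*-≢0ˡ : ∀ x y → x ℚ.* y ≢ 0ℚ → x ≢ 0ℚ
*-≢0ˡ x y xy≢0 x≡0 = xy≢0 (trans (cong (ℚ._* y) x≡0) (ℚₚ.*-zeroˡ y))

*-≢0ʳ : ∀ x y → x ℚ.* y ≢ 0ℚ → y ≢ 0ℚ
*-≢0ʳ x y xy≢0 y≡0 = xy≢0 (trans (cong (x ℚ.*_) y≡0) (ℚₚ.*-zeroʳ x))

hasSum-⊛ : ∀ {F : I → Series} {G : J → Series} {s t} → HasSum F s → HasSum G t → HasSum (λ (i , j) → F i ⊛ G j) (s ⊛ t)
hasSum-⊛ {F = F} {G} {s} {t} p r .enum n = enumeration (cartesianProduct (a .list) (b .list)) (Uniq.cartesianProduct⁺ (a .unique) (b .unique)) supp tot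
  where
  a = p .enum n
  b = r .enum n
  supp : ∀ ij k → k ≤ n → (F (proj₁ ij) ⊛ G (proj₂ ij)) k ≢ 0ℚ → ij ∈ cartesianProduct (a .list) (b .list)
  supp (i , j) k k≤n ≢0 with sumTo-≢0 k (λ m → F i m ℚ.* G j (k ∸ m)) ≢0
  ... | m , m≤k , ≢0′ = ∈-cartesianProduct⁺
    (a .support i m (ℕₚ.≤-trans m≤k k≤n) (*-≢0ˡ (F i m) (G j (k ∸ m)) ≢0′))
    (b .support j (k ∸ m) (ℕₚ.≤-trans (ℕₚ.m∸n≤m k m) k≤n) (*-≢0ʳ (F i m) (G j (k ∸ m)) ≢0′))
  tot : ∀ k → k ≤ n → sumL (cartesianProduct (a .list) (b .list)) (λ ij → (F (proj₁ ij) ⊛ G (proj₂ ij)) k) ≡ (s ⊛ t) k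
  tot k k≤n = begin
    sumL (cartesianProduct (a .list) (b .list)) (λ ij → (F (proj₁ ij) ⊛ G (proj₂ ij)) k)
      ≡⟨ sumL-cartesian (a .list) (b .list) (λ ij → (F (proj₁ ij) ⊛ G (proj₂ ij)) k) ⟩
    sumL (a .list) (λ i → sumL (b .list) (λ j → sumTo k (λ m → F i m ℚ.* G j (k ∸ m))))
      ≡⟨ sumL-cong (a .list) (λ i → sumL-sumTo (b .list) k (λ j m → F i m ℚ.* G j (k ∸ m))) ⟩
    sumL (a .list) (λ i → sumTo k (λ m → sumL (b .list) (λ j → F i m ℚ.* G j (k ∸ m))))
      ≡⟨ sumL-sumTo (a .list) k (λ i m → sumL (b .list) (λ j → F i m ℚ.* G j (k ∸ m))) ⟩
    sumTo k (λ m → sumL (a .list) (λ i → sumL (b .list) (λ j → F i m ℚ.* G j (k ∸ m))))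
      ≡⟨ sumTo-cong≤ k (λ m m≤k → trans (sumL-cong (a .list) λ i → trans (sumL-*ˡ (b .list) (F i m) (λ j → G j (k ∸ m)))
             (cong (F i m ℚ.*_) (b .total (k ∸ m) (ℕₚ.≤-trans (ℕₚ.m∸n≤m k m) k≤n))))
           (trans (sumL-*ʳ (a .list) (t (k ∸ m)) (λ i → F i m)) (cong (ℚ._* t (k ∸ m)) (a .total m (ℕₚ.≤-trans m≤k k≤n))))) ⟩
    (s ⊛ t) k ∎
    where open ≡-Reasoning

hasSum-scale : ∀ g {F : I → Series} {s} → HasSum F s → HasSum (λ i → g ⊛ F i) (g ⊛ s)
hasSum-scale g {F} {s} p .enum n = enumeration (a .list) (a .unique) supp tot
  where
  a = p .enum n
  supp : ∀ i k → k ≤ n → (g ⊛ F i) k ≢ 0ℚ → i ∈ a .list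
  supp i k k≤n ≢0 with sumTo-≢0 k (λ m → g m ℚ.* F i (k ∸ m)) ≢0
  ... | m , m≤k , ≢0′ = a .support i (k ∸ m) (ℕₚ.≤-trans (ℕₚ.m∸n≤m k m) k≤n) (*-≢0ʳ (g m) (F i (k ∸ m)) ≢0′)
  tot : ∀ k → k ≤ n → sumL (a .list) (λ i → (g ⊛ F i) k) ≡ (g ⊛ s) k
  tot k k≤n = trans (sumL-sumTo (a .list) k (λ i m → g m ℚ.* F i (k ∸ m))) (sumTo-cong k λ m →
    trans (sumL-*ˡ (a .list) (g m) (λ i → F i (k ∸ m))) (cong (g m ℚ.*_) (a .total (k ∸ m) (ℕₚ.≤-trans (ℕₚ.m∸n≤m k m) k≤n))))

hasSum-reindex : ∀ (f : J → I) (g : I → J) → (∀ i → f (g i) ≡ i) → (∀ j → g (f j) ≡ j) →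
  ∀ {F : I → Series} {s} → HasSum F s → HasSum (λ j → F (f j)) s
hasSum-reindex f g fg gf {F} p .enum n = let a = p .enum n in enumeration (map g (a .list))
  (Uniq.map⁺ (λ {x} {y} e → trans (sym (fg x)) (trans (cong f e) (fg y))) (a .unique))
  (λ j k k≤n ≢0 → subst (_∈ map g (a .list)) (gf j) (∈-map⁺ g (a .support (f j) k k≤n ≢0)))
  (λ k k≤n → trans (sumL-map g (a .list) (λ j → F (f j) k)) (trans (sumL-cong (a .list) λ i → cong (λ i → F i k) (fg i)) (a .total k k≤n)))

hasSum-sub : ∀ d .{{_ : NonZero d}} {F : I → Series} {s} → HasSum F s → HasSum (λ i → sub d (F i)) (sub d s)
hasSum-sub d {F} {s} p .enum n = enumeration (a .list) (a .unique) supp tot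
  where
  a = p .enum n
  supp : ∀ i k → k ≤ n → sub d (F i) k ≢ 0ℚ → i ∈ a .list
  supp i k k≤n ≢0 with d ∣? k
  ... | yes _ = a .support i (k / d) (ℕₚ.≤-trans (m/n≤m k d) k≤n) ≢0
  ... | no  _ = contradiction refl ≢0
  tot : ∀ k → k ≤ n → sumL (a .list) (λ i → sub d (F i) k) ≡ sub d s k
  tot k k≤n with d ∣? k
  ... | yes _ = a .total (k / d) (ℕₚ.≤-trans (m/n≤m k d) k≤n)
  ... | no  _ = sumL-0 (a .list) λ _ _ → refl

sumFin : ∀ r → (Fin r → Series) → Series
sumFin zero    s = zeroS
sumFin (suc r) s = s zero ⊕ sumFin r (λ i → s (suc i))

hasSum-Fin : ∀ r {F : Fin r × I → Series} {s : Fin r → Series} → (∀ c → HasSum (λ i → F (c , i)) (s c)) → HasSum F (sumFin r s)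
hasSum-Fin zero    p .enum n = enumeration [] [] (λ { (() , _) }) (λ k _ → refl)
hasSum-Fin {I = I} (suc r) {F} {s} p .enum n = enumeration (map (zero ,_) (a .list) ++ map up (b .list))
  (Uniq.++⁺ (Uniq.map⁺ (λ { refl → refl }) (a .unique)) (Uniq.map⁺ (λ { refl → refl }) (b .unique)) disjoint) supp tot
  where
  up : Fin r × I → Fin (suc r) × I
  up (c , i) = suc c , i
  a = p zero .enum n
  b = hasSum-Fin r {λ ci → F (up ci)} {λ c → s (suc c)} (λ c → p (suc c)) .enum n
  disjoint : ∀ {x} → ¬ (x ∈ map (zero ,_) (a .list) × x ∈ map up (b .list))
  disjoint (x∈ , x∈′) with ∈-map⁻ (zero ,_) x∈ | ∈-map⁻ up x∈′
  ... | _ , _ , refl | _ , _ , ()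
  supp : ∀ ci k → k ≤ n → F ci k ≢ 0ℚ → ci ∈ map (zero ,_) (a .list) ++ map up (b .list)
  supp (zero  , i) k k≤n ≢0 = ∈-++⁺ˡ (∈-map⁺ (zero ,_) (a .support i k k≤n ≢0))
  supp (suc c , i) k k≤n ≢0 = ∈-++⁺ʳ (map (zero ,_) (a .list)) (∈-map⁺ up (b .support (c , i) k k≤n ≢0))
  tot : ∀ k → k ≤ n → sumL (map (zero ,_) (a .list) ++ map up (b .list)) (λ ci → F ci k) ≡ (s zero ⊕ sumFin r (λ c → s (suc c))) k
  tot k k≤n = trans (sumL-++ (map (zero ,_) (a .list)) (map up (b .list)) (λ ci → F ci k))
    (cong₂ ℚ._+_ (trans (sumL-map (zero ,_) (a .list) (λ ci → F ci k)) (a .total k k≤n)) (trans (sumL-map up (b .list) (λ ci → F ci k)) (b .total k k≤n)))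

-- Families indexed by ℤ

box : ℕ → List ℤ
box zero    = + 0 ∷ []
box (suc n) = + suc n ∷ -[1+ n ] ∷ box n

box-≤ : ∀ n {x} → x ∈ box n → ℤ.∣ x ∣ ≤ n
box-≤ zero    (here refl)         = z≤n
box-≤ (suc n) (here refl)         = ℕₚ.≤-refl
box-≤ (suc n) (there (here refl)) = ℕₚ.≤-refl
box-≤ (suc n) (there (there x∈))  = ℕₚ.m≤n⇒m≤1+n (box-≤ n x∈)

box-unique : ∀ n → Unique (box n)
box-unique zero    = [] ∷ []
box-unique (suc n) = ((λ ()) ∷ All.tabulate λ { x∈ refl → ℕₚ.<-irrefl refl (box-≤ n x∈) }) ∷ (All.tabulate λ { x∈ refl → ℕₚ.<-irrefl refl (box-≤ n x∈) }) ∷ box-unique n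

∈-box : ∀ n x → ℤ.∣ x ∣ ≤ n → x ∈ box n
∈-box zero    (+ zero)  z≤n = here refl
∈-box (suc n) x         ≤n with ℤ.∣ x ∣ ℕ.≟ suc n
∈-box (suc n) (+ _)     ≤n | yes refl = here refl
∈-box (suc n) -[1+ _ ]  ≤n | yes refl = there (here refl)
∈-box (suc n) x         ≤n | no  ≢n   = there (there (∈-box n x (ℕ.s≤s⁻¹ (ℕₚ.≤∧≢⇒< ≤n ≢n))))

fold : (ℤ → Series) → ℕ → Series
fold F zero    = F (+ 0)
fold F (suc k) = F (+ suc k) ⊕ F -[1+ k ]

record Bounded (F : ℤ → Series) : Set where
  constructor bounded
  field
    bound : ∀ x k → suc k < ℤ.∣ x ∣ → F x k ≡ 0ℚ
open Bounded public

fold-summable : ∀ {F} → Bounded F → Summable (fold F)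
fold-summable b = summable λ k → upTo λ i i≤k →
  trans (cong₂ ℚ._+_ (b .bound (+ suc (suc k)) i (s≤s (s≤s i≤k))) (b .bound -[1+ suc k ] i (s≤s (s≤s i≤k)))) (ℚₚ.+-identityʳ 0ℚ)

sumL-box : ∀ F n k → sumL (box (suc n)) (λ x → F x k) ≡ partialSum (fold F) n k
sumL-box F n k = trans (go n) (ℚₚ.+-comm (sumS n (λ j → fold F (suc j)) k) (F (+ 0) k))
  where
  go : ∀ n → sumL (box (suc n)) (λ x → F x k) ≡ sumS n (λ j → fold F (suc j)) k ℚ.+ F (+ 0) k
  go zero    = trans (sym (ℚₚ.+-assoc (F (+ 1) k) (F -[1+ 0 ] k) (F (+ 0) k ℚ.+ 0ℚ))) (cong (fold F 1 k ℚ.+_) (ℚₚ.+-identityʳ (F (+ 0) k)))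
  go (suc n) = trans (cong (λ z → F (+ suc (suc n)) k ℚ.+ (F -[1+ suc n ] k ℚ.+ z)) (go n))
    (rearrange (F (+ suc (suc n)) k) (F -[1+ suc n ] k) (sumS n (λ j → fold F (suc j)) k) (F (+ 0) k))
    where
    rearrange : ∀ a b c d → a ℚ.+ (b ℚ.+ (c ℚ.+ d)) ≡ (c ℚ.+ (a ℚ.+ b)) ℚ.+ d
    rearrange = Q.solve 4 (λ a b c d → a Q.:+ (b Q.:+ (c Q.:+ d)) Q.:= (c Q.:+ (a Q.:+ b)) Q.:+ d) refl

hasSum-ℤ : ∀ {F} → Bounded F → HasSum F (seriesSum (fold F))
hasSum-ℤ {F} b .enum n = enumeration (box (suc n)) (box-unique (suc n)) supp
  λ k k≤n → trans (sumL-box F n k) (diag-≈ (partialSum-cauchy (fold-summable b)) (ℕₚ.≤-refl {n}) .below k k≤n)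
  where
  supp : ∀ x k → k ≤ n → F x k ≢ 0ℚ → x ∈ box (suc n)
  supp x k k≤n ≢0 with ℤ.∣ x ∣ ℕ.≤? suc k
  ... | yes ≤k = ∈-box (suc n) x (ℕₚ.≤-trans ≤k (s≤s k≤n))
  ... | no  ≰k = contradiction (b .bound x k (ℕₚ.≰⇒> ≰k)) ≢0

-- Division with remainder, as a bijection ℤ ≅ Fin d × ℤ

module Division (d : ℕ) .{{_ : NonZero d}} where
  join : Fin d × ℤ → ℤ
  join (r , k) = + toℕ r ℤ.+ k ℤ.* + d

  rem : ℤ → Fin d
  rem x = fromℕ< (n%ℕd<d x d)

  quo : ℤ → ℤ
  quo x = x /ℕ d

  join-split : ∀ x → join (rem x , quo x) ≡ x
  join-split x = trans (cong (λ r → + r ℤ.+ quo x ℤ.* + d) (Finₚ.toℕ-fromℕ< (n%ℕd<d x d))) (sym (a≡a%ℕn+[a/ℕn]*n x d))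

  -- The remainders differ by a multiple of d that is smaller than d in absolute value, so the
  -- multiple is zero.
  join-injective : ∀ p p′ → join p ≡ join p′ → p ≡ p′
  join-injective (r , k) (r′ , k′) e = cong₂ _,_ (Finₚ.toℕ-injective (ℤₚ.+-injective r≡r′)) k≡k′
    where
    diff : (k ℤ.- k′) ℤ.* + d ≡ toℕ r′ ℤ.⊖ toℕ r
    diff = trans (Z.solve 5 (λ k k′ d r r′ → (k Z.:- k′) Z.:* d Z.:= (r Z.:+ k Z.:* d) Z.:- (r′ Z.:+ k′ Z.:* d) Z.:+ (r′ Z.:- r)) refl k k′ (+ d) (+ toℕ r) (+ toℕ r′))
      (trans (cong (λ z → z ℤ.- join (r′ , k′) ℤ.+ (+ toℕ r′ ℤ.- + toℕ r)) e)
        (trans (Z.solve 2 (λ j m → j Z.:- j Z.:+ m Z.:= m) refl (join (r′ , k′)) (+ toℕ r′ ℤ.- + toℕ r)) (ℤₚ.m-n≡m⊖n (toℕ r′) (toℕ r))))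
    small : ℤ.∣ k ℤ.- k′ ∣ ℕ.* d < d
    small = subst (_< d) (trans (cong ℤ.∣_∣ (sym diff)) (ℤₚ.abs-* (k ℤ.- k′) (+ d)))
      (ℕₚ.≤-<-trans (ℤₚ.∣m⊝n∣≤m⊔n (toℕ r′) (toℕ r)) (ℕₚ.⊔-pres-<m (Finₚ.toℕ<n r′) (Finₚ.toℕ<n r)))
    zero′ : ℤ.∣ k ℤ.- k′ ∣ ≡ 0
    zero′ with ℤ.∣ k ℤ.- k′ ∣ | small
    ... | zero  | _ = refl
    ... | suc m | p = contradiction (ℕₚ.m≤m+n d (m ℕ.* d)) (ℕₚ.<⇒≱ p)
    k≡k′ : k ≡ k′
    k≡k′ = ℤₚ.i-j≡0⇒i≡j k k′ (ℤₚ.∣i∣≡0⇒i≡0 zero′)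
    r≡r′ : + toℕ r ≡ + toℕ r′
    r≡r′ = trans (Z.solve 2 (λ r m → r Z.:= (r Z.:+ m) Z.:- m) refl (+ toℕ r) (k ℤ.* + d))
      (trans (cong₂ ℤ._-_ e (cong (ℤ._* + d) k≡k′)) (Z.solve 2 (λ r m → (r Z.:+ m) Z.:- m Z.:= r) refl (+ toℕ r′) (k′ ℤ.* + d)))

  split-join : ∀ p → (rem (join p) , quo (join p)) ≡ p
  split-join p = join-injective (rem (join p) , quo (join p)) p (join-split (join p))

tri : ℕ → ℕ
tri zero    = 0
tri (suc k) = tri k ℕ.+ k

tri-ℤ : ∀ k → + 2 ℤ.* + tri (suc k) ≡ + k ℤ.* (+ k ℤ.+ + 1)
tri-ℤ zero    = refl
tri-ℤ (suc k) = begin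
  + 2 ℤ.* + (tri (suc k) ℕ.+ suc k)                   ≡⟨ cong (+ 2 ℤ.*_) (trans (ℤₚ.pos-+ (tri (suc k)) (suc k)) (cong (λ z → + tri (suc k) ℤ.+ z) (ℤₚ.pos-+ 1 k))) ⟩
  + 2 ℤ.* (+ tri (suc k) ℤ.+ (+ 1 ℤ.+ + k))           ≡⟨ ℤₚ.*-distribˡ-+ (+ 2) (+ tri (suc k)) (+ 1 ℤ.+ + k) ⟩
  + 2 ℤ.* + tri (suc k) ℤ.+ + 2 ℤ.* (+ 1 ℤ.+ + k)     ≡⟨ cong (ℤ._+ + 2 ℤ.* (+ 1 ℤ.+ + k)) (tri-ℤ k) ⟩
  + k ℤ.* (+ k ℤ.+ + 1) ℤ.+ + 2 ℤ.* (+ 1 ℤ.+ + k)     ≡⟨ Z.solve 1 (λ k → k Z.:* (k Z.:+ Z.con (+ 1)) Z.:+ Z.con (+ 2) Z.:* (Z.con (+ 1) Z.:+ k) Z.:= (Z.con (+ 1) Z.:+ k) Z.:* ((Z.con (+ 1) Z.:+ k) Z.:+ Z.con (+ 1))) refl (+ k) ⟩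
  (+ 1 ℤ.+ + k) ℤ.* ((+ 1 ℤ.+ + k) ℤ.+ + 1)           ≡⟨ cong (λ z → z ℤ.* (z ℤ.+ + 1)) (sym (ℤₚ.pos-+ 1 k)) ⟩
  + suc k ℤ.* (+ suc k ℤ.+ + 1)                       ∎
  where open ≡-Reasoning

-- The exponent α x(x+1)/2 + β x(x-1)/2 of Ramanujan's f(q^α, q^β).
ex : ℕ → ℕ → ℤ → ℕ
ex α β (+ k)    = α ℕ.* tri (suc k) ℕ.+ β ℕ.* tri k
ex α β -[1+ k ] = α ℕ.* tri (suc k) ℕ.+ β ℕ.* tri (suc (suc k))

-- Doubled to avoid halves. Through it, equalities of natural exponents become polynomial identities
-- over ℤ.
ex-ℤ : ∀ α β x → + 2 ℤ.* + ex α β x ≡ + α ℤ.* (x ℤ.* (x ℤ.+ + 1)) ℤ.+ + β ℤ.* (x ℤ.* (x ℤ.- + 1))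
ex-ℤ α β x = trans (cong (+ 2 ℤ.*_) (trans (cong +_ (expand x)) (trans (ℤₚ.pos-+ (α ℕ.* up x) (β ℕ.* dn x)) (cong₂ ℤ._+_ (ℤₚ.pos-* α (up x)) (ℤₚ.pos-* β (dn x))))))
  (trans (Z.solve 4 (λ a b u d → Z.con (+ 2) Z.:* (a Z.:* u Z.:+ b Z.:* d) Z.:= a Z.:* (Z.con (+ 2) Z.:* u) Z.:+ b Z.:* (Z.con (+ 2) Z.:* d)) refl (+ α) (+ β) (+ up x) (+ dn x))
    (cong₂ (λ u d → + α ℤ.* u ℤ.+ + β ℤ.* d) (up-ℤ x) (dn-ℤ x)))
  where
  up dn : ℤ → ℕ
  up (+ k)    = tri (suc k)
  up -[1+ k ] = tri (suc k)
  dn (+ k)    = tri k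
  dn -[1+ k ] = tri (suc (suc k))
  expand : ∀ x → ex α β x ≡ α ℕ.* up x ℕ.+ β ℕ.* dn x
  expand (+ k)    = refl
  expand -[1+ k ] = refl
  neg : ∀ k → -[1+ k ] ≡ ℤ.- (+ k) ℤ.- + 1
  neg k = trans (cong (ℤ.-_) (trans (cong +_ (ℕₚ.+-comm 1 k)) (ℤₚ.pos-+ k 1))) (ℤₚ.neg-distrib-+ (+ k) (+ 1))
  up-ℤ : ∀ x → + 2 ℤ.* + up x ≡ x ℤ.* (x ℤ.+ + 1)
  up-ℤ (+ k)    = tri-ℤ k
  up-ℤ -[1+ k ] = trans (tri-ℤ k) (trans (Z.solve 1 (λ k → k Z.:* (k Z.:+ Z.con (+ 1)) Z.:= (Z.:- k Z.:- Z.con (+ 1)) Z.:* (Z.:- k Z.:- Z.con (+ 1) Z.:+ Z.con (+ 1))) refl (+ k))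
    (cong (λ z → z ℤ.* (z ℤ.+ + 1)) (sym (neg k))))
  dn-ℤ : ∀ x → + 2 ℤ.* + dn x ≡ x ℤ.* (x ℤ.- + 1)
  dn-ℤ (+ zero)  = refl
  dn-ℤ (+ suc k) = trans (tri-ℤ k) (trans (Z.solve 1 (λ k → k Z.:* (k Z.:+ Z.con (+ 1)) Z.:= (Z.con (+ 1) Z.:+ k) Z.:* ((Z.con (+ 1) Z.:+ k) Z.:- Z.con (+ 1))) refl (+ k))
    (cong (λ z → z ℤ.* (z ℤ.- + 1)) (sym (ℤₚ.pos-+ 1 k))))
  dn-ℤ -[1+ k ]  = trans (tri-ℤ (suc k)) (trans (cong (λ z → z ℤ.* (z ℤ.+ + 1)) (ℤₚ.pos-+ 1 k))
    (trans (Z.solve 1 (λ k → (Z.con (+ 1) Z.:+ k) Z.:* ((Z.con (+ 1) Z.:+ k) Z.:+ Z.con (+ 1)) Z.:= (Z.:- k Z.:- Z.con (+ 1)) Z.:* (Z.:- k Z.:- Z.con (+ 1) Z.:- Z.con (+ 1))) refl (+ k))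
      (cong (λ z → z ℤ.* (z ℤ.- + 1)) (sym (neg k)))))

tri-≤ : ∀ k → k ≤ tri (suc k)
tri-≤ k = ℕₚ.m≤n+m k (tri k)

ex-≥ : ∀ α β .{{_ : NonZero (α ℕ.+ β)}} x k → suc k < ℤ.∣ x ∣ → k < ex α β x
ex-≥ α β x k k<x = lemma x k<x
  where
  base : ∀ j → k ≤ j → k < (α ℕ.+ β) ℕ.* tri (suc (suc j))
  base j k≤j = ℕₚ.<-≤-trans (ℕₚ.≤-<-trans k≤j (ℕₚ.<-≤-trans (ℕₚ.n<1+n j) (tri-≤ (suc j)))) (ℕₚ.m≤n*m (tri (suc (suc j))) (α ℕ.+ β))
  lemma : ∀ x → suc k < ℤ.∣ x ∣ → k < ex α β x
  lemma (+ suc (suc j)) (s≤s (s≤s k≤j)) = ℕₚ.<-≤-trans (base j k≤j) (ℕₚ.≤-trans (ℕₚ.≤-reflexive (ℕₚ.*-distribʳ-+ (tri (suc (suc j))) α β))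
    (ℕₚ.+-monoˡ-≤ (β ℕ.* tri (suc (suc j))) (ℕₚ.*-monoʳ-≤ α (ℕₚ.m≤m+n (tri (suc (suc j))) (suc (suc j))))))
  lemma -[1+ suc j ] (s≤s (s≤s k≤j)) = ℕₚ.<-≤-trans (base j k≤j) (ℕₚ.≤-trans (ℕₚ.≤-reflexive (ℕₚ.*-distribʳ-+ (tri (suc (suc j))) α β))
    (ℕₚ.+-monoʳ-≤ (α ℕ.* tri (suc (suc j))) (ℕₚ.*-monoʳ-≤ β (ℕₚ.m≤m+n (tri (suc (suc j))) (suc (suc j))))))

epow : ℚ → ℕ → ℚ
epow ε zero    = 1ℚ
epow ε (suc k) = ε ℚ.* epow ε k

thetaFam : ℚ → ℕ → ℕ → ℤ → Series
thetaFam ε α β x = epow ε ℤ.∣ x ∣ · mono (ex α β x)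

bounded-mono : ∀ (c : ℤ → ℚ) (e : ℤ → ℕ) → (∀ x k → suc k < ℤ.∣ x ∣ → k < e x) → Bounded (λ x → c x · mono (e x))
bounded-mono c e k<e = bounded λ x k k<x → trans (cong (c x ℚ.*_) (shift-< (e x) oneS (k<e x k k<x))) (ℚₚ.*-zeroʳ (c x))

theta-bounded : ∀ ε α β .{{_ : NonZero (α ℕ.+ β)}} → Bounded (thetaFam ε α β)
theta-bounded ε α β = bounded-mono (λ x → epow ε ℤ.∣ x ∣) (ex α β) (ex-≥ α β)

theta : ℚ → ℕ → ℕ → Series
theta ε α β = seriesSum (fold (thetaFam ε α β))

theta-hasSum : ∀ ε α β .{{_ : NonZero (α ℕ.+ β)}} → HasSum (thetaFam ε α β) (theta ε α β)
theta-hasSum ε α β = hasSum-ℤ (theta-bounded ε α β)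

sumS-cong : ∀ N {F G : ℕ → Series} → (∀ k → F k ≋ G k) → sumS N F ≋ sumS N G
sumS-cong zero    e = e 0
sumS-cong (suc N) e = 𝕊.+-cong (sumS-cong N e) (e (suc N))

-- Jacobi's triple product as an identity of series.

module JacobiTripleProduct (ε : ℚ) (ε² : ε ℚ.* ε ≡ 1ℚ) (α β : ℕ) .{{_ : NonZero (α ℕ.+ β)}} where
  a = α ℕ.+ β
  x = const ε ⊛ mono α
  y = const ε ⊛ mono β
  open GaussLimit a
  open FiniteTripleProduct seriesRing (x ⊕ y) (mono a)
  module X = GaussCoefficients seriesRing x
  module Y = GaussCoefficients seriesRing y
  open ≋-Reasoning

  ε-ε : ∀ f g → (const ε ⊛ f) ⊛ (const ε ⊛ g) ≋ f ⊛ g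
  ε-ε f g = 𝕊.trans (solve 3 (λ c f g → (c :* f) :* (c :* g) := (c :* c) :* (f :* g)) 𝕊.refl (const ε) f g)
    (𝕊.trans (𝕊.*-congʳ {f ⊛ g} (𝕊.trans (𝕊.sym (const-* ε ε)) (𝕊.trans (const-cong ε²) (coeffwise λ n → ℚₚ.*-identityˡ (oneS n))))) (𝕊.*-identityˡ (f ⊛ g)))

  w≋ : mono a ≋ x ⊛ y
  w≋ = 𝕊.sym (𝕊.trans (ε-ε (mono α) (mono β)) (mono-+ α β))

  const-pw : ∀ γ k → GaussCoefficients.pw seriesRing (const ε ⊛ mono γ) k ≋ const (epow ε k) ⊛ mono (γ ℕ.* k)
  const-pw γ zero    = 𝕊.sym (𝕊.trans (𝕊.*-cong (coeffwise λ n → ℚₚ.*-identityˡ (oneS n)) (mono-cong (ℕₚ.*-zeroʳ γ))) (𝕊.*-identityˡ oneS))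
  const-pw γ (suc k) = begin
    (const ε ⊛ mono γ) ⊛ GaussCoefficients.pw seriesRing (const ε ⊛ mono γ) k   ≈⟨ 𝕊.*-congˡ {const ε ⊛ mono γ} (const-pw γ k) ⟩
    (const ε ⊛ mono γ) ⊛ (const (epow ε k) ⊛ mono (γ ℕ.* k))                    ≈⟨ solve 4 (λ c m d n → (c :* m) :* (d :* n) := (c :* d) :* (m :* n)) 𝕊.refl (const ε) (mono γ) (const (epow ε k)) (mono (γ ℕ.* k)) ⟩
    (const ε ⊛ const (epow ε k)) ⊛ (mono γ ⊛ mono (γ ℕ.* k))                    ≈⟨ 𝕊.*-cong (𝕊.sym (const-* ε (epow ε k))) (𝕊.trans (mono-+ γ (γ ℕ.* k)) (mono-cong (sym (ℕₚ.*-suc γ k)))) ⟩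
    const (epow ε (suc k)) ⊛ mono (γ ℕ.* suc k)                                 ∎

  triPower≋ : ∀ k → triPower k ≋ mono (a ℕ.* tri k)
  triPower≋ zero    = mono-cong (sym (ℕₚ.*-zeroʳ a))
  triPower≋ (suc k) = 𝕊.trans (𝕊.*-cong (triPower≋ k) (pw≋ k)) (𝕊.trans (mono-+ (a ℕ.* tri k) (a ℕ.* k)) (mono-cong (sym (ℕₚ.*-distribˡ-+ a (tri k) k))))

  F = thetaFam ε α β

  term≋ : ∀ k → term (suc k) ≋ fold F (suc k)
  term≋ k = begin
    triPower (suc k) ⊛ powerSum (suc k)
      ≈⟨ 𝕊.*-cong (triPower≋ (suc k)) (𝕊.trans (powerSum-split x y 𝕊.refl w≋ (suc k)) (𝕊.+-cong (const-pw α (suc k)) (const-pw β (suc k)))) ⟩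
    mono (a ℕ.* tri (suc k)) ⊛ (const e ⊛ mono (α ℕ.* suc k) ⊕ const e ⊛ mono (β ℕ.* suc k))
      ≈⟨ solve 4 (λ m c u v → m :* (c :* u :+ c :* v) := c :* (m :* u) :+ c :* (m :* v)) 𝕊.refl (mono (a ℕ.* tri (suc k))) (const e) (mono (α ℕ.* suc k)) (mono (β ℕ.* suc k)) ⟩
    const e ⊛ (mono (a ℕ.* tri (suc k)) ⊛ mono (α ℕ.* suc k)) ⊕ const e ⊛ (mono (a ℕ.* tri (suc k)) ⊛ mono (β ℕ.* suc k))
      ≈⟨ 𝕊.+-cong (𝕊.*-congˡ {const e} (𝕊.trans (mono-+ (a ℕ.* tri (suc k)) (α ℕ.* suc k)) (mono-cong pos)))
                  (𝕊.*-congˡ {const e} (𝕊.trans (mono-+ (a ℕ.* tri (suc k)) (β ℕ.* suc k)) (mono-cong neg))) ⟩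
    const e ⊛ mono (ex α β (+ suc k)) ⊕ const e ⊛ mono (ex α β -[1+ k ])
      ≈⟨ 𝕊.+-cong (𝕊.sym (·-const e (mono (ex α β (+ suc k))))) (𝕊.sym (·-const e (mono (ex α β -[1+ k ])))) ⟩
    fold F (suc k) ∎
    where
    e = epow ε (suc k)
    pos : a ℕ.* tri (suc k) ℕ.+ α ℕ.* suc k ≡ ex α β (+ suc k)
    pos = ℕS.solve 4 (λ α β t k → (α ℕS.:+ β) ℕS.:* t ℕS.:+ α ℕS.:* k ℕS.:= α ℕS.:* (t ℕS.:+ k) ℕS.:+ β ℕS.:* t) refl α β (tri (suc k)) (suc k)
    neg : a ℕ.* tri (suc k) ℕ.+ β ℕ.* suc k ≡ ex α β -[1+ k ]
    neg = ℕS.solve 4 (λ α β t k → (α ℕS.:+ β) ℕS.:* t ℕS.:+ β ℕS.:* k ℕS.:= α ℕS.:* t ℕS.:+ β ℕS.:* (t ℕS.:+ k)) refl α β (tri (suc k)) (suc k)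

  fold-0 : fold F 0 ≋ oneS
  fold-0 = 𝕊.trans (coeffwise λ n → ℚₚ.*-identityˡ (mono (ex α β (+ 0)) n)) (mono-cong (cong₂ ℕ._+_ (ℕₚ.*-zeroʳ α) (ℕₚ.*-zeroʳ β)))

  sumR≋sumS : ∀ N f → sumR N f ≋ sumS N f
  sumR≋sumS zero    f = 𝕊.refl
  sumR≋sumS (suc N) f = 𝕊.+-congʳ {f (suc N)} (sumR≋sumS N f)

  partial≋ : ∀ N → partial N ≋ weighted (fold F) N
  partial≋ N = 𝕊.+-cong (𝕊.sym (𝕊.trans (𝕊.*-congˡ {gauss N 0} fold-0) (𝕊.*-identityʳ (gauss N 0))))
    (𝕊.trans (sumR≋sumS N _) (sumS-cong N λ k → 𝕊.*-congˡ {gauss N (suc k)} (term≋ k)))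

  factor : ℕ → ℕ → Series
  factor γ m = oneS ⊕ const ε ⊛ mono (γ ℕ.+ a ℕ.* (m ∸ 1))

  prodR≋ : ∀ N → prodR N ≋ prodUpTo (factor α) N ⊛ prodUpTo (factor β) N
  prodR≋ zero    = 𝕊.sym (𝕊.*-identityˡ oneS)
  prodR≋ (suc N) = 𝕊.trans (𝕊.*-cong (prodR≋ N) step)
    (solve 4 (λ a b c d → (a :* b) :* (c :* d) := (a :* c) :* (b :* d)) 𝕊.refl (prodUpTo (factor α) N) (prodUpTo (factor β) N) (factor α (suc N)) (factor β (suc N)))
    where
    u = const ε ⊛ mono (α ℕ.+ a ℕ.* N)
    v = const ε ⊛ mono (β ℕ.+ a ℕ.* N)
    part : ∀ γ → (const ε ⊛ mono γ) ⊛ pw N ≋ const ε ⊛ mono (γ ℕ.+ a ℕ.* N)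
    part γ = 𝕊.trans (𝕊.*-assoc (const ε) (mono γ) (pw N)) (𝕊.*-congˡ {const ε} (𝕊.trans (𝕊.*-congˡ {mono γ} (pw≋ N)) (mono-+ γ (a ℕ.* N))))
    step : oneS ⊕ (x ⊕ y) ⊛ pw N ⊕ pw (N ℕ.+ suc N) ≋ (oneS ⊕ u) ⊛ (oneS ⊕ v)
    step = begin
      oneS ⊕ (x ⊕ y) ⊛ pw N ⊕ pw (N ℕ.+ suc N)
        ≈⟨ 𝕊.+-cong (𝕊.+-congˡ {oneS} (𝕊.trans (𝕊.distribʳ (pw N) x y) (𝕊.+-cong (part α) (part β))))
             (𝕊.trans (pw≋ (N ℕ.+ suc N)) (𝕊.sym (𝕊.trans (ε-ε (mono (α ℕ.+ a ℕ.* N)) (mono (β ℕ.+ a ℕ.* N))) (𝕊.trans (mono-+ (α ℕ.+ a ℕ.* N) (β ℕ.+ a ℕ.* N)) (mono-cong expo))))) ⟩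
      oneS ⊕ (u ⊕ v) ⊕ u ⊛ v
        ≈⟨ solve 2 (λ u v → con (+ 1) :+ (u :+ v) :+ u :* v := (con (+ 1) :+ u) :* (con (+ 1) :+ v)) 𝕊.refl u v ⟩
      (oneS ⊕ u) ⊛ (oneS ⊕ v) ∎
      where
      expo : α ℕ.+ a ℕ.* N ℕ.+ (β ℕ.+ a ℕ.* N) ≡ a ℕ.* (N ℕ.+ suc N)
      expo = ℕS.solve 3 (λ α β N → α ℕS.:+ (α ℕS.:+ β) ℕS.:* N ℕS.:+ (β ℕS.:+ (α ℕS.:+ β) ℕS.:* N) ℕS.:= (α ℕS.:+ β) ℕS.:* (N ℕS.:+ (ℕS.con 1 ℕS.:+ N))) refl α β N

  -- Kept as a limit so that β = 0 is covered: there the first factor is 1 + ε, not congruent to 1,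
  -- and `infProd` is not the right description of the β-product.
  jacobi-conv : Conv (λ N → euler a ⊛ (prodUpTo (factor α) N ⊛ prodUpTo (factor β) N)) (theta ε α β)
  jacobi-conv = conv-cong (λ N → 𝕊.*-congˡ {euler a} (𝕊.trans (𝕊.sym (partial≋ N)) (𝕊.trans (𝕊.sym (triple N)) (prodR≋ N))))
    (weighted-conv (fold-summable (theta-bounded ε α β)))

  unital-factor : ∀ γ .{{_ : NonZero γ}} → Unital (factor γ)
  unital-factor γ .≈one m = 𝕋.trans m (𝕋.+-congˡ m {oneS} (𝕋.trans m (𝕋.*-congˡ m {const ε} (shift-≈0 oneS large)) (𝕋.zeroʳ m (const ε)))) (𝕋.+-identityʳ m oneS)
    where
    large : m < γ ℕ.+ a ℕ.* m
    large = ℕₚ.+-mono-≤ (ℕ.>-nonZero⁻¹ γ) (ℕₚ.m≤n*m m a)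

  jacobi : .{{_ : NonZero α}} .{{_ : NonZero β}} → theta ε α β ≋ euler a ⊛ (infProd (factor α) ⊛ infProd (factor β))
  jacobi = conv-unique jacobi-conv (conv-⊛ (conv-const (euler a)) (conv-⊛ (infProd-conv (unital-factor α)) (infProd-conv (unital-factor β))))

-- φ as a theta series.

ex-square : ∀ x → + ex 1 1 x ≡ x ℤ.* x
ex-square x = ℤₚ.*-cancelˡ-≡ (+ 2) (+ ex 1 1 x) (x ℤ.* x) (trans (ex-ℤ 1 1 x)
  (Z.solve 1 (λ x → Z.con (+ 1) Z.:* (x Z.:* (x Z.:+ Z.con (+ 1))) Z.:+ Z.con (+ 1) Z.:* (x Z.:* (x Z.:- Z.con (+ 1))) Z.:= Z.con (+ 2) Z.:* (x Z.:* x)) refl x))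

epow-1 : ∀ k → epow 1ℚ k ≡ 1ℚ
epow-1 zero    = refl
epow-1 (suc k) = trans (ℚₚ.*-identityˡ (epow 1ℚ k)) (epow-1 k)

thetaFam-1 : ∀ α β x → thetaFam 1ℚ α β x ≋ mono (ex α β x)
thetaFam-1 α β x = coeffwise λ n → trans (cong (ℚ._* mono (ex α β x) n) (epow-1 ℤ.∣ x ∣)) (ℚₚ.*-identityˡ (mono (ex α β x) n))

range : ℕ → List ℕ
range zero    = 0 ∷ []
range (suc n) = suc n ∷ range n

range-≤ : ∀ n {i} → i ∈ range n → i ≤ n
range-≤ zero    (here refl) = z≤n
range-≤ (suc n) (here refl) = ℕₚ.≤-refl
range-≤ (suc n) (there i∈)  = ℕₚ.m≤n⇒m≤1+n (range-≤ n i∈)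

range-unique : ∀ n → Unique (range n)
range-unique zero    = [] ∷ []
range-unique (suc n) = (All.tabulate λ { i∈ refl → ℕₚ.<-irrefl refl (range-≤ n i∈) }) ∷ range-unique n

∈-range : ∀ n i → i ≤ n → i ∈ range n
∈-range zero    zero z≤n = here refl
∈-range (suc n) i    i≤n with i ℕ.≟ suc n
... | yes refl = here refl
... | no  i≢n  = there (∈-range n i (ℕ.s≤s⁻¹ (ℕₚ.≤∧≢⇒< i≤n i≢n)))

sumTo-range : ∀ n f → sumTo n f ≡ sumL (range n) f
sumTo-range zero    f = sym (ℚₚ.+-identityʳ (f 0))
sumTo-range (suc n) f = trans (ℚₚ.+-comm (sumTo n f) (f (suc n))) (cong (f (suc n) ℚ.+_) (sumTo-range n f))

-- The summand of φ n involves a local function; unification against φ n gives it a name.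
summand : ∀ {N} {h : ℕ → ℚ} (x : ℚ) → x ≡ sumTo N h → ℕ → ℚ
summand {h = h} _ _ = h

φ-summand : ℕ → ℕ → ℚ
φ-summand n = summand {2 ℕ.* n} (φ n) refl

-- A solution of x² = n satisfies |x| ≤ n, so the finite window in the definition of φ misses no
-- term of the sum over ℤ.
φ≋theta : φ ≋ theta 1ℚ 1 1
φ≋theta = coeffwise λ n → trans (sumTo-cong (2 ℕ.* n) (indicator n)) (trans (sumTo-range (2 ℕ.* n) (λ j → f n (centre n j)))
  (trans (sym (sumL-map (centre n) (range (2 ℕ.* n)) (f n))) (compare n)))
  where
  centre : ℕ → ℕ → ℤ
  centre n j = + j ℤ.- + n
  uncentre : ∀ n j → centre n j ℤ.+ + n ≡ + j
  uncentre n j = Z.solve 2 (λ j n → j Z.:- n Z.:+ n Z.:= j) refl (+ j) (+ n)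
  centre-injective : ∀ n i j → centre n i ≡ centre n j → i ≡ j
  centre-injective n i j p = ℤₚ.+-injective (trans (sym (uncentre n i)) (trans (cong (ℤ._+ + n) p) (uncentre n j)))
  f : ℕ → ℤ → ℚ
  f n x = thetaFam 1ℚ 1 1 x n
  f-yes : ∀ n x → x ℤ.* x ≡ + n → f n x ≡ 1ℚ
  f-yes n x e = trans (thetaFam-1 1 1 x .coeff n) (trans (cong (λ k → mono k n) (ℤₚ.+-injective (trans (ex-square x) e))) (mono-≡ n))
  f-no : ∀ n x → x ℤ.* x ≢ + n → f n x ≡ 0ℚ
  f-no n x ne = trans (thetaFam-1 1 1 x .coeff n) (mono-≢ (ex 1 1 x) n λ e → ne (trans (sym (ex-square x)) (cong +_ e)))
  indicator : ∀ n j → φ-summand n j ≡ f n (centre n j)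
  indicator n j with centre n j ℤ.* centre n j ℤ.≟ + n
  ... | yes e = sym (f-yes n (centre n j) e)
  ... | no ne = sym (f-no n (centre n j) ne)
  compare : ∀ n → sumL (map (centre n) (range (2 ℕ.* n))) (f n) ≡ theta 1ℚ 1 1 n
  compare n = trans (sumL-support (f n) (map (centre n) (range (2 ℕ.* n))) (e .list)
      (Uniq.map⁺ (λ {i} {j} p → centre-injective n i j p) (range-unique (2 ℕ.* n))) (e .unique)
      (λ x _ → e .support x n ℕₚ.≤-refl) inside) (e .total n ℕₚ.≤-refl)
    where
    open Enumeration
    e = HasSum.enum (theta-hasSum 1ℚ 1 1) n
    n≤n² : ∀ m → m ≤ m ℕ.* m
    n≤n² zero    = z≤n
    n≤n² (suc m) = ℕₚ.m≤m+n (suc m) (m ℕ.* suc m)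
    inside : ∀ x → x ∈ e .list → f n x ≢ 0ℚ → x ∈ map (centre n) (range (2 ℕ.* n))
    inside x _ ≢0 with x ℤ.* x ℤ.≟ + n
    ... | no ne = contradiction (f-no n x ne) ≢0
    ... | yes q = subst (_∈ map (centre n) (range (2 ℕ.* n))) back (∈-map⁺ (centre n) (∈-range (2 ℕ.* n) j j≤))
      where
      ∣x∣≤n : ℤ.∣ x ∣ ≤ n
      ∣x∣≤n = ℕₚ.≤-trans (n≤n² ℤ.∣ x ∣) (ℕₚ.≤-reflexive (trans (sym (ℤₚ.abs-* x x)) (cong ℤ.∣_∣ q)))
      j : ℕ
      j = ℤ.∣ x ℤ.+ + n ∣
      j≤ : j ≤ 2 ℕ.* n
      j≤ = ℕₚ.≤-trans (ℤₚ.∣i+j∣≤∣i∣+∣j∣ x (+ n)) (ℕₚ.≤-trans (ℕₚ.+-monoˡ-≤ n ∣x∣≤n) (ℕₚ.≤-reflexive (cong (n ℕ.+_) (sym (ℕₚ.+-identityʳ n)))))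
      nonneg : ∀ x → ℤ.∣ x ∣ ≤ n → + 0 ℤ.≤ x ℤ.+ + n
      nonneg (+ k)    _ = ℤ.+≤+ z≤n
      nonneg -[1+ k ] p = subst (+ 0 ℤ.≤_) (sym (ℤₚ.⊖-≥ p)) (ℤ.+≤+ z≤n)
      back : centre n j ≡ x
      back = trans (cong (ℤ._- + n) (ℤₚ.0≤i⇒+∣i∣≡i (nonneg x ∣x∣≤n))) (Z.solve 2 (λ x n → x Z.:+ n Z.:- n Z.:= x) refl x (+ n))

φ-hasSum : HasSum (thetaFam 1ℚ 1 1) φ
φ-hasSum = hasSum-lim (𝕊.sym φ≋theta) (theta-hasSum 1ℚ 1 1)

-- Product formulas

odd : ℕ → ℕ
odd m = suc ((m ∸ 1) ℕ.* 2)

O o : Series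
O = infProd (λ m → oneS ⊕ mono (odd m))
o = infProd (λ m → oneS ⊕ ⊖ mono (odd m))

m<odd : ∀ m → m < odd (suc m)
m<odd m = s≤s (ℕₚ.m≤m*n m 2)

unital-O : Unital (λ m → oneS ⊕ mono (odd m))
unital-O = unital-⊕mono odd m<odd

unital-o : Unital (λ m → oneS ⊕ ⊖ mono (odd m))
unital-o = unital-⊖mono odd m<odd

const-1 : ∀ f → const 1ℚ ⊛ f ≋ f
const-1 f = 𝕊.trans (𝕊.sym (·-const 1ℚ f)) (coeffwise λ n → ℚₚ.*-identityˡ (f n))

const-neg-1 : ∀ f → const (ℚ.- 1ℚ) ⊛ f ≋ ⊖ f
const-neg-1 f = 𝕊.trans (𝕊.sym (·-const (ℚ.- 1ℚ) f)) (coeffwise λ n → trans (sym (ℚₚ.neg-distribˡ-* 1ℚ (f n))) (cong ℚ.-_ (ℚₚ.*-identityˡ (f n))))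

plus : ∀ {a b} → a ≡ b → oneS ⊕ const 1ℚ ⊛ mono a ≋ oneS ⊕ mono b
plus {a} refl = 𝕊.+-congˡ {oneS} (const-1 (mono a))

minus : ∀ {a b} → a ≡ b → oneS ⊕ const (ℚ.- 1ℚ) ⊛ mono a ≋ oneS ⊕ ⊖ mono b
minus {a} refl = 𝕊.+-congˡ {oneS} (const-neg-1 (mono a))

plain : ∀ {a b} → a ≡ b → oneS ⊕ ⊖ mono a ≋ oneS ⊕ ⊖ mono b
plain refl = 𝕊.refl

φ≋ : φ ≋ euler 2 ⊛ (O ⊛ O)
φ≋ = 𝕊.trans φ≋theta (𝕊.trans jacobi (𝕊.*-congˡ {euler 2} (𝕊.*-cong eq eq)))
  where
  open JacobiTripleProduct 1ℚ refl 1 1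
  eq : infProd (factor 1) ≋ O
  eq = infProd-cong λ m → plus (cong suc (ℕₚ.*-comm 2 m))

difference-of-squares : ∀ e → (oneS ⊕ mono e) ⊛ (oneS ⊕ ⊖ mono e) ≋ oneS ⊕ ⊖ mono (2 ℕ.* e)
difference-of-squares e = 𝕊.trans (solve 1 (λ x → (con (+ 1) :+ x) :* (con (+ 1) :+ :- x) := con (+ 1) :+ :- (x :* x)) 𝕊.refl (mono e))
  (𝕊.+-congˡ {oneS} (𝕊.-‿cong (𝕊.trans (mono-+ e e) (mono-cong (cong (e ℕ.+_) (sym (ℕₚ.+-identityʳ e)))))))

O⊛o : O ⊛ o ≋ sub 2 o
O⊛o = begin
  O ⊛ o                                                                            ≈⟨ 𝕊.sym (infProd-⊛ unital-O unital-o) ⟩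
  infProd (λ m → (oneS ⊕ mono (odd m)) ⊛ (oneS ⊕ ⊖ mono (odd m)))                  ≈⟨ infProd-cong (λ m → eq (suc m)) ⟩
  infProd (λ m → sub 2 (oneS ⊕ ⊖ mono (odd m)))                                    ≈⟨ 𝕊.sym (infProd-sub 2 unital-o (unital-cong (λ m → eq (suc m)) (unital-⊛ unital-O unital-o))) ⟩
  sub 2 o                                                                          ∎
  where
  open ≋-Reasoning
  eq : ∀ m → (oneS ⊕ mono (odd m)) ⊛ (oneS ⊕ ⊖ mono (odd m)) ≋ sub 2 (oneS ⊕ ⊖ mono (odd m))
  eq m = 𝕊.trans (difference-of-squares (odd m)) (𝕊.sym (sub-1-mono 2 (odd m)))

prodBelow-2 : ∀ H → prodBelow H 2 ≋ H 0 ⊛ H 1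
prodBelow-2 H = 𝕊.*-congʳ {H 1} (𝕊.*-identityˡ (H 0))

prodBelow-3 : ∀ H → prodBelow H 3 ≋ H 0 ⊛ H 1 ⊛ H 2
prodBelow-3 H = 𝕊.*-congʳ {H 2} (prodBelow-2 H)

prodBelow-5 : ∀ H → prodBelow H 5 ≋ H 0 ⊛ H 1 ⊛ H 2 ⊛ H 3 ⊛ H 4
prodBelow-5 H = 𝕊.*-congʳ {H 4} (𝕊.*-congʳ {H 3} (prodBelow-3 H))

o⊛euler₂ : o ⊛ euler 2 ≋ euler 1
o⊛euler₂ = 𝕊.sym (𝕊.trans (infProd-stride (unital-euler 1) 2) (𝕊.trans (prodBelow-2 H)
  (𝕊.*-cong {H 0} {o} {H 1} (infProd-cong λ m → plain (ℕₚ.*-identityˡ (odd (suc m))))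
            (infProd-cong λ m → plain (trans (ℕₚ.*-identityˡ (stride 2 1 (suc m))) (ℕₚ.*-comm (suc m) 2))))))
  where
  H : ℕ → Series
  H j = infProd (λ m → oneS ⊕ ⊖ mono (1 ℕ.* stride 2 j m))

alt-O : alt O ≋ o
alt-O = 𝕊.trans (infProd-alt unital-O (unital-cong (λ m → 𝕊.sym (eq (suc m))) unital-o)) (infProd-cong λ m → eq (suc m))
  where
  sgn-odd : ∀ m → sgn (odd m) ≡ ℚ.- 1ℚ
  sgn-odd m = cong ℚ.-_ (even (m ∸ 1))
    where
    neg-neg : ∀ x → ℚ.- (ℚ.- x) ≡ x
    neg-neg = Q.solve 1 (λ x → Q.:- (Q.:- x) Q.:= x) refl
    even : ∀ k → sgn (k ℕ.* 2) ≡ 1ℚ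
    even zero    = refl
    even (suc k) = trans (neg-neg (sgn (k ℕ.* 2))) (even k)
  eq : ∀ m → alt (oneS ⊕ mono (odd m)) ≋ oneS ⊕ ⊖ mono (odd m)
  eq m = 𝕊.trans (alt-⊕ oneS (mono (odd m))) (𝕊.+-cong alt-one (𝕊.trans (alt-mono (odd m)) (𝕊.trans (𝕊.*-congʳ {mono (odd m)} (const-cong (sgn-odd m))) (const-neg-1 (mono (odd m))))))

alt-euler₂ : alt (euler 2) ≋ euler 2
alt-euler₂ = 𝕊.trans (alt-cong (𝕊.sym (sub-euler 2 1))) (𝕊.trans (alt-sub₂ (euler 1)) (sub-euler 2 1))

altφ≋ : alt φ ≋ euler 2 ⊛ (o ⊛ o)
altφ≋ = 𝕊.trans (alt-cong φ≋) (𝕊.trans (alt-⊛ (euler 2) (O ⊛ O)) (𝕊.*-cong alt-euler₂ (𝕊.trans (alt-⊛ O O) (𝕊.*-cong alt-O alt-O))))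

E₄ : Series
E₄ = infProd (λ m → oneS ⊕ mono (4 ℕ.* m))

unital-E₄ : Unital (λ m → oneS ⊕ mono (4 ℕ.* m))
unital-E₄ = unital-⊕mono (4 ℕ.*_) λ m → ℕₚ.m≤n*m (suc m) 4

-- The product form of ψ(q⁴) = Σ_{x ≥ 0} q^{2x(x+1)}.
ψ₄ : Series
ψ₄ = euler 4 ⊛ (E₄ ⊛ E₄)

ψ₄⊛euler₄ : ψ₄ ⊛ euler 4 ≋ euler 8 ⊛ euler 8
ψ₄⊛euler₄ = 𝕊.trans (solve 2 (λ e E → e :* (E :* E) :* e := (E :* e) :* (E :* e)) 𝕊.refl (euler 4) E₄) (𝕊.*-cong eq eq)
  where
  eq : E₄ ⊛ euler 4 ≋ euler 8
  eq = 𝕊.trans (𝕊.sym (infProd-⊛ unital-E₄ (unital-euler 4))) (infProd-cong λ m → 𝕊.trans (difference-of-squares (4 ℕ.* suc m)) (plain (sym (ℕₚ.*-assoc 2 4 (suc m)))))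

-- The first factor of the β-product is 1 + q⁰ = 2 and the others repeat the α-product. The sequence
-- is taken from N + 1 on so that this doubling factor is always present.
theta-4-0 : theta 1ℚ 4 0 ≋ ψ₄ ⊕ ψ₄
theta-4-0 = conv-unique (conv-along suc (ℕₚ.n≤1+n) jacobi-conv)
  (conv-cong (λ N → 𝕊.sym (step N)) (conv-lim (solve 2 (λ e E → e :* (E :* (E :+ E)) := e :* (E :* E) :+ e :* (E :* E)) 𝕊.refl (euler 4) E₄)
    (conv-⊛ (conv-const (euler 4)) (conv-⊛ (conv-along suc ℕₚ.n≤1+n (infProd-conv unital-E₄)) (conv-⊕ (infProd-conv unital-E₄) (infProd-conv unital-E₄))))))
  where
  open JacobiTripleProduct 1ℚ refl 4 0
  P : ℕ → Series
  P = prodUpTo (λ m → oneS ⊕ mono (4 ℕ.* m))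
  left : ∀ N → prodUpTo (factor 4) N ≋ P N
  left = prodUpTo-cong λ m → plus (sym (ℕₚ.*-suc 4 m))
  right : ∀ N → prodUpTo (factor 0) (suc N) ≋ P N ⊕ P N
  right zero    = 𝕊.trans (𝕊.*-identityˡ (factor 0 1)) (plus {0} refl)
  right (suc N) = 𝕊.trans (𝕊.*-cong (right N) (plus {4 ℕ.* suc N} refl)) (𝕊.distribʳ (oneS ⊕ mono (4 ℕ.* suc N)) (P N) (P N))
  step : ∀ N → euler 4 ⊛ (prodUpTo (factor 4) (suc N) ⊛ prodUpTo (factor 0) (suc N)) ≋ euler 4 ⊛ (P (suc N) ⊛ (P N ⊕ P N))
  step N = 𝕊.*-congˡ {euler 4} (𝕊.*-cong (left (suc N)) (right N))

-- Euler's pentagonal number theorem at q²: the exponents congruent to 2, 4 and 0 modulo 6 exhaust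
-- the even numbers.
pentagonal : theta (ℚ.- 1ℚ) 4 2 ≋ euler 2
pentagonal = begin
  theta (ℚ.- 1ℚ) 4 2                                       ≈⟨ jacobi ⟩
  euler 6 ⊛ (infProd (factor 4) ⊛ infProd (factor 2))      ≈⟨ solve 3 (λ a b c → a :* (b :* c) := c :* b :* a) 𝕊.refl (euler 6) (infProd (factor 4)) (infProd (factor 2)) ⟩
  infProd (factor 2) ⊛ infProd (factor 4) ⊛ euler 6        ≈⟨ 𝕊.*-cong (𝕊.*-cong (infProd-cong λ m → minus (e 0 m)) (infProd-cong λ m → minus (e 1 m))) (infProd-cong λ m → plain (trans (ℕₚ.*-suc 6 m) (e 2 m))) ⟩
  H 0 ⊛ H 1 ⊛ H 2                                          ≈⟨ 𝕊.sym (𝕊.trans (infProd-stride (unital-euler 2) 3) (prodBelow-3 H)) ⟩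
  euler 2                                                  ∎
  where
  open JacobiTripleProduct (ℚ.- 1ℚ) refl 4 2
  open ≋-Reasoning
  H : ℕ → Series
  H j = infProd (λ m → oneS ⊕ ⊖ mono (2 ℕ.* stride 3 j m))
  e : ∀ j m → 2 ℕ.+ 2 ℕ.* j ℕ.+ 6 ℕ.* m ≡ 2 ℕ.* suc (j ℕ.+ m ℕ.* 3)
  e = ℕS.solve 2 (λ j m → ℕS.con 2 ℕS.:+ ℕS.con 2 ℕS.:* j ℕS.:+ ℕS.con 6 ℕS.:* m ℕS.:= ℕS.con 2 ℕS.:* (ℕS.con 1 ℕS.:+ (j ℕS.:+ m ℕS.:* ℕS.con 3))) refl

O₅ : Series
O₅ = sub 5 O

sub₅-factor : ∀ m → sub 5 (oneS ⊕ mono (odd m)) ≋ oneS ⊕ mono (5 ℕ.* odd m)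
sub₅-factor m = 𝕊.trans (sub-⊕ 5 oneS (mono (odd m))) (𝕊.+-cong (sub-one 5) (sub-mono 5 (odd m)))

unital-O₅ : Unital (λ m → sub 5 (oneS ⊕ mono (odd m)))
unital-O₅ = unital-cong (λ m → 𝕊.sym (sub₅-factor (suc m))) (unital-⊕mono (λ m → 5 ℕ.* odd m) λ m → ℕₚ.<-≤-trans (m<odd m) (ℕₚ.m≤n*m (odd (suc m)) 5))

O₅≋ : O₅ ≋ infProd (λ m → sub 5 (oneS ⊕ mono (odd m)))
O₅≋ = infProd-sub 5 unital-O unital-O₅

-- The two theta series supply the exponents congruent to 1, 9, 3 and 7 modulo 10, and `O₅` those
-- congruent to 5; together these are all odd exponents.
theta-9-1-7-3 : theta 1ℚ 9 1 ⊛ theta 1ℚ 7 3 ⊛ O₅ ≋ euler 10 ⊛ euler 10 ⊛ O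
theta-9-1-7-3 = begin
  theta 1ℚ 9 1 ⊛ theta 1ℚ 7 3 ⊛ O₅
    ≈⟨ 𝕊.*-cong (𝕊.*-cong A.jacobi B.jacobi) O₅≋ ⟩
  (e ⊛ (infProd (A.factor 9) ⊛ infProd (A.factor 1))) ⊛ (e ⊛ (infProd (B.factor 7) ⊛ infProd (B.factor 3))) ⊛ infProd (λ m → sub 5 (oneS ⊕ mono (odd m)))
    ≈⟨ 𝕊.*-cong (𝕊.*-cong (𝕊.*-congˡ {e} (𝕊.*-cong (infProd-cong λ m → plus (eq 4 m)) (infProd-cong λ m → plus (eq 0 m))))
                          (𝕊.*-congˡ {e} (𝕊.*-cong (infProd-cong λ m → plus (eq 3 m)) (infProd-cong λ m → plus (eq 1 m)))))
         (infProd-cong λ m → 𝕊.trans (sub₅-factor (suc m)) (𝕊.+-congˡ {oneS} (mono-cong (eq₅ m)))) ⟩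
  (e ⊛ (H 4 ⊛ H 0)) ⊛ (e ⊛ (H 3 ⊛ H 1)) ⊛ H 2
    ≈⟨ solve 6 (λ e a b c d f → (e :* (f :* a)) :* (e :* (d :* b)) :* c := e :* e :* (a :* b :* c :* d :* f)) 𝕊.refl e (H 0) (H 1) (H 2) (H 3) (H 4) ⟩
  e ⊛ e ⊛ (H 0 ⊛ H 1 ⊛ H 2 ⊛ H 3 ⊛ H 4)
    ≈⟨ 𝕊.*-congˡ {e ⊛ e} (𝕊.sym (𝕊.trans (infProd-stride unital-O 5) (prodBelow-5 H))) ⟩
  e ⊛ e ⊛ O ∎
  where
  open ≋-Reasoning
  module A = JacobiTripleProduct 1ℚ refl 9 1
  module B = JacobiTripleProduct 1ℚ refl 7 3
  e = euler 10
  H : ℕ → Series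
  H j = infProd (λ m → oneS ⊕ mono (odd (stride 5 j m)))
  eq : ∀ j m → 1 ℕ.+ 2 ℕ.* j ℕ.+ 10 ℕ.* m ≡ suc ((j ℕ.+ m ℕ.* 5) ℕ.* 2)
  eq = ℕS.solve 2 (λ j m → ℕS.con 1 ℕS.:+ ℕS.con 2 ℕS.:* j ℕS.:+ ℕS.con 10 ℕS.:* m ℕS.:= ℕS.con 1 ℕS.:+ (j ℕS.:+ m ℕS.:* ℕS.con 5) ℕS.:* ℕS.con 2) refl
  eq₅ : ∀ m → 5 ℕ.* suc (m ℕ.* 2) ≡ suc ((2 ℕ.+ m ℕ.* 5) ℕ.* 2)
  eq₅ = ℕS.solve 1 (λ m → ℕS.con 5 ℕS.:* (ℕS.con 1 ℕS.:+ m ℕS.:* ℕS.con 2) ℕS.:= ℕS.con 1 ℕS.:+ (ℕS.con 2 ℕS.:+ m ℕS.:* ℕS.con 5) ℕS.:* ℕS.con 2) refl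

-- The triple product at fifth roots of unity.

module GoldenTheta where
  open Golden seriesRing using (goldenRing; _⊠_; norm; norm-⊠)
  module 𝔾 = CommutativeRing goldenRing
  open GaussLimit 2

  ι : Series → Series × Series
  ι f = f , zeroS

  -- The parameters for α = ζq and β = ζ⁻¹q: the sum is τq and the product q².
  sᴳ wᴳ : Series × Series
  sᴳ = zeroS , mono 1
  wᴳ = ι (mono 2)

  module G = GaussCoefficients goldenRing wᴳ
  module F = FiniteTripleProduct goldenRing sᴳ wᴳ

  ι-⊕ : ∀ f g → ι (f ⊕ g) 𝔾.≈ ι f 𝔾.+ ι g
  ι-⊕ f g = 𝕊.refl , 𝕊.sym (𝕊.+-identityʳ zeroS)

  ι-⊠ : ∀ f (p : Series × Series) → ι f ⊠ p 𝔾.≈ (f ⊛ proj₁ p , f ⊛ proj₂ p)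
  ι-⊠ f (a , b) = solve 3 (λ f a b → f :* a :+ con (+ 0) :* b := f :* a) 𝕊.refl f a b
               , solve 3 (λ f a b → f :* b :+ con (+ 0) :* a :- con (+ 0) :* b := f :* b) 𝕊.refl f a b

  ι-⊛ : ∀ f g → ι f ⊠ ι g 𝔾.≈ ι (f ⊛ g)
  ι-⊛ f g = 𝔾.trans (ι-⊠ f (ι g)) (𝕊.refl , 𝕊.zeroʳ f)

  pw-ι : ∀ k → G.pw k 𝔾.≈ ι (pw k)
  pw-ι zero    = 𝔾.refl
  pw-ι (suc k) = 𝔾.trans (𝔾.*-congˡ {wᴳ} (pw-ι k)) (ι-⊛ (mono 2) (pw k))

  gauss-ι : ∀ N k → G.gauss N k 𝔾.≈ ι (gauss N k)
  gauss-ι zero    zero    = 𝔾.refl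
  gauss-ι zero    (suc k) = 𝔾.refl
  gauss-ι (suc N) zero    = 𝔾.trans (𝔾.+-cong
      (𝔾.trans (𝔾.*-cong (gauss-ι N 0) (one+pw (N ℕ.+ suc N))) (ι-⊛ (gauss N 0) (oneS ⊕ pw (N ℕ.+ suc N))))
      (𝔾.trans (𝔾.*-cong (𝔾.sym (ι-⊕ oneS oneS)) (𝔾.trans (𝔾.*-cong (pw-ι (suc N)) (gauss-ι N 1)) (ι-⊛ (pw (suc N)) (gauss N 1)))) (ι-⊛ (oneS ⊕ oneS) (pw (suc N) ⊛ gauss N 1))))
    (𝔾.sym (ι-⊕ (gauss N 0 ⊛ (oneS ⊕ pw (N ℕ.+ suc N))) ((oneS ⊕ oneS) ⊛ (pw (suc N) ⊛ gauss N 1))))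
    where
    one+pw : ∀ m → 𝔾.1# 𝔾.+ G.pw m 𝔾.≈ ι (oneS ⊕ pw m)
    one+pw m = 𝔾.trans (𝔾.+-congˡ {𝔾.1#} (pw-ι m)) (𝔾.sym (ι-⊕ oneS (pw m)))
  gauss-ι (suc N) (suc k) = 𝔾.trans (𝔾.+-cong (𝔾.trans (𝔾.+-cong
      (𝔾.trans (𝔾.*-cong (gauss-ι N (suc k)) (𝔾.trans (𝔾.+-congˡ {𝔾.1#} (pw-ι m)) (𝔾.sym (ι-⊕ oneS (pw m))))) (ι-⊛ (gauss N (suc k)) (oneS ⊕ pw m)))
      (times (N ∸ k) k)) (𝔾.sym (ι-⊕ (gauss N (suc k) ⊛ (oneS ⊕ pw m)) (pw (N ∸ k) ⊛ gauss N k)))) (times (suc (suc (N ℕ.+ k))) (suc (suc k))))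
    (𝔾.sym (ι-⊕ (gauss N (suc k) ⊛ (oneS ⊕ pw m) ⊕ pw (N ∸ k) ⊛ gauss N k) (pw (suc (suc (N ℕ.+ k))) ⊛ gauss N (suc (suc k)))))
    where
    m = N ℕ.+ suc N
    times : ∀ i j → G.pw i 𝔾.* G.gauss N j 𝔾.≈ ι (pw i ⊛ gauss N j)
    times i j = 𝔾.trans (𝔾.*-cong (pw-ι i) (gauss-ι N j)) (ι-⊛ (pw i) (gauss N j))

  -- ζ^k + ζ^{-k} = ga k + gb k τ, where ζ is a fifth root of unity with ζ + ζ⁻¹ = τ.
  ga gb : ℕ → ℚ
  ga zero          = 1ℚ ℚ.+ 1ℚ
  ga (suc zero)    = 0ℚ
  ga (suc (suc k)) = gb (suc k) ℚ.- ga k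
  gb zero          = 0ℚ
  gb (suc zero)    = 1ℚ
  gb (suc (suc k)) = ga (suc k) ℚ.- gb (suc k) ℚ.- gb k

  powerSum≈ : ∀ k → F.powerSum k 𝔾.≈ (const (ga k) ⊛ mono k , const (gb k) ⊛ mono k)
  powerSum≈ zero          = 𝕊.sym (𝕊.trans (𝕊.*-identityʳ (const (ga 0))) (coeffwise λ n → two (oneS n)))
                          , 𝕊.sym (𝕊.trans (𝕊.*-identityʳ (const 0ℚ)) (coeffwise λ n → ℚₚ.*-zeroˡ (oneS n)))
    where
    two : ∀ x → (1ℚ ℚ.+ 1ℚ) ℚ.* x ≡ x ℚ.+ x
    two x = trans (ℚₚ.*-distribʳ-+ x 1ℚ 1ℚ) (cong₂ ℚ._+_ (ℚₚ.*-identityˡ x) (ℚₚ.*-identityˡ x))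
  powerSum≈ (suc zero)    = 𝕊.sym (𝕊.trans (𝕊.sym (·-const 0ℚ (mono 1))) (coeffwise λ n → ℚₚ.*-zeroˡ (mono 1 n))) , 𝕊.sym (const-1 (mono 1))
  powerSum≈ (suc (suc k)) = 𝔾.trans (𝔾.+-cong {sᴳ ⊠ F.powerSum (suc k)} (𝔾.*-congˡ {sᴳ} (powerSum≈ (suc k))) (𝔾.-‿cong {wᴳ ⊠ F.powerSum k} (𝔾.trans (𝔾.*-congˡ {wᴳ} (powerSum≈ k)) (ι-⊠ (mono 2) (const (ga k) ⊛ mono k , const (gb k) ⊛ mono k)))))
      (first , second)
    where
    open ≋-Reasoning
    A = const (ga (suc k))
    B = const (gb (suc k))
    a = const (ga k)
    b = const (gb k)
    m₀ = mono k
    m₁ = mono (suc k)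
    m₂ = mono (suc (suc k))
    const-diff : ∀ c d → const (c ℚ.- d) ≋ const c ⊕ ⊖ const d
    const-diff c d = coeffwise λ n → Q.solve 3 (λ c d x → (c Q.:- d) Q.:* x Q.:= c Q.:* x Q.:+ Q.:- (d Q.:* x)) refl c d (oneS n)
    first : zeroS ⊛ (A ⊛ m₁) ⊕ mono 1 ⊛ (B ⊛ m₁) ⊕ ⊖ (mono 2 ⊛ (a ⊛ m₀)) ≋ const (gb (suc k) ℚ.- ga k) ⊛ m₂
    first = begin
      zeroS ⊛ (A ⊛ m₁) ⊕ mono 1 ⊛ (B ⊛ m₁) ⊕ ⊖ (mono 2 ⊛ (a ⊛ m₀))
        ≈⟨ solve 7 (λ A B a q q₂ m₁ m₀ → con (+ 0) :* (A :* m₁) :+ q :* (B :* m₁) :+ :- (q₂ :* (a :* m₀)) := B :* (q :* m₁) :+ :- a :* (q₂ :* m₀)) 𝕊.refl A B a (mono 1) (mono 2) m₁ m₀ ⟩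
      B ⊛ (mono 1 ⊛ m₁) ⊕ ⊖ a ⊛ (mono 2 ⊛ m₀)
        ≈⟨ 𝕊.+-cong (𝕊.*-congˡ {B} (mono-+ 1 (suc k))) (𝕊.*-congˡ {⊖ a} (mono-+ 2 k)) ⟩
      B ⊛ m₂ ⊕ ⊖ a ⊛ m₂
        ≈⟨ solve 3 (λ B a m → B :* m :+ :- a :* m := (B :- a) :* m) 𝕊.refl B a m₂ ⟩
      (B ⊕ ⊖ a) ⊛ m₂
        ≈⟨ 𝕊.*-congʳ {m₂} (𝕊.sym (const-diff (gb (suc k)) (ga k))) ⟩
      const (gb (suc k) ℚ.- ga k) ⊛ m₂ ∎
    second : zeroS ⊛ (B ⊛ m₁) ⊕ mono 1 ⊛ (A ⊛ m₁) ⊕ ⊖ (mono 1 ⊛ (B ⊛ m₁)) ⊕ ⊖ (mono 2 ⊛ (b ⊛ m₀)) ≋ const (ga (suc k) ℚ.- gb (suc k) ℚ.- gb k) ⊛ m₂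
    second = begin
      zeroS ⊛ (B ⊛ m₁) ⊕ mono 1 ⊛ (A ⊛ m₁) ⊕ ⊖ (mono 1 ⊛ (B ⊛ m₁)) ⊕ ⊖ (mono 2 ⊛ (b ⊛ m₀))
        ≈⟨ solve 7 (λ A B b q q₂ m₁ m₀ → con (+ 0) :* (B :* m₁) :+ q :* (A :* m₁) :+ :- (q :* (B :* m₁)) :+ :- (q₂ :* (b :* m₀)) := (A :- B) :* (q :* m₁) :+ :- b :* (q₂ :* m₀)) 𝕊.refl A B b (mono 1) (mono 2) m₁ m₀ ⟩
      (A ⊕ ⊖ B) ⊛ (mono 1 ⊛ m₁) ⊕ ⊖ b ⊛ (mono 2 ⊛ m₀)
        ≈⟨ 𝕊.+-cong (𝕊.*-congˡ {A ⊕ ⊖ B} (mono-+ 1 (suc k))) (𝕊.*-congˡ {⊖ b} (mono-+ 2 k)) ⟩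
      (A ⊕ ⊖ B) ⊛ m₂ ⊕ ⊖ b ⊛ m₂
        ≈⟨ solve 4 (λ A B b m → (A :- B) :* m :+ :- b :* m := (A :- B :- b) :* m) 𝕊.refl A B b m₂ ⟩
      (A ⊕ ⊖ B ⊕ ⊖ b) ⊛ m₂
        ≈⟨ 𝕊.*-congʳ {m₂} (𝕊.sym (𝕊.trans (const-diff (ga (suc k) ℚ.- gb (suc k)) (gb k)) (𝕊.+-congʳ {⊖ b} (const-diff (ga (suc k)) (gb (suc k)))))) ⟩
      const (ga (suc k) ℚ.- gb (suc k) ℚ.- gb k) ⊛ m₂ ∎

  triPower≈ : ∀ k → F.triPower k 𝔾.≈ ι (mono (2 ℕ.* tri k))
  triPower≈ zero    = 𝔾.refl
  triPower≈ (suc k) = 𝔾.trans (𝔾.*-cong (triPower≈ k) (𝔾.trans (pw-ι k) (pw≋ k , 𝕊.refl)))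
    (𝔾.trans (ι-⊛ (mono (2 ℕ.* tri k)) (mono (2 ℕ.* k))) (𝕊.trans (mono-+ (2 ℕ.* tri k) (2 ℕ.* k)) (mono-cong (sym (ℕₚ.*-distribˡ-+ 2 (tri k) k))) , 𝕊.refl))

  tri-square : ∀ k → 2 ℕ.* tri k ℕ.+ k ≡ k ℕ.* k
  tri-square zero    = refl
  tri-square (suc k) = trans (ℕS.solve 2 (λ t k → ℕS.con 2 ℕS.:* (t ℕS.:+ k) ℕS.:+ (ℕS.con 1 ℕS.:+ k) ℕS.:= (ℕS.con 2 ℕS.:* t ℕS.:+ k) ℕS.:+ (ℕS.con 1 ℕS.:+ (k ℕS.:+ k))) refl (tri k) k)
    (trans (cong (ℕ._+ suc (k ℕ.+ k)) (tri-square k)) (ℕS.solve 1 (λ k → k ℕS.:* k ℕS.:+ (ℕS.con 1 ℕS.:+ (k ℕS.:+ k)) ℕS.:= (ℕS.con 1 ℕS.:+ k) ℕS.:* (ℕS.con 1 ℕS.:+ k)) refl k))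

  term≈ : ∀ k → F.term k 𝔾.≈ (const (ga k) ⊛ mono (k ℕ.* k) , const (gb k) ⊛ mono (k ℕ.* k))
  term≈ k = 𝔾.trans (𝔾.*-cong (triPower≈ k) (powerSum≈ k)) (𝔾.trans (ι-⊠ (mono (2 ℕ.* tri k)) (const (ga k) ⊛ mono k , const (gb k) ⊛ mono k)) (part (ga k) , part (gb k)))
    where
    part : ∀ c → mono (2 ℕ.* tri k) ⊛ (const c ⊛ mono k) ≋ const c ⊛ mono (k ℕ.* k)
    part c = 𝕊.trans (solve 3 (λ m c n → m :* (c :* n) := c :* (m :* n)) 𝕊.refl (mono (2 ℕ.* tri k)) (const c) (mono k))
      (𝕊.*-congˡ {const c} (𝕊.trans (mono-+ (2 ℕ.* tri k) k) (mono-cong (tri-square k))))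

  -- Halved, because the sum over x ∈ ℤ meets each |x| > 0 twice.
  half : ℚ
  half = 1 // 2

  goldenFam : (ℕ → ℚ) → ℤ → Series
  goldenFam c x = (half ℚ.* c ℤ.∣ x ∣) · mono (ℤ.∣ x ∣ ℕ.* ℤ.∣ x ∣)

  golden-bounded : ∀ c → Bounded (goldenFam c)
  golden-bounded c = bounded-mono (λ x → half ℚ.* c ℤ.∣ x ∣) (λ x → ℤ.∣ x ∣ ℕ.* ℤ.∣ x ∣) λ x k k<x → large ℤ.∣ x ∣ k k<x
    where
    large : ∀ m k → suc k < m → k < m ℕ.* m
    large (suc m) k (s≤s k<m) = ℕₚ.<-≤-trans k<m (ℕₚ.≤-trans (ℕₚ.n≤1+n m) (ℕₚ.m≤m+n (suc m) (m ℕ.* suc m)))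

  Φ : (ℕ → ℚ) → Series
  Φ c = seriesSum (fold (goldenFam c))

  Φ-hasSum : ∀ c → HasSum (goldenFam c) (Φ c)
  Φ-hasSum c = hasSum-ℤ (golden-bounded c)

  fold-golden : ∀ c k → fold (goldenFam c) (suc k) ≋ const (c (suc k)) ⊛ mono (suc k ℕ.* suc k)
  fold-golden c k = 𝕊.trans (coeffwise λ n → double (c (suc k)) (mono (suc k ℕ.* suc k) n)) (·-const (c (suc k)) (mono (suc k ℕ.* suc k)))
    where
    double : ∀ c x → half ℚ.* c ℚ.* x ℚ.+ half ℚ.* c ℚ.* x ≡ c ℚ.* x
    double = Q.solve 2 (λ c x → Q.con half Q.:* c Q.:* x Q.:+ Q.con half Q.:* c Q.:* x Q.:= c Q.:* x) refl

  sumR-proj₁ : ∀ N f → proj₁ (F.sumR N f) ≋ sumS N (λ k → proj₁ (f k))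
  sumR-proj₁ zero    f = 𝕊.refl
  sumR-proj₁ (suc N) f = 𝕊.+-congʳ {proj₁ (f (suc N))} (sumR-proj₁ N f)

  sumR-proj₂ : ∀ N f → proj₂ (F.sumR N f) ≋ sumS N (λ k → proj₂ (f k))
  sumR-proj₂ zero    f = 𝕊.refl
  sumR-proj₂ (suc N) f = 𝕊.+-congʳ {proj₂ (f (suc N))} (sumR-proj₂ N f)

  summand≈ : ∀ N k → G.gauss N (suc k) 𝔾.* F.term (suc k) 𝔾.≈ (gauss N (suc k) ⊛ fold (goldenFam ga) (suc k) , gauss N (suc k) ⊛ fold (goldenFam gb) (suc k))
  summand≈ N k = 𝔾.trans (𝔾.*-cong (gauss-ι N (suc k)) (𝔾.trans (term≈ (suc k)) (𝕊.sym (fold-golden ga k) , 𝕊.sym (fold-golden gb k))))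
    (ι-⊠ (gauss N (suc k)) (fold (goldenFam ga) (suc k) , fold (goldenFam gb) (suc k)))

  prod₁ : ∀ N → proj₁ (F.prodR N) ≋ weighted (fold (goldenFam ga)) N
  prod₁ N = 𝕊.trans (proj₁ (F.triple N)) (𝕊.+-cong (𝕊.trans (proj₁ (gauss-ι N 0)) (𝕊.sym (𝕊.trans (𝕊.*-congˡ {gauss N 0} (coeffwise λ n → ℚₚ.*-identityˡ (oneS n))) (𝕊.*-identityʳ (gauss N 0)))))
    (𝕊.trans (sumR-proj₁ N _) (sumS-cong N λ k → proj₁ (summand≈ N k))))

  prod₂ : ∀ N → proj₂ (F.prodR N) ≋ weighted (fold (goldenFam gb)) N
  prod₂ N = 𝕊.trans (proj₂ (F.triple N)) (𝕊.+-cong (𝕊.trans (proj₂ (gauss-ι N 0)) (𝕊.sym (𝕊.trans (𝕊.*-congˡ {gauss N 0} (coeffwise λ n → ℚₚ.*-zeroˡ (oneS n))) (𝕊.zeroʳ (gauss N 0)))))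
    (𝕊.trans (sumR-proj₂ N _) (sumS-cong N λ k → proj₂ (summand≈ N k))))

  conv₁ : Conv (λ N → euler 2 ⊛ proj₁ (F.prodR N)) (Φ ga)
  conv₁ = conv-cong (λ N → 𝕊.*-congˡ {euler 2} (𝕊.sym (prod₁ N))) (weighted-conv (fold-summable (golden-bounded ga)))

  conv₂ : Conv (λ N → euler 2 ⊛ proj₂ (F.prodR N)) (Φ gb)
  conv₂ = conv-cong (λ N → 𝕊.*-congˡ {euler 2} (𝕊.sym (prod₂ N))) (weighted-conv (fold-summable (golden-bounded gb)))

  -- `Φ ga` + `Φ gb` τ is the sum of ζ^x q^(x²), and conjugation replaces ζ by ζ². Hence T is the
  -- sum of ζ^(x+2y) q^(x²+y²) over ℤ², the twisted sum of two squares.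
  T : Series
  T = norm (Φ ga , Φ gb)

  y : ℕ → Series
  y m = mono (odd m)

  ν : ℕ → Series
  ν m = norm (oneS ⊕ y m ⊛ y m , y m)

  norm-cong : ∀ {p r} → p 𝔾.≈ r → norm p ≋ norm r
  norm-cong (e , f) = 𝕊.+-cong (𝕊.+-cong (𝕊.*-cong e e) (𝕊.-‿cong (𝕊.*-cong e f))) (𝕊.-‿cong (𝕊.*-cong f f))

  factor≈ : ∀ N → 𝔾.1# 𝔾.+ sᴳ 𝔾.* G.pw N 𝔾.+ G.pw (N ℕ.+ suc N) 𝔾.≈ (oneS ⊕ y (suc N) ⊛ y (suc N) , y (suc N))
  factor≈ N = 𝔾.trans (𝔾.+-cong (𝔾.+-congˡ {𝔾.1#} (𝔾.*-congˡ {sᴳ} (𝔾.trans (pw-ι N) (pw≋ N , 𝕊.refl)))) (𝔾.trans (pw-ι (N ℕ.+ suc N)) (pw≋ (N ℕ.+ suc N) , 𝕊.refl)))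
    ( 𝕊.trans (solve 3 (λ m q w → con (+ 1) :+ (con (+ 0) :* m :+ q :* con (+ 0)) :+ w := con (+ 1) :+ w) 𝕊.refl m (mono 1) (mono (2 ℕ.* (N ℕ.+ suc N))))
        (𝕊.+-congˡ {oneS} (𝕊.sym (𝕊.trans (mono-+ (odd (suc N)) (odd (suc N))) (mono-cong (ℕS.solve 1 (λ N → (ℕS.con 1 ℕS.:+ N ℕS.:* ℕS.con 2) ℕS.:+ (ℕS.con 1 ℕS.:+ N ℕS.:* ℕS.con 2) ℕS.:= ℕS.con 2 ℕS.:* (N ℕS.:+ (ℕS.con 1 ℕS.:+ N))) refl N)))))
    , 𝕊.trans (solve 2 (λ m q → con (+ 0) :+ (con (+ 0) :* con (+ 0) :+ q :* m :- q :* con (+ 0)) :+ con (+ 0) := q :* m) 𝕊.refl m (mono 1))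
        (𝕊.trans (mono-+ 1 (2 ℕ.* N)) (mono-cong (cong suc (ℕₚ.*-comm 2 N)))) )
    where m = mono (2 ℕ.* N)

  norm-prod : ∀ N → norm (F.prodR N) ≋ prodUpTo ν N
  norm-prod zero    = solve 0 (con (+ 1) :* con (+ 1) :- con (+ 1) :* con (+ 0) :- con (+ 0) :* con (+ 0) := con (+ 1)) 𝕊.refl
  norm-prod (suc N) = 𝕊.trans (norm-⊠ (F.prodR N) (𝔾.1# 𝔾.+ sᴳ 𝔾.* G.pw N 𝔾.+ G.pw (N ℕ.+ suc N))) (𝕊.*-cong (norm-prod N) (norm-cong (factor≈ N)))

  T-conv : Conv (λ N → euler 2 ⊛ euler 2 ⊛ prodUpTo ν N) T
  T-conv = conv-cong (λ N → 𝕊.trans (solve 3 (λ e a b → e :* a :* (e :* a) :+ :- (e :* a :* (e :* b)) :+ :- (e :* b :* (e :* b)) := e :* e :* (a :* a :- a :* b :- b :* b)) 𝕊.refl (euler 2) (proj₁ (F.prodR N)) (proj₂ (F.prodR N)))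
      (𝕊.*-congˡ {euler 2 ⊛ euler 2} (norm-prod N)))
    (conv-⊕ (conv-⊕ (conv-⊛ conv₁ conv₁) (conv-⊖ (conv-⊛ conv₁ conv₂))) (conv-⊖ (conv-⊛ conv₂ conv₂)))

  -- `ν m` is the product of 1 + ζ^k y over the four nontrivial fifth roots of unity, that is (1 +
  -- y⁵)/(1 + y).
  ν-factor : ∀ m → ν m ⊛ (oneS ⊕ mono (odd m)) ≋ sub 5 (oneS ⊕ mono (odd m))
  ν-factor m = 𝕊.trans (solve 1 (λ y → let i = con (+ 1) ; a = i :+ y :* y in (a :* a :- a :* y :- y :* y) :* (i :+ y) := i :+ y :* y :* y :* y :* y) 𝕊.refl (y m))
    (𝕊.trans (𝕊.+-congˡ {oneS} power) (𝕊.sym (sub₅-factor m)))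
    where
    e = odd m
    power : y m ⊛ y m ⊛ y m ⊛ y m ⊛ y m ≋ mono (5 ℕ.* e)
    power = 𝕊.trans (𝕊.*-congʳ {y m} (𝕊.trans (𝕊.*-congʳ {y m} (𝕊.trans (𝕊.*-congʳ {y m} (mono-+ e e)) (mono-+ (e ℕ.+ e) e))) (mono-+ (e ℕ.+ e ℕ.+ e) e)))
      (𝕊.trans (mono-+ (e ℕ.+ e ℕ.+ e ℕ.+ e) e) (mono-cong (ℕS.solve 1 (λ e → e ℕS.:+ e ℕS.:+ e ℕS.:+ e ℕS.:+ e ℕS.:= ℕS.con 5 ℕS.:* e) refl e)))

  T⊛O : T ⊛ O ≋ euler 2 ⊛ euler 2 ⊛ O₅
  T⊛O = 𝕊.trans (conv-unique (conv-⊛ T-conv (infProd-conv unital-O)) (conv-cong (λ N → 𝕊.sym (step N)) (conv-⊛ (conv-const (euler 2 ⊛ euler 2)) (infProd-conv unital-O₅))))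
    (𝕊.*-congˡ {euler 2 ⊛ euler 2} (𝕊.sym O₅≋))
    where
    step : ∀ N → euler 2 ⊛ euler 2 ⊛ prodUpTo ν N ⊛ prodUpTo (λ m → oneS ⊕ mono (odd m)) N ≋ euler 2 ⊛ euler 2 ⊛ prodUpTo (λ m → sub 5 (oneS ⊕ mono (odd m))) N
    step N = 𝕊.trans (𝕊.*-assoc (euler 2 ⊛ euler 2) (prodUpTo ν N) (prodUpTo (λ m → oneS ⊕ mono (odd m)) N))
      (𝕊.*-congˡ {euler 2 ⊛ euler 2} (𝕊.trans (𝕊.sym (prodUpTo-⊛ ν (λ m → oneS ⊕ mono (odd m)) N)) (prodUpTo-cong (λ m → ν-factor (suc m)) N)))

-- Exponents as integer polynomials, and changes of variables on ℤ².

sq : ℤ → ℕ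
sq x = ex 1 1 x

halve : ∀ {e p} → + 2 ℤ.* + e ≡ + 2 ℤ.* p → + e ≡ p
halve {e} {p} = ℤₚ.*-cancelˡ-≡ (+ 2) (+ e) p

private
  k : ∀ {n} → ℕ → Z.Polynomial n
  k n = Z.con (+ n)

ex-4-0 : ∀ x → + ex 4 0 x ≡ + 2 ℤ.* (x ℤ.* x) ℤ.+ + 2 ℤ.* x
ex-4-0 x = halve (trans (ex-ℤ 4 0 x) (Z.solve 1 (λ x → k 4 Z.:* (x Z.:* (x Z.:+ k 1)) Z.:+ k 0 Z.:* (x Z.:* (x Z.:- k 1)) Z.:= k 2 Z.:* (k 2 Z.:* (x Z.:* x) Z.:+ k 2 Z.:* x)) refl x))

ex-4-2 : ∀ x → + ex 4 2 x ≡ + 3 ℤ.* (x ℤ.* x) ℤ.+ x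
ex-4-2 x = halve (trans (ex-ℤ 4 2 x) (Z.solve 1 (λ x → k 4 Z.:* (x Z.:* (x Z.:+ k 1)) Z.:+ k 2 Z.:* (x Z.:* (x Z.:- k 1)) Z.:= k 2 Z.:* (k 3 Z.:* (x Z.:* x) Z.:+ x)) refl x))

ex-6-0 : ∀ x → + ex 6 0 x ≡ + 3 ℤ.* (x ℤ.* x) ℤ.+ + 3 ℤ.* x
ex-6-0 x = halve (trans (ex-ℤ 6 0 x) (Z.solve 1 (λ x → k 6 Z.:* (x Z.:* (x Z.:+ k 1)) Z.:+ k 0 Z.:* (x Z.:* (x Z.:- k 1)) Z.:= k 2 Z.:* (k 3 Z.:* (x Z.:* x) Z.:+ k 3 Z.:* x)) refl x))

ex-9-1 : ∀ x → + ex 9 1 x ≡ + 5 ℤ.* (x ℤ.* x) ℤ.+ + 4 ℤ.* x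
ex-9-1 x = halve (trans (ex-ℤ 9 1 x) (Z.solve 1 (λ x → k 9 Z.:* (x Z.:* (x Z.:+ k 1)) Z.:+ k 1 Z.:* (x Z.:* (x Z.:- k 1)) Z.:= k 2 Z.:* (k 5 Z.:* (x Z.:* x) Z.:+ k 4 Z.:* x)) refl x))

ex-7-3 : ∀ x → + ex 7 3 x ≡ + 5 ℤ.* (x ℤ.* x) ℤ.+ + 2 ℤ.* x
ex-7-3 x = halve (trans (ex-ℤ 7 3 x) (Z.solve 1 (λ x → k 7 Z.:* (x Z.:* (x Z.:+ k 1)) Z.:+ k 3 Z.:* (x Z.:* (x Z.:- k 1)) Z.:= k 2 Z.:* (k 5 Z.:* (x Z.:* x) Z.:+ k 2 Z.:* x)) refl x))

+-sum : ∀ {a b} {x y : ℤ} → + a ≡ x → + b ≡ y → + (a ℕ.+ b) ≡ x ℤ.+ y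
+-sum {a} {b} p r = trans (ℤₚ.pos-+ a b) (cong₂ ℤ._+_ p r)

+-mul : ∀ c {a} {x : ℤ} → + a ≡ x → + (c ℕ.* a) ≡ + c ℤ.* x
+-mul c {a} p = trans (ℤₚ.pos-* c a) (cong (+ c ℤ.*_) p)

mono² : ∀ a b c d {x x′ y y′ : ℤ} → + a ≡ x → + b ≡ x′ → + c ≡ y → + d ≡ y′ → x ℤ.+ x′ ≡ y ℤ.+ y′ → mono a ⊛ mono b ≋ mono c ⊛ mono d
mono² a b c d p p′ r r′ e = 𝕊.trans (mono-+ a b) (𝕊.trans (mono-cong (ℤₚ.+-injective
  (trans (+-sum {a} {b} p p′) (trans e (sym (+-sum {c} {d} r r′)))))) (𝕊.sym (mono-+ c d)))

sub-φ-hasSum : ∀ d .{{_ : NonZero d}} → HasSum (λ x → mono (d ℕ.* sq x)) (sub d φ)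
sub-φ-hasSum d = hasSum-cong (λ x → 𝕊.trans (sub-cong d (thetaFam-1 1 1 x)) (sub-mono d (sq x))) (hasSum-sub d φ-hasSum)

φ-hasSum′ : HasSum (λ x → mono (sq x)) φ
φ-hasSum′ = hasSum-cong (thetaFam-1 1 1) φ-hasSum

theta₁-hasSum : ∀ α β .{{_ : NonZero (α ℕ.+ β)}} → HasSum (λ x → mono (ex α β x)) (theta 1ℚ α β)
theta₁-hasSum α β = hasSum-cong (thetaFam-1 α β) (theta-hasSum 1ℚ α β)

module _ (d : ℕ) .{{_ : NonZero d}} where
  open Division d

  -- A dissection into d cosets of a sublattice: the linear form `num` has the coset as remainder
  -- and one coordinate as quotient, and `rest` recovers the other coordinate. The hypotheses say
  -- that these invert f.
  hasSum-divide : (f : Fin d × ℤ × ℤ → ℤ × ℤ) (num : ℤ × ℤ → ℤ) (rest : ℤ × ℤ → Fin d × ℤ → ℤ) →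
    (∀ r j l → num (f (r , j , l)) ≡ join (r , j)) →
    (∀ r j l → rest (f (r , j , l)) (r , j) ≡ l) →
    (∀ p r j → num p ≡ join (r , j) → f (r , j , rest p (r , j)) ≡ p) →
    ∀ {F : ℤ × ℤ → Series} {s} → HasSum F s → HasSum (λ q → F (f q)) s
  hasSum-divide f num rest num-f rest-f f-rest = hasSum-reindex f g fg gf
    where
    g : ℤ × ℤ → Fin d × ℤ × ℤ
    g p = let rj = rem (num p) , quo (num p) in proj₁ rj , proj₂ rj , rest p rj
    fg : ∀ p → f (g p) ≡ p
    fg p = f-rest p (rem (num p)) (quo (num p)) (sym (join-split (num p)))
    gf : ∀ q → g (f q) ≡ q
    gf (r , j , l) = trans (cong (λ rj → proj₁ rj , proj₂ rj , rest (f (r , j , l)) rj) eq) (cong (λ z → r , j , z) (rest-f r j l))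
      where
      eq : (rem (num (f (r , j , l))) , quo (num (f (r , j , l)))) ≡ (r , j)
      eq = trans (cong (λ x → rem x , quo x) (num-f r j l)) (split-join (r , j))

-- The sum of q^(2x(x+1)) over all integers x, which is 2ψ(q⁴).
ψ̂ : Series
ψ̂ = theta 1ℚ 4 0

-- Sums of two squares split by parity.

module SquareSplitting where
  -- The two cosets of (1 + i)ℤ[i]; `c` is the parity of the difference of the coordinates.
  f : Fin 2 × ℤ × ℤ → ℤ × ℤ
  f (c , j , y) = y ℤ.+ j ℤ.+ + toℕ c , y ℤ.- j

  split : HasSum (λ q → mono (sq (proj₁ (f q))) ⊛ mono (sq (proj₂ (f q)))) (φ ⊛ φ)
  split = hasSum-divide 2 f (λ (x , y) → x ℤ.- y) (λ (x , y) (_ , j) → y ℤ.+ j)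
    (λ r j y → Z.solve 3 (λ c j y → (y Z.:+ j Z.:+ c) Z.:- (y Z.:- j) Z.:= c Z.:+ j Z.:* k 2) refl (+ toℕ r) j y)
    (λ r j y → Z.solve 2 (λ j y → y Z.:- j Z.:+ j Z.:= y) refl j y)
    (λ (x , y) r j e → cong₂ _,_
      (trans (Z.solve 3 (λ c j y → y Z.:+ j Z.:+ j Z.:+ c Z.:= (c Z.:+ j Z.:* k 2) Z.:+ y) refl (+ toℕ r) j y)
        (trans (cong (ℤ._+ y) (sym e)) (Z.solve 2 (λ x y → x Z.:- y Z.:+ y Z.:= x) refl x y)))
      (Z.solve 2 (λ j y → y Z.:+ j Z.:- j Z.:= y) refl j y))
    {λ (x , y) → mono (sq x) ⊛ mono (sq y)} (hasSum-⊛ φ-hasSum′ φ-hasSum′)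

  pieces : Fin 2 → Series
  pieces zero       = sub 2 φ ⊛ sub 2 φ
  pieces (suc zero) = mono 1 ⊛ (ψ̂ ⊛ ψ̂)

  F : Fin 2 × ℤ × ℤ → Series
  F q = mono (sq (proj₁ (f q))) ⊛ mono (sq (proj₂ (f q)))

  piece-hasSum : ∀ c → HasSum (λ jy → F (c , jy)) (pieces c)
  piece-hasSum zero = hasSum-cong {F = λ (j , y) → mono (2 ℕ.* sq j) ⊛ mono (2 ℕ.* sq y)} (λ (j , y) → mono² (2 ℕ.* sq j) (2 ℕ.* sq y) (sq (y ℤ.+ j ℤ.+ + 0)) (sq (y ℤ.- j)) (+-mul 2 (ex-square j)) (+-mul 2 (ex-square y)) (ex-square (y ℤ.+ j ℤ.+ + 0)) (ex-square (y ℤ.- j))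
      (Z.solve 2 (λ j y → k 2 Z.:* (j Z.:* j) Z.:+ k 2 Z.:* (y Z.:* y) Z.:= (y Z.:+ j Z.:+ k 0) Z.:* (y Z.:+ j Z.:+ k 0) Z.:+ (y Z.:- j) Z.:* (y Z.:- j)) refl j y))
    (hasSum-⊛ (sub-φ-hasSum 2) (sub-φ-hasSum 2))
  piece-hasSum (suc zero) = hasSum-cong {F = λ (j , y) → mono 1 ⊛ (mono (ex 4 0 j) ⊛ mono (ex 4 0 y))} (λ (j , y) → 𝕊.trans (𝕊.*-congˡ {mono 1} {mono (ex 4 0 j) ⊛ mono (ex 4 0 y)} (mono-+ (ex 4 0 j) (ex 4 0 y)))
      (mono² 1 (ex 4 0 j ℕ.+ ex 4 0 y) (sq (y ℤ.+ j ℤ.+ + 1)) (sq (y ℤ.- j)) refl (+-sum {ex 4 0 j} {ex 4 0 y} (ex-4-0 j) (ex-4-0 y)) (ex-square (y ℤ.+ j ℤ.+ + 1)) (ex-square (y ℤ.- j))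
        (Z.solve 2 (λ j y → k 1 Z.:+ (k 2 Z.:* (j Z.:* j) Z.:+ k 2 Z.:* j Z.:+ (k 2 Z.:* (y Z.:* y) Z.:+ k 2 Z.:* y)) Z.:= (y Z.:+ j Z.:+ k 1) Z.:* (y Z.:+ j Z.:+ k 1) Z.:+ (y Z.:- j) Z.:* (y Z.:- j)) refl j y)))
    (hasSum-scale (mono 1) (hasSum-⊛ (theta₁-hasSum 4 0) (theta₁-hasSum 4 0)))

  φ² : φ ⊛ φ ≋ sub 2 φ ⊛ sub 2 φ ⊕ mono 1 ⊛ (ψ̂ ⊛ ψ̂)
  φ² = 𝕊.trans (hasSum-unique split (hasSum-Fin 2 {F} piece-hasSum)) (𝕊.+-congˡ {sub 2 φ ⊛ sub 2 φ} (𝕊.+-identityʳ (mono 1 ⊛ (ψ̂ ⊛ ψ̂))))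

-- Theta series of residue classes modulo 5.

θfam : ℤ → ℤ → Series
θfam c x = mono (sq (c ℤ.+ x ℤ.* + 5))

-- The sums of q^(x²) over one class x ≡ 0, 1, 2 modulo 5; the monomials are the contributions of
-- the smallest representatives.
θ₀ θ₁ θ₂ : Series
θ₀ = mono 0 ⊛ theta 1ℚ 25 25
θ₁ = mono 1 ⊛ theta 1ℚ 35 15
θ₂ = mono 4 ⊛ theta 1ℚ 45 5

θ-0 : HasSum (θfam (+ 0)) θ₀
θ-0 = hasSum-cong (λ x → 𝕊.trans (mono-+ 0 (ex 25 25 x)) (mono-cong (ℤₚ.+-injective (trans (halve {ex 25 25 x} {+ 25 ℤ.* (x ℤ.* x)} (trans (ex-ℤ 25 25 x) (Z.solve 1 (λ x → k 25 Z.:* (x Z.:* (x Z.:+ k 1)) Z.:+ k 25 Z.:* (x Z.:* (x Z.:- k 1)) Z.:= k 2 Z.:* (k 25 Z.:* (x Z.:* x))) refl x)))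
    (trans (Z.solve 1 (λ x → k 25 Z.:* (x Z.:* x) Z.:= (k 0 Z.:+ x Z.:* k 5) Z.:* (k 0 Z.:+ x Z.:* k 5)) refl x) (sym (ex-square (+ 0 ℤ.+ x ℤ.* + 5))))))))
  (hasSum-scale (mono 0) (theta₁-hasSum 25 25))

θ-1 : HasSum (θfam (+ 1)) θ₁
θ-1 = hasSum-cong (λ x → 𝕊.trans (mono-+ 1 (ex 35 15 x)) (mono-cong (ℤₚ.+-injective (trans (+-sum {1} {ex 35 15 x} refl (halve {ex 35 15 x} {+ 25 ℤ.* (x ℤ.* x) ℤ.+ + 10 ℤ.* x} (trans (ex-ℤ 35 15 x) (Z.solve 1 (λ x → k 35 Z.:* (x Z.:* (x Z.:+ k 1)) Z.:+ k 15 Z.:* (x Z.:* (x Z.:- k 1)) Z.:= k 2 Z.:* (k 25 Z.:* (x Z.:* x) Z.:+ k 10 Z.:* x)) refl x))))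
    (trans (Z.solve 1 (λ x → k 1 Z.:+ (k 25 Z.:* (x Z.:* x) Z.:+ k 10 Z.:* x) Z.:= (k 1 Z.:+ x Z.:* k 5) Z.:* (k 1 Z.:+ x Z.:* k 5)) refl x) (sym (ex-square (+ 1 ℤ.+ x ℤ.* + 5))))))))
  (hasSum-scale (mono 1) (theta₁-hasSum 35 15))

θ-2 : HasSum (θfam (+ 2)) θ₂
θ-2 = hasSum-cong (λ x → 𝕊.trans (mono-+ 4 (ex 45 5 x)) (mono-cong (ℤₚ.+-injective (trans (+-sum {4} {ex 45 5 x} refl (halve {ex 45 5 x} {+ 25 ℤ.* (x ℤ.* x) ℤ.+ + 20 ℤ.* x} (trans (ex-ℤ 45 5 x) (Z.solve 1 (λ x → k 45 Z.:* (x Z.:* (x Z.:+ k 1)) Z.:+ k 5 Z.:* (x Z.:* (x Z.:- k 1)) Z.:= k 2 Z.:* (k 25 Z.:* (x Z.:* x) Z.:+ k 20 Z.:* x)) refl x))))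
    (trans (Z.solve 1 (λ x → k 4 Z.:+ (k 25 Z.:* (x Z.:* x) Z.:+ k 20 Z.:* x) Z.:= (k 2 Z.:+ x Z.:* k 5) Z.:* (k 2 Z.:+ x Z.:* k 5)) refl x) (sym (ex-square (+ 2 ℤ.+ x ℤ.* + 5))))))))
  (hasSum-scale (mono 4) (theta₁-hasSum 45 5))

sq-cong : ∀ {x y} → x ℤ.* x ≡ y ℤ.* y → mono (sq x) ≋ mono (sq y)
sq-cong {x} {y} e = mono-cong (ℤₚ.+-injective (trans (ex-square x) (trans e (sym (ex-square y)))))

-- (5x + c)² = (5(-n-x) + c′)² whenever c + c′ = 5n
θ-reflect : ∀ c c′ n → c ℤ.+ c′ ≡ + 5 ℤ.* n → ∀ {s} → HasSum (θfam c) s → HasSum (θfam c′) s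
θ-reflect c c′ n e p = hasSum-cong (λ x → sq-cong {c ℤ.+ (ℤ.- n ℤ.- x) ℤ.* + 5} {c′ ℤ.+ x ℤ.* + 5} (square x))
  (hasSum-reindex (λ x → ℤ.- n ℤ.- x) (λ x → ℤ.- n ℤ.- x) invol invol p)
  where
  invol : ∀ x → ℤ.- n ℤ.- (ℤ.- n ℤ.- x) ≡ x
  invol = Z.solve 2 (λ n x → Z.:- n Z.:- (Z.:- n Z.:- x) Z.:= x) refl n
  square : ∀ x → (c ℤ.+ (ℤ.- n ℤ.- x) ℤ.* + 5) ℤ.* (c ℤ.+ (ℤ.- n ℤ.- x) ℤ.* + 5) ≡ (c′ ℤ.+ x ℤ.* + 5) ℤ.* (c′ ℤ.+ x ℤ.* + 5)
  square x = trans (cong (λ z → z ℤ.* z) (trans (Z.solve 4 (λ c c′ n x → c Z.:+ (Z.:- n Z.:- x) Z.:* k 5 Z.:= (c Z.:+ c′) Z.:- k 5 Z.:* n Z.:- (c′ Z.:+ x Z.:* k 5)) refl c c′ n x)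
      (trans (cong (λ z → z ℤ.- + 5 ℤ.* n ℤ.- (c′ ℤ.+ x ℤ.* + 5)) e) (Z.solve 3 (λ m c′ x → m Z.:- m Z.:- (c′ Z.:+ x Z.:* k 5) Z.:= Z.:- (c′ Z.:+ x Z.:* k 5)) refl (+ 5 ℤ.* n) c′ x))))
    (Z.solve 1 (λ z → Z.:- z Z.:* Z.:- z Z.:= z Z.:* z) refl (c′ ℤ.+ x ℤ.* + 5))

θ-3 : HasSum (θfam (+ 3)) θ₂
θ-3 = θ-reflect (+ 2) (+ 3) (+ 1) refl θ-2

θ-4 : HasSum (θfam (+ 4)) θ₁
θ-4 = θ-reflect (+ 1) (+ 4) (+ 1) refl θ-1

θ-5 : HasSum (θfam (+ 5)) θ₀
θ-5 = θ-reflect (+ 0) (+ 5) (+ 1) refl θ-0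

θ-6 : HasSum (θfam (+ 6)) θ₁
θ-6 = θ-reflect (+ 4) (+ 6) (+ 2) refl θ-4

θ-7 : HasSum (θfam (+ 7)) θ₂
θ-7 = θ-reflect (+ 3) (+ 7) (+ 2) refl θ-3

θ-8 : HasSum (θfam (+ 8)) θ₂
θ-8 = θ-reflect (+ 2) (+ 8) (+ 2) refl θ-2

θ-9 : HasSum (θfam (+ 9)) θ₁
θ-9 = θ-reflect (+ 1) (+ 9) (+ 2) refl θ-1

open Division 5 using () renaming (join to join₅; rem to rem₅; quo to quo₅; join-split to join-split₅; split-join to split-join₅)

split₅ : ∀ {F : ℤ → Series} {s} → HasSum F s → HasSum (λ q → F (join₅ q)) s
split₅ = hasSum-reindex join₅ (λ x → rem₅ x , quo₅ x) join-split₅ split-join₅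

φ-split₅ : φ ≋ θ₀ ⊕ (θ₁ ⊕ (θ₂ ⊕ (θ₂ ⊕ (θ₁ ⊕ zeroS))))
φ-split₅ = hasSum-unique (split₅ φ-hasSum′) (hasSum-Fin 5 {s = s} p)
  where
  s : Fin 5 → Series
  s zero                         = θ₀
  s (suc zero)                   = θ₁
  s (suc (suc zero))             = θ₂
  s (suc (suc (suc zero)))       = θ₂
  s (suc (suc (suc (suc zero)))) = θ₁
  p : ∀ c → HasSum (λ i → mono (sq (join₅ (c , i)))) (s c)
  p zero                         = θ-0
  p (suc zero)                   = θ-1
  p (suc (suc zero))             = θ-2
  p (suc (suc (suc zero)))       = θ-3
  p (suc (suc (suc (suc zero)))) = θ-4

-- Multiplication by 2 + i maps ℤ² onto a sublattice of index 5.
module RotateBy[2+i] where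
  f : Fin 5 × ℤ × ℤ → ℤ × ℤ
  f (r , j , l) = j ℤ.+ + toℕ r ℤ.+ + 2 ℤ.* l , l ℤ.- + 2 ℤ.* j

  rotate : ∀ {F : ℤ × ℤ → Series} {s} → HasSum F s → HasSum (λ q → F (f q)) s
  rotate = hasSum-divide 5 f (λ (x , y) → x ℤ.- + 2 ℤ.* y) (λ (x , y) (_ , j) → y ℤ.+ + 2 ℤ.* j)
    (λ r j l → Z.solve 3 (λ r j l → (j Z.:+ r Z.:+ k 2 Z.:* l) Z.:- k 2 Z.:* (l Z.:- k 2 Z.:* j) Z.:= r Z.:+ j Z.:* k 5) refl (+ toℕ r) j l)
    (λ r j l → Z.solve 2 (λ j l → l Z.:- k 2 Z.:* j Z.:+ k 2 Z.:* j Z.:= l) refl j l)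
    (λ (x , y) r j e → cong₂ _,_
      (trans (Z.solve 3 (λ r j y → j Z.:+ r Z.:+ k 2 Z.:* (y Z.:+ k 2 Z.:* j) Z.:= (r Z.:+ j Z.:* k 5) Z.:+ k 2 Z.:* y) refl (+ toℕ r) j y)
        (trans (cong (ℤ._+ + 2 ℤ.* y) (sym e)) (Z.solve 2 (λ x y → x Z.:- k 2 Z.:* y Z.:+ k 2 Z.:* y Z.:= x) refl x y)))
      (Z.solve 2 (λ j y → y Z.:+ k 2 Z.:* j Z.:- k 2 Z.:* j Z.:= y) refl j y))

  -- 5 (x² + y²) is the norm of a multiple of 2 + i, hence t² + u² with u ≡ 2t modulo 5: the class r
  -- of t is paired with the class 2r of u.
  sub₅φ² : sub 5 φ ⊛ sub 5 φ ≋ θ₀ ⊛ θ₀ ⊕ (θ₁ ⊛ θ₂ ⊕ (θ₂ ⊛ θ₁ ⊕ (θ₂ ⊛ θ₁ ⊕ (θ₁ ⊛ θ₂ ⊕ zeroS))))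
  sub₅φ² = hasSum-unique (hasSum-cong same (rotate {λ (x , y) → mono (5 ℕ.* sq x) ⊛ mono (5 ℕ.* sq y)} (hasSum-⊛ (sub-φ-hasSum 5) (sub-φ-hasSum 5)))) (hasSum-Fin 5 {F} {s} p)
    where
    F : Fin 5 × ℤ × ℤ → Series
    F (r , j , l) = θfam (+ toℕ r) j ⊛ θfam (+ 2 ℤ.* + toℕ r) l
    same : ∀ q → mono (5 ℕ.* sq (proj₁ (f q))) ⊛ mono (5 ℕ.* sq (proj₂ (f q))) ≋ F q
    same (r , j , l) = mono² (5 ℕ.* sq x) (5 ℕ.* sq y) (sq (+ toℕ r ℤ.+ j ℤ.* + 5)) (sq (+ 2 ℤ.* + toℕ r ℤ.+ l ℤ.* + 5)) (+-mul 5 (ex-square x)) (+-mul 5 (ex-square y))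
      (ex-square (+ toℕ r ℤ.+ j ℤ.* + 5)) (ex-square (+ 2 ℤ.* + toℕ r ℤ.+ l ℤ.* + 5))
      (Z.solve 3 (λ r j l → let x = j Z.:+ r Z.:+ k 2 Z.:* l ; y = l Z.:- k 2 Z.:* j ; t = r Z.:+ j Z.:* k 5 ; u = k 2 Z.:* r Z.:+ l Z.:* k 5 in
        k 5 Z.:* (x Z.:* x) Z.:+ k 5 Z.:* (y Z.:* y) Z.:= t Z.:* t Z.:+ u Z.:* u) refl (+ toℕ r) j l)
      where
      x = proj₁ (f (r , j , l))
      y = proj₂ (f (r , j , l))
    s : Fin 5 → Series
    s zero                         = θ₀ ⊛ θ₀
    s (suc zero)                   = θ₁ ⊛ θ₂
    s (suc (suc zero))             = θ₂ ⊛ θ₁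
    s (suc (suc (suc zero)))       = θ₂ ⊛ θ₁
    s (suc (suc (suc (suc zero)))) = θ₁ ⊛ θ₂
    p : ∀ c → HasSum (λ jl → F (c , jl)) (s c)
    p zero                         = hasSum-⊛ θ-0 θ-0
    p (suc zero)                   = hasSum-⊛ θ-1 θ-2
    p (suc (suc zero))             = hasSum-⊛ θ-2 θ-4
    p (suc (suc (suc zero)))       = hasSum-⊛ θ-3 θ-6
    p (suc (suc (suc (suc zero)))) = hasSum-⊛ θ-4 θ-8

  -- The same lattice shifted by one: completing squares turns the exponent into t² + u² with u ≡ 2t
  -- + 1 modulo 5.
  S≋ : mono 1 ⊛ (theta 1ℚ 9 1 ⊛ theta 1ℚ 7 3) ≋ θ₀ ⊛ θ₁ ⊕ (θ₁ ⊛ θ₂ ⊕ (θ₂ ⊛ θ₀ ⊕ (θ₂ ⊛ θ₂ ⊕ (θ₁ ⊛ θ₁ ⊕ zeroS))))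
  S≋ = hasSum-unique (hasSum-cong same (rotate {λ (x , y) → mono 1 ⊛ (mono (ex 9 1 x) ⊛ mono (ex 7 3 y))} (hasSum-scale (mono 1) (hasSum-⊛ (theta₁-hasSum 9 1) (theta₁-hasSum 7 3))))) (hasSum-Fin 5 {F} {s} p)
    where
    F : Fin 5 × ℤ × ℤ → Series
    F (r , j , l) = θfam (+ toℕ r) j ⊛ θfam (+ 2 ℤ.* + toℕ r ℤ.+ + 1) l
    same : ∀ q → mono 1 ⊛ (mono (ex 9 1 (proj₁ (f q))) ⊛ mono (ex 7 3 (proj₂ (f q)))) ≋ F q
    same (r , j , l) = 𝕊.trans (𝕊.*-congˡ {mono 1} (mono-+ (ex 9 1 x) (ex 7 3 y)))
      (mono² 1 (ex 9 1 x ℕ.+ ex 7 3 y) (sq (+ toℕ r ℤ.+ j ℤ.* + 5)) (sq (+ 2 ℤ.* + toℕ r ℤ.+ + 1 ℤ.+ l ℤ.* + 5)) refl (+-sum {ex 9 1 x} {ex 7 3 y} (ex-9-1 x) (ex-7-3 y)) (ex-square (+ toℕ r ℤ.+ j ℤ.* + 5)) (ex-square (+ 2 ℤ.* + toℕ r ℤ.+ + 1 ℤ.+ l ℤ.* + 5))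
        (Z.solve 3 (λ r j l → let x = j Z.:+ r Z.:+ k 2 Z.:* l ; y = l Z.:- k 2 Z.:* j ; t = r Z.:+ j Z.:* k 5 ; u = k 2 Z.:* r Z.:+ k 1 Z.:+ l Z.:* k 5 in
          k 1 Z.:+ (k 5 Z.:* (x Z.:* x) Z.:+ k 4 Z.:* x Z.:+ (k 5 Z.:* (y Z.:* y) Z.:+ k 2 Z.:* y)) Z.:= t Z.:* t Z.:+ u Z.:* u) refl (+ toℕ r) j l))
      where
      x = proj₁ (f (r , j , l))
      y = proj₂ (f (r , j , l))
    s : Fin 5 → Series
    s zero                         = θ₀ ⊛ θ₁
    s (suc zero)                   = θ₁ ⊛ θ₂
    s (suc (suc zero))             = θ₂ ⊛ θ₀
    s (suc (suc (suc zero)))       = θ₂ ⊛ θ₂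
    s (suc (suc (suc (suc zero)))) = θ₁ ⊛ θ₁
    p : ∀ c → HasSum (λ jl → F (c , jl)) (s c)
    p zero                         = hasSum-⊛ θ-0 θ-1
    p (suc zero)                   = hasSum-⊛ θ-1 θ-3
    p (suc (suc zero))             = hasSum-⊛ θ-2 θ-5
    p (suc (suc (suc zero)))       = hasSum-⊛ θ-3 θ-7
    p (suc (suc (suc (suc zero)))) = hasSum-⊛ θ-4 θ-9

-- The twisted theta series in terms of residue classes.

-[1+]-ℤ : ∀ n → -[1+ n ] ≡ ℤ.- (+ 1) ℤ.- + n
-[1+]-ℤ n = trans (cong ℤ.-_ (ℤₚ.pos-+ 1 n)) (ℤₚ.neg-distrib-+ (+ 1) (+ n))

module GoldenSplitting where
  open GoldenTheta

  abs-square : ∀ x → ℤ.∣ x ∣ ℕ.* ℤ.∣ x ∣ ≡ sq x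
  abs-square x = ℤₚ.+-injective (trans (step x) (sym (ex-square x)))
    where
    step : ∀ x → + (ℤ.∣ x ∣ ℕ.* ℤ.∣ x ∣) ≡ x ℤ.* x
    step (+ n)    = ℤₚ.pos-* n n
    step -[1+ n ] = refl

  -- Reflects ζ⁵ = 1, obtained here by running the recursion five steps.
  ga-period : ∀ m → ga (5 ℕ.+ m) ≡ ga m
  ga-period m = Q.solve 4 (λ a b a₁ b₁ → let a₂ = b₁ Q.:- a ; b₂ = a₁ Q.:- b₁ Q.:- b ; a₃ = b₂ Q.:- a₁ ; b₃ = a₂ Q.:- b₂ Q.:- b₁ ; b₄ = a₃ Q.:- b₃ Q.:- b₂ in
    b₄ Q.:- a₃ Q.:= a) refl (ga m) (gb m) (ga (suc m)) (gb (suc m))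

  gb-period : ∀ m → gb (5 ℕ.+ m) ≡ gb m
  gb-period m = Q.solve 4 (λ a b a₁ b₁ → let a₂ = b₁ Q.:- a ; b₂ = a₁ Q.:- b₁ Q.:- b ; a₃ = b₂ Q.:- a₁ ; b₃ = a₂ Q.:- b₂ Q.:- b₁ ; a₄ = b₃ Q.:- a₂ ; b₄ = a₃ Q.:- b₃ Q.:- b₂ in
    a₄ Q.:- b₄ Q.:- b₃ Q.:= b) refl (ga m) (gb m) (ga (suc m)) (gb (suc m))

  module _ (c : ℕ → ℚ) (period : ∀ m → c (5 ℕ.+ m) ≡ c m) (even₁ : c 4 ≡ c 1) (even₂ : c 3 ≡ c 2) where
    periods : ∀ r n → c (r ℕ.+ n ℕ.* 5) ≡ c r
    periods r zero    = cong c (ℕₚ.+-identityʳ r)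
    periods r (suc n) = trans (cong c (ℕS.solve 2 (λ r n → r ℕS.:+ (ℕS.con 5 ℕS.:+ n) ℕS.:= ℕS.con 5 ℕS.:+ (r ℕS.:+ n)) refl r (n ℕ.* 5))) (trans (period (r ℕ.+ n ℕ.* 5)) (periods r n))

    abs-pos : ∀ r n → ℤ.∣ + r ℤ.+ + n ℤ.* + 5 ∣ ≡ r ℕ.+ n ℕ.* 5
    abs-pos r n = cong ℤ.∣_∣ (trans (cong (λ z → + r ℤ.+ z) (sym (ℤₚ.pos-* n 5))) (sym (ℤₚ.pos-+ r (n ℕ.* 5))))

    abs-neg : ∀ r s n → r ℕ.+ s ≡ 5 → ℤ.∣ + r ℤ.+ -[1+ n ] ℤ.* + 5 ∣ ≡ s ℕ.+ n ℕ.* 5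
    abs-neg r s n e = trans (cong ℤ.∣_∣ eq) (trans (ℤₚ.∣-i∣≡∣i∣ (+ s ℤ.+ + n ℤ.* + 5)) (abs-pos s n))
      where
      five : + r ℤ.+ + s ≡ + 5
      five = trans (sym (ℤₚ.pos-+ r s)) (cong +_ e)
      eq : + r ℤ.+ -[1+ n ] ℤ.* + 5 ≡ ℤ.- (+ s ℤ.+ + n ℤ.* + 5)
      eq = trans (cong (λ z → + r ℤ.+ z ℤ.* + 5) (-[1+]-ℤ n)) (trans
        (Z.solve 3 (λ r s n → r Z.:+ (Z.:- k 1 Z.:- n) Z.:* k 5 Z.:= (r Z.:+ s) Z.:- k 5 Z.:- (s Z.:+ n Z.:* k 5)) refl (+ r) (+ s) (+ n))
        (trans (cong (λ z → z ℤ.- + 5 ℤ.- (+ s ℤ.+ + n ℤ.* + 5)) five) (Z.solve 1 (λ m → k 5 Z.:- k 5 Z.:- m Z.:= Z.:- m) refl (+ s ℤ.+ + n ℤ.* + 5))))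

    coefficient : ∀ (r : Fin 5) j → c ℤ.∣ + toℕ r ℤ.+ j ℤ.* + 5 ∣ ≡ c (toℕ r)
    coefficient r (+ n) = trans (cong c (abs-pos (toℕ r) n)) (periods (toℕ r) n)
    coefficient zero                         -[1+ n ] = trans (cong c (abs-neg 0 5 n refl)) (trans (periods 5 n) (period 0))
    coefficient (suc zero)                   -[1+ n ] = trans (cong c (abs-neg 1 4 n refl)) (trans (periods 4 n) even₁)
    coefficient (suc (suc zero))             -[1+ n ] = trans (cong c (abs-neg 2 3 n refl)) (trans (periods 3 n) even₂)
    coefficient (suc (suc (suc zero)))       -[1+ n ] = trans (cong c (abs-neg 3 2 n refl)) (trans (periods 2 n) (sym even₂))
    coefficient (suc (suc (suc (suc zero)))) -[1+ n ] = trans (cong c (abs-neg 4 1 n refl)) (trans (periods 1 n) (sym even₁))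

    w : ℕ → Series
    w r = const (half ℚ.* c r)

    Φ-split : Φ c ≋ w 0 ⊛ θ₀ ⊕ (w 1 ⊛ θ₁ ⊕ (w 2 ⊛ θ₂ ⊕ (w 3 ⊛ θ₂ ⊕ (w 4 ⊛ θ₁ ⊕ zeroS))))
    Φ-split = hasSum-unique (hasSum-cong same (split₅ (Φ-hasSum c))) (hasSum-Fin 5 {F} {s} p)
      where
      F : Fin 5 × ℤ → Series
      F (r , j) = w (toℕ r) ⊛ θfam (+ toℕ r) j
      same : ∀ q → goldenFam c (Division.join 5 q) ≋ F q
      same (r , j) = 𝕊.trans (·-const (half ℚ.* c ℤ.∣ x ∣) (mono (ℤ.∣ x ∣ ℕ.* ℤ.∣ x ∣)))
        (𝕊.*-cong (const-cong (cong (half ℚ.*_) (coefficient r j))) (mono-cong (abs-square x)))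
        where x = + toℕ r ℤ.+ j ℤ.* + 5
      s : Fin 5 → Series
      s zero                         = w 0 ⊛ θ₀
      s (suc zero)                   = w 1 ⊛ θ₁
      s (suc (suc zero))             = w 2 ⊛ θ₂
      s (suc (suc (suc zero)))       = w 3 ⊛ θ₂
      s (suc (suc (suc (suc zero)))) = w 4 ⊛ θ₁
      p : ∀ r → HasSum (λ j → F (r , j)) (s r)
      p zero                         = hasSum-scale (w 0) θ-0
      p (suc zero)                   = hasSum-scale (w 1) θ-1
      p (suc (suc zero))             = hasSum-scale (w 2) θ-2
      p (suc (suc (suc zero)))       = hasSum-scale (w 3) θ-3
      p (suc (suc (suc (suc zero)))) = hasSum-scale (w 4) θ-4

  -- For k = 0, ..., 4 the values of ζ^k + ζ^(-k) are 2, τ, -1 - τ, -1 - τ, τ. Here the rational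
  -- parts are collected, and in `Φb≋` the coefficients of τ.
  Φa≋ : Φ ga ≋ θ₀ ⊕ ⊖ θ₂
  Φa≋ = 𝕊.trans (Φ-split ga ga-period refl refl) (coeffwise λ n →
    trans (cong₂ ℚ._+_ (s 0 θ₀ n) (cong₂ ℚ._+_ (s 1 θ₁ n) (cong₂ ℚ._+_ (s 2 θ₂ n) (cong₂ ℚ._+_ (s 3 θ₂ n) (cong (ℚ._+ 0ℚ) (s 4 θ₁ n))))))
    (Q.solve 3 (λ a b c → Q.con (half ℚ.* ga 0) Q.:* a Q.:+ (Q.con (half ℚ.* ga 1) Q.:* b Q.:+ (Q.con (half ℚ.* ga 2) Q.:* c Q.:+ (Q.con (half ℚ.* ga 3) Q.:* c Q.:+ (Q.con (half ℚ.* ga 4) Q.:* b Q.:+ Q.con 0ℚ))))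
      Q.:= a Q.:+ Q.:- c) refl (θ₀ n) (θ₁ n) (θ₂ n)))
    where
    s : ∀ r f n → (const (half ℚ.* ga r) ⊛ f) n ≡ half ℚ.* ga r ℚ.* f n
    s r f n = sym (·-const (half ℚ.* ga r) f .coeff n)

  Φb≋ : Φ gb ≋ θ₁ ⊕ ⊖ θ₂
  Φb≋ = 𝕊.trans (Φ-split gb gb-period refl refl) (coeffwise λ n →
    trans (cong₂ ℚ._+_ (s 0 θ₀ n) (cong₂ ℚ._+_ (s 1 θ₁ n) (cong₂ ℚ._+_ (s 2 θ₂ n) (cong₂ ℚ._+_ (s 3 θ₂ n) (cong (ℚ._+ 0ℚ) (s 4 θ₁ n))))))
    (Q.solve 3 (λ a b c → Q.con (half ℚ.* gb 0) Q.:* a Q.:+ (Q.con (half ℚ.* gb 1) Q.:* b Q.:+ (Q.con (half ℚ.* gb 2) Q.:* c Q.:+ (Q.con (half ℚ.* gb 3) Q.:* c Q.:+ (Q.con (half ℚ.* gb 4) Q.:* b Q.:+ Q.con 0ℚ))))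
      Q.:= b Q.:+ Q.:- c) refl (θ₀ n) (θ₁ n) (θ₂ n)))
    where
    s : ∀ r f n → (const (half ℚ.* gb r) ⊛ f) n ≡ half ℚ.* gb r ℚ.* f n
    s r f n = sym (·-const (half ℚ.* gb r) f .coeff n)

-- The sign (-1)^x, and f₂ f₁₀ by dissection of a lattice sum.

sz : ℤ → ℚ
sz x = epow (ℚ.- 1ℚ) ℤ.∣ x ∣

private
  neg-one : ∀ x → ℚ.- 1ℚ ℚ.* x ≡ ℚ.- x
  neg-one = Q.solve 1 (λ x → Q.con (ℚ.- 1ℚ) Q.:* x Q.:= Q.:- x) refl

  neg-neg : ∀ x → ℚ.- (ℚ.- x) ≡ x
  neg-neg = Q.solve 1 (λ x → Q.:- (Q.:- x) Q.:= x) refl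

sz-suc : ∀ x → sz (x ℤ.+ + 1) ≡ ℚ.- sz x
sz-suc (+ n)        = trans (cong (epow (ℚ.- 1ℚ)) (ℕₚ.+-comm n 1)) (neg-one (epow (ℚ.- 1ℚ) n))
sz-suc -[1+ zero ]  = refl
sz-suc -[1+ suc n ] = sym (trans (cong ℚ.-_ (neg-one (epow (ℚ.- 1ℚ) (suc n)))) (neg-neg (epow (ℚ.- 1ℚ) (suc n))))

sz-+ : ∀ x y → sz (x ℤ.+ y) ≡ sz x ℚ.* sz y
sz-+ x (+ n)    = pos n
  where
  pos : ∀ n → sz (x ℤ.+ + n) ≡ sz x ℚ.* sz (+ n)
  pos zero    = trans (cong sz (ℤₚ.+-identityʳ x)) (sym (ℚₚ.*-identityʳ (sz x)))
  pos (suc n) = trans (cong sz (trans (cong (λ z → x ℤ.+ z) (ℤₚ.pos-+ 1 n)) (Z.solve 2 (λ x n → x Z.:+ (k 1 Z.:+ n) Z.:= (x Z.:+ n) Z.:+ k 1) refl x (+ n))))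
    (trans (sz-suc (x ℤ.+ + n)) (trans (cong ℚ.-_ (pos n)) (trans (ℚₚ.neg-distribʳ-* (sz x) (sz (+ n))) (cong (sz x ℚ.*_) (sym (neg-one (sz (+ n))))))))
sz-+ x -[1+ n ] = neg n
  where
  back : ∀ x → sz (x ℤ.- + 1) ≡ ℚ.- sz x
  back x = trans (sym (neg-neg (sz (x ℤ.- + 1)))) (cong ℚ.-_ (trans (sym (sz-suc (x ℤ.- + 1))) (cong sz (Z.solve 1 (λ x → x Z.:- k 1 Z.:+ k 1 Z.:= x) refl x))))
  neg : ∀ n → sz (x ℤ.+ -[1+ n ]) ≡ sz x ℚ.* sz -[1+ n ]
  neg zero    = trans (back x) (Q.solve 1 (λ x → Q.:- x Q.:= x Q.:* Q.con (sz -[1+ 0 ])) refl (sz x))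
  neg (suc n) = trans (cong sz (trans (cong (λ z → x ℤ.+ z) (trans (-[1+]-ℤ (suc n)) (trans (cong (λ z → ℤ.- (+ 1) ℤ.- z) (ℤₚ.pos-+ 1 n)) (trans (Z.solve 1 (λ n → Z.:- k 1 Z.:- (k 1 Z.:+ n) Z.:= (Z.:- k 1 Z.:- n) Z.:- k 1) refl (+ n)) (cong (ℤ._- + 1) (sym (-[1+]-ℤ n)))))))
      (Z.solve 2 (λ x y → x Z.:+ (y Z.:- k 1) Z.:= x Z.:+ y Z.:- k 1) refl x -[1+ n ])))
    (trans (back (x ℤ.+ -[1+ n ])) (trans (cong ℚ.-_ (neg n)) (trans (ℚₚ.neg-distribʳ-* (sz x) (sz -[1+ n ])) (cong (sz x ℚ.*_) (sym (neg-one (sz -[1+ n ])))))))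

sz-neg : ∀ x → sz (ℤ.- x) ≡ sz x
sz-neg x = cong (epow (ℚ.- 1ℚ)) (ℤₚ.∣-i∣≡∣i∣ x)

sz-square : ∀ x → sz x ℚ.* sz x ≡ 1ℚ
sz-square x = trans (cong (ℚ._* sz x) (sym (sz-neg x))) (trans (sym (sz-+ (ℤ.- x) x)) (cong sz (ℤₚ.+-inverseˡ x)))

sz-double : ∀ x → sz (x ℤ.* + 2) ≡ 1ℚ
sz-double x = trans (cong sz (Z.solve 1 (λ x → x Z.:* k 2 Z.:= x Z.:+ x) refl x)) (trans (sz-+ x x) (sz-square x))

sz-reflect : ∀ x → sz (ℤ.- (+ 1) ℤ.- x) ≡ ℚ.- sz x
sz-reflect x = trans (sz-+ (ℤ.- (+ 1)) (ℤ.- x)) (trans (cong (sz (ℤ.- (+ 1)) ℚ.*_) (sz-neg x)) (neg-one (sz x)))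

·-mono-⊛ : ∀ c d a b → (c · mono a) ⊛ (d · mono b) ≋ (c ℚ.* d) · mono (a ℕ.+ b)
·-mono-⊛ c d a b = begin
  (c · mono a) ⊛ (d · mono b)                         ≈⟨ 𝕊.*-cong (·-const c (mono a)) (·-const d (mono b)) ⟩
  (const c ⊛ mono a) ⊛ (const d ⊛ mono b)             ≈⟨ solve 4 (λ c a d b → (c :* a) :* (d :* b) := (c :* d) :* (a :* b)) 𝕊.refl (const c) (mono a) (const d) (mono b) ⟩
  (const c ⊛ const d) ⊛ (mono a ⊛ mono b)             ≈⟨ 𝕊.*-cong (𝕊.sym (const-* c d)) (mono-+ a b) ⟩
  const (c ℚ.* d) ⊛ mono (a ℕ.+ b)                    ≈⟨ 𝕊.sym (·-const (c ℚ.* d) (mono (a ℕ.+ b))) ⟩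
  (c ℚ.* d) · mono (a ℕ.+ b)                          ∎
  where open ≋-Reasoning

·-mono-cong : ∀ {c d a b} → c ≡ d → a ≡ b → c · mono a ≋ d · mono b
·-mono-cong refl refl = 𝕊.refl

-- The lattice sum Σ (-1)^x q^{E(x,y)} is dissected modulo 2 in x and modulo 3 in y.
module PentagonalProduct where
  -- The quadratic part 2y² - 2xy + 3x² becomes diagonal in two ways: x = 2i, y = j + i gives 10i² +
  -- 2j², and (x, y) replaced by (y - x, 3y) gives 15y² + 3x². The linear terms are chosen so that
  -- the two dissections produce φψ products and pentagonal series.
  E : ℤ × ℤ → ℤ
  E (x , y) = + 2 ℤ.* (y ℤ.* y) ℤ.+ + 2 ℤ.* y ℤ.- + 2 ℤ.* (y ℤ.* x) ℤ.- x ℤ.+ + 3 ℤ.* (x ℤ.* x)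

  G : ℤ × ℤ → Series
  G p = sz (proj₁ p) · mono ℤ.∣ E p ∣

  ψ̂₂₀ : Series
  ψ̂₂₀ = sub 5 ψ̂

  ψ̂₂₀-hasSum : HasSum (λ x → mono (5 ℕ.* ex 4 0 x)) ψ̂₂₀
  ψ̂₂₀-hasSum = hasSum-cong (λ x → sub-mono 5 (ex 4 0 x)) (hasSum-sub 5 (theta₁-hasSum 4 0))

  module Two where
    open Division 2

    f : Fin 2 × ℤ × ℤ → ℤ × ℤ
    f (c , i , j) = join (c , i) , j ℤ.+ i

    pieces : Fin 2 → Series
    pieces zero       = sub 10 φ ⊛ ψ̂
    pieces (suc zero) = const (ℚ.- 1ℚ) ⊛ (mono 2 ⊛ (ψ̂₂₀ ⊛ sub 2 φ))

    exponent : ∀ {p e} → + e ≡ E p → ℤ.∣ E p ∣ ≡ e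
    exponent q = sym (cong ℤ.∣_∣ q)

    p : ∀ c → HasSum (λ ij → G (f (c , ij))) (pieces c)
    p zero = hasSum-cong {F = λ (i , j) → mono (10 ℕ.* sq i) ⊛ mono (ex 4 0 j)} same (hasSum-⊛ (sub-φ-hasSum 10) (theta₁-hasSum 4 0))
      where
      same : ∀ ij → mono (10 ℕ.* sq (proj₁ ij)) ⊛ mono (ex 4 0 (proj₂ ij)) ≋ G (f (zero , ij))
      same (i , j) = 𝕊.trans (mono-+ (10 ℕ.* sq i) (ex 4 0 j)) (𝕊.trans (coeffwise λ n → sym (ℚₚ.*-identityˡ (mono (10 ℕ.* sq i ℕ.+ ex 4 0 j) n)))
        (·-mono-cong (sym (trans (cong sz (ℤₚ.+-identityˡ (i ℤ.* + 2))) (sz-double i))) (sym (exponent {f (zero , i , j)}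
          (trans (+-sum {10 ℕ.* sq i} {ex 4 0 j} (+-mul 10 (ex-square i)) (ex-4-0 j))
            (Z.solve 2 (λ i j → let x = k 0 Z.:+ i Z.:* k 2 ; y = j Z.:+ i in k 10 Z.:* (i Z.:* i) Z.:+ (k 2 Z.:* (j Z.:* j) Z.:+ k 2 Z.:* j)
              Z.:= k 2 Z.:* (y Z.:* y) Z.:+ k 2 Z.:* y Z.:- k 2 Z.:* (y Z.:* x) Z.:- x Z.:+ k 3 Z.:* (x Z.:* x)) refl i j))))))
    p (suc zero) = hasSum-cong {F = λ (i , j) → const (ℚ.- 1ℚ) ⊛ (mono 2 ⊛ (mono (5 ℕ.* ex 4 0 i) ⊛ mono (2 ℕ.* sq j)))} same
      (hasSum-scale (const (ℚ.- 1ℚ)) (hasSum-scale (mono 2) (hasSum-⊛ ψ̂₂₀-hasSum (sub-φ-hasSum 2))))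
      where
      same : ∀ ij → const (ℚ.- 1ℚ) ⊛ (mono 2 ⊛ (mono (5 ℕ.* ex 4 0 (proj₁ ij)) ⊛ mono (2 ℕ.* sq (proj₂ ij)))) ≋ G (f (suc zero , ij))
      same (i , j) = 𝕊.trans (𝕊.*-congˡ {const (ℚ.- 1ℚ)} (𝕊.trans (𝕊.*-congˡ {mono 2} (mono-+ a b)) (mono-+ 2 (a ℕ.+ b)))) (𝕊.trans (𝕊.sym (·-const (ℚ.- 1ℚ) (mono (2 ℕ.+ (a ℕ.+ b)))))
        (·-mono-cong (sym (trans (sz-+ (+ 1) (i ℤ.* + 2)) (cong (sz (+ 1) ℚ.*_) (sz-double i)))) (sym (exponent {f (suc zero , i , j)}
          (trans (+-sum {2} {a ℕ.+ b} refl (+-sum {a} {b} (+-mul 5 (ex-4-0 i)) (+-mul 2 (ex-square j))))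
            (Z.solve 2 (λ i j → let x = k 1 Z.:+ i Z.:* k 2 ; y = j Z.:+ i in k 2 Z.:+ (k 5 Z.:* (k 2 Z.:* (i Z.:* i) Z.:+ k 2 Z.:* i) Z.:+ k 2 Z.:* (j Z.:* j))
              Z.:= k 2 Z.:* (y Z.:* y) Z.:+ k 2 Z.:* y Z.:- k 2 Z.:* (y Z.:* x) Z.:- x Z.:+ k 3 Z.:* (x Z.:* x)) refl i j))))))
        where
        a = 5 ℕ.* ex 4 0 i
        b = 2 ℕ.* sq j

    g : ℤ × ℤ → Fin 2 × ℤ × ℤ
    g (x , y) = rem x , quo x , y ℤ.- quo x

    gf : ∀ q → g (f q) ≡ q
    gf (c , i , j) = trans (cong (λ ci → proj₁ ci , proj₂ ci , (j ℤ.+ i) ℤ.- proj₂ ci) (split-join (c , i))) (cong (λ z → c , i , z) (Z.solve 2 (λ i j → j Z.:+ i Z.:- i Z.:= j) refl i j))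

    fg : ∀ q → f (g q) ≡ q
    fg (x , y) = cong₂ _,_ (join-split x) (Z.solve 2 (λ y z → y Z.:- z Z.:+ z Z.:= y) refl y (quo x))

    G-hasSum : HasSum G (sumFin 2 pieces)
    G-hasSum = hasSum-cong (λ q → 𝕊.reflexive (cong G (fg q))) (hasSum-reindex g f gf fg (hasSum-Fin 2 {λ q → G (f q)} p))

  module Three where
    f : Fin 3 × ℤ × ℤ → ℤ × ℤ
    f (r , y , x) = y ℤ.- x , + toℕ r ℤ.+ y ℤ.* + 3

    split : ∀ {s} → HasSum G s → HasSum (λ q → G (f q)) s
    split = hasSum-divide 3 f (λ (u , v) → v) (λ (u , v) (_ , y) → y ℤ.- u)
      (λ r y x → refl)
      (λ r y x → Z.solve 2 (λ y x → y Z.:- (y Z.:- x) Z.:= x) refl y x)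
      (λ (u , v) r y e → cong₂ _,_ (Z.solve 2 (λ y u → y Z.:- (y Z.:- u) Z.:= u) refl y u) (sym e))

    penta : ℤ → Series
    penta = thetaFam (ℚ.- 1ℚ) 4 2

    penta-hasSum : HasSum penta (euler 2)
    penta-hasSum = hasSum-lim pentagonal (theta-hasSum (ℚ.- 1ℚ) 4 2)

    sub₅-fam : ∀ α β x → sub 5 (thetaFam (ℚ.- 1ℚ) α β x) ≋ sz x · mono (5 ℕ.* ex α β x)
    sub₅-fam α β x = 𝕊.trans (sub-· 5 (sz x) (mono (ex α β x))) (coeffwise λ n → cong (sz x ℚ.*_) (sub-mono 5 (ex α β x) .coeff n))

    penta₅-hasSum : HasSum (λ y → sz y · mono (5 ℕ.* ex 4 2 y)) (sub 5 (euler 2))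
    penta₅-hasSum = hasSum-cong (sub₅-fam 4 2) (hasSum-sub 5 penta-hasSum)

    reflect : ∀ {F : ℤ → Series} {s} → HasSum F s → HasSum (λ x → F (ℤ.- (+ 1) ℤ.- x)) s
    reflect = hasSum-reindex (λ x → ℤ.- (+ 1) ℤ.- x) (λ x → ℤ.- (+ 1) ℤ.- x) invol invol
      where
      invol : ∀ x → ℤ.- (+ 1) ℤ.- (ℤ.- (+ 1) ℤ.- x) ≡ x
      invol = Z.solve 1 (λ x → Z.:- k 1 Z.:- (Z.:- k 1 Z.:- x) Z.:= x) refl

    -- x ↦ -1-x preserves 3x² + 3x and reverses the sign.
    theta-6-0 : theta (ℚ.- 1ℚ) 6 0 ≋ zeroS
    theta-6-0 = coeffwise λ n → vanish (theta (ℚ.- 1ℚ) 6 0 n) (negated .coeff n)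
      where
      vanish : ∀ x → x ≡ 0ℚ ℚ.- x → x ≡ 0ℚ
      vanish x e = trans (Q.solve 1 (λ x → x Q.:= Q.con (1 // 2) Q.:* (x Q.:+ x)) refl x) (trans (cong (λ z → (1 // 2) ℚ.* (x ℚ.+ z)) e) (Q.solve 1 (λ x → Q.con (1 // 2) Q.:* (x Q.:+ (Q.con 0ℚ Q.:- x)) Q.:= Q.con 0ℚ) refl x))
      same : ∀ x → const (ℚ.- 1ℚ) ⊛ thetaFam (ℚ.- 1ℚ) 6 0 (ℤ.- (+ 1) ℤ.- x) ≋ thetaFam (ℚ.- 1ℚ) 6 0 x
      same x = 𝕊.trans (const-neg-1 (thetaFam (ℚ.- 1ℚ) 6 0 (ℤ.- (+ 1) ℤ.- x))) (𝕊.trans (coeffwise λ n → ℚₚ.neg-distribˡ-* (sz (ℤ.- (+ 1) ℤ.- x)) (mono (ex 6 0 (ℤ.- (+ 1) ℤ.- x)) n))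
        (·-mono-cong (trans (cong ℚ.-_ (sz-reflect x)) (neg-neg (sz x)))
          (ℤₚ.+-injective (trans (ex-6-0 (ℤ.- (+ 1) ℤ.- x)) (trans (Z.solve 1 (λ x → let y = Z.:- k 1 Z.:- x in k 3 Z.:* (y Z.:* y) Z.:+ k 3 Z.:* y Z.:= k 3 Z.:* (x Z.:* x) Z.:+ k 3 Z.:* x) refl x) (sym (ex-6-0 x)))))))
      negated : theta (ℚ.- 1ℚ) 6 0 ≋ zeroS ⊕ ⊖ theta (ℚ.- 1ℚ) 6 0
      negated = 𝕊.trans (hasSum-unique (theta-hasSum (ℚ.- 1ℚ) 6 0) (hasSum-cong same (hasSum-scale (const (ℚ.- 1ℚ)) (reflect (theta-hasSum (ℚ.- 1ℚ) 6 0)))))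
        (𝕊.trans (const-neg-1 (theta (ℚ.- 1ℚ) 6 0)) (𝕊.sym (𝕊.+-identityˡ (⊖ theta (ℚ.- 1ℚ) 6 0))))

    pieces : Fin 3 → Series
    pieces zero             = sub 5 (euler 2) ⊛ euler 2
    pieces (suc zero)       = mono 4 ⊛ (sub 5 (theta (ℚ.- 1ℚ) 6 0) ⊛ theta (ℚ.- 1ℚ) 6 0)
    pieces (suc (suc zero)) = sub 5 (euler 2) ⊛ euler 2

    sign : ∀ x y → sz y ℚ.* sz x ≡ sz (y ℤ.- x)
    sign x y = sym (trans (sz-+ y (ℤ.- x)) (cong (sz y ℚ.*_) (sz-neg x)))

    p : ∀ c → HasSum (λ yx → G (f (c , yx))) (pieces c)
    p zero = hasSum-cong {F = λ (y , x) → (sz y · mono (5 ℕ.* ex 4 2 y)) ⊛ penta x} same (hasSum-⊛ penta₅-hasSum penta-hasSum)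
      where
      same : ∀ yx → (sz (proj₁ yx) · mono (5 ℕ.* ex 4 2 (proj₁ yx))) ⊛ penta (proj₂ yx) ≋ G (f (zero , yx))
      same (y , x) = 𝕊.trans (·-mono-⊛ (sz y) (sz x) (5 ℕ.* ex 4 2 y) (ex 4 2 x)) (·-mono-cong (sign x y) (sym (Two.exponent {f (zero , y , x)}
        (trans (+-sum {5 ℕ.* ex 4 2 y} {ex 4 2 x} (+-mul 5 (ex-4-2 y)) (ex-4-2 x))
          (Z.solve 2 (λ x y → let u = y Z.:- x ; v = k 0 Z.:+ y Z.:* k 3 in k 5 Z.:* (k 3 Z.:* (y Z.:* y) Z.:+ y) Z.:+ (k 3 Z.:* (x Z.:* x) Z.:+ x)
            Z.:= k 2 Z.:* (v Z.:* v) Z.:+ k 2 Z.:* v Z.:- k 2 Z.:* (v Z.:* u) Z.:- u Z.:+ k 3 Z.:* (u Z.:* u)) refl x y)))))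
    p (suc zero) = hasSum-cong {F = λ (y , x) → mono 4 ⊛ ((sz y · mono (5 ℕ.* ex 6 0 y)) ⊛ thetaFam (ℚ.- 1ℚ) 6 0 x)} same
      (hasSum-scale (mono 4) (hasSum-⊛ (hasSum-cong (sub₅-fam 6 0) (hasSum-sub 5 (theta-hasSum (ℚ.- 1ℚ) 6 0))) (theta-hasSum (ℚ.- 1ℚ) 6 0)))
      where
      same : ∀ yx → mono 4 ⊛ ((sz (proj₁ yx) · mono (5 ℕ.* ex 6 0 (proj₁ yx))) ⊛ thetaFam (ℚ.- 1ℚ) 6 0 (proj₂ yx)) ≋ G (f (suc zero , yx))
      same (y , x) = 𝕊.trans (𝕊.*-cong (𝕊.sym (coeffwise λ n → ℚₚ.*-identityˡ (mono 4 n))) (·-mono-⊛ (sz y) (sz x) a b)) (𝕊.trans (·-mono-⊛ 1ℚ (sz y ℚ.* sz x) 4 (a ℕ.+ b))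
        (·-mono-cong (trans (ℚₚ.*-identityˡ (sz y ℚ.* sz x)) (sign x y)) (sym (Two.exponent {f (suc zero , y , x)}
        (trans (+-sum {4} {a ℕ.+ b} refl (+-sum {a} {b} (+-mul 5 (ex-6-0 y)) (ex-6-0 x)))
          (Z.solve 2 (λ x y → let u = y Z.:- x ; v = k 1 Z.:+ y Z.:* k 3 in k 4 Z.:+ (k 5 Z.:* (k 3 Z.:* (y Z.:* y) Z.:+ k 3 Z.:* y) Z.:+ (k 3 Z.:* (x Z.:* x) Z.:+ k 3 Z.:* x))
            Z.:= k 2 Z.:* (v Z.:* v) Z.:+ k 2 Z.:* v Z.:- k 2 Z.:* (v Z.:* u) Z.:- u Z.:+ k 3 Z.:* (u Z.:* u)) refl x y))))))
        where
        a = 5 ℕ.* ex 6 0 y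
        b = ex 6 0 x
    -- The class 2 is the class 0 after v ↦ -1 - v in both variables; the two sign changes cancel.
    p (suc (suc zero)) = hasSum-cong {F = λ (y , x) → (sz (ℤ.- (+ 1) ℤ.- y) · mono (5 ℕ.* ex 4 2 (ℤ.- (+ 1) ℤ.- y))) ⊛ penta (ℤ.- (+ 1) ℤ.- x)} same
      (hasSum-⊛ (reflect {λ y → sz y · mono (5 ℕ.* ex 4 2 y)} penta₅-hasSum) (reflect penta-hasSum))
      where
      same : ∀ yx → (sz (ℤ.- (+ 1) ℤ.- proj₁ yx) · mono (5 ℕ.* ex 4 2 (ℤ.- (+ 1) ℤ.- proj₁ yx))) ⊛ penta (ℤ.- (+ 1) ℤ.- proj₂ yx) ≋ G (f (suc (suc zero) , yx))
      same (y , x) = 𝕊.trans (·-mono-⊛ (sz y′) (sz x′) (5 ℕ.* ex 4 2 y′) (ex 4 2 x′)) (·-mono-cong signs (sym (Two.exponent {f (suc (suc zero) , y , x)}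
        (trans (+-sum {5 ℕ.* ex 4 2 y′} {ex 4 2 x′} (+-mul 5 (ex-4-2 y′)) (ex-4-2 x′))
          (Z.solve 2 (λ x y → let u = y Z.:- x ; v = k 2 Z.:+ y Z.:* k 3 ; x′ = Z.:- k 1 Z.:- x ; y′ = Z.:- k 1 Z.:- y in k 5 Z.:* (k 3 Z.:* (y′ Z.:* y′) Z.:+ y′) Z.:+ (k 3 Z.:* (x′ Z.:* x′) Z.:+ x′)
            Z.:= k 2 Z.:* (v Z.:* v) Z.:+ k 2 Z.:* v Z.:- k 2 Z.:* (v Z.:* u) Z.:- u Z.:+ k 3 Z.:* (u Z.:* u)) refl x y)))))
        where
        x′ = ℤ.- (+ 1) ℤ.- x
        y′ = ℤ.- (+ 1) ℤ.- y
        signs : sz y′ ℚ.* sz x′ ≡ sz (y ℤ.- x)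
        signs = trans (cong₂ ℚ._*_ (sz-reflect y) (sz-reflect x)) (trans (Q.solve 2 (λ a b → Q.:- a Q.:* Q.:- b Q.:= a Q.:* b) refl (sz y) (sz x)) (sign x y))

    G-hasSum : HasSum (λ q → G (f q)) (sumFin 3 pieces)
    G-hasSum = hasSum-Fin 3 {λ q → G (f q)} p

  -- On the right the classes 0 and 2 each contribute f₂ f₁₀ and the middle class contributes zero
  -- by `theta-6-0`; the resulting factor 2 matches ψ̂ = 2ψ(q⁴) on the left.
  product : sub 10 φ ⊛ ψ̂ ⊕ (const (ℚ.- 1ℚ) ⊛ (mono 2 ⊛ (ψ̂₂₀ ⊛ sub 2 φ)) ⊕ zeroS) ≋ sub 5 (euler 2) ⊛ euler 2 ⊕ (mono 4 ⊛ (sub 5 (theta (ℚ.- 1ℚ) 6 0) ⊛ theta (ℚ.- 1ℚ) 6 0) ⊕ (sub 5 (euler 2) ⊛ euler 2 ⊕ zeroS))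
  product = hasSum-unique (Three.split Two.G-hasSum) Three.G-hasSum

-- Lambert series and the logarithmic derivative of Euler products.

divisorSum-suc-∣ : ∀ n d → suc d ∣ n → divisorSum n (suc d) ≡ divisorSum n d ℕ.+ suc d
divisorSum-suc-∣ n d d∣n with suc d ∣? n
... | yes _   = refl
... | no  d∤n = contradiction d∣n d∤n

-- m q^m/(1 - q^m), obtained by removing the constant term from the geometric series.
lambertTerm : ℕ → Series
lambertTerm zero    = zeroS
lambertTerm (suc m) = const (rat (suc m)) ⊛ (geomQ (suc m) ⊕ ⊖ oneS)

lambert : ℕ → Series
lambert zero    = zeroS
lambert (suc N) = lambert N ⊕ lambertTerm (suc N)

σS : Series
σS zero    = 0ℚ
σS (suc n) = rat (σ (suc n))

lambertTerm-∣ : ∀ m n → suc m ∣ suc n → lambertTerm (suc m) (suc n) ≡ rat (suc m)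
lambertTerm-∣ m n m∣n = trans (sym (·-const (rat (suc m)) (geomQ (suc m) ⊕ ⊖ oneS) .coeff (suc n))) (trans (cong (λ c → rat (suc m) ℚ.* (c ℚ.+ 0ℚ)) geom) (ℚₚ.*-identityʳ (rat (suc m))))
  where
  geom : geomQ (suc m) (suc n) ≡ 1ℚ
  geom with suc m ∣? suc n
  ... | yes _   = refl
  ... | no  m∤n = contradiction m∣n m∤n

lambertTerm-∤ : ∀ m n → ¬ (suc m ∣ suc n) → lambertTerm (suc m) (suc n) ≡ 0ℚ
lambertTerm-∤ m n m∤n = trans (sym (·-const (rat (suc m)) (geomQ (suc m) ⊕ ⊖ oneS) .coeff (suc n))) (trans (cong (λ c → rat (suc m) ℚ.* (c ℚ.+ 0ℚ)) geom) (ℚₚ.*-zeroʳ (rat (suc m))))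
  where
  geom : geomQ (suc m) (suc n) ≡ 0ℚ
  geom with suc m ∣? suc n
  ... | yes m∣n = contradiction m∣n m∤n
  ... | no  _   = refl

lambertTerm-0 : ∀ m → lambertTerm (suc m) 0 ≡ 0ℚ
lambertTerm-0 m = trans (cong (λ c → (rat (suc m) ℚ.* 1ℚ) ℚ.* (c ℚ.+ ℚ.- 1ℚ)) geom) (ℚₚ.*-zeroʳ (rat (suc m) ℚ.* 1ℚ))
  where
  geom : geomQ (suc m) 0 ≡ 1ℚ
  geom with suc m ∣? 0
  ... | yes _   = refl
  ... | no  m∤0 = contradiction (suc m ∣0) m∤0

lambert-coeff : ∀ n d → lambert d (suc n) ≡ rat (divisorSum (suc n) d)
lambert-coeff n zero    = refl
lambert-coeff n (suc d) with suc d ∣? suc n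
... | yes d∣n = trans (cong₂ ℚ._+_ (lambert-coeff n d) (lambertTerm-∣ d n d∣n)) (sym (rat-+ (divisorSum (suc n) d) (suc d)))
... | no  d∤n = trans (cong₂ ℚ._+_ (lambert-coeff n d) (lambertTerm-∤ d n d∤n)) (ℚₚ.+-identityʳ (rat (divisorSum (suc n) d)))

lambert-cauchy : Cauchy lambert
lambert-cauchy N = 𝕋.trans N (𝕋.+-congˡ N {lambert N} (upTo small)) (𝕋.+-identityʳ N (lambert N))
  where
  small : ∀ k → k ≤ N → lambertTerm (suc N) k ≡ 0ℚ
  small zero    _   = lambertTerm-0 N
  small (suc k) k<N = lambertTerm-∤ N k λ N∣k → ℕₚ.<⇒≱ (s≤s k<N) (∣⇒≤ N∣k)

lambert-conv : Conv lambert σS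
lambert-conv = conv-lim (coeffwise limit) (conv-diag lambert-cauchy)
  where
  limit : ∀ n → lambert n n ≡ σS n
  limit zero    = refl
  limit (suc n) = trans (lambert-coeff n (suc n)) (cong rat (trans (divisorSum-suc-∣ (suc n) n ∣-refl) (sym (σ-divisorSum n))))

D-factor : ∀ m → D (oneS ⊕ ⊖ mono (suc m)) ≋ ⊖ ((oneS ⊕ ⊖ mono (suc m)) ⊛ lambertTerm (suc m))
D-factor m = begin
  D (oneS ⊕ ⊖ x)                              ≈⟨ 𝕊.trans (D-⊕ oneS (⊖ x)) (𝕊.+-cong D-one (𝕊.trans (D-⊖ x) (𝕊.-‿cong (D-mono (suc m))))) ⟩
  zeroS ⊕ ⊖ (c ⊛ x)                           ≈⟨ solve 2 (λ c x → con (+ 0) :+ :- (c :* x) := :- (c :* (con (+ 1) :- (con (+ 1) :- x)))) 𝕊.refl c x ⟩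
  ⊖ (c ⊛ (oneS ⊕ ⊖ (oneS ⊕ ⊖ x)))             ≈⟨ 𝕊.-‿cong (𝕊.*-congˡ {c} (𝕊.+-congʳ {⊖ (oneS ⊕ ⊖ x)} (𝕊.sym (geomQ-inverse (suc m))))) ⟩
  ⊖ (c ⊛ (g ⊛ (oneS ⊕ ⊖ x) ⊕ ⊖ (oneS ⊕ ⊖ x))) ≈⟨ solve 3 (λ c g y → :- (c :* (g :* y :+ :- y)) := :- (y :* (c :* (g :+ :- con (+ 1))))) 𝕊.refl c g (oneS ⊕ ⊖ x) ⟩
  ⊖ ((oneS ⊕ ⊖ x) ⊛ (c ⊛ (g ⊕ ⊖ oneS)))       ∎
  where
  open ≋-Reasoning
  x = mono (suc m)
  c = const (rat (suc m))
  g = geomQ (suc m)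

eulerFactor : ℕ → Series
eulerFactor m = oneS ⊕ ⊖ mono m

D-prodUpTo : ∀ N → D (prodUpTo eulerFactor N) ≋ ⊖ (prodUpTo eulerFactor N ⊛ lambert N)
D-prodUpTo zero    = 𝕊.trans D-one (𝕊.sym (𝕊.trans (𝕊.-‿cong (𝕊.zeroʳ oneS)) (coeffwise λ n → refl)))
D-prodUpTo (suc N) = begin
  D (P ⊛ F)                                ≈⟨ D-⊛ P F ⟩
  D P ⊛ F ⊕ P ⊛ D F                        ≈⟨ 𝕊.+-cong (𝕊.*-congʳ {F} (D-prodUpTo N)) (𝕊.*-congˡ {P} (D-factor N)) ⟩
  ⊖ (P ⊛ l) ⊛ F ⊕ P ⊛ ⊖ (F ⊛ t)            ≈⟨ solve 4 (λ P F l t → (:- (P :* l)) :* F :+ P :* (:- (F :* t)) := :- (P :* F :* (l :+ t))) 𝕊.refl P F l t ⟩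
  ⊖ (P ⊛ F ⊛ (l ⊕ t))                      ∎
  where
  open ≋-Reasoning
  P = prodUpTo eulerFactor N
  F = eulerFactor (suc N)
  l = lambert N
  t = lambertTerm (suc N)

euler₁ : euler 1 ≋ infProd eulerFactor
euler₁ = infProd-cong λ m → 𝕊.+-congˡ {oneS} (𝕊.-‿cong (mono-cong (ℕₚ.*-identityˡ (suc m))))

D-euler₁ : D (euler 1) ≋ ⊖ (euler 1 ⊛ σS)
D-euler₁ = begin
  D (euler 1)                      ≈⟨ D-cong euler₁ ⟩
  D (infProd eulerFactor)          ≈⟨ conv-unique (λ n → let (M , p) = c n in M , λ N M≤N → D-≈ (p N M≤N))
                                        (conv-cong (λ N → 𝕊.sym (D-prodUpTo N)) (conv-⊖ (conv-⊛ c lambert-conv))) ⟩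
  ⊖ (infProd eulerFactor ⊛ σS)     ≈⟨ 𝕊.-‿cong (𝕊.*-congʳ {σS} (𝕊.sym euler₁)) ⟩
  ⊖ (euler 1 ⊛ σS)                 ∎
  where
  open ≋-Reasoning
  c = infProd-conv (unital-⊖mono (λ m → m) (λ m → ℕₚ.≤-refl))

D-euler : ∀ r .{{_ : NonZero r}} → D (euler r) ≋ ⊖ (euler r ⊛ (const (rat r) ⊛ sub r σS))
D-euler r = begin
  D (euler r)                                  ≈⟨ D-cong (𝕊.sym (at r)) ⟩
  D (sub r (euler 1))                          ≈⟨ D-sub r (euler 1) ⟩
  const (rat r) ⊛ sub r (D (euler 1))          ≈⟨ 𝕊.*-congˡ {const (rat r)} (𝕊.trans (sub-cong r D-euler₁) (𝕊.trans (sub-⊖ r (euler 1 ⊛ σS)) (𝕊.-‿cong (sub-⊛ r (euler 1) σS)))) ⟩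
  const (rat r) ⊛ ⊖ (sub r (euler 1) ⊛ sub r σS) ≈⟨ solve 3 (λ c e s → c :* (:- (e :* s)) := :- (e :* (c :* s))) 𝕊.refl (const (rat r)) (sub r (euler 1)) (sub r σS) ⟩
  ⊖ (sub r (euler 1) ⊛ (const (rat r) ⊛ sub r σS)) ≈⟨ 𝕊.-‿cong (𝕊.*-congʳ {const (rat r) ⊛ sub r σS} (at r)) ⟩
  ⊖ (euler r ⊛ (const (rat r) ⊛ sub r σS))     ∎
  where
  open ≋-Reasoning
  at : ∀ r .{{_ : NonZero r}} → sub r (euler 1) ≋ euler r
  at r = 𝕊.trans (sub-euler r 1) (infProd-cong λ m → 𝕊.+-congˡ {oneS} (𝕊.-‿cong (mono-cong (cong (ℕ._* suc m) (ℕₚ.*-identityʳ r)))))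

L≋ : L ≋ const (ℚ.- (1 // 24)) ⊕ σS
L≋ = coeffwise λ { zero → refl ; (suc n) → sym (trans (cong (ℚ._+ rat (σ (suc n))) (ℚₚ.*-zeroʳ (ℚ.- (1 // 24)))) (ℚₚ.+-identityˡ (rat (σ (suc n))))) }

-- Integer multiples under substitution, sign change and differentiation.

open RingIdentities seriesRing

#-const : ∀ n → # n ≋ const (rat n)
#-const zero    = coeffwise λ n → sym (ℚₚ.*-zeroˡ (oneS n))
#-const (suc n) = 𝕊.trans (1+× n oneS) (𝕊.trans (𝕊.+-congˡ {oneS} (#-const n)) (coeffwise λ j →
    sym (trans (cong (ℚ._* oneS j) (rat-+ 1 n)) (trans (ℚₚ.*-distribʳ-+ (oneS j) 1ℚ (rat n)) (cong (ℚ._+ rat n ℚ.* oneS j) (ℚₚ.*-identityˡ (oneS j)))))))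
  where open Algebra.Properties.Semiring.Mult.TCOptimised 𝕊.semiring using (1+×)

#-⊛ : ∀ n f → # n ⊛ f ≋ rat n · f
#-⊛ n f = 𝕊.trans (𝕊.*-congʳ {f} (#-const n)) (𝕊.sym (·-const (rat n) f))

#-cancel : ∀ n (c : ℚ) → c ℚ.* rat n ≡ 1ℚ → ∀ {f g} → # n ⊛ f ≋ # n ⊛ g → f ≋ g
#-cancel n c c⁻¹ {f} {g} e = 𝕊.trans (𝕊.sym (undo f)) (𝕊.trans (𝕊.*-congˡ {const c} e) (undo g))
  where
  undo : ∀ f → const c ⊛ (# n ⊛ f) ≋ f
  undo f = 𝕊.trans (𝕊.*-congˡ {const c} (#-⊛ n f)) (𝕊.trans (𝕊.sym (·-const c (rat n · f))) (coeffwise λ j →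
    trans (sym (ℚₚ.*-assoc c (rat n) (f j))) (trans (cong (ℚ._* f j) c⁻¹) (ℚₚ.*-identityˡ (f j)))))

sub-# : ∀ k .{{_ : NonZero k}} n → sub k (# n) ≋ # n
sub-# k n = 𝕊.trans (sub-cong k (#-const n)) (𝕊.trans (sub-const k (rat n)) (𝕊.sym (#-const n)))

sub-#⊛ : ∀ k .{{_ : NonZero k}} n f → sub k (# n ⊛ f) ≋ # n ⊛ sub k f
sub-#⊛ k n f = 𝕊.trans (sub-⊛ k (# n) f) (𝕊.*-congʳ {sub k f} (sub-# k n))

sub-diff : ∀ k .{{_ : NonZero k}} f g → sub k (f ⊕ ⊖ g) ≋ sub k f ⊕ ⊖ sub k g
sub-diff k f g = 𝕊.trans (sub-⊕ k f (⊖ g)) (𝕊.+-congˡ {sub k f} (sub-⊖ k g))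

D-# : ∀ n → D (# n) ≋ zeroS
D-# n = 𝕊.trans (D-cong (#-const n)) (coeffwise step)
  where
  step : ∀ j → rat j ℚ.* (rat n ℚ.* oneS j) ≡ 0ℚ
  step zero    = ℚₚ.*-zeroˡ (rat n ℚ.* oneS 0)
  step (suc j) = trans (cong (rat (suc j) ℚ.*_) (ℚₚ.*-zeroʳ (rat n))) (ℚₚ.*-zeroʳ (rat (suc j)))

D-#⊛ : ∀ n f → D (# n ⊛ f) ≋ # n ⊛ D f
D-#⊛ n f = 𝕊.trans (D-⊛ (# n) f) (𝕊.trans (𝕊.+-congʳ {# n ⊛ D f} (𝕊.trans (𝕊.*-congʳ {f} (D-# n)) (𝕊.zeroˡ f))) (𝕊.+-identityˡ (# n ⊛ D f)))

D-diff : ∀ f g → D (f ⊕ ⊖ g) ≋ D f ⊕ ⊖ D g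
D-diff f g = 𝕊.trans (D-⊕ f (⊖ g)) (𝕊.+-congˡ {D f} (D-⊖ g))

-- Logarithmic derivatives

-- Stated without a quotient, so that series with zero constant term such as A₁ are covered.
record LogD (f ℓ : Series) : Set where
  constructor logD
  field
    derivative : D f ≋ f ⊛ ℓ
open LogD public

logD-⊛ : ∀ {f g ℓ m} → LogD f ℓ → LogD g m → LogD (f ⊛ g) (ℓ ⊕ m)
logD-⊛ {f} {g} {ℓ} {m} p r .derivative = begin
  D (f ⊛ g)                        ≈⟨ D-⊛ f g ⟩
  D f ⊛ g ⊕ f ⊛ D g                ≈⟨ 𝕊.+-cong (𝕊.*-congʳ {g} (p .derivative)) (𝕊.*-congˡ {f} (r .derivative)) ⟩
  f ⊛ ℓ ⊛ g ⊕ f ⊛ (g ⊛ m)          ≈⟨ solve 4 (λ f g l m → f :* l :* g :+ f :* (g :* m) := f :* g :* (l :+ m)) 𝕊.refl f g ℓ m ⟩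
  f ⊛ g ⊛ (ℓ ⊕ m)                  ∎
  where open ≋-Reasoning

logD-cong : ∀ {f g ℓ m} → f ≋ g → ℓ ≋ m → LogD f ℓ → LogD g m
logD-cong {f} {g} {ℓ} {m} e e′ p .derivative = 𝕊.trans (D-cong (𝕊.sym e)) (𝕊.trans (p .derivative) (𝕊.*-cong e e′))

logD-divide : ∀ {f g h ℓ m} → f 0 ≡ 1ℚ → LogD f ℓ → LogD h m → f ⊛ g ≋ h → LogD g (m ⊕ ⊖ ℓ)
logD-divide {f} {g} {h} {ℓ} {m} f0 p r e .derivative = ⊛-cancel-unit f f0 (begin
  f ⊛ D g                                          ≈⟨ solve 4 (λ f Dg Df g → f :* Dg := (Df :* g :+ f :* Dg) :- Df :* g) 𝕊.refl f (D g) (D f) g ⟩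
  (D f ⊛ g ⊕ f ⊛ D g) ⊕ ⊖ (D f ⊛ g)                ≈⟨ 𝕊.+-cong (𝕊.trans (𝕊.sym (D-⊛ f g)) (𝕊.trans (D-cong e) (r .derivative))) (𝕊.-‿cong (𝕊.*-congʳ {g} (p .derivative))) ⟩
  h ⊛ m ⊕ ⊖ (f ⊛ ℓ ⊛ g)                            ≈⟨ 𝕊.+-congʳ {⊖ (f ⊛ ℓ ⊛ g)} (𝕊.*-congʳ {m} (𝕊.sym e)) ⟩
  f ⊛ g ⊛ m ⊕ ⊖ (f ⊛ ℓ ⊛ g)                        ≈⟨ solve 4 (λ f g l m → f :* g :* m :+ :- (f :* l :* g) := f :* (g :* (m :+ :- l))) 𝕊.refl f g ℓ m ⟩
  f ⊛ (g ⊛ (m ⊕ ⊖ ℓ))                              ∎)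
  where open ≋-Reasoning

logD-sub : ∀ k .{{_ : NonZero k}} {f ℓ} → LogD f ℓ → LogD (sub k f) (# k ⊛ sub k ℓ)
logD-sub k {f} {ℓ} p .derivative = begin
  D (sub k f)                          ≈⟨ D-sub k f ⟩
  const (rat k) ⊛ sub k (D f)          ≈⟨ 𝕊.*-cong (𝕊.sym (#-const k)) (𝕊.trans (sub-cong k (p .derivative)) (sub-⊛ k f ℓ)) ⟩
  # k ⊛ (sub k f ⊛ sub k ℓ)            ≈⟨ solve 3 (λ k f l → k :* (f :* l) := f :* (k :* l)) 𝕊.refl (# k) (sub k f) (sub k ℓ) ⟩
  sub k f ⊛ (# k ⊛ sub k ℓ)            ∎
  where open ≋-Reasoning

-- Adding it removes the constant term -1/24 of L. In the quotients for φ(q) and φ(-q) the multiples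
-- of κ cancel; in A₁ they amount to -24κ = -1 and cancel the logarithmic derivative of the leading
-- q.
κ : Series
κ = const (1 // 24)

σS≋ : σS ≋ L ⊕ κ
σS≋ = coeffwise λ n → sym (trans (cong (ℚ._+ κ n) (L≋ .coeff n)) (Q.solve 2 (λ x s → (Q.con (ℚ.- (1 // 24)) Q.:* x Q.:+ s) Q.:+ Q.con (1 // 24) Q.:* x Q.:= s) refl (oneS n) (σS n)))

logD-euler : ∀ r .{{_ : NonZero r}} → LogD (euler r) (⊖ (# r ⊛ (sub r L ⊕ κ)))
logD-euler r .derivative = begin
  D (euler r)                                       ≈⟨ D-euler r ⟩
  ⊖ (euler r ⊛ (const (rat r) ⊛ sub r σS))          ≈⟨ 𝕊.-‿cong (𝕊.*-congˡ {euler r} (𝕊.*-cong (𝕊.sym (#-const r)) (𝕊.trans (sub-cong r σS≋) (𝕊.trans (sub-⊕ r L κ) (𝕊.+-congˡ {sub r L} (sub-const r (1 // 24))))))) ⟩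
  ⊖ (euler r ⊛ (# r ⊛ (sub r L ⊕ κ)))               ≈⟨ solve 2 (λ e x → :- (e :* x) := e :* (:- x)) 𝕊.refl (euler r) (# r ⊛ (sub r L ⊕ κ)) ⟩
  euler r ⊛ ⊖ (# r ⊛ (sub r L ⊕ κ))                 ∎
  where open ≋-Reasoning

-- Jacobi's four-square theorem.

a u b v : Series
a = φ
u = alt φ
b = sub 2 φ
v = sub 2 u

e₁ e₂ e₄ e₈ : Series
e₁ = euler 1
e₂ = euler 2
e₄ = euler 4
e₈ = euler 8

o₂ : Series
o₂ = sub 2 o

o₂⊛e₄ : o₂ ⊛ e₄ ≋ e₂
o₂⊛e₄ = 𝕊.trans (𝕊.*-congˡ {o₂} (𝕊.sym (sub-euler 2 2))) (𝕊.trans (𝕊.sym (sub-⊛ 2 o e₂)) (𝕊.trans (sub-cong 2 o⊛euler₂) (sub-euler 2 1)))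

O-product : O ⊛ (e₁ ⊛ e₄) ≋ e₂ ⊛ e₂
O-product = begin
  O ⊛ (e₁ ⊛ e₄)                ≈⟨ 𝕊.*-congˡ {O} (𝕊.*-congʳ {e₄} (𝕊.sym o⊛euler₂)) ⟩
  O ⊛ (o ⊛ e₂ ⊛ e₄)            ≈⟨ solve 4 (λ O o e f → O :* (o :* e :* f) := (O :* o) :* f :* e) 𝕊.refl O o e₂ e₄ ⟩
  O ⊛ o ⊛ e₄ ⊛ e₂              ≈⟨ 𝕊.*-congʳ {e₂} (𝕊.trans (𝕊.*-congʳ {e₄} O⊛o) o₂⊛e₄) ⟩
  e₂ ⊛ e₂                      ∎
  where open ≋-Reasoning

a-product : (e₁ ⊛ e₄) ⊛ (e₁ ⊛ e₄) ⊛ a ≋ e₂ ⊛ (e₂ ⊛ e₂) ⊛ (e₂ ⊛ e₂)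
a-product = begin
  (e₁ ⊛ e₄) ⊛ (e₁ ⊛ e₄) ⊛ a                    ≈⟨ 𝕊.*-congˡ {(e₁ ⊛ e₄) ⊛ (e₁ ⊛ e₄)} φ≋ ⟩
  (e₁ ⊛ e₄) ⊛ (e₁ ⊛ e₄) ⊛ (e₂ ⊛ (O ⊛ O))       ≈⟨ solve 3 (λ x e O → x :* x :* (e :* (O :* O)) := e :* (O :* x) :* (O :* x)) 𝕊.refl (e₁ ⊛ e₄) e₂ O ⟩
  e₂ ⊛ (O ⊛ (e₁ ⊛ e₄)) ⊛ (O ⊛ (e₁ ⊛ e₄))       ≈⟨ 𝕊.*-cong (𝕊.*-congˡ {e₂} O-product) O-product ⟩
  e₂ ⊛ (e₂ ⊛ e₂) ⊛ (e₂ ⊛ e₂)                   ∎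
  where open ≋-Reasoning

u-product : e₂ ⊛ u ≋ e₁ ⊛ e₁
u-product = 𝕊.trans (𝕊.*-congˡ {e₂} altφ≋) (𝕊.trans (solve 2 (λ e o → e :* (e :* (o :* o)) := (o :* e) :* (o :* e)) 𝕊.refl e₂ o) (𝕊.*-cong o⊛euler₂ o⊛euler₂))

-- The factors 1 + q^(2m-1) and 1 - q^(2m-1) multiply to the odd factors at q², and half of what
-- remains of f₂ completes φ(-q²).
au : a ⊛ u ≋ v ⊛ v
au = begin
  a ⊛ u                                        ≈⟨ 𝕊.*-cong φ≋ altφ≋ ⟩
  (e₂ ⊛ (O ⊛ O)) ⊛ (e₂ ⊛ (o ⊛ o))              ≈⟨ solve 3 (λ e O o → (e :* (O :* O)) :* (e :* (o :* o)) := (e :* (O :* o)) :* (e :* (O :* o))) 𝕊.refl e₂ O o ⟩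
  (e₂ ⊛ (O ⊛ o)) ⊛ (e₂ ⊛ (O ⊛ o))              ≈⟨ 𝕊.*-cong half half ⟩
  v ⊛ v                                        ∎
  where
  open ≋-Reasoning
  half : e₂ ⊛ (O ⊛ o) ≋ v
  half = begin
    e₂ ⊛ (O ⊛ o)             ≈⟨ 𝕊.*-cong (𝕊.sym o₂⊛e₄) O⊛o ⟩
    o₂ ⊛ e₄ ⊛ o₂             ≈⟨ solve 2 (λ o e → o :* e :* o := e :* (o :* o)) 𝕊.refl o₂ e₄ ⟩
    e₄ ⊛ (o₂ ⊛ o₂)           ≈⟨ 𝕊.sym (𝕊.trans (sub-cong 2 altφ≋) (𝕊.trans (sub-⊛ 2 e₂ (o ⊛ o)) (𝕊.*-cong (sub-euler 2 2) (sub-⊛ 2 o o)))) ⟩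
    v                        ∎

L₁ L₂ L₄ L₈ : Series
L₁ = L
L₂ = sub 2 L
L₄ = sub 4 L
L₈ = sub 8 L

module 𝓔₁ = Eisenstein L₁ L₂ L₄
module 𝓔₂ = Eisenstein L₂ L₄ L₈

sub₂L₂ : sub 2 L₂ ≋ L₄
sub₂L₂ = sub-sub 2 2 L

sub₂L₄ : sub 2 L₄ ≋ L₈
sub₂L₄ = sub-sub 2 4 L

sub₁L : sub 1 L ≋ L
sub₁L = coeffwise step
  where
  step : ∀ n → sub 1 L n ≡ L n
  step n = trans (sub-∣ 1 L (divides n (sym (ℕₚ.*-identityʳ n)))) (cong L (n/1≡n n))

sub-lin₃ : ∀ k .{{_ : NonZero k}} p q r f g h → sub k (# p ⊛ f ⊕ ⊖ (# q ⊛ g) ⊕ # r ⊛ h) ≋ # p ⊛ sub k f ⊕ ⊖ (# q ⊛ sub k g) ⊕ # r ⊛ sub k h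
sub-lin₃ k p q r f g h = 𝕊.trans (sub-⊕ k (# p ⊛ f ⊕ ⊖ (# q ⊛ g)) (# r ⊛ h)) (𝕊.+-cong (𝕊.trans (sub-diff k (# p ⊛ f) (# q ⊛ g)) (𝕊.+-cong (sub-#⊛ k p f) (𝕊.-‿cong (sub-#⊛ k q g)))) (sub-#⊛ k r h))

sub₂e : sub 2 𝓔₁.e ≋ 𝓔₂.e
sub₂e = 𝕊.trans (sub-lin₃ 2 2 10 8 L₁ L₂ L₄) (𝕊.+-cong (𝕊.+-congˡ {# 2 ⊛ L₂} (𝕊.-‿cong (𝕊.*-congˡ {# 10} sub₂L₂))) (𝕊.*-congˡ {# 8} sub₂L₄))

sub₂δ : sub 2 𝓔₁.δ ≋ 𝓔₂.δ
sub₂δ = 𝕊.trans (sub-lin₃ 2 4 12 8 L₁ L₂ L₄) (𝕊.+-cong (𝕊.+-congˡ {# 4 ⊛ L₂} (𝕊.-‿cong (𝕊.*-congˡ {# 12} sub₂L₂))) (𝕊.*-congˡ {# 8} sub₂L₄))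

sub₂u⁴ : sub 2 𝓔₁.u⁴ ≋ 𝓔₂.u⁴
sub₂u⁴ = 𝕊.trans (sub-diff 2 (# 48 ⊛ L₂ ⊕ ⊖ (# 8 ⊛ L₁)) (# 64 ⊛ L₄)) (𝕊.+-cong
  (𝕊.trans (sub-diff 2 (# 48 ⊛ L₂) (# 8 ⊛ L₁)) (𝕊.+-cong (𝕊.trans (sub-#⊛ 2 48 L₂) (𝕊.*-congˡ {# 48} sub₂L₂)) (𝕊.-‿cong (sub-#⊛ 2 8 L₁))))
  (𝕊.-‿cong (𝕊.trans (sub-#⊛ 2 64 L₄) (𝕊.*-congˡ {# 64} sub₂L₄))))

logD-a : LogD a 𝓔₁.e
logD-a = logD-cong 𝕊.refl eq (logD-divide refl (logD-⊛ (logD-⊛ ℓ₁ ℓ₄) (logD-⊛ ℓ₁ ℓ₄)) (logD-⊛ (logD-⊛ ℓ₂ (logD-⊛ ℓ₂ ℓ₂)) (logD-⊛ ℓ₂ ℓ₂)) a-product)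
  where
  ℓ₁ = logD-euler 1
  ℓ₂ = logD-euler 2
  ℓ₄ = logD-euler 4
  m : ℕ → Series → Series
  m r f = ⊖ (# r ⊛ (f ⊕ κ))
  eq : (m 2 L₂ ⊕ (m 2 L₂ ⊕ m 2 L₂)) ⊕ (m 2 L₂ ⊕ m 2 L₂) ⊕ ⊖ ((m 1 (sub 1 L) ⊕ m 4 L₄) ⊕ (m 1 (sub 1 L) ⊕ m 4 L₄)) ≋ 𝓔₁.e
  eq = 𝕊.trans (𝕊.+-congˡ {(m 2 L₂ ⊕ (m 2 L₂ ⊕ m 2 L₂)) ⊕ (m 2 L₂ ⊕ m 2 L₂)} (𝕊.-‿cong (𝕊.+-cong one one)))
    (solve 4 (λ a b c κ → let m : ℕ → Polynomial 4 → Polynomial 4 ; m r f = :- (con (+ r) :* (f :+ κ)) in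
      (m 2 b :+ (m 2 b :+ m 2 b)) :+ (m 2 b :+ m 2 b) :+ :- ((m 1 a :+ m 4 c) :+ (m 1 a :+ m 4 c)) := con (+ 2) :* a :- con (+ 10) :* b :+ con (+ 8) :* c) 𝕊.refl L₁ L₂ L₄ κ)
    where
    one : m 1 (sub 1 L) ⊕ m 4 L₄ ≋ m 1 L ⊕ m 4 L₄
    one = 𝕊.+-congʳ {m 4 L₄} (𝕊.-‿cong (𝕊.*-congˡ {# 1} (𝕊.+-congʳ {κ} sub₁L)))

logD-u : LogD u 𝓔₁.e⁻
logD-u = logD-cong 𝕊.refl eq (logD-divide refl (logD-euler 2) (logD-⊛ (logD-euler 1) (logD-euler 1)) u-product)
  where
  m : ℕ → Series → Series
  m r f = ⊖ (# r ⊛ (f ⊕ κ))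
  eq : m 1 (sub 1 L) ⊕ m 1 (sub 1 L) ⊕ ⊖ m 2 L₂ ≋ 𝓔₁.e⁻
  eq = 𝕊.trans (𝕊.+-congʳ {⊖ m 2 L₂} (𝕊.+-cong one one))
    (solve 3 (λ a b κ → let m : ℕ → Polynomial 3 → Polynomial 3 ; m r f = :- (con (+ r) :* (f :+ κ)) in
      m 1 a :+ m 1 a :+ :- m 2 b := con (+ 2) :* b :- con (+ 2) :* a) 𝕊.refl L₁ L₂ κ)
    where
    one : m 1 (sub 1 L) ≋ m 1 L
    one = 𝕊.-‿cong (𝕊.*-congˡ {# 1} (𝕊.+-congʳ {κ} sub₁L))

logD-b : LogD b (# 2 ⊛ 𝓔₂.e)
logD-b = logD-cong 𝕊.refl (𝕊.*-congˡ {# 2} sub₂e) (logD-sub 2 logD-a)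

X U Y : Series
X = a ⊛ a
U = u ⊛ u
Y = b ⊛ b

ψ̂-even : alt ψ̂ ≋ ψ̂
ψ̂-even = 𝕊.trans (alt-cong eq) (𝕊.trans (alt-sub₂ (theta 1ℚ 2 0)) (𝕊.sym eq))
  where
  eq : ψ̂ ≋ sub 2 (theta 1ℚ 2 0)
  eq = hasSum-unique (theta₁-hasSum 4 0) (hasSum-cong (λ x → 𝕊.trans (sub-mono 2 (ex 2 0 x)) (mono-cong (double x))) (hasSum-sub 2 (theta₁-hasSum 2 0)))
    where
    double : ∀ x → 2 ℕ.* ex 2 0 x ≡ ex 4 0 x
    double (+ n)    = ℕS.solve 1 (λ t → ℕS.con 2 ℕS.:* (ℕS.con 2 ℕS.:* t ℕS.:+ ℕS.con 0) ℕS.:= ℕS.con 4 ℕS.:* t ℕS.:+ ℕS.con 0) refl (tri (suc n))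
    double -[1+ n ] = ℕS.solve 1 (λ t → ℕS.con 2 ℕS.:* (ℕS.con 2 ℕS.:* t ℕS.:+ ℕS.con 0) ℕS.:= ℕS.con 4 ℕS.:* t ℕS.:+ ℕS.con 0) refl (tri (suc n))

ψ̂² : Series
ψ̂² = ψ̂ ⊛ ψ̂

U≋ : U ≋ Y ⊕ ⊖ (mono 1 ⊛ ψ̂²)
U≋ = begin
  alt a ⊛ alt a                      ≈⟨ 𝕊.sym (alt-⊛ a a) ⟩
  alt (a ⊛ a)                        ≈⟨ 𝕊.trans (alt-cong SquareSplitting.φ²) (alt-⊕ Y (mono 1 ⊛ ψ̂²)) ⟩
  alt Y ⊕ alt (mono 1 ⊛ ψ̂²)          ≈⟨ 𝕊.+-cong (𝕊.trans (alt-⊛ b b) (𝕊.*-cong (alt-sub₂ φ) (alt-sub₂ φ)))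
                                          (𝕊.trans (alt-⊛ (mono 1) ψ̂²) (𝕊.*-cong (𝕊.trans (alt-mono 1) (const-neg-1 (mono 1))) (𝕊.trans (alt-⊛ ψ̂ ψ̂) (𝕊.*-cong ψ̂-even ψ̂-even)))) ⟩
  Y ⊕ ⊖ mono 1 ⊛ ψ̂²                  ≈⟨ 𝕊.+-congˡ {Y} (solve 2 (λ q p → :- q :* p := :- (q :* p)) 𝕊.refl (mono 1) ψ̂²) ⟩
  Y ⊕ ⊖ (mono 1 ⊛ ψ̂²)                ∎
  where open ≋-Reasoning

sum : X ⊕ U ≋ # 2 ⊛ Y
sum = 𝕊.trans (𝕊.+-cong SquareSplitting.φ² U≋) (solve 2 (λ Y p → (Y :+ p) :+ (Y :+ :- p) := con (+ 2) :* Y) 𝕊.refl Y (mono 1 ⊛ ψ̂²))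

X-Y : X ⊕ ⊖ Y ≋ # 4 ⊛ (mono 1 ⊛ (ψ₄ ⊛ ψ₄))
X-Y = 𝕊.trans (𝕊.+-congʳ {⊖ Y} (𝕊.trans SquareSplitting.φ² (𝕊.+-congˡ {Y} (𝕊.*-congˡ {mono 1} (𝕊.*-cong theta-4-0 theta-4-0)))))
  (solve 3 (λ Y q p → (Y :+ q :* ((p :+ p) :* (p :+ p))) :+ :- Y := con (+ 4) :* (q :* (p :* p))) 𝕊.refl Y (mono 1) ψ₄)

X-U : X ⊕ ⊖ U ≋ # 8 ⊛ (mono 1 ⊛ (ψ₄ ⊛ ψ₄))
X-U = linear₂ {X ⊕ ⊖ U} {# 8 ⊛ p} {X ⊕ ⊖ Y} {# 4 ⊛ p} {X ⊕ U} {# 2 ⊛ Y} (# 2) (⊖ # 1)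
  (solve 4 (λ X U Y p → (X :- U) :- con (+ 8) :* p := con (+ 2) :* ((X :- Y) :- con (+ 4) :* p) :+ (:- con (+ 1)) :* ((X :+ U) :- con (+ 2) :* Y)) 𝕊.refl X U Y p) X-Y sum
  where p = mono 1 ⊛ (ψ₄ ⊛ ψ₄)

δ-eq : (X ⊕ ⊖ U) ⊛ 𝓔₁.δ ≋ # 8 ⊛ (Y ⊛ 𝓔₂.δ)
δ-eq = δ-equation {X} {U} {Y} {L₁} {L₂} {L₄} {L₈} sum (begin
  X ⊛ (𝓔₁.e ⊕ 𝓔₁.e) ⊕ U ⊛ (𝓔₁.e⁻ ⊕ 𝓔₁.e⁻)       ≈⟨ 𝕊.+-cong (𝕊.sym (logD-⊛ logD-a logD-a .derivative)) (𝕊.sym (logD-⊛ logD-u logD-u .derivative)) ⟩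
  D X ⊕ D U                                     ≈⟨ 𝕊.sym (D-⊕ X U) ⟩
  D (X ⊕ U)                                     ≈⟨ D-cong sum ⟩
  D (# 2 ⊛ Y)                                   ≈⟨ D-#⊛ 2 Y ⟩
  # 2 ⊛ D Y                                     ≈⟨ 𝕊.*-congˡ {# 2} (logD-⊛ logD-b logD-b .derivative) ⟩
  # 2 ⊛ (Y ⊛ (# 2 ⊛ 𝓔₂.e ⊕ # 2 ⊛ 𝓔₂.e))         ∎)
  where open ≋-Reasoning

sub₂U : sub 2 U ≋ a ⊛ u
sub₂U = 𝕊.trans (sub-⊛ 2 u u) (𝕊.sym au)

sub₂U² : sub 2 (U ⊛ U) ≋ X ⊛ U
sub₂U² = 𝕊.trans (sub-⊛ 2 U U) (𝕊.trans (𝕊.*-cong sub₂U sub₂U) (solve 2 (λ a u → (a :* u) :* (a :* u) := (a :* a) :* (u :* u)) 𝕊.refl a u))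

sub₂X : sub 2 X ≋ Y
sub₂X = sub-⊛ 2 a a

sub₂-≈0 : ∀ {n N f} → f ≈[ n ] zeroS → N < suc n ℕ.* 2 → sub 2 f ≈[ N ] zeroS
sub₂-≈0 {n} {N} {f} p N< = upTo step
  where
  step : ∀ i → i ≤ N → sub 2 f i ≡ 0ℚ
  step i i≤N with 2 ∣? i
  ... | yes _ = p .below (i / 2) (ℕ.s≤s⁻¹ (m<n*o⇒m/o<n {i} {suc n} (ℕₚ.≤-<-trans i≤N N<)))
  ... | no  _ = refl

-- If f vanishes through q^n, then f(q²) vanishes through q^(2n+1), so the order of vanishing grows
-- without bound.
fixed-by-sub₂ : ∀ {f} → f ≋ sub 2 f → f 0 ≡ 0ℚ → f ≋ zeroS
fixed-by-sub₂ {f} e f0 = ≈⇒≋ go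
  where
  go : ∀ n → f ≈[ n ] zeroS
  go zero    = upTo λ { zero _ → f0 }
  go (suc n) = 𝕋.trans (suc n) (≋⇒≈ e) (sub₂-≈0 (go n) (s≤s (s≤s (ℕₚ.m≤m*n n 2))))

-- Substituting q² doubles the order of vanishing and dividing by q costs one. There is a net gain
-- only from order 2 on, which is why the coefficients of q⁰ and q¹ must be given.
shift-equation : ∀ {d g h} → g 0 ≡ 1ℚ → mono 1 ⊛ (g ⊛ d) ≋ h ⊛ sub 2 d → d 0 ≡ 0ℚ → d 1 ≡ 0ℚ → d ≋ zeroS
shift-equation {d} {g} {h} g0 e d0 d1 = ≈⇒≋ λ { zero → ≈-weaken z≤n (go 0) ; (suc n) → go n }
  where
  go : ∀ n → d ≈[ suc n ] zeroS
  go zero    = upTo λ { zero _ → d0 ; (suc zero) _ → d1 ; (suc (suc k)) (s≤s ()) }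
  go (suc n) = ⊛-cancel-unit-≈ g g0 (𝕋.trans (suc (suc n)) cut (𝕋.sym (suc (suc n)) (𝕋.zeroʳ (suc (suc n)) g)))
    where
    N = suc (suc (suc n))
    N< : N < suc (suc n) ℕ.* 2
    N< = s≤s (s≤s (s≤s (s≤s (ℕₚ.m≤m*n n 2))))
    shifted : mono 1 ⊛ (g ⊛ d) ≈[ N ] zeroS
    shifted = 𝕋.trans N (≋⇒≈ e) (𝕋.trans N (𝕋.*-congˡ N {h} (sub₂-≈0 (go n) N<)) (𝕋.zeroʳ N h))
    cut : g ⊛ d ≈[ suc (suc n) ] zeroS
    cut = upTo λ i i≤ → trans (sym (mono-⊛ 1 (g ⊛ d) .coeff (suc i))) (shifted .below (suc i) (s≤s i≤))

-- `d` is the error in the expected equality of Δ and 4δ.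
Δ d : Series
Δ = X ⊛ X ⊕ ⊖ (U ⊛ U)
d = # 4 ⊛ 𝓔₁.δ ⊕ ⊖ Δ

sub₂Δ : sub 2 Δ ≋ Y ⊛ Y ⊕ ⊖ (X ⊛ U)
sub₂Δ = 𝕊.trans (sub-diff 2 (X ⊛ X) (U ⊛ U)) (𝕊.+-cong (𝕊.trans (sub-⊛ 2 X X) (𝕊.*-cong sub₂X sub₂X)) (𝕊.-‿cong sub₂U²))

-- Both 4δ and Δ satisfy (X - U) f = 8 Y f(q²). As X - U = 8 q ψ(q⁴)², the 8 cancels and the factor
-- q required by `shift-equation` remains.
d-equation : mono 1 ⊛ (ψ₄ ⊛ ψ₄ ⊛ d) ≋ Y ⊛ sub 2 d
d-equation = #-cancel 8 (1 // 8) refl (begin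
  # 8 ⊛ (mono 1 ⊛ (ψ₄ ⊛ ψ₄ ⊛ d))                         ≈⟨ solve 4 (λ e q p d → e :* (q :* (p :* d)) := (e :* (q :* p)) :* d) 𝕊.refl (# 8) (mono 1) (ψ₄ ⊛ ψ₄) d ⟩
  (# 8 ⊛ (mono 1 ⊛ (ψ₄ ⊛ ψ₄))) ⊛ d                       ≈⟨ 𝕊.*-congʳ {d} (𝕊.sym X-U) ⟩
  (X ⊕ ⊖ U) ⊛ d                                          ≈⟨ solve 4 (λ w f δ Δ → w :* (f :* δ :- Δ) := f :* (w :* δ) :- w :* Δ) 𝕊.refl (X ⊕ ⊖ U) (# 4) 𝓔₁.δ Δ ⟩
  # 4 ⊛ ((X ⊕ ⊖ U) ⊛ 𝓔₁.δ) ⊕ ⊖ ((X ⊕ ⊖ U) ⊛ Δ)          ≈⟨ 𝕊.+-cong (𝕊.*-congˡ {# 4} δ-eq) (𝕊.-‿cong (Δ-equation {X} {U} {Y} {L₁} {L₂} {L₄} {L₈} sum)) ⟩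
  # 4 ⊛ (# 8 ⊛ (Y ⊛ 𝓔₂.δ)) ⊕ ⊖ (# 8 ⊛ (Y ⊛ (Y ⊛ Y ⊕ ⊖ (X ⊛ U))))
    ≈⟨ solve 5 (λ f e Y δ Δ → f :* (e :* (Y :* δ)) :- e :* (Y :* Δ) := e :* (Y :* (f :* δ :- Δ))) 𝕊.refl (# 4) (# 8) Y 𝓔₂.δ (Y ⊛ Y ⊕ ⊖ (X ⊛ U)) ⟩
  # 8 ⊛ (Y ⊛ (# 4 ⊛ 𝓔₂.δ ⊕ ⊖ (Y ⊛ Y ⊕ ⊖ (X ⊛ U))))      ≈⟨ 𝕊.*-congˡ {# 8} (𝕊.*-congˡ {Y} (𝕊.sym (𝕊.trans (sub-diff 2 (# 4 ⊛ 𝓔₁.δ) Δ) (𝕊.+-cong (𝕊.trans (sub-#⊛ 2 4 𝓔₁.δ) (𝕊.*-congˡ {# 4} sub₂δ)) (𝕊.-‿cong sub₂Δ))))) ⟩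
  # 8 ⊛ (Y ⊛ sub 2 d)                                    ∎)
  where open ≋-Reasoning

X²-U² : Δ ≋ # 4 ⊛ 𝓔₁.δ
-- The last two `refl` evaluate the coefficients of q⁰ and q¹ in `d`.
X²-U² = 𝕊.sym (from-difference {# 4 ⊛ 𝓔₁.δ} {Δ} (shift-equation {d} {ψ₄ ⊛ ψ₄} {Y} refl d-equation refl refl))

Y²-XU : Y ⊛ Y ⊕ ⊖ (X ⊛ U) ≋ # 4 ⊛ 𝓔₂.δ
Y²-XU = 𝕊.trans (𝕊.sym sub₂Δ) (𝕊.trans (sub-cong 2 X²-U²) (𝕊.trans (sub-#⊛ 2 4 𝓔₁.δ) (𝕊.*-congˡ {# 4} sub₂δ)))

U²-formula : U ⊛ U ≋ 𝓔₁.u⁴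
U²-formula = from-difference {U ⊛ U} {𝓔₁.u⁴} (fixed-by-sub₂ (𝕊.trans (#-cancel 2 (1 // 2) refl (J-equation {X} {U} {Y} {L₁} {L₂} {L₄} {L₈} sum X²-U² Y²-XU))
  (𝕊.sym (𝕊.trans (sub-diff 2 (U ⊛ U) 𝓔₁.u⁴) (𝕊.+-cong sub₂U² (𝕊.-‿cong sub₂u⁴))))) refl)

X²-formula : X ⊛ X ≋ 𝓔₁.x²
X²-formula = x²-formula {X} {U} {Y} {L₁} {L₂} {L₄} {L₈} sum X²-U² U²-formula

XY-formula : X ⊛ Y ≋ # 4 ⊛ L₁ ⊕ ⊖ (# 4 ⊛ L₂) ⊕ # 8 ⊛ L₄ ⊕ ⊖ (# 32 ⊛ L₈)
XY-formula = #-cancel 2 (1 // 2) refl (xy-formula {X} {U} {Y} {L₁} {L₂} {L₄} {L₈} sum X²-formula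
  (𝕊.trans (𝕊.sym sub₂U²) (𝕊.trans (sub-cong 2 U²-formula) sub₂u⁴)))

-- The eta quotients A₁, A₂, A₃.

powS-cong : ∀ {f g} e → f ≋ g → powS f e ≋ powS g e
powS-cong zero    p = 𝕊.refl
powS-cong (suc e) p = 𝕊.*-cong (powS-cong e p) p

powS-2 : ∀ f → powS f 2 ≋ f ⊛ f
powS-2 f = 𝕊.*-congʳ {f} (𝕊.*-identityˡ f)

e₅ e₁₀ e₂₀ e₄₀ : Series
e₅  = euler 5
e₁₀ = euler 10
e₂₀ = euler 20
e₄₀ = euler 40

eta-product : ∀ r s .{{_ : NonZero r}} .{{_ : NonZero s}} → infProd (λ m → powS (oneMinusQ (r ℕ.* m)) 2 ⊛ powS (oneMinusQ (s ℕ.* m)) 2) ≋ (euler r ⊛ euler r) ⊛ (euler s ⊛ euler s)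
eta-product r s = begin
  infProd (λ m → powS (oneMinusQ (r ℕ.* m)) 2 ⊛ powS (oneMinusQ (s ℕ.* m)) 2)
    ≈⟨ infProd-cong (λ m → 𝕊.*-cong (powS-cong 2 (oneMinusQ≋ (r ℕ.* suc m) {{ℕₚ.m*n≢0 r (suc m)}})) (powS-cong 2 (oneMinusQ≋ (s ℕ.* suc m) {{ℕₚ.m*n≢0 s (suc m)}}))) ⟩
  infProd (λ m → powS (oneS ⊕ ⊖ mono (r ℕ.* m)) 2 ⊛ powS (oneS ⊕ ⊖ mono (s ℕ.* m)) 2)
    ≈⟨ infProd-⊛ (unital-pow (unital-euler r) 2) (unital-pow (unital-euler s) 2) ⟩
  infProd (λ m → powS (oneS ⊕ ⊖ mono (r ℕ.* m)) 2) ⊛ infProd (λ m → powS (oneS ⊕ ⊖ mono (s ℕ.* m)) 2)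
    ≈⟨ 𝕊.*-cong (𝕊.trans (infProd-pow (unital-euler r) 2) (powS-2 (euler r))) (𝕊.trans (infProd-pow (unital-euler s) 2) (powS-2 (euler s))) ⟩
  (euler r ⊛ euler r) ⊛ (euler s ⊛ euler s) ∎
  where open ≋-Reasoning

A₁≋ : A₁ ≋ mono 1 ⊛ ((e₂ ⊛ e₂) ⊛ (e₁₀ ⊛ e₁₀))
A₁≋ = 𝕊.trans (shift-cong 1 (eta-product 2 10)) (𝕊.sym (mono-⊛ 1 ((e₂ ⊛ e₂) ⊛ (e₁₀ ⊛ e₁₀))))

A₂≋ : A₂ ≋ mono 2 ⊛ ((e₄ ⊛ e₄) ⊛ (e₂₀ ⊛ e₂₀))
A₂≋ = 𝕊.trans (shift-cong 2 (eta-product 4 20)) (𝕊.sym (mono-⊛ 2 ((e₄ ⊛ e₄) ⊛ (e₂₀ ⊛ e₂₀))))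

sub₂A₁ : sub 2 A₁ ≋ A₂
sub₂A₁ = begin
  sub 2 A₁                                                            ≈⟨ sub-cong 2 A₁≋ ⟩
  sub 2 (mono 1 ⊛ ((e₂ ⊛ e₂) ⊛ (e₁₀ ⊛ e₁₀)))                          ≈⟨ sub-⊛ 2 (mono 1) ((e₂ ⊛ e₂) ⊛ (e₁₀ ⊛ e₁₀)) ⟩
  sub 2 (mono 1) ⊛ sub 2 ((e₂ ⊛ e₂) ⊛ (e₁₀ ⊛ e₁₀))                    ≈⟨ 𝕊.*-cong (sub-mono 2 1) (𝕊.trans (sub-⊛ 2 (e₂ ⊛ e₂) (e₁₀ ⊛ e₁₀)) (𝕊.*-cong
                                                                           (𝕊.trans (sub-⊛ 2 e₂ e₂) (𝕊.*-cong (sub-euler 2 2) (sub-euler 2 2))) (𝕊.trans (sub-⊛ 2 e₁₀ e₁₀) (𝕊.*-cong (sub-euler 2 10) (sub-euler 2 10))))) ⟩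
  mono 2 ⊛ ((e₄ ⊛ e₄) ⊛ (e₂₀ ⊛ e₂₀))                                  ≈⟨ 𝕊.sym A₂≋ ⟩
  A₂                                                                  ∎
  where open ≋-Reasoning

alt-even : ∀ {f g} → f ≋ sub 2 g → alt f ≋ f
alt-even {f} {g} e = 𝕊.trans (alt-cong e) (𝕊.trans (alt-sub₂ g) (𝕊.sym e))

altA₁ : alt A₁ ≋ ⊖ A₁
altA₁ = begin
  alt A₁                                                              ≈⟨ 𝕊.trans (alt-cong A₁≋) (alt-⊛ (mono 1) ((e₂ ⊛ e₂) ⊛ (e₁₀ ⊛ e₁₀))) ⟩
  alt (mono 1) ⊛ alt ((e₂ ⊛ e₂) ⊛ (e₁₀ ⊛ e₁₀))                        ≈⟨ 𝕊.*-cong (𝕊.trans (alt-mono 1) (const-neg-1 (mono 1))) (𝕊.trans (alt-⊛ (e₂ ⊛ e₂) (e₁₀ ⊛ e₁₀)) (𝕊.*-cong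
                                                                           (𝕊.trans (alt-⊛ e₂ e₂) (𝕊.*-cong even₂ even₂)) (𝕊.trans (alt-⊛ e₁₀ e₁₀) (𝕊.*-cong even₁₀ even₁₀)))) ⟩
  ⊖ mono 1 ⊛ ((e₂ ⊛ e₂) ⊛ (e₁₀ ⊛ e₁₀))                                ≈⟨ solve 2 (λ q p → :- q :* p := :- (q :* p)) 𝕊.refl (mono 1) ((e₂ ⊛ e₂) ⊛ (e₁₀ ⊛ e₁₀)) ⟩
  ⊖ (mono 1 ⊛ ((e₂ ⊛ e₂) ⊛ (e₁₀ ⊛ e₁₀)))                              ≈⟨ 𝕊.-‿cong (𝕊.sym A₁≋) ⟩
  ⊖ A₁                                                                ∎
  where
  open ≋-Reasoning
  even₂ : alt e₂ ≋ e₂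
  even₂ = alt-even {e₂} {euler 1} (𝕊.sym (sub-euler 2 1))
  even₁₀ : alt e₁₀ ≋ e₁₀
  even₁₀ = alt-even {e₁₀} {e₅} (𝕊.sym (sub-euler 2 5))

-- A named copy of the factor that is local to `A₃`.
A₃-factor : ℕ → Series
A₃-factor zero    = oneS
A₃-factor (suc k) =
  powS (oneMinusQ (4 ℕ.* m)) 5 ⊛ oneMinusQ (10 ℕ.* m) ⊛ powS (oneMinusQ (40 ℕ.* m)) 2
  ⊛ geomQ (2 ℕ.* m) ⊛ powS (geomQ (8 ℕ.* m)) 2 ⊛ geomQ (20 ℕ.* m)
  where m = suc k

A₃-unfold : A₃ ≋ shift 3 (infProd A₃-factor)
A₃-unfold = shift-cong 3 (infProd-cong λ m → 𝕊.refl)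

private
  ηFactor : ℕ → ℕ → Series
  ηFactor r m = oneS ⊕ ⊖ mono (r ℕ.* m)

  num den : ℕ → Series
  num m = powS (ηFactor 4 m) 5 ⊛ ηFactor 10 m ⊛ powS (ηFactor 40 m) 2
  den m = ηFactor 2 m ⊛ powS (ηFactor 8 m) 2 ⊛ ηFactor 20 m

A₃-factor⊛den : ∀ m → A₃-factor (suc m) ⊛ den (suc m) ≋ num (suc m)
A₃-factor⊛den m = begin
  A₃-factor (suc m) ⊛ den (suc m)
    ≈⟨ 𝕊.*-congʳ {den (suc m)} (𝕊.*-congʳ {g₂₀} (𝕊.*-congʳ {powS g₈ 2} (𝕊.*-congʳ {g₂} (𝕊.*-cong (𝕊.*-cong (powS-cong 5 (oneMinusQ≋ (4 ℕ.* suc m))) (oneMinusQ≋ (10 ℕ.* suc m))) (powS-cong 2 (oneMinusQ≋ (40 ℕ.* suc m))))))) ⟩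
  N ⊛ g₂ ⊛ powS g₈ 2 ⊛ g₂₀ ⊛ den (suc m)
    ≈⟨ 𝕊.*-cong (𝕊.*-congʳ {g₂₀} (𝕊.*-congˡ {N ⊛ g₂} (powS-2 g₈))) (𝕊.*-congʳ {ηFactor 20 (suc m)} (𝕊.*-congˡ {ηFactor 2 (suc m)} (powS-2 (ηFactor 8 (suc m))))) ⟩
  N ⊛ g₂ ⊛ (g₈ ⊛ g₈) ⊛ g₂₀ ⊛ (ηFactor 2 (suc m) ⊛ (ηFactor 8 (suc m) ⊛ ηFactor 8 (suc m)) ⊛ ηFactor 20 (suc m))
    ≈⟨ solve 7 (λ N g h k a b c → N :* g :* (h :* h) :* k :* (a :* (b :* b) :* c) := N :* ((g :* a) :* ((h :* b) :* (h :* b)) :* (k :* c))) 𝕊.refl N g₂ g₈ g₂₀ (ηFactor 2 (suc m)) (ηFactor 8 (suc m)) (ηFactor 20 (suc m)) ⟩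
  N ⊛ ((g₂ ⊛ ηFactor 2 (suc m)) ⊛ ((g₈ ⊛ ηFactor 8 (suc m)) ⊛ (g₈ ⊛ ηFactor 8 (suc m))) ⊛ (g₂₀ ⊛ ηFactor 20 (suc m)))
    ≈⟨ 𝕊.*-congˡ {N} (𝕊.*-cong (𝕊.*-cong (geomQ-inverse (2 ℕ.* suc m)) (𝕊.*-cong (geomQ-inverse (8 ℕ.* suc m)) (geomQ-inverse (8 ℕ.* suc m)))) (geomQ-inverse (20 ℕ.* suc m))) ⟩
  N ⊛ (oneS ⊛ (oneS ⊛ oneS) ⊛ oneS)
    ≈⟨ solve 1 (λ N → N :* (con (+ 1) :* (con (+ 1) :* con (+ 1)) :* con (+ 1)) := N) 𝕊.refl N ⟩
  N ∎
  where
  open ≋-Reasoning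
  N = num (suc m)
  g₂ = geomQ (2 ℕ.* suc m)
  g₈ = geomQ (8 ℕ.* suc m)
  g₂₀ = geomQ (20 ℕ.* suc m)

unital-num : Unital num
unital-num = unital-⊛ (unital-⊛ (unital-pow (unital-euler 4) 5) (unital-euler 10)) (unital-pow (unital-euler 40) 2)

unital-den : Unital den
unital-den = unital-⊛ (unital-⊛ (unital-euler 2) (unital-pow (unital-euler 8) 2)) (unital-euler 20)

unital-A₃ : Unital A₃-factor
unital-A₃ .≈one m = ⊛-cancel-unit-≈ (den (suc m)) refl (begin
  den (suc m) ⊛ A₃-factor (suc m)     ≈⟨ ≋⇒≈ (𝕊.trans (𝕊.*-comm (den (suc m)) (A₃-factor (suc m))) (A₃-factor⊛den m)) ⟩
  num (suc m)                         ≈⟨ unital-num .≈one m ⟩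
  oneS                                ≈⟨ 𝕋.sym m (unital-den .≈one m) ⟩
  den (suc m)                         ≈⟨ ≋⇒≈ (𝕊.sym (𝕊.*-identityʳ (den (suc m)))) ⟩
  den (suc m) ⊛ oneS                  ∎)
  where open import Relation.Binary.Reasoning.Setoid (𝕋.setoid m)

A₃-quotient : infProd A₃-factor ⊛ (e₂ ⊛ (e₈ ⊛ e₈) ⊛ e₂₀) ≋ powS e₄ 5 ⊛ e₁₀ ⊛ (e₄₀ ⊛ e₄₀)
A₃-quotient = begin
  infProd A₃-factor ⊛ (e₂ ⊛ (e₈ ⊛ e₈) ⊛ e₂₀)
    ≈⟨ 𝕊.*-congˡ {infProd A₃-factor} (𝕊.sym (𝕊.trans (infProd-⊛ (unital-⊛ (unital-euler 2) (unital-pow (unital-euler 8) 2)) (unital-euler 20)) (𝕊.*-congʳ {e₂₀} (𝕊.trans (infProd-⊛ (unital-euler 2) (unital-pow (unital-euler 8) 2))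
         (𝕊.*-congˡ {e₂} (𝕊.trans (infProd-pow (unital-euler 8) 2) (powS-2 e₈))))))) ⟩
  infProd A₃-factor ⊛ infProd den
    ≈⟨ 𝕊.sym (infProd-⊛ unital-A₃ unital-den) ⟩
  infProd (λ m → A₃-factor m ⊛ den m)
    ≈⟨ infProd-cong A₃-factor⊛den ⟩
  infProd num
    ≈⟨ 𝕊.trans (infProd-⊛ (unital-⊛ (unital-pow (unital-euler 4) 5) (unital-euler 10)) (unital-pow (unital-euler 40) 2)) (𝕊.*-cong (𝕊.trans (infProd-⊛ (unital-pow (unital-euler 4) 5) (unital-euler 10))
         (𝕊.*-congʳ {e₁₀} (infProd-pow (unital-euler 4) 5))) (𝕊.trans (infProd-pow (unital-euler 40) 2) (powS-2 e₄₀))) ⟩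
  powS e₄ 5 ⊛ e₁₀ ⊛ (e₄₀ ⊛ e₄₀) ∎
  where open ≋-Reasoning

ψ₂₀ : Series
ψ₂₀ = sub 5 ψ₄

b-product : (e₂ ⊛ e₈) ⊛ (e₂ ⊛ e₈) ⊛ b ≋ e₄ ⊛ (e₄ ⊛ e₄) ⊛ (e₄ ⊛ e₄)
b-product = 𝕊.trans (𝕊.*-congʳ {b} (𝕊.*-cong den₁ den₁)) (𝕊.trans (𝕊.trans (𝕊.*-congʳ {b} (𝕊.sym (sub-⊛ 2 (e₁ ⊛ e₄) (e₁ ⊛ e₄)))) (𝕊.sym (sub-⊛ 2 ((e₁ ⊛ e₄) ⊛ (e₁ ⊛ e₄)) a)))
  (𝕊.trans (sub-cong 2 a-product) (𝕊.trans (sub-⊛ 2 (e₂ ⊛ (e₂ ⊛ e₂)) (e₂ ⊛ e₂)) (𝕊.*-cong (𝕊.trans (sub-⊛ 2 e₂ (e₂ ⊛ e₂)) (𝕊.*-cong (sub-euler 2 2) sq₂)) sq₂))))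
  where
  den₁ : e₂ ⊛ e₈ ≋ sub 2 (e₁ ⊛ e₄)
  den₁ = 𝕊.sym (𝕊.trans (sub-⊛ 2 e₁ e₄) (𝕊.*-cong (sub-euler 2 1) (sub-euler 2 4)))
  sq₂ : sub 2 (e₂ ⊛ e₂) ≋ e₄ ⊛ e₄
  sq₂ = 𝕊.trans (sub-⊛ 2 e₂ e₂) (𝕊.*-cong (sub-euler 2 2) (sub-euler 2 2))

ψ₂₀-product : ψ₂₀ ⊛ e₂₀ ≋ e₄₀ ⊛ e₄₀
ψ₂₀-product = 𝕊.trans (𝕊.*-congˡ {ψ₂₀} (𝕊.sym (sub-euler 5 4))) (𝕊.trans (𝕊.sym (sub-⊛ 5 ψ₄ e₄)) (𝕊.trans (sub-cong 5 ψ₄⊛euler₄) (𝕊.trans (sub-⊛ 5 e₈ e₈) (𝕊.*-cong (sub-euler 5 8) (sub-euler 5 8)))))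

-- The eta quotient regroups: f₄⁵/(f₂² f₈²) is φ(q²), f₄₀²/f₂₀ is ψ(q²⁰), and f₂ f₁₀ is left over.
A₃≋ : A₃ ≋ mono 3 ⊛ (b ⊛ ψ₂₀ ⊛ (e₂ ⊛ e₁₀))
A₃≋ = 𝕊.trans A₃-unfold (𝕊.trans (shift-cong 3 main) (𝕊.sym (mono-⊛ 3 (b ⊛ ψ₂₀ ⊛ (e₂ ⊛ e₁₀)))))
  where
  open ≋-Reasoning
  q = e₂ ⊛ (e₈ ⊛ e₈) ⊛ e₂₀
  main : infProd A₃-factor ≋ b ⊛ ψ₂₀ ⊛ (e₂ ⊛ e₁₀)
  main = ⊛-cancel-unit q refl (begin
    q ⊛ infProd A₃-factor                                          ≈⟨ 𝕊.trans (𝕊.*-comm q (infProd A₃-factor)) A₃-quotient ⟩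
    powS e₄ 5 ⊛ e₁₀ ⊛ (e₄₀ ⊛ e₄₀)                                  ≈⟨ 𝕊.*-cong (𝕊.*-congʳ {e₁₀} (𝕊.trans (solve 1 (λ e → con (+ 1) :* e :* e :* e :* e :* e := e :* (e :* e) :* (e :* e)) 𝕊.refl e₄) (𝕊.sym b-product))) (𝕊.sym ψ₂₀-product) ⟩
    (e₂ ⊛ e₈) ⊛ (e₂ ⊛ e₈) ⊛ b ⊛ e₁₀ ⊛ (ψ₂₀ ⊛ e₂₀)                  ≈⟨ solve 6 (λ e f b g ψ h → (e :* f) :* (e :* f) :* b :* g :* (ψ :* h) := (e :* (f :* f) :* h) :* (b :* ψ :* (e :* g))) 𝕊.refl e₂ e₈ b e₁₀ ψ₂₀ e₂₀ ⟩
    q ⊛ (b ⊛ ψ₂₀ ⊛ (e₂ ⊛ e₁₀))                                     ∎)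

-- The relation (X - Z)(5Z - X) = 16 A₁ at q, -q and q².

A B Z W : Series
A = sub 5 φ
B = sub 10 φ
Z = A ⊛ A
W = B ⊛ B

S : Series
S = mono 1 ⊛ (theta 1ℚ 9 1 ⊛ theta 1ℚ 7 3)

open GoldenTheta using (T; T⊛O; Φ; ga; gb)

-- With φ = θ₀ + 2θ₁ + 2θ₂ and φ(q⁵)² = θ₀² + 4θ₁θ₂, both sides are the same polynomial in the
-- residue-class series.
X-Z : X ⊕ ⊖ Z ≋ # 4 ⊛ S
X-Z = 𝕊.trans (𝕊.+-cong (𝕊.*-cong φ-split₅ φ-split₅) (𝕊.-‿cong RotateBy[2+i].sub₅φ²)) (𝕊.trans
  (solve 3 (λ a b c → let f = a :+ (b :+ (c :+ (c :+ (b :+ con (+ 0))))) in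
    f :* f :- (a :* a :+ (b :* c :+ (c :* b :+ (c :* b :+ (b :* c :+ con (+ 0)))))) := con (+ 4) :* (a :* b :+ (b :* c :+ (c :* a :+ (c :* c :+ (b :* b :+ con (+ 0))))))) 𝕊.refl θ₀ θ₁ θ₂)
  (𝕊.*-congˡ {# 4} (𝕊.sym RotateBy[2+i].S≋)))

-- The same comparison, now with T as the norm of (θ₀ - θ₂) + (θ₁ - θ₂)τ.
5Z-X : # 5 ⊛ Z ⊕ ⊖ X ≋ # 4 ⊛ T
5Z-X = 𝕊.trans (𝕊.+-cong (𝕊.*-congˡ {# 5} RotateBy[2+i].sub₅φ²) (𝕊.-‿cong (𝕊.*-cong φ-split₅ φ-split₅))) (𝕊.trans
  (solve 3 (λ a b c → let f = a :+ (b :+ (c :+ (c :+ (b :+ con (+ 0))))) ; x = a :+ :- c ; y = b :+ :- c in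
    con (+ 5) :* (a :* a :+ (b :* c :+ (c :* b :+ (c :* b :+ (b :* c :+ con (+ 0)))))) :- f :* f := con (+ 4) :* (x :* x :+ :- (x :* y) :+ :- (y :* y))) 𝕊.refl θ₀ θ₁ θ₂)
  (𝕊.*-congˡ {# 4} (𝕊.+-cong (𝕊.+-cong (𝕊.*-cong pa pa) (𝕊.-‿cong (𝕊.*-cong pa pb))) (𝕊.-‿cong (𝕊.*-cong pb pb)))))
  where
  pa = 𝕊.sym GoldenSplitting.Φa≋
  pb = 𝕊.sym GoldenSplitting.Φb≋

-- In product form S is q f₁₀² O/O₅ and T is f₂² O₅/O, so the odd products cancel.
S⊛T : S ⊛ T ≋ A₁
S⊛T = 𝕊.trans (⊛-cancel-unit (O ⊛ O₅) refl (begin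
  (O ⊛ O₅) ⊛ (S ⊛ T)                                                ≈⟨ solve 5 (λ O P q s T → (O :* P) :* ((q :* s) :* T) := q :* (s :* P) :* (T :* O)) 𝕊.refl O O₅ (mono 1) (theta 1ℚ 9 1 ⊛ theta 1ℚ 7 3) T ⟩
  mono 1 ⊛ (theta 1ℚ 9 1 ⊛ theta 1ℚ 7 3 ⊛ O₅) ⊛ (T ⊛ O)             ≈⟨ 𝕊.*-cong (𝕊.*-congˡ {mono 1} theta-9-1-7-3) T⊛O ⟩
  mono 1 ⊛ (e₁₀ ⊛ e₁₀ ⊛ O) ⊛ (e₂ ⊛ e₂ ⊛ O₅)                         ≈⟨ solve 5 (λ q e O f P → q :* (e :* e :* O) :* (f :* f :* P) := (O :* P) :* (q :* ((f :* f) :* (e :* e)))) 𝕊.refl (mono 1) e₁₀ O e₂ O₅ ⟩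
  (O ⊛ O₅) ⊛ (mono 1 ⊛ ((e₂ ⊛ e₂) ⊛ (e₁₀ ⊛ e₁₀)))                   ∎)) (𝕊.sym A₁≋)
  where open ≋-Reasoning

hP : # 16 ⊛ A₁ ≋ (X ⊕ ⊖ Z) ⊛ (# 5 ⊛ Z ⊕ ⊖ X)
hP = 𝕊.sym (𝕊.trans (𝕊.*-cong X-Z 5Z-X) (𝕊.trans (solve 2 (λ S T → con (+ 4) :* S :* (con (+ 4) :* T) := con (+ 16) :* (S :* T)) 𝕊.refl S T) (𝕊.*-congˡ {# 16} S⊛T)))

sub₂A : sub 2 A ≋ B
sub₂A = sub-sub 2 5 φ

sub₅b : sub 5 b ≋ B
sub₅b = sub-sub 5 2 φ

sub₂Z : sub 2 Z ≋ W
sub₂Z = 𝕊.trans (sub-⊛ 2 A A) (𝕊.*-cong sub₂A sub₂A)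

sub₅X : sub 5 X ≋ Z
sub₅X = sub-⊛ 5 a a

sub₅Y : sub 5 Y ≋ W
sub₅Y = 𝕊.trans (sub-⊛ 5 b b) (𝕊.*-cong sub₅b sub₅b)

U₅ : Series
U₅ = sub 5 U

U-formula : U ≋ # 2 ⊛ Y ⊕ ⊖ X
U-formula = linear {U} {# 2 ⊛ Y ⊕ ⊖ X} {X ⊕ U} {# 2 ⊛ Y} (# 1) (solve 3 (λ X U Y → U :- (con (+ 2) :* Y :- X) := con (+ 1) :* ((X :+ U) :- con (+ 2) :* Y)) 𝕊.refl X U Y) sum

U₅-formula : U₅ ≋ # 2 ⊛ W ⊕ ⊖ Z
U₅-formula = 𝕊.trans (sub-cong 5 U-formula) (𝕊.trans (sub-diff 5 (# 2 ⊛ Y) X) (𝕊.+-cong (𝕊.trans (sub-#⊛ 5 2 Y) (𝕊.*-congˡ {# 2} sub₅Y)) (𝕊.-‿cong sub₅X)))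

alt-# : ∀ n → alt (# n) ≋ # n
alt-# n = 𝕊.trans (alt-cong (#-const n)) (𝕊.trans (coeffwise step) (𝕊.sym (#-const n)))
  where
  step : ∀ j → sgn j ℚ.* (rat n ℚ.* oneS j) ≡ rat n ℚ.* oneS j
  step zero    = ℚₚ.*-identityˡ (rat n ℚ.* oneS 0)
  step (suc j) = trans (cong (sgn (suc j) ℚ.*_) (ℚₚ.*-zeroʳ (rat n))) (trans (ℚₚ.*-zeroʳ (sgn (suc j))) (sym (ℚₚ.*-zeroʳ (rat n))))

alt-#⊛ : ∀ n f → alt (# n ⊛ f) ≋ # n ⊛ alt f
alt-#⊛ n f = 𝕊.trans (alt-⊛ (# n) f) (𝕊.*-congʳ {alt f} (alt-# n))

alt-diff : ∀ f g → alt (f ⊕ ⊖ g) ≋ alt f ⊕ ⊖ alt g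
alt-diff f g = 𝕊.trans (alt-⊕ f (⊖ g)) (𝕊.+-congˡ {alt f} (alt-⊖ g))

altX : alt X ≋ # 2 ⊛ Y ⊕ ⊖ X
altX = 𝕊.trans (alt-⊛ a a) U-formula

altZ : alt Z ≋ # 2 ⊛ W ⊕ ⊖ Z
altZ = 𝕊.trans (𝕊.trans (alt-⊛ A A) (𝕊.trans (𝕊.*-cong (alt-sub₅ φ) (alt-sub₅ φ)) (𝕊.sym (sub-⊛ 5 u u)))) U₅-formula

hP⁻ : ⊖ (# 16 ⊛ A₁) ≋ ((# 2 ⊛ Y ⊕ ⊖ X) ⊕ ⊖ (# 2 ⊛ W ⊕ ⊖ Z)) ⊛ (# 5 ⊛ (# 2 ⊛ W ⊕ ⊖ Z) ⊕ ⊖ (# 2 ⊛ Y ⊕ ⊖ X))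
hP⁻ = begin
  ⊖ (# 16 ⊛ A₁)                                    ≈⟨ solve 1 (λ A → :- (con (+ 16) :* A) := con (+ 16) :* (:- A)) 𝕊.refl A₁ ⟩
  # 16 ⊛ ⊖ A₁                                      ≈⟨ 𝕊.sym (𝕊.trans (alt-#⊛ 16 A₁) (𝕊.*-congˡ {# 16} altA₁)) ⟩
  alt (# 16 ⊛ A₁)                                  ≈⟨ 𝕊.trans (alt-cong hP) (alt-⊛ (X ⊕ ⊖ Z) (# 5 ⊛ Z ⊕ ⊖ X)) ⟩
  alt (X ⊕ ⊖ Z) ⊛ alt (# 5 ⊛ Z ⊕ ⊖ X)              ≈⟨ 𝕊.*-cong (𝕊.trans (alt-diff X Z) (𝕊.+-cong altX (𝕊.-‿cong altZ))) (𝕊.trans (alt-diff (# 5 ⊛ Z) X) (𝕊.+-cong (𝕊.trans (alt-#⊛ 5 Z) (𝕊.*-congˡ {# 5} altZ)) (𝕊.-‿cong altX))) ⟩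
  ((# 2 ⊛ Y ⊕ ⊖ X) ⊕ ⊖ (# 2 ⊛ W ⊕ ⊖ Z)) ⊛ (# 5 ⊛ (# 2 ⊛ W ⊕ ⊖ Z) ⊕ ⊖ (# 2 ⊛ Y ⊕ ⊖ X)) ∎
  where open ≋-Reasoning

hP₂ : # 16 ⊛ A₂ ≋ (Y ⊕ ⊖ W) ⊛ (# 5 ⊛ W ⊕ ⊖ Y)
hP₂ = begin
  # 16 ⊛ A₂                                        ≈⟨ 𝕊.sym (𝕊.trans (sub-#⊛ 2 16 A₁) (𝕊.*-congˡ {# 16} sub₂A₁)) ⟩
  sub 2 (# 16 ⊛ A₁)                                ≈⟨ 𝕊.trans (sub-cong 2 hP) (sub-⊛ 2 (X ⊕ ⊖ Z) (# 5 ⊛ Z ⊕ ⊖ X)) ⟩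
  sub 2 (X ⊕ ⊖ Z) ⊛ sub 2 (# 5 ⊛ Z ⊕ ⊖ X)          ≈⟨ 𝕊.*-cong (𝕊.trans (sub-diff 2 X Z) (𝕊.+-cong sub₂X (𝕊.-‿cong sub₂Z))) (𝕊.trans (sub-diff 2 (# 5 ⊛ Z) X) (𝕊.+-cong (𝕊.trans (sub-#⊛ 2 5 Z) (𝕊.*-congˡ {# 5} sub₂Z)) (𝕊.-‿cong sub₂X))) ⟩
  (Y ⊕ ⊖ W) ⊛ (# 5 ⊛ W ⊕ ⊖ Y)                      ∎
  where open ≋-Reasoning

-- The relation XW - YZ = 4 A₁ + 8 A₃.

e₁₀≋ : sub 5 e₂ ≋ e₁₀
e₁₀≋ = sub-euler 5 2

h : Series
h = e₂ ⊛ e₁₀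

h≋ : h ≋ B ⊛ ψ₄ ⊕ ⊖ (mono 2 ⊛ (ψ₂₀ ⊛ b))
h≋ = #-cancel 2 (1 // 2) refl (𝕊.sym (begin
  # 2 ⊛ (B ⊛ ψ₄ ⊕ ⊖ (mono 2 ⊛ (ψ₂₀ ⊛ b)))
    ≈⟨ solve 5 (λ B p q r b → con (+ 2) :* (B :* p :- q :* (r :* b)) := B :* (p :+ p) :+ (:- (q :* ((r :+ r) :* b)) :+ con (+ 0))) 𝕊.refl B ψ₄ (mono 2) ψ₂₀ b ⟩
  B ⊛ (ψ₄ ⊕ ψ₄) ⊕ (⊖ (mono 2 ⊛ ((ψ₂₀ ⊕ ψ₂₀) ⊛ b)) ⊕ zeroS)
    ≈⟨ 𝕊.+-cong (𝕊.*-congˡ {B} (𝕊.sym theta-4-0)) (𝕊.+-congʳ {zeroS} (𝕊.trans (𝕊.-‿cong (𝕊.*-congˡ {mono 2} (𝕊.*-congʳ {b} (𝕊.sym (𝕊.trans (sub-cong 5 theta-4-0) (sub-⊕ 5 ψ₄ ψ₄)))))) (𝕊.sym (const-neg-1 (mono 2 ⊛ (sub 5 ψ̂ ⊛ b)))))) ⟩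
  B ⊛ ψ̂ ⊕ (const (ℚ.- 1ℚ) ⊛ (mono 2 ⊛ (sub 5 ψ̂ ⊛ b)) ⊕ zeroS)
    ≈⟨ PentagonalProduct.product ⟩
  sub 5 e₂ ⊛ e₂ ⊕ (mono 4 ⊛ (sub 5 ϑ ⊛ ϑ) ⊕ (sub 5 e₂ ⊛ e₂ ⊕ zeroS))
    ≈⟨ 𝕊.+-cong (𝕊.*-congʳ {e₂} e₁₀≋) (𝕊.+-cong (𝕊.*-congˡ {mono 4} (𝕊.*-congˡ {sub 5 ϑ} PentagonalProduct.Three.theta-6-0)) (𝕊.+-congʳ {zeroS} (𝕊.*-congʳ {e₂} e₁₀≋))) ⟩
  e₁₀ ⊛ e₂ ⊕ (mono 4 ⊛ (sub 5 ϑ ⊛ zeroS) ⊕ (e₁₀ ⊛ e₂ ⊕ zeroS))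
    ≈⟨ solve 4 (λ e f q t → f :* e :+ (q :* (t :* con (+ 0)) :+ (f :* e :+ con (+ 0))) := con (+ 2) :* (e :* f)) 𝕊.refl e₂ e₁₀ (mono 4) (sub 5 ϑ) ⟩
  # 2 ⊛ h ∎))
  where
  open ≋-Reasoning
  ϑ = theta (ℚ.- 1ℚ) 6 0

Z-W : Z ⊕ ⊖ W ≋ # 4 ⊛ (mono 5 ⊛ (ψ₂₀ ⊛ ψ₂₀))
Z-W = begin
  Z ⊕ ⊖ W                                          ≈⟨ 𝕊.sym (𝕊.trans (sub-diff 5 X Y) (𝕊.+-cong sub₅X (𝕊.-‿cong sub₅Y))) ⟩
  sub 5 (X ⊕ ⊖ Y)                                  ≈⟨ sub-cong 5 X-Y ⟩
  sub 5 (# 4 ⊛ (mono 1 ⊛ (ψ₄ ⊛ ψ₄)))               ≈⟨ 𝕊.trans (sub-#⊛ 5 4 (mono 1 ⊛ (ψ₄ ⊛ ψ₄))) (𝕊.*-congˡ {# 4} (𝕊.trans (sub-⊛ 5 (mono 1) (ψ₄ ⊛ ψ₄)) (𝕊.*-cong (sub-mono 5 1) (sub-⊛ 5 ψ₄ ψ₄)))) ⟩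
  # 4 ⊛ (mono 5 ⊛ (ψ₂₀ ⊛ ψ₂₀))                     ∎
  where open ≋-Reasoning

A₁≋h : A₁ ≋ mono 1 ⊛ (h ⊛ h)
A₁≋h = 𝕊.trans A₁≋ (𝕊.*-congˡ {mono 1} (solve 2 (λ e f → (e :* e) :* (f :* f) := (e :* f) :* (e :* f)) 𝕊.refl e₂ e₁₀))

A₃≋h : A₃ ≋ mono 1 ⊛ mono 2 ⊛ (b ⊛ ψ₂₀ ⊛ h)
A₃≋h = 𝕊.trans A₃≋ (𝕊.*-congʳ {b ⊛ ψ₂₀ ⊛ h} (𝕊.sym (mono-+ 1 2)))

mono-5 : mono 5 ≋ mono 1 ⊛ mono 2 ⊛ mono 2
mono-5 = 𝕊.sym (𝕊.trans (𝕊.*-congʳ {mono 2} (mono-+ 1 2)) (mono-+ 3 2))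

-- By X - Y = 4qψ(q⁴)² and Z - W = 4q⁵ψ(q²⁰)², the left side is 4q (r² - s²) with r = Bψ₄ and s =
-- q²ψ₂₀b. Since r - s = h, this is 4q (h² + 2hs).
hQ : X ⊛ W ⊕ ⊖ (Y ⊛ Z) ≋ # 4 ⊛ A₁ ⊕ # 8 ⊛ A₃
hQ = begin
  X ⊛ W ⊕ ⊖ (Y ⊛ Z)                                          ≈⟨ solve 4 (λ X Y Z W → X :* W :- Y :* Z := (X :- Y) :* W :- Y :* (Z :- W)) 𝕊.refl X Y Z W ⟩
  (X ⊕ ⊖ Y) ⊛ W ⊕ ⊖ (Y ⊛ (Z ⊕ ⊖ W))                          ≈⟨ 𝕊.+-cong (𝕊.*-congʳ {W} X-Y) (𝕊.-‿cong (𝕊.*-congˡ {Y} (𝕊.trans Z-W (𝕊.*-congˡ {# 4} (𝕊.*-congʳ {ψ₂₀ ⊛ ψ₂₀} mono-5))))) ⟩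
  # 4 ⊛ (mono 1 ⊛ (ψ₄ ⊛ ψ₄)) ⊛ W ⊕ ⊖ (Y ⊛ (# 4 ⊛ (mono 1 ⊛ mono 2 ⊛ mono 2 ⊛ (ψ₂₀ ⊛ ψ₂₀))))
    ≈⟨ solve 6 (λ q p b B ψ χ → let g = B :* ψ :- p :* (χ :* b) in
         con (+ 4) :* (q :* (ψ :* ψ)) :* (B :* B) :- b :* b :* (con (+ 4) :* (q :* p :* p :* (χ :* χ))) := con (+ 4) :* (q :* (g :* g)) :+ con (+ 8) :* (q :* p :* (b :* χ :* g))) 𝕊.refl (mono 1) (mono 2) b B ψ₄ ψ₂₀ ⟩
  # 4 ⊛ (mono 1 ⊛ (g ⊛ g)) ⊕ # 8 ⊛ (mono 1 ⊛ mono 2 ⊛ (b ⊛ ψ₂₀ ⊛ g))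
    ≈⟨ 𝕊.+-cong (𝕊.*-congˡ {# 4} (𝕊.*-congˡ {mono 1} (𝕊.*-cong (𝕊.sym h≋) (𝕊.sym h≋)))) (𝕊.*-congˡ {# 8} (𝕊.*-congˡ {mono 1 ⊛ mono 2} (𝕊.*-congˡ {b ⊛ ψ₂₀} (𝕊.sym h≋)))) ⟩
  # 4 ⊛ (mono 1 ⊛ (h ⊛ h)) ⊕ # 8 ⊛ (mono 1 ⊛ mono 2 ⊛ (b ⊛ ψ₂₀ ⊛ h))
    ≈⟨ 𝕊.+-cong (𝕊.*-congˡ {# 4} (𝕊.sym A₁≋h)) (𝕊.*-congˡ {# 8} (𝕊.sym A₃≋h)) ⟩
  # 4 ⊛ A₁ ⊕ # 8 ⊛ A₃ ∎
  where
  open ≋-Reasoning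
  g = B ⊛ ψ₄ ⊕ ⊖ (mono 2 ⊛ (ψ₂₀ ⊛ b))

-- One more relation, beyond the quadric, is required to tie the parameters m, n, t together: this
-- is the origin of `rel`. It holds because Z - W is 4q⁵ times a square.
hR : A₁ ⊛ (Y ⊛ (Z ⊕ ⊖ W)) ≋ # 4 ⊛ (A₃ ⊛ A₃)
hR = begin
  A₁ ⊛ (Y ⊛ (Z ⊕ ⊖ W))                                       ≈⟨ 𝕊.*-cong A₁≋h (𝕊.*-congˡ {Y} (𝕊.trans Z-W (𝕊.*-congˡ {# 4} (𝕊.*-congʳ {ψ₂₀ ⊛ ψ₂₀} mono-5)))) ⟩
  mono 1 ⊛ (h ⊛ h) ⊛ (Y ⊛ (# 4 ⊛ (mono 1 ⊛ mono 2 ⊛ mono 2 ⊛ (ψ₂₀ ⊛ ψ₂₀))))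
    ≈⟨ solve 5 (λ q p b χ h → q :* (h :* h) :* (b :* b :* (con (+ 4) :* (q :* p :* p :* (χ :* χ)))) := con (+ 4) :* ((q :* p :* (b :* χ :* h)) :* (q :* p :* (b :* χ :* h)))) 𝕊.refl (mono 1) (mono 2) b ψ₂₀ h ⟩
  # 4 ⊛ ((mono 1 ⊛ mono 2 ⊛ (b ⊛ ψ₂₀ ⊛ h)) ⊛ (mono 1 ⊛ mono 2 ⊛ (b ⊛ ψ₂₀ ⊛ h)))
    ≈⟨ 𝕊.*-congˡ {# 4} (𝕊.*-cong (𝕊.sym A₃≋h) (𝕊.sym A₃≋h)) ⟩
  # 4 ⊛ (A₃ ⊛ A₃) ∎
  where open ≋-Reasoning

-- The logarithmic derivative of φ(q)/φ(q⁵).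

L₅ L₁₀ L₂₀ L₄₀ : Series
L₅  = sub 5 L
L₁₀ = sub 10 L
L₂₀ = sub 20 L
L₄₀ = sub 40 L

module 𝓔₅ = Eisenstein L₅ L₁₀ L₂₀

sub₅L₂ : sub 5 L₂ ≋ L₁₀
sub₅L₂ = sub-sub 5 2 L

sub₅L₄ : sub 5 L₄ ≋ L₂₀
sub₅L₄ = sub-sub 5 4 L

sub₅L₈ : sub 5 L₈ ≋ L₄₀
sub₅L₈ = sub-sub 5 8 L

sub₅e : sub 5 𝓔₁.e ≋ 𝓔₅.e
sub₅e = 𝕊.trans (sub-lin₃ 5 2 10 8 L₁ L₂ L₄) (𝕊.+-cong (𝕊.+-congˡ {# 2 ⊛ L₅} (𝕊.-‿cong (𝕊.*-congˡ {# 10} sub₅L₂))) (𝕊.*-congˡ {# 8} sub₅L₄))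

Z²-formula : Z ⊛ Z ≋ 𝓔₅.x²
Z²-formula = 𝕊.trans (𝕊.sym (𝕊.trans (sub-⊛ 5 X X) (𝕊.*-cong sub₅X sub₅X))) (𝕊.trans (sub-cong 5 X²-formula)
  (𝕊.trans (sub-diff 5 (# 8 ⊛ L₁) (# 32 ⊛ L₄)) (𝕊.+-cong (sub-#⊛ 5 8 L₁) (𝕊.-‿cong (𝕊.trans (sub-#⊛ 5 32 L₄) (𝕊.*-congˡ {# 32} sub₅L₄))))))

U₅²-formula : U₅ ⊛ U₅ ≋ 𝓔₅.u⁴
U₅²-formula = 𝕊.trans (𝕊.sym (sub-⊛ 5 U U)) (𝕊.trans (sub-cong 5 U²-formula) (𝕊.trans (sub-diff 5 (# 48 ⊛ L₂ ⊕ ⊖ (# 8 ⊛ L₁)) (# 64 ⊛ L₄)) (𝕊.+-cong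
  (𝕊.trans (sub-diff 5 (# 48 ⊛ L₂) (# 8 ⊛ L₁)) (𝕊.+-cong (𝕊.trans (sub-#⊛ 5 48 L₂) (𝕊.*-congˡ {# 48} sub₅L₂)) (𝕊.-‿cong (sub-#⊛ 5 8 L₁))))
  (𝕊.-‿cong (𝕊.trans (sub-#⊛ 5 64 L₄) (𝕊.*-congˡ {# 64} sub₅L₄))))))

ZW-formula : Z ⊛ W ≋ # 4 ⊛ L₅ ⊕ ⊖ (# 4 ⊛ L₁₀) ⊕ # 8 ⊛ L₂₀ ⊕ ⊖ (# 32 ⊛ L₄₀)
ZW-formula = 𝕊.trans (𝕊.sym (𝕊.trans (sub-⊛ 5 X Y) (𝕊.*-cong sub₅X sub₅Y))) (𝕊.trans (sub-cong 5 XY-formula)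
  (𝕊.trans (sub-diff 5 (# 4 ⊛ L₁ ⊕ ⊖ (# 4 ⊛ L₂) ⊕ # 8 ⊛ L₄) (# 32 ⊛ L₈)) (𝕊.+-cong
    (𝕊.trans (sub-lin₃ 5 4 4 8 L₁ L₂ L₄) (𝕊.+-cong (𝕊.+-congˡ {# 4 ⊛ L₅} (𝕊.-‿cong (𝕊.*-congˡ {# 4} sub₅L₂))) (𝕊.*-congˡ {# 8} sub₅L₄)))
    (𝕊.-‿cong (𝕊.trans (sub-#⊛ 5 32 L₈) (𝕊.*-congˡ {# 32} sub₅L₈))))))

Y²-formula : Y ⊛ Y ≋ # 8 ⊛ L₂ ⊕ ⊖ (# 32 ⊛ L₈)
Y²-formula = 𝕊.trans (𝕊.sym (𝕊.trans (sub-⊛ 2 X X) (𝕊.*-cong sub₂X sub₂X))) (𝕊.trans (sub-cong 2 X²-formula)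
  (𝕊.trans (sub-diff 2 (# 8 ⊛ L₁) (# 32 ⊛ L₄)) (𝕊.+-cong (sub-#⊛ 2 8 L₁) (𝕊.-‿cong (𝕊.trans (sub-#⊛ 2 32 L₄) (𝕊.*-congˡ {# 32} sub₂L₄))))))

W²-formula : W ⊛ W ≋ # 8 ⊛ L₁₀ ⊕ ⊖ (# 32 ⊛ L₄₀)
W²-formula = 𝕊.trans (𝕊.sym (𝕊.trans (sub-⊛ 5 Y Y) (𝕊.*-cong sub₅Y sub₅Y))) (𝕊.trans (sub-cong 5 Y²-formula)
  (𝕊.trans (sub-diff 5 (# 8 ⊛ L₂) (# 32 ⊛ L₈)) (𝕊.+-cong (𝕊.trans (sub-#⊛ 5 8 L₂) (𝕊.*-congˡ {# 8} sub₅L₂)) (𝕊.-‿cong (𝕊.trans (sub-#⊛ 5 32 L₈) (𝕊.*-congˡ {# 32} sub₅L₈))))))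

-- The logarithmic derivatives of φ(q⁵), φ(q)/φ(q⁵) and A₁.
e′ g Λ : Series
e′ = # 5 ⊛ 𝓔₅.e
g  = 𝓔₁.e ⊕ ⊖ e′
Λ  = ⊖ (# 4 ⊛ L₂) ⊕ ⊖ (# 20 ⊛ L₁₀)

logD-A : LogD A e′
logD-A = logD-cong 𝕊.refl (𝕊.*-congˡ {# 5} sub₅e) (logD-sub 5 logD-a)

24κ : # 24 ⊛ κ ≋ oneS
24κ = 𝕊.trans (#-⊛ 24 κ) (coeffwise λ n → trans (sym (ℚₚ.*-assoc (rat 24) (1 // 24) (oneS n))) (ℚₚ.*-identityˡ (oneS n)))

logD-A₁ : LogD A₁ Λ
logD-A₁ = logD-cong (𝕊.sym A₁≋) eq (logD-⊛ (logD {mono 1} {oneS} (𝕊.trans (D-mono 1) (𝕊.trans (𝕊.*-comm (const (rat 1)) (mono 1)) (𝕊.*-congˡ {mono 1} (coeffwise λ n → ℚₚ.*-identityˡ (oneS n))))))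
    (logD-⊛ (logD-⊛ (logD-euler 2) (logD-euler 2)) (logD-⊛ (logD-euler 10) (logD-euler 10))))
  where
  m : ℕ → Series → Series
  m r f = ⊖ (# r ⊛ (f ⊕ κ))
  eq : oneS ⊕ ((m 2 L₂ ⊕ m 2 L₂) ⊕ (m 10 L₁₀ ⊕ m 10 L₁₀)) ≋ Λ
  eq = linear {oneS ⊕ ((m 2 L₂ ⊕ m 2 L₂) ⊕ (m 10 L₁₀ ⊕ m 10 L₁₀))} {Λ} {# 24 ⊛ κ} {oneS} (⊖ # 1)
    (solve 3 (λ a b κ → let m : ℕ → Polynomial 3 → Polynomial 3 ; m r f = :- (con (+ r) :* (f :+ κ)) in
      (con (+ 1) :+ ((m 2 a :+ m 2 a) :+ (m 10 b :+ m 10 b))) :- (:- (con (+ 4) :* a) :+ :- (con (+ 20) :* b)) := (:- con (+ 1)) :* (con (+ 24) :* κ :- con (+ 1))) 𝕊.refl L₂ L₁₀ κ) 24κ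

DX : D X ≋ X ⊛ (𝓔₁.e ⊕ 𝓔₁.e)
DX = logD-⊛ logD-a logD-a .derivative

DZ : D Z ≋ Z ⊛ (e′ ⊕ e′)
DZ = logD-⊛ logD-A logD-A .derivative

hD : # 16 ⊛ (A₁ ⊛ Λ) ≋ (X ⊛ (𝓔₁.e ⊕ 𝓔₁.e) ⊕ ⊖ (Z ⊛ (e′ ⊕ e′))) ⊛ (# 5 ⊛ Z ⊕ ⊖ X) ⊕ (X ⊕ ⊖ Z) ⊛ (# 5 ⊛ (Z ⊛ (e′ ⊕ e′)) ⊕ ⊖ (X ⊛ (𝓔₁.e ⊕ 𝓔₁.e)))
hD = begin
  # 16 ⊛ (A₁ ⊛ Λ)                                     ≈⟨ 𝕊.*-congˡ {# 16} (𝕊.sym (logD-A₁ .derivative)) ⟩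
  # 16 ⊛ D A₁                                         ≈⟨ 𝕊.sym (D-#⊛ 16 A₁) ⟩
  D (# 16 ⊛ A₁)                                       ≈⟨ 𝕊.trans (D-cong hP) (D-⊛ (X ⊕ ⊖ Z) (# 5 ⊛ Z ⊕ ⊖ X)) ⟩
  D (X ⊕ ⊖ Z) ⊛ (# 5 ⊛ Z ⊕ ⊖ X) ⊕ (X ⊕ ⊖ Z) ⊛ D (# 5 ⊛ Z ⊕ ⊖ X)
    ≈⟨ 𝕊.+-cong (𝕊.*-congʳ {# 5 ⊛ Z ⊕ ⊖ X} (𝕊.trans (D-diff X Z) (𝕊.+-cong DX (𝕊.-‿cong DZ)))) (𝕊.*-congˡ {X ⊕ ⊖ Z} (𝕊.trans (D-diff (# 5 ⊛ Z) X) (𝕊.+-cong (𝕊.trans (D-#⊛ 5 Z) (𝕊.*-congˡ {# 5} DZ)) (𝕊.-‿cong DX)))) ⟩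
  (X ⊛ (𝓔₁.e ⊕ 𝓔₁.e) ⊕ ⊖ (Z ⊛ (e′ ⊕ e′))) ⊛ (# 5 ⊛ Z ⊕ ⊖ X) ⊕ (X ⊕ ⊖ Z) ⊛ (# 5 ⊛ (Z ⊛ (e′ ⊕ e′)) ⊕ ⊖ (X ⊛ (𝓔₁.e ⊕ 𝓔₁.e))) ∎
  where open ≋-Reasoning

-- The four-square theorem leads back from L to theta series: 6 (Λ - 2e - 2e′) is 2φ(-q)⁴ - φ(q)⁴
-- plus five times the same expression at q⁵.
hg : # 12 ⊛ (g ⊛ (# 5 ⊛ (Z ⊛ Z) ⊕ ⊖ (X ⊛ X))) ≋ # 16 ⊛ A₁ ⊛ (# 2 ⊛ (U ⊛ U) ⊕ ⊖ (X ⊛ X) ⊕ # 5 ⊛ (# 2 ⊛ (U₅ ⊛ U₅) ⊕ ⊖ (Z ⊛ Z)))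
hg = begin
  # 12 ⊛ (g ⊛ (# 5 ⊛ (Z ⊛ Z) ⊕ ⊖ (X ⊛ X)))
    ≈⟨ solve 1 (λ x → con (+ 12) :* x := con (+ 6) :* (con (+ 2) :* x)) 𝕊.refl (g ⊛ (# 5 ⊛ (Z ⊛ Z) ⊕ ⊖ (X ⊛ X))) ⟩
  # 6 ⊛ (# 2 ⊛ (g ⊛ (# 5 ⊛ (Z ⊛ Z) ⊕ ⊖ (X ⊛ X))))
    ≈⟨ 𝕊.*-congˡ {# 6} (derived {X} {Z} {A₁} {𝓔₁.e} {e′} {Λ} hP hD) ⟩
  # 6 ⊛ (# 16 ⊛ A₁ ⊛ (Λ ⊕ ⊖ (# 2 ⊛ 𝓔₁.e) ⊕ ⊖ (# 2 ⊛ e′)))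
    ≈⟨ solve 7 (λ A a b c p q r → con (+ 6) :* (con (+ 16) :* A :* ((:- (con (+ 4) :* b) :+ :- (con (+ 20) :* q)) :+ :- (con (+ 2) :* (con (+ 2) :* a :- con (+ 10) :* b :+ con (+ 8) :* c)) :+ :- (con (+ 2) :* (con (+ 5) :* (con (+ 2) :* p :- con (+ 10) :* q :+ con (+ 8) :* r)))))
         := con (+ 16) :* A :* (con (+ 2) :* (con (+ 48) :* b :- con (+ 8) :* a :- con (+ 64) :* c) :- (con (+ 8) :* a :- con (+ 32) :* c) :+ con (+ 5) :* (con (+ 2) :* (con (+ 48) :* q :- con (+ 8) :* p :- con (+ 64) :* r) :- (con (+ 8) :* p :- con (+ 32) :* r)))) 𝕊.refl A₁ L₁ L₂ L₄ L₅ L₁₀ L₂₀ ⟩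
  # 16 ⊛ A₁ ⊛ (# 2 ⊛ 𝓔₁.u⁴ ⊕ ⊖ 𝓔₁.x² ⊕ # 5 ⊛ (# 2 ⊛ 𝓔₅.u⁴ ⊕ ⊖ 𝓔₅.x²))
    ≈⟨ 𝕊.*-congˡ {# 16 ⊛ A₁} (𝕊.sym (𝕊.+-cong (𝕊.+-cong (𝕊.*-congˡ {# 2} U²-formula) (𝕊.-‿cong X²-formula)) (𝕊.*-congˡ {# 5} (𝕊.+-cong (𝕊.*-congˡ {# 2} U₅²-formula) (𝕊.-‿cong Z²-formula))))) ⟩
  # 16 ⊛ A₁ ⊛ (# 2 ⊛ (U ⊛ U) ⊕ ⊖ (X ⊛ X) ⊕ # 5 ⊛ (# 2 ⊛ (U₅ ⊛ U₅) ⊕ ⊖ (Z ⊛ Z))) ∎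
  where open ≋-Reasoning

-- The parametrisation by t and the product of four theta series.

¼ : ℚ
¼ = 1 // 4

-- The linear forms of `quadric`, which reads V n = m l. The factor 1/4 gives n the constant term 1
-- and m the leading term q, so both can be cancelled.
V m n l t : Series
V = ¼ · (Y ⊕ ⊖ W)
m = ¼ · (X ⊕ ⊖ Z ⊕ ⊖ (Y ⊕ ⊖ W))
n = ¼ · (# 5 ⊛ W ⊕ ⊖ Y)
l = ¼ · (X ⊕ ⊖ (# 5 ⊛ Z) ⊕ ⊖ (Y ⊕ ⊖ (# 5 ⊛ W)))

n0 : n 0 ≡ 1ℚ
n0 = refl

-- The common ratio l/n = V/m of the quadric, computed with the denominator that is invertible.
t = inv n n0 ⊛ l

n⊛t : n ⊛ t ≋ l
n⊛t = 𝕊.trans (𝕊.sym (𝕊.*-assoc n (inv n n0) l)) (𝕊.trans (𝕊.*-congʳ {l} (inverseʳ n n0)) (𝕊.*-identityˡ l))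

module QI = Quintic {X} {Y} {Z} {W} {A₁} {A₂} {A₃} hP hP⁻ hP₂ hQ

V⊛n : V ⊛ n ≋ m ⊛ l
V⊛n = begin
  V ⊛ n                                      ≈⟨ 𝕊.*-cong (·-const ¼ p) (·-const ¼ q) ⟩
  (const ¼ ⊛ p) ⊛ (const ¼ ⊛ q)              ≈⟨ solve 3 (λ c p q → (c :* p) :* (c :* q) := c :* c :* (p :* q)) 𝕊.refl (const ¼) p q ⟩
  const ¼ ⊛ const ¼ ⊛ (p ⊛ q)                ≈⟨ 𝕊.*-congˡ {const ¼ ⊛ const ¼} (#-cancel 2 (1 // 2) refl {p ⊛ q} {r ⊛ s} QI.quadric) ⟩
  const ¼ ⊛ const ¼ ⊛ (r ⊛ s)                ≈⟨ solve 3 (λ c p q → c :* c :* (p :* q) := (c :* p) :* (c :* q)) 𝕊.refl (const ¼) r s ⟩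
  (const ¼ ⊛ r) ⊛ (const ¼ ⊛ s)              ≈⟨ 𝕊.*-cong (𝕊.sym (·-const ¼ r)) (𝕊.sym (·-const ¼ s)) ⟩
  m ⊛ l                                      ∎
  where
  open ≋-Reasoning
  p = Y ⊕ ⊖ W
  q = # 5 ⊛ W ⊕ ⊖ Y
  r = X ⊕ ⊖ Z ⊕ ⊖ (Y ⊕ ⊖ W)
  s = X ⊕ ⊖ (# 5 ⊛ Z) ⊕ ⊖ (Y ⊕ ⊖ (# 5 ⊛ W))

t⊛m : t ⊛ m ≋ V
t⊛m = ⊛-cancel-unit n n0 (begin
  n ⊛ (t ⊛ m)      ≈⟨ 𝕊.sym (𝕊.*-assoc n t m) ⟩
  n ⊛ t ⊛ m        ≈⟨ 𝕊.*-congʳ {m} n⊛t ⟩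
  l ⊛ m            ≈⟨ 𝕊.*-comm l m ⟩
  m ⊛ l            ≈⟨ 𝕊.sym V⊛n ⟩
  V ⊛ n            ≈⟨ 𝕊.*-comm V n ⟩
  n ⊛ V            ∎)
  where open ≋-Reasoning

module Par = Parametrised m n t

quarter : ∀ f → # 4 ⊛ (¼ · f) ≋ f
quarter f = 𝕊.trans (#-⊛ 4 (¼ · f)) (coeffwise λ k → trans (sym (ℚₚ.*-assoc (rat 4) ¼ (f k))) (ℚₚ.*-identityˡ (f k)))

private
  4V = quarter (Y ⊕ ⊖ W)
  4m = quarter (X ⊕ ⊖ Z ⊕ ⊖ (Y ⊕ ⊖ W))
  4n = quarter (# 5 ⊛ W ⊕ ⊖ Y)
  4l = quarter (X ⊕ ⊖ (# 5 ⊛ Z) ⊕ ⊖ (Y ⊕ ⊖ (# 5 ⊛ W)))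

  by-quarters : ∀ {f g h} → # 4 ⊛ f ≋ h → # 4 ⊛ g ≋ h → f ≋ g
  by-quarters p r = #-cancel 4 ¼ refl (𝕊.trans p (𝕊.sym r))

-- Inverting the four linear forms gives W = n + V, Y = n + 5V, Z = n - l + m + V and X = n - l + 5
-- (m + V); the parametrisation follows with V = tm and l = tn.
W≋ : W ≋ Par.W
W≋ = 𝕊.trans (by-quarters 𝕊.refl (begin
    # 4 ⊛ (n ⊕ V)                  ≈⟨ 𝕊.trans (𝕊.distribˡ (# 4) n V) (𝕊.+-cong 4n 4V) ⟩
    (# 5 ⊛ W ⊕ ⊖ Y) ⊕ (Y ⊕ ⊖ W)    ≈⟨ solve 2 (λ Y W → (con (+ 5) :* W :- Y) :+ (Y :- W) := con (+ 4) :* W) 𝕊.refl Y W ⟩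
    # 4 ⊛ W                        ∎))
  (𝕊.+-congˡ {n} (𝕊.sym t⊛m))
  where open ≋-Reasoning

Y≋ : Y ≋ Par.Y
Y≋ = 𝕊.trans (by-quarters 𝕊.refl (begin
    # 4 ⊛ (n ⊕ # 5 ⊛ V)                  ≈⟨ 𝕊.trans (solve 2 (λ n V → con (+ 4) :* (n :+ con (+ 5) :* V) := con (+ 4) :* n :+ con (+ 5) :* (con (+ 4) :* V)) 𝕊.refl n V) (𝕊.+-cong 4n (𝕊.*-congˡ {# 5} 4V)) ⟩
    (# 5 ⊛ W ⊕ ⊖ Y) ⊕ # 5 ⊛ (Y ⊕ ⊖ W)    ≈⟨ solve 2 (λ Y W → (con (+ 5) :* W :- Y) :+ con (+ 5) :* (Y :- W) := con (+ 4) :* Y) 𝕊.refl Y W ⟩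
    # 4 ⊛ Y                              ∎))
  (𝕊.+-congˡ {n} (𝕊.*-congˡ {# 5} (𝕊.sym t⊛m)))
  where open ≋-Reasoning

Z≋ : Z ≋ Par.Z
Z≋ = 𝕊.trans (by-quarters 𝕊.refl (begin
    # 4 ⊛ (n ⊕ ⊖ l ⊕ (m ⊕ V))
      ≈⟨ 𝕊.trans (solve 4 (λ n l m V → con (+ 4) :* (n :- l :+ (m :+ V)) := con (+ 4) :* n :- con (+ 4) :* l :+ (con (+ 4) :* m :+ con (+ 4) :* V)) 𝕊.refl n l m V) (𝕊.+-cong (𝕊.+-cong 4n (𝕊.-‿cong 4l)) (𝕊.+-cong 4m 4V)) ⟩
    (# 5 ⊛ W ⊕ ⊖ Y) ⊕ ⊖ (X ⊕ ⊖ (# 5 ⊛ Z) ⊕ ⊖ (Y ⊕ ⊖ (# 5 ⊛ W))) ⊕ ((X ⊕ ⊖ Z ⊕ ⊖ (Y ⊕ ⊖ W)) ⊕ (Y ⊕ ⊖ W))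
      ≈⟨ solve 4 (λ X Y Z W → (con (+ 5) :* W :- Y) :- (X :- con (+ 5) :* Z :- (Y :- con (+ 5) :* W)) :+ ((X :- Z :- (Y :- W)) :+ (Y :- W)) := con (+ 4) :* Z) 𝕊.refl X Y Z W ⟩
    # 4 ⊛ Z ∎))
  (𝕊.trans (𝕊.+-cong (𝕊.+-congˡ {n} (𝕊.-‿cong (𝕊.sym n⊛t))) (𝕊.+-congˡ {m} (𝕊.sym t⊛m)))
    (solve 3 (λ m n t → n :- n :* t :+ (m :+ t :* m) := (con (+ 1) :- t) :* n :+ (con (+ 1) :+ t) :* m) 𝕊.refl m n t))
  where open ≋-Reasoning

X≋ : X ≋ Par.X
X≋ = 𝕊.trans (by-quarters 𝕊.refl (begin
    # 4 ⊛ (n ⊕ ⊖ l ⊕ # 5 ⊛ (m ⊕ V))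
      ≈⟨ 𝕊.trans (solve 4 (λ n l m V → con (+ 4) :* (n :- l :+ con (+ 5) :* (m :+ V)) := con (+ 4) :* n :- con (+ 4) :* l :+ con (+ 5) :* (con (+ 4) :* m :+ con (+ 4) :* V)) 𝕊.refl n l m V) (𝕊.+-cong (𝕊.+-cong 4n (𝕊.-‿cong 4l)) (𝕊.*-congˡ {# 5} (𝕊.+-cong 4m 4V))) ⟩
    (# 5 ⊛ W ⊕ ⊖ Y) ⊕ ⊖ (X ⊕ ⊖ (# 5 ⊛ Z) ⊕ ⊖ (Y ⊕ ⊖ (# 5 ⊛ W))) ⊕ # 5 ⊛ ((X ⊕ ⊖ Z ⊕ ⊖ (Y ⊕ ⊖ W)) ⊕ (Y ⊕ ⊖ W))
      ≈⟨ solve 4 (λ X Y Z W → (con (+ 5) :* W :- Y) :- (X :- con (+ 5) :* Z :- (Y :- con (+ 5) :* W)) :+ con (+ 5) :* ((X :- Z :- (Y :- W)) :+ (Y :- W)) := con (+ 4) :* X) 𝕊.refl X Y Z W ⟩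
    # 4 ⊛ X ∎))
  (𝕊.trans (𝕊.+-cong (𝕊.+-congˡ {n} (𝕊.-‿cong (𝕊.sym n⊛t))) (𝕊.*-congˡ {# 5} (𝕊.+-congˡ {m} (𝕊.sym t⊛m))))
    (solve 3 (λ m n t → n :- n :* t :+ con (+ 5) :* (m :+ t :* m) := (con (+ 1) :- t) :* n :+ con (+ 5) :* ((con (+ 1) :+ t) :* m)) 𝕊.refl m n t))
  where open ≋-Reasoning

U≋ᵖ : U ≋ Par.U
U≋ᵖ = 𝕊.trans U-formula (𝕊.+-cong (𝕊.*-congˡ {# 2} Y≋) (𝕊.-‿cong X≋))

U₅≋ᵖ : U₅ ≋ Par.U₅
U₅≋ᵖ = 𝕊.trans U₅-formula (𝕊.+-cong (𝕊.*-congˡ {# 2} W≋) (𝕊.-‿cong Z≋))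

A₁≋ᵖ : A₁ ≋ m ⊛ n ⊛ Par.c
A₁≋ᵖ = #-cancel 16 (1 // 16) refl (Par.A₁-formula {A₁} (𝕊.trans hP (𝕊.*-cong (𝕊.+-cong X≋ (𝕊.-‿cong Z≋)) (𝕊.+-cong (𝕊.*-congˡ {# 5} Z≋) (𝕊.-‿cong X≋)))))

A₃≋ᵖ : A₃ ≋ t ⊛ t ⊛ (m ⊛ n)
A₃≋ᵖ = #-cancel 8 (1 // 8) refl (Par.A₃-formula {A₁} {A₃} A₁≋ᵖ (𝕊.trans (𝕊.+-cong (𝕊.*-cong (𝕊.sym X≋) (𝕊.sym W≋)) (𝕊.-‿cong (𝕊.*-cong (𝕊.sym Y≋) (𝕊.sym Z≋)))) hQ))

⊛-cancel-order₁ : ∀ f → f 0 ≡ 0ℚ → f 1 ≡ 1ℚ → ∀ {g h} → f ⊛ g ≋ f ⊛ h → g ≋ h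
⊛-cancel-order₁ f f0 f1 {g} {h} e = ⊛-cancel-unit (tail f) f1 (⊛-cancel-mono 1 (𝕊.trans (𝕊.sym (split g)) (𝕊.trans e (split h))))
  where
  f≋ : f ≋ mono 1 ⊛ tail f
  f≋ = 𝕊.trans (coeffwise λ { zero → f0 ; (suc k) → refl }) (𝕊.sym (mono-⊛ 1 (tail f)))
  split : ∀ g → f ⊛ g ≋ mono 1 ⊛ (tail f ⊛ g)
  split g = 𝕊.trans (𝕊.*-congʳ {g} f≋) (𝕊.*-assoc (mono 1) (tail f) g)

rel≋0 : Par.rel ≋ zeroS
rel≋0 = ⊛-cancel-order₁ m refl refl (⊛-cancel-unit n n0 (Par.relation {A₁} {A₃} A₁≋ᵖ A₃≋ᵖ
  (𝕊.trans (𝕊.*-congˡ {A₁} (𝕊.*-cong (𝕊.sym Y≋) (𝕊.+-cong (𝕊.sym Z≋) (𝕊.-‿cong (𝕊.sym W≋))))) hR)))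

c⊛g : Par.c ⊛ g ≋ Par.N
c⊛g = ⊛-cancel-unit Par.D₁ refl (#-cancel 48 (1 // 48) refl (Par.g-formula {A₁} {g} rel≋0 A₁≋ᵖ (begin
  # 12 ⊛ (g ⊛ (# 5 ⊛ (Par.Z ⊛ Par.Z) ⊕ ⊖ (Par.X ⊛ Par.X)))
    ≈⟨ 𝕊.*-congˡ {# 12} (𝕊.*-congˡ {g} (𝕊.+-cong (𝕊.*-congˡ {# 5} ZZ) (𝕊.-‿cong XX))) ⟩
  # 12 ⊛ (g ⊛ (# 5 ⊛ (Z ⊛ Z) ⊕ ⊖ (X ⊛ X)))
    ≈⟨ hg ⟩
  # 16 ⊛ A₁ ⊛ (# 2 ⊛ (U ⊛ U) ⊕ ⊖ (X ⊛ X) ⊕ # 5 ⊛ (# 2 ⊛ (U₅ ⊛ U₅) ⊕ ⊖ (Z ⊛ Z)))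
    ≈⟨ 𝕊.*-congˡ {# 16 ⊛ A₁} (𝕊.+-cong (𝕊.+-cong (𝕊.*-congˡ {# 2} (𝕊.*-cong U≋ᵖ U≋ᵖ)) (𝕊.-‿cong (𝕊.sym XX))) (𝕊.*-congˡ {# 5} (𝕊.+-cong (𝕊.*-congˡ {# 2} (𝕊.*-cong U₅≋ᵖ U₅≋ᵖ)) (𝕊.-‿cong (𝕊.sym ZZ))))) ⟩
  # 16 ⊛ A₁ ⊛ (# 2 ⊛ (Par.U ⊛ Par.U) ⊕ ⊖ (Par.X ⊛ Par.X) ⊕ # 5 ⊛ (# 2 ⊛ (Par.U₅ ⊛ Par.U₅) ⊕ ⊖ (Par.Z ⊛ Par.Z))) ∎)))
  where
  open ≋-Reasoning
  ZZ : Par.Z ⊛ Par.Z ≋ Z ⊛ Z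
  ZZ = 𝕊.*-cong (𝕊.sym Z≋) (𝕊.sym Z≋)
  XX : Par.X ⊛ Par.X ≋ X ⊛ X
  XX = 𝕊.*-cong (𝕊.sym X≋) (𝕊.sym X≋)

F : Series
F = a ⊛ b ⊛ A ⊛ B

⊛-cancel-head : ∀ f c → c ℚ.* f 0 ≡ 1ℚ → ∀ {g h} → f ⊛ g ≋ f ⊛ h → g ≋ h
⊛-cancel-head f c cf0 {g} {h} e = ⊛-cancel-unit (c · f) cf0 (𝕊.trans (scale g) (𝕊.trans (𝕊.*-congˡ {const c} e) (𝕊.sym (scale h))))
  where
  scale : ∀ g → (c · f) ⊛ g ≋ const c ⊛ (f ⊛ g)
  scale g = 𝕊.trans (𝕊.*-congʳ {g} (·-const c f)) (𝕊.*-assoc (const c) f g)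

-- The factor c F + M of the vanishing product has constant term 2, which `1 // 2` inverts, so the
-- other factor is zero.
c⊛F : Par.c ⊛ F ⊕ ⊖ Par.M ≋ zeroS
c⊛F = ⊛-cancel-head (Par.c ⊛ F ⊕ Par.M) (1 // 2) refl (Par.square-formula {F} rel≋0 (𝕊.trans
  (solve 4 (λ a b A B → (a :* b :* A :* B) :* (a :* b :* A :* B) := (a :* a) :* (b :* b) :* ((A :* A) :* (B :* B))) 𝕊.refl a b A B)
  (𝕊.*-cong (𝕊.*-cong X≋ Y≋) (𝕊.*-cong Z≋ W≋))))

F-formula : # 4 ⊛ F ⊕ # 4 ⊛ g ≋ X ⊛ W ⊕ ⊖ (Y ⊛ Z) ⊕ ⊖ (# 4 ⊛ (Y ⊛ Y)) ⊕ # 3 ⊛ (X ⊛ Y) ⊕ # 20 ⊛ (W ⊛ W) ⊕ ⊖ (# 15 ⊛ (Z ⊛ W))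
F-formula = 𝕊.trans (⊛-cancel-unit Par.c refl (Par.theta-formula {F} {g} c⊛F c⊛g))
  (𝕊.+-cong (𝕊.+-cong (𝕊.+-cong (𝕊.+-cong (𝕊.+-cong (𝕊.*-cong (𝕊.sym X≋) (𝕊.sym W≋)) (𝕊.-‿cong (𝕊.*-cong (𝕊.sym Y≋) (𝕊.sym Z≋))))
    (𝕊.-‿cong (𝕊.*-congˡ {# 4} (𝕊.*-cong (𝕊.sym Y≋) (𝕊.sym Y≋))))) (𝕊.*-congˡ {# 3} (𝕊.*-cong (𝕊.sym X≋) (𝕊.sym Y≋)))) (𝕊.*-congˡ {# 20} (𝕊.*-cong (𝕊.sym W≋) (𝕊.sym W≋)))) (𝕊.-‿cong (𝕊.*-congˡ {# 15} (𝕊.*-cong (𝕊.sym Z≋) (𝕊.sym W≋)))))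

-- The six identities with their rational coefficients.

powS-4 : ∀ f → powS f 4 ≋ (f ⊛ f) ⊛ (f ⊛ f)
powS-4 = solve 1 (λ f → con (+ 1) :* f :* f :* f :* f := (f :* f) :* (f :* f)) 𝕊.refl

#-coeff : ∀ n f k → (# n ⊛ f) k ≡ rat n ℚ.* f k
#-coeff n f k = #-⊛ n f .coeff k

private
  c : ∀ {n} → ℚ → Q.Polynomial n
  c = Q.con

φ⁴-formula : ∀ n → powS φ 4 n ≡ (8 // 1 · L ⊕ ℚ.- (32 // 1) · sub 4 L) n
φ⁴-formula n = trans (powS-4 φ .coeff n) (trans (X²-formula .coeff n) (trans (cong₂ (λ x y → x ℚ.+ ℚ.- y) (#-coeff 8 L₁ n) (#-coeff 32 L₄ n))
  (Q.solve 2 (λ x y → c (rat 8) Q.:* x Q.:+ Q.:- (c (rat 32) Q.:* y) Q.:= c (8 // 1) Q.:* x Q.:+ c (ℚ.- (32 // 1)) Q.:* y) refl (L₁ n) (L₄ n))))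

φ²φ₂²-formula : ∀ n → (powS φ 2 ⊛ powS (sub 2 φ) 2) n ≡ (4 // 1 · L ⊕ ℚ.- (4 // 1) · sub 2 L ⊕ 8 // 1 · sub 4 L ⊕ ℚ.- (32 // 1) · sub 8 L) n
φ²φ₂²-formula n = trans (𝕊.*-cong (powS-2 φ) (powS-2 b) .coeff n) (trans (XY-formula .coeff n)
  (trans (cong₂ ℚ._+_ (cong₂ ℚ._+_ (cong₂ (λ x y → x ℚ.+ ℚ.- y) (#-coeff 4 L₁ n) (#-coeff 4 L₂ n)) (#-coeff 8 L₄ n)) (cong ℚ.-_ (#-coeff 32 L₈ n)))
  (Q.solve 4 (λ x y z w → c (rat 4) Q.:* x Q.:+ Q.:- (c (rat 4) Q.:* y) Q.:+ c (rat 8) Q.:* z Q.:+ Q.:- (c (rat 32) Q.:* w)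
    Q.:= c (4 // 1) Q.:* x Q.:+ c (ℚ.- (4 // 1)) Q.:* y Q.:+ c (8 // 1) Q.:* z Q.:+ c (ℚ.- (32 // 1)) Q.:* w) refl (L₁ n) (L₂ n) (L₄ n) (L₈ n))))

divide : ∀ r (s : ℚ) → s ℚ.* rat r ≡ 1ℚ → ∀ f {g} → # r ⊛ f ≋ g → ∀ n → f n ≡ s ℚ.* g n
divide r s s⁻¹ f {g} e n = trans (sym (ℚₚ.*-identityˡ (f n))) (trans (cong (ℚ._* f n) (sym s⁻¹)) (trans (ℚₚ.*-assoc s (rat r) (f n)) (cong (s ℚ.*_) (trans (sym (#-coeff r f n)) (e .coeff n)))))

φ²φ₅²-formula : ∀ n → (powS φ 2 ⊛ powS (sub 5 φ) 2) n ≡ (4 // 3 · L ⊕ ℚ.- (16 // 3) · sub 4 L ⊕ 20 // 3 · sub 5 L ⊕ ℚ.- (80 // 3) · sub 20 L ⊕ 8 // 3 · A₁) n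
φ²φ₅²-formula n = trans (𝕊.*-cong (powS-2 φ) (powS-2 A) .coeff n) (trans (divide 6 (1 // 6) refl (X ⊛ Z) eq n)
  (trans (cong ((1 // 6) ℚ.*_) (cong₂ ℚ._+_ (cong₂ ℚ._+_ (cong₂ (λ x y → x ℚ.+ ℚ.- y) (#-coeff 8 L₁ n) (#-coeff 32 L₄ n)) (cong₂ (λ x y → x ℚ.+ ℚ.- y) (#-coeff 40 L₅ n) (#-coeff 160 L₂₀ n))) (#-coeff 16 A₁ n)))
  (Q.solve 5 (λ x y z w A → c (1 // 6) Q.:* (c (rat 8) Q.:* x Q.:+ Q.:- (c (rat 32) Q.:* y) Q.:+ (c (rat 40) Q.:* z Q.:+ Q.:- (c (rat 160) Q.:* w)) Q.:+ c (rat 16) Q.:* A)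
    Q.:= c (4 // 3) Q.:* x Q.:+ c (ℚ.- (16 // 3)) Q.:* y Q.:+ c (20 // 3) Q.:* z Q.:+ c (ℚ.- (80 // 3)) Q.:* w Q.:+ c (8 // 3) Q.:* A) refl (L₁ n) (L₄ n) (L₅ n) (L₂₀ n) (A₁ n))))
  where
  eq : # 6 ⊛ (X ⊛ Z) ≋ (# 8 ⊛ L₁ ⊕ ⊖ (# 32 ⊛ L₄)) ⊕ (# 40 ⊛ L₅ ⊕ ⊖ (# 160 ⊛ L₂₀)) ⊕ # 16 ⊛ A₁
  eq = 𝕊.trans QI.xz-formula (𝕊.+-congʳ {# 16 ⊛ A₁} (𝕊.+-cong X²-formula (𝕊.trans (𝕊.*-congˡ {# 5} Z²-formula)
    (solve 2 (λ x y → con (+ 5) :* (con (+ 8) :* x :- con (+ 32) :* y) := con (+ 40) :* x :- con (+ 160) :* y) 𝕊.refl L₅ L₂₀))))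

-- The expansion of XY + 5ZW in values of L, the common Eisenstein part of 6XW and 6YZ.
E₁₀ : Series
E₁₀ = # 4 ⊛ L₁ ⊕ ⊖ (# 4 ⊛ L₂) ⊕ # 8 ⊛ L₄ ⊕ # 20 ⊛ L₅ ⊕ ⊖ (# 32 ⊛ L₈) ⊕ ⊖ (# 20 ⊛ L₁₀) ⊕ # 40 ⊛ L₂₀ ⊕ ⊖ (# 160 ⊛ L₄₀)

E₁₀≋ : X ⊛ Y ⊕ # 5 ⊛ (Z ⊛ W) ≋ E₁₀
E₁₀≋ = 𝕊.trans (𝕊.+-cong XY-formula (𝕊.*-congˡ {# 5} ZW-formula))
  (solve 8 (λ a b d e p q r s → (con (+ 4) :* a :- con (+ 4) :* b :+ con (+ 8) :* d :- con (+ 32) :* e) :+ con (+ 5) :* (con (+ 4) :* p :- con (+ 4) :* q :+ con (+ 8) :* r :- con (+ 32) :* s)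
    := con (+ 4) :* a :+ :- (con (+ 4) :* b) :+ con (+ 8) :* d :+ con (+ 20) :* p :+ :- (con (+ 32) :* e) :+ :- (con (+ 20) :* q) :+ con (+ 40) :* r :+ :- (con (+ 160) :* s)) 𝕊.refl L₁ L₂ L₄ L₈ L₅ L₁₀ L₂₀ L₄₀)

E₁₀-coeff : ∀ n → E₁₀ n ≡ rat 4 ℚ.* L₁ n ℚ.+ ℚ.- (rat 4 ℚ.* L₂ n) ℚ.+ rat 8 ℚ.* L₄ n ℚ.+ rat 20 ℚ.* L₅ n ℚ.+ ℚ.- (rat 32 ℚ.* L₈ n) ℚ.+ ℚ.- (rat 20 ℚ.* L₁₀ n) ℚ.+ rat 40 ℚ.* L₂₀ n ℚ.+ ℚ.- (rat 160 ℚ.* L₄₀ n)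
E₁₀-coeff n = cong₂ ℚ._+_ (cong₂ ℚ._+_ (cong₂ ℚ._+_ (cong₂ ℚ._+_ (cong₂ ℚ._+_ (cong₂ ℚ._+_ (cong₂ ℚ._+_ (#-coeff 4 L₁ n) (cong ℚ.-_ (#-coeff 4 L₂ n))) (#-coeff 8 L₄ n)) (#-coeff 20 L₅ n))
  (cong ℚ.-_ (#-coeff 32 L₈ n))) (cong ℚ.-_ (#-coeff 20 L₁₀ n))) (#-coeff 40 L₂₀ n)) (cong ℚ.-_ (#-coeff 160 L₄₀ n))

φ²φ₁₀²-formula : ∀ n → (powS φ 2 ⊛ powS (sub 10 φ) 2) n
  ≡ (2 // 3 · L ⊕ ℚ.- (2 // 3) · sub 2 L ⊕ 4 // 3 · sub 4 L ⊕ 10 // 3 · sub 5 L ⊕ ℚ.- (16 // 3) · sub 8 L ⊕ ℚ.- (10 // 3) · sub 10 L ⊕ 20 // 3 · sub 20 L ⊕ ℚ.- (80 // 3) · sub 40 L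
     ⊕ 10 // 3 · A₁ ⊕ 8 // 3 · A₂ ⊕ 4 // 1 · A₃) n
φ²φ₁₀²-formula n = trans (𝕊.*-cong (powS-2 φ) (powS-2 B) .coeff n) (trans (divide 6 (1 // 6) refl (X ⊛ W) eq n)
  (trans (cong ((1 // 6) ℚ.*_) (cong₂ ℚ._+_ (cong₂ ℚ._+_ (cong₂ ℚ._+_ (E₁₀-coeff n) (#-coeff 20 A₁ n)) (#-coeff 16 A₂ n)) (#-coeff 24 A₃ n)))
  (Q.solve 11 (λ a b d p e q r s A A′ A″ → c (1 // 6) Q.:* (c (rat 4) Q.:* a Q.:+ Q.:- (c (rat 4) Q.:* b) Q.:+ c (rat 8) Q.:* d Q.:+ c (rat 20) Q.:* p Q.:+ Q.:- (c (rat 32) Q.:* e) Q.:+ Q.:- (c (rat 20) Q.:* q) Q.:+ c (rat 40) Q.:* r Q.:+ Q.:- (c (rat 160) Q.:* s)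
      Q.:+ c (rat 20) Q.:* A Q.:+ c (rat 16) Q.:* A′ Q.:+ c (rat 24) Q.:* A″)
    Q.:= c (2 // 3) Q.:* a Q.:+ c (ℚ.- (2 // 3)) Q.:* b Q.:+ c (4 // 3) Q.:* d Q.:+ c (10 // 3) Q.:* p Q.:+ c (ℚ.- (16 // 3)) Q.:* e Q.:+ c (ℚ.- (10 // 3)) Q.:* q Q.:+ c (20 // 3) Q.:* r Q.:+ c (ℚ.- (80 // 3)) Q.:* s
      Q.:+ c (10 // 3) Q.:* A Q.:+ c (8 // 3) Q.:* A′ Q.:+ c (4 // 1) Q.:* A″) refl (L₁ n) (L₂ n) (L₄ n) (L₅ n) (L₈ n) (L₁₀ n) (L₂₀ n) (L₄₀ n) (A₁ n) (A₂ n) (A₃ n))))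
  where
  eq : # 6 ⊛ (X ⊛ W) ≋ E₁₀ ⊕ # 20 ⊛ A₁ ⊕ # 16 ⊛ A₂ ⊕ # 24 ⊛ A₃
  eq = 𝕊.trans (#-cancel 4 (1 // 4) refl {# 6 ⊛ (X ⊛ W)} {X ⊛ Y ⊕ # 5 ⊛ (Z ⊛ W) ⊕ # 20 ⊛ A₁ ⊕ # 16 ⊛ A₂ ⊕ # 24 ⊛ A₃}
      (𝕊.trans (solve 1 (λ x → con (+ 4) :* (con (+ 6) :* x) := con (+ 24) :* x) 𝕊.refl (X ⊛ W)) QI.xw-formula))
    (𝕊.+-congʳ {# 24 ⊛ A₃} (𝕊.+-congʳ {# 16 ⊛ A₂} (𝕊.+-congʳ {# 20 ⊛ A₁} E₁₀≋)))

φφ₂φ₅φ₁₀-formula : ∀ n → (φ ⊛ sub 2 φ ⊛ sub 5 φ ⊛ sub 10 φ) n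
  ≡ (L ⊕ ℚ.- (1 // 1) · sub 2 L ⊕ ℚ.- (2 // 1) · sub 4 L ⊕ ℚ.- (5 // 1) · sub 5 L ⊕ 8 // 1 · sub 8 L ⊕ 5 // 1 · sub 10 L ⊕ 10 // 1 · sub 20 L ⊕ ℚ.- (40 // 1) · sub 40 L
     ⊕ A₁ ⊕ 2 // 1 · A₃) n
φφ₂φ₅φ₁₀-formula n = trans (divide 4 (1 // 4) refl (F) eq n)
  (trans (cong ((1 // 4) ℚ.*_) (cong₂ ℚ._+_ (cong₂ ℚ._+_ (cong₂ ℚ._+_ (cong₂ ℚ._+_ (cong₂ ℚ._+_ (cong₂ ℚ._+_ (cong₂ ℚ._+_ (cong₂ ℚ._+_ (cong₂ ℚ._+_ (#-coeff 4 L₁ n) (cong ℚ.-_ (#-coeff 4 L₂ n))) (cong ℚ.-_ (#-coeff 8 L₄ n))) (cong ℚ.-_ (#-coeff 20 L₅ n)))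
    (#-coeff 32 L₈ n)) (#-coeff 20 L₁₀ n)) (#-coeff 40 L₂₀ n)) (cong ℚ.-_ (#-coeff 160 L₄₀ n))) (#-coeff 4 A₁ n)) (#-coeff 8 A₃ n)))
  (Q.solve 10 (λ a b d p e q r s A A″ → c (1 // 4) Q.:* (c (rat 4) Q.:* a Q.:+ Q.:- (c (rat 4) Q.:* b) Q.:+ Q.:- (c (rat 8) Q.:* d) Q.:+ Q.:- (c (rat 20) Q.:* p) Q.:+ c (rat 32) Q.:* e Q.:+ c (rat 20) Q.:* q Q.:+ c (rat 40) Q.:* r Q.:+ Q.:- (c (rat 160) Q.:* s)
      Q.:+ c (rat 4) Q.:* A Q.:+ c (rat 8) Q.:* A″)
    Q.:= a Q.:+ c (ℚ.- (1 // 1)) Q.:* b Q.:+ c (ℚ.- (2 // 1)) Q.:* d Q.:+ c (ℚ.- (5 // 1)) Q.:* p Q.:+ c (8 // 1) Q.:* e Q.:+ c (5 // 1) Q.:* q Q.:+ c (10 // 1) Q.:* r Q.:+ c (ℚ.- (40 // 1)) Q.:* s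
      Q.:+ A Q.:+ c (2 // 1) Q.:* A″) refl (L₁ n) (L₂ n) (L₄ n) (L₅ n) (L₈ n) (L₁₀ n) (L₂₀ n) (L₄₀ n) (A₁ n) (A₃ n)))
  where
  open ≋-Reasoning
  eq : # 4 ⊛ F ≋ # 4 ⊛ L₁ ⊕ ⊖ (# 4 ⊛ L₂) ⊕ ⊖ (# 8 ⊛ L₄) ⊕ ⊖ (# 20 ⊛ L₅) ⊕ # 32 ⊛ L₈ ⊕ # 20 ⊛ L₁₀ ⊕ # 40 ⊛ L₂₀ ⊕ ⊖ (# 160 ⊛ L₄₀) ⊕ # 4 ⊛ A₁ ⊕ # 8 ⊛ A₃
  eq = begin
    # 4 ⊛ F
      -- `F-formula` determines F + g; since g is linear in values of L, it can be subtracted again.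
      ≈⟨ solve 2 (λ F g → con (+ 4) :* F := (con (+ 4) :* F :+ con (+ 4) :* g) :- con (+ 4) :* g) 𝕊.refl F g ⟩
    (# 4 ⊛ F ⊕ # 4 ⊛ g) ⊕ ⊖ (# 4 ⊛ g)
      ≈⟨ 𝕊.+-congʳ {⊖ (# 4 ⊛ g)} (𝕊.trans F-formula (𝕊.+-cong (𝕊.+-cong (𝕊.+-cong (𝕊.+-cong hQ (𝕊.-‿cong (𝕊.*-congˡ {# 4} Y²-formula))) (𝕊.*-congˡ {# 3} XY-formula)) (𝕊.*-congˡ {# 20} W²-formula)) (𝕊.-‿cong (𝕊.*-congˡ {# 15} ZW-formula)))) ⟩
    (# 4 ⊛ A₁ ⊕ # 8 ⊛ A₃) ⊕ ⊖ (# 4 ⊛ (# 8 ⊛ L₂ ⊕ ⊖ (# 32 ⊛ L₈))) ⊕ # 3 ⊛ (# 4 ⊛ L₁ ⊕ ⊖ (# 4 ⊛ L₂) ⊕ # 8 ⊛ L₄ ⊕ ⊖ (# 32 ⊛ L₈)) ⊕ # 20 ⊛ (# 8 ⊛ L₁₀ ⊕ ⊖ (# 32 ⊛ L₄₀)) ⊕ ⊖ (# 15 ⊛ (# 4 ⊛ L₅ ⊕ ⊖ (# 4 ⊛ L₁₀) ⊕ # 8 ⊛ L₂₀ ⊕ ⊖ (# 32 ⊛ L₄₀))) ⊕ ⊖ (# 4 ⊛ g)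
      ≈⟨ solve 10 (λ a b d e p q r s A B → let k : ℕ → Polynomial 10 ; k n = con (+ n) in
           (k 4 :* A :+ k 8 :* B) :- k 4 :* (k 8 :* b :- k 32 :* e) :+ k 3 :* (k 4 :* a :- k 4 :* b :+ k 8 :* d :- k 32 :* e) :+ k 20 :* (k 8 :* q :- k 32 :* s) :- k 15 :* (k 4 :* p :- k 4 :* q :+ k 8 :* r :- k 32 :* s)
             :- k 4 :* ((k 2 :* a :- k 10 :* b :+ k 8 :* d) :- k 5 :* (k 2 :* p :- k 10 :* q :+ k 8 :* r))
           := k 4 :* a :- k 4 :* b :- k 8 :* d :- k 20 :* p :+ k 32 :* e :+ k 20 :* q :+ k 40 :* r :- k 160 :* s :+ k 4 :* A :+ k 8 :* B) 𝕊.refl L₁ L₂ L₄ L₈ L₅ L₁₀ L₂₀ L₄₀ A₁ A₃ ⟩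
    # 4 ⊛ L₁ ⊕ ⊖ (# 4 ⊛ L₂) ⊕ ⊖ (# 8 ⊛ L₄) ⊕ ⊖ (# 20 ⊛ L₅) ⊕ # 32 ⊛ L₈ ⊕ # 20 ⊛ L₁₀ ⊕ # 40 ⊛ L₂₀ ⊕ ⊖ (# 160 ⊛ L₄₀) ⊕ # 4 ⊛ A₁ ⊕ # 8 ⊛ A₃ ∎

φ₂²φ₅²-formula : ∀ n → (powS (sub 2 φ) 2 ⊛ powS (sub 5 φ) 2) n
  ≡ (2 // 3 · L ⊕ ℚ.- (2 // 3) · sub 2 L ⊕ 4 // 3 · sub 4 L ⊕ 10 // 3 · sub 5 L ⊕ ℚ.- (16 // 3) · sub 8 L ⊕ ℚ.- (10 // 3) · sub 10 L ⊕ 20 // 3 · sub 20 L ⊕ ℚ.- (80 // 3) · sub 40 L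
     ⊕ ℚ.- (2 // 3) · A₁ ⊕ 8 // 3 · A₂ ⊕ ℚ.- (4 // 1) · A₃) n
φ₂²φ₅²-formula n = trans (𝕊.*-cong (powS-2 b) (powS-2 A) .coeff n) (trans (divide 6 (1 // 6) refl (Y ⊛ Z) eq n)
  (trans (cong ((1 // 6) ℚ.*_) (cong₂ ℚ._+_ (cong₂ ℚ._+_ (cong₂ ℚ._+_ (E₁₀-coeff n) (cong ℚ.-_ (#-coeff 4 A₁ n))) (#-coeff 16 A₂ n)) (cong ℚ.-_ (#-coeff 24 A₃ n))))
  (Q.solve 11 (λ a b d p e q r s A A′ A″ → c (1 // 6) Q.:* (c (rat 4) Q.:* a Q.:+ Q.:- (c (rat 4) Q.:* b) Q.:+ c (rat 8) Q.:* d Q.:+ c (rat 20) Q.:* p Q.:+ Q.:- (c (rat 32) Q.:* e) Q.:+ Q.:- (c (rat 20) Q.:* q) Q.:+ c (rat 40) Q.:* r Q.:+ Q.:- (c (rat 160) Q.:* s)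
      Q.:+ Q.:- (c (rat 4) Q.:* A) Q.:+ c (rat 16) Q.:* A′ Q.:+ Q.:- (c (rat 24) Q.:* A″))
    Q.:= c (2 // 3) Q.:* a Q.:+ c (ℚ.- (2 // 3)) Q.:* b Q.:+ c (4 // 3) Q.:* d Q.:+ c (10 // 3) Q.:* p Q.:+ c (ℚ.- (16 // 3)) Q.:* e Q.:+ c (ℚ.- (10 // 3)) Q.:* q Q.:+ c (20 // 3) Q.:* r Q.:+ c (ℚ.- (80 // 3)) Q.:* s
      Q.:+ c (ℚ.- (2 // 3)) Q.:* A Q.:+ c (8 // 3) Q.:* A′ Q.:+ c (ℚ.- (4 // 1)) Q.:* A″) refl (L₁ n) (L₂ n) (L₄ n) (L₅ n) (L₈ n) (L₁₀ n) (L₂₀ n) (L₄₀ n) (A₁ n) (A₂ n) (A₃ n))))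
  where
  eq : # 6 ⊛ (Y ⊛ Z) ≋ E₁₀ ⊕ ⊖ (# 4 ⊛ A₁) ⊕ # 16 ⊛ A₂ ⊕ ⊖ (# 24 ⊛ A₃)
  eq = 𝕊.trans (#-cancel 4 (1 // 4) refl {# 6 ⊛ (Y ⊛ Z)} {X ⊛ Y ⊕ # 5 ⊛ (Z ⊛ W) ⊕ ⊖ (# 4 ⊛ A₁) ⊕ # 16 ⊛ A₂ ⊕ ⊖ (# 24 ⊛ A₃)}
      (𝕊.trans (solve 1 (λ x → con (+ 4) :* (con (+ 6) :* x) := con (+ 24) :* x) 𝕊.refl (Y ⊛ Z)) QI.yz-formula))
    (𝕊.+-congʳ {⊖ (# 24 ⊛ A₃)} (𝕊.+-congʳ {# 16 ⊛ A₂} (𝕊.+-congʳ {⊖ (# 4 ⊛ A₁)} E₁₀≋)))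

theorem2p5 : (∀ n → powS φ 4 n
    ≡ (8 // 1 · L ⊕ ℚ.- (32 // 1) · sub 4 L) n)
    × (∀ n → (powS φ 2 ⊛ powS (sub 2 φ) 2) n
    ≡ (4 // 1 · L ⊕ ℚ.- (4 // 1) · sub 2 L ⊕ 8 // 1 · sub 4 L ⊕ ℚ.- (32 // 1) · sub 8 L) n)
    × (∀ n → (powS φ 2 ⊛ powS (sub 5 φ) 2) n
    ≡ (4 // 3 · L ⊕ ℚ.- (16 // 3) · sub 4 L ⊕ 20 // 3 · sub 5 L ⊕ ℚ.- (80 // 3) · sub 20 L
    ⊕ 8 // 3 · A₁) n)
    × (∀ n → (powS φ 2 ⊛ powS (sub 10 φ) 2) n
    ≡ (2 // 3 · L ⊕ ℚ.- (2 // 3) · sub 2 L ⊕ 4 // 3 · sub 4 L ⊕ 10 // 3 · sub 5 L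
    ⊕ ℚ.- (16 // 3) · sub 8 L ⊕ ℚ.- (10 // 3) · sub 10 L ⊕ 20 // 3 · sub 20 L
    ⊕ ℚ.- (80 // 3) · sub 40 L
    ⊕ 10 // 3 · A₁ ⊕ 8 // 3 · A₂ ⊕ 4 // 1 · A₃) n)
    × (∀ n → (φ ⊛ sub 2 φ ⊛ sub 5 φ ⊛ sub 10 φ) n
    ≡ (L ⊕ ℚ.- (1 // 1) · sub 2 L ⊕ ℚ.- (2 // 1) · sub 4 L ⊕ ℚ.- (5 // 1) · sub 5 L
    ⊕ 8 // 1 · sub 8 L ⊕ 5 // 1 · sub 10 L ⊕ 10 // 1 · sub 20 L
    ⊕ ℚ.- (40 // 1) · sub 40 L
    ⊕ A₁ ⊕ 2 // 1 · A₃) n)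
    × (∀ n → (powS (sub 2 φ) 2 ⊛ powS (sub 5 φ) 2) n
    ≡ (2 // 3 · L ⊕ ℚ.- (2 // 3) · sub 2 L ⊕ 4 // 3 · sub 4 L ⊕ 10 // 3 · sub 5 L
    ⊕ ℚ.- (16 // 3) · sub 8 L ⊕ ℚ.- (10 // 3) · sub 10 L ⊕ 20 // 3 · sub 20 L
    ⊕ ℚ.- (80 // 3) · sub 40 L
    ⊕ ℚ.- (2 // 3) · A₁ ⊕ 8 // 3 · A₂ ⊕ ℚ.- (4 // 1) · A₃) n)
theorem2p5 = φ⁴-formula , φ²φ₂²-formula , φ²φ₅²-formula , φ²φ₁₀²-formula , φφ₂φ₅φ₁₀-formula , φ₂²φ₅²-formula
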